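{- The symmetric function $Q_{\lambda,j}$ is Schur-positive. Moreover, if $k$ is the multiplicity of $1$ in $\lambda$ then the symmetric sequence $$Q_{\lambda,0},Q_{\lambda,1},\cdots,Q_{\lambda,n-k-1},Q_{\lambda,n-k}$$ is Schur-unimodal in the sense that $Q_{\lambda,j}-Q_{\lambda,j-1}$ is Schur-positive for $1\leq j\leq\frac{n-k}{2}$.
   Context: Let $\lambda$ be a partition of $n$ and $j\in\mathbb{N}$. For $\sigma\in{\mathfrak S}_n$, let $\mathrm{exc}(\sigma)=|\{i\in[n-1]:\sigma(i)>i\}|$ be its excedance number, $\lambda(\sigma)$ its cycle type, and $\mathrm{Dex}(\sigma)\subseteq[n-1]$ the set defined by Shareshian and Wachs (Eulerian quasisymmetric functions). The cycle type Eulerian quasisymmetric function is $Q_{\lambda,j}({\mathbf x})=\sum_{\sigma\in{\mathfrak S}_n,\ \mathrm{exc}(\sigma)=j,\ \lambda(\sigma)=\lambda}F_{\mathrm{Dex}(\sigma),n}({\mathbf x})$, where $F_{S,n}$ is Gessel's fundamental quasisymmetric function. Equivalently (and this is all that is used), these are the symmetric functions determined by: $\sum_{n,j}Q_{n,j}t^jz^n=\frac{(1-t)H(z)}{H(zt)-tH(z)}$ with $Q_{n,j}=\sum_{\lambda\vdash n}Q_{\lambda,j}$ and $H(z)=\sum_{n\ge0}h_nz^n$; $\sum_j Q_{\lambda,j}t^j=\prod_{i\ge1}h_{m_i}[\sum_j Q_{(i),j}t^j]$ where $m_i$ is the multiplicity of $i$ in $\lambda$ and $[\;]$ denotes plethysm;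 and $\sum_{n,j}Q_{n,j}t^jz^n=\sum_n h_n[\sum_{i,j}Q_{(i),j}t^jz^i]$. They satisfy $Q_{\lambda,j}=Q_{\lambda,n-k-j}$ and $Q_{\lambda,j}=0$ unless $j\le n-k$. -}

module Defs where

-- Cycle type Eulerian quasisymmetric functions Q_{λ,j} (Shareshian–Wachs),
-- Schur functions, and Schur positivity, all made concrete through
-- monomial coefficients.
--
-- Conventions:
--  * A monomial x^α = x_1^{α_1} ⋯ x_N^{α_N} is given by its exponent list
--    α : List ℕ (N = length α).  A (formal power series) symmetric function f
--    is represented by its coefficient function  α ↦ [x^α] f.  Two such
--    power series are equal iff all monomial coefficients agree.
--  * A word of length m over the alphabet [N] is a List ℕ with entries < N
--    (0-based letters 0,…,N-1 stand for the variables x_1,…,x_N).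
--  * A permutation σ ∈ 𝔖_n is its one-line notation, a List ℕ of length n
--    with distinct entries in {0,…,n-1} (0-based: entry at 0-based position i
--    is σ(i+1)-1).

open import Data.Bool using (Bool; true; false; _∧_; not; if_then_else_)
open import Data.Nat using (ℕ; zero; suc; _+_; _*_; _∸_; _≤_; _≥_; _/_; _≡ᵇ_; _<ᵇ_; _≤ᵇ_)
open import Data.List using (List; []; _∷_; map; concatMap; upTo; downFrom; length; filterᵇ; zip; zipWith; drop; replicate; concat)
open import Data.Bool.ListAction using (and; any)
open import Data.Nat.ListAction using (sum)
open import Data.List.Relation.Unary.All using (All)
open import Data.List.Relation.Unary.Linked using (Linked)
open import Data.Product using (_×_; _,_; ∃-syntax)
open import Relation.Binary.PropositionalEquality using (_≡_)

countᵇ : {A : Set} → (A → Bool) → List A → ℕ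
countᵇ p xs = length (filterᵇ p xs)

eqList : List ℕ → List ℕ → Bool
eqList []       []       = true
eqList (x ∷ xs) (y ∷ ys) = (x ≡ᵇ y) ∧ eqList xs ys
eqList _        _        = false

words : ℕ → ℕ → List (List ℕ)
words N zero    = [] ∷ []
words N (suc m) = concatMap (λ a → map (a ∷_) (words N m)) (upTo N)

content : ℕ → List ℕ → List ℕ
content N w = map (λ a → countᵇ (λ b → a ≡ᵇ b) w) (upTo N)

hasContent : List ℕ → List ℕ → Bool
hasContent α w = eqList (content (length α) w) α

distinct : List ℕ → Bool
distinct []       = true
distinct (x ∷ xs) = not (any (λ y → x ≡ᵇ y) xs) ∧ distinct xs

perms : ℕ → List (List ℕ)
perms n = filterᵇ distinct (words n n)

at : List ℕ → ℕ → ℕ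
at []       i       = 0
at (x ∷ xs) zero    = x
at (x ∷ xs) (suc i) = at xs i

indexed : List ℕ → List (ℕ × ℕ)
indexed σ = zip (upTo (length σ)) σ

exc : List ℕ → ℕ
exc σ = countᵇ (λ { (i , v) → i <ᵇ v }) (indexed σ)

iter : List ℕ → ℕ → ℕ → ℕ
iter σ zero    i = i
iter σ (suc k) i = at σ (iter σ k i)

firstWith : (ℕ → Bool) → ℕ → List ℕ → ℕ
firstWith p d []       = d
firstWith p d (k ∷ ks) = if p k then k else firstWith p d ks

cycleLength : List ℕ → ℕ → ℕ
cycleLength σ i = firstWith (λ k → iter σ k i ≡ᵇ i) (length σ) (map suc (upTo (length σ)))

numCycles : List ℕ → ℕ → ℕ
numCycles σ ℓ = countᵇ (λ i → cycleLength σ i ≡ᵇ suc ℓ) (upTo (length σ)) / suc ℓ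

cycleType : List ℕ → List ℕ
cycleType σ = concatMap (λ ℓ → replicate (numCycles σ ℓ) (suc ℓ)) (downFrom (length σ))

-- Dex(σ) (Shareshian–Wachs): form the word \bar σ from the one-line
-- notation by barring σ(i) whenever i is an excedance; order the letters
-- \bar1 < ⋯ < \bar n < 1 < ⋯ < n; Dex(σ) = Des(\bar σ).
-- The key below realises this order (barred v ↦ v, unbarred v ↦ n + v).
barKey : List ℕ → List ℕ
barKey σ = map (λ { (i , v) → if i <ᵇ v then v else length σ + v }) (indexed σ)

-- Dex(σ) ⊆ [n-1] as a characteristic list: entry i (0-based) is true iff i+1 ∈ Dex(σ)
dex : List ℕ → List Bool
dex σ = zipWith (λ a b → b <ᵇ a) (barKey σ) (drop 1 (barKey σ))

-- Gessel's fundamental quasisymmetric function F_{S,n}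
--   F_{S,n} = Σ_{i_1 ≤ ⋯ ≤ i_n, i_k < i_{k+1} for k ∈ S} x_{i_1} ⋯ x_{i_n}

compatible : List Bool → List ℕ → Bool
compatible (b ∷ bs) (x ∷ y ∷ ws) = (if b then x <ᵇ y else x ≤ᵇ y) ∧ compatible bs (y ∷ ws)
compatible _        _            = true

Fcoeff : List Bool → ℕ → List ℕ → ℕ
Fcoeff S n α = countᵇ (λ w → compatible S w ∧ hasContent α w) (words (length α) n)

Qcoeff : ℕ → List ℕ → ℕ → List ℕ → ℕ
Qcoeff n lam j α =
  sum (map (λ σ → Fcoeff (dex σ) n α)
           (filterᵇ (λ σ → (exc σ ≡ᵇ j) ∧ eqList (cycleType σ) lam) (perms n)))

IsPartition : List ℕ → Set
IsPartition μ = All (λ x → 1 ≤ x) μ × Linked _≥_ μ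

IsPartitionOf : ℕ → List ℕ → Set
IsPartitionOf n μ = IsPartition μ × sum μ ≡ n

multiplicity : ℕ → List ℕ → ℕ
multiplicity i μ = countᵇ (λ x → x ≡ᵇ i) μ

fillings : ℕ → List ℕ → List (List (List ℕ))
fillings N []       = [] ∷ []
fillings N (r ∷ rs) = concatMap (λ row → map (row ∷_) (fillings N rs)) (words N r)

weaklyIncreasing : List ℕ → Bool
weaklyIncreasing (x ∷ y ∷ ws) = (x ≤ᵇ y) ∧ weaklyIncreasing (y ∷ ws)
weaklyIncreasing _            = true

-- columns strictly increasing between consecutive rows (lower row not longer)
columnsStrict : List (List ℕ) → Bool
columnsStrict (r₁ ∷ r₂ ∷ rs) = and (zipWith _<ᵇ_ r₁ r₂) ∧ columnsStrict (r₂ ∷ rs)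
columnsStrict _              = true

isSSYT : List (List ℕ) → Bool
isSSYT T = and (map weaklyIncreasing T) ∧ columnsStrict T

schurCoeff : List ℕ → List ℕ → ℕ
schurCoeff μ α = countᵇ (λ T → isSSYT T ∧ hasContent α (concat T)) (fillings (length α) μ)

-- f = Σ_{μ ∈ L} s_μ for a finite list (multiset) L of partitions,
-- i.e. f is a nonnegative integer combination of Schur functions
SchurPositive : (List ℕ → ℕ) → Set
SchurPositive f =
  ∃[ L ] (All IsPartition L × (∀ α → f α ≡ sum (map (λ μ → schurCoeff μ α) L)))

SchurPositiveDiff : (List ℕ → ℕ) → (List ℕ → ℕ) → Set
SchurPositiveDiff f g =
  ∃[ L ] (All IsPartition L × (∀ α → f α ≡ g α + sum (map (λ μ → schurCoeff μ α) L)))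

{-# OPTIONS --safe #-}
module Submission where

-- By a Gessel–Reutenauer bijection Q_{λ,j} counts orbits of primitive bicoloured words on permutations of
-- cycle type λ. A Möbius-type twist ε of the stabilisers replaces primitivity by fixed points of pairs of
-- commuting permutations; for these, comparing traces of transfer matrices trades bicoloured words for tilings
-- of the cycles by blocks of m letters carrying m - 2 marks of two kinds. Tilings with l blocks give a positive
-- definite class function φ on a product of two symmetric groups. Pairing it with an irreducible character of
-- the first (built from Kostka numbers through RSK and Schur's lemma) and a two-rowed permutation character of
-- the second gives the Schur coefficients; differences of two-rowed characters give unimodality.
-- On ℚ the ring operations are written & (product), # (sum), ~ (negation); δ is the indicator of a decision.


open import Level using (Level)
open import Data.Bool using (Bool;true;false;_∧_;not;if_then_else_)
open import Data.Empty using (⊥;⊥-elim)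
open import Data.Unit using (⊤;tt)
open import Data.Nat using (ℕ;suc;pred;_+_;_*_;_∸_;_^_;_⊔_;_⊓_;_≤_;_<_;_≥_;z≤n;s≤s) renaming (zero to zr;_≟_ to _≟ℕ_;_≤?_ to _≤?ℕ_;_<?_ to _<?ℕ_)
open import Data.Nat.Properties using (+-comm;+-assoc;+-suc;*-comm;*-assoc;*-identityˡ;*-identityʳ;*-zeroʳ;*-distribˡ-+;*-distribʳ-+;≤-antisym;≤-total;<-trans;<-cmp;<-irrefl;<⇒≤;<⇒≱;≮⇒≥;≰⇒>;<-≤-trans;≤-<-trans;n≤1+n;n<1+n;m≤m+n;m≤n+m;+-mono-≤;+-monoˡ-≤;+-monoʳ-≤;+-cancelˡ-≡;+-cancelʳ-≡;+-cancelˡ-≤;suc-injective;m+[n∸m]≡n;m∸n+n≡m;m+n∸m≡n;m+n∸n≡m;≤∧≢⇒<) renaming (+-identityʳ to +-idr;≤-refl to ≤=;≤-reflexive to ≤r;≤-trans to ≤t;<⇒≢ to <≢)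
open import Data.Fin using (Fin;suc;fromℕ<) renaming (zero to zr;toℕ to tn;_≟_ to _≟F_)
open import Data.Fin.Properties using (toℕ<n;any?;all?) renaming (toℕ-injective to tn-inj;toℕ-fromℕ< to tn-fr)
open import Data.List using (List;[];_∷_;_++_;length;concatMap;cartesianProductWith;allFin) renaming (map to mapL)
open import Data.List.Membership.Propositional using (_∈_)
open import Data.List.Relation.Unary.Any using (here;there)
open import Data.List.Relation.Unary.Unique.Propositional using (Unique)
open import Data.List.Relation.Unary.All using (All;[];_∷_)
open import Data.List.Relation.Unary.AllPairs using (AllPairs;[];_∷_)
open import Data.Vec using (Vec;[];_∷_) renaming (lookup to lk;tabulate to tab)
open import Data.Vec.Properties using (tabulate∘lookup;tabulate-cong) renaming (lookup∘tabulate to lk-tab)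
open import Data.Product using (∃;_×_;_,_) renaming (proj₁ to fst;proj₂ to snd)
open import Data.Product.Properties using () renaming (≡-dec to ×-≡-dec)
open import Data.Sum using (_⊎_;[_,_]′) renaming (inj₁ to inl;inj₂ to inr)
open import Data.Rational using (ℚ;positive;nonNegative) renaming (0ℚ to 0q;1ℚ to 1q;_≤_ to infix 4 _≤ᵠ_;_<_ to infix 4 _<ᵠ_)
import Data.Rational as ℚ
import Data.Rational.Properties as ℚP
open import Function using (_∘_;id;_$_;case_of_)
open import Relation.Binary.PropositionalEquality using (_≢_;sym;trans;subst;module ≡-Reasoning) renaming (_≡_ to _==_;refl to rfl;cong to cg;cong₂ to ap2;subst₂ to subst2)
open import Relation.Binary using (DecidableEquality;tri<;tri≈;tri>)
open import Relation.Nullary using (¬_;Dec;yes;no) renaming (contradiction to absurd)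
open import Relation.Nullary.Decidable using (_×-dec_;_⊎-dec_;¬?;map′;dec⇒maybe;recompute)
open import Relation.Unary using (Decidable)
open import Tactic.RingSolver using () renaming (solve-∀ to slv)
open import Tactic.RingSolver.Core.AlmostCommutativeRing using (AlmostCommutativeRing;fromCommutativeRing)
import Data.List.Membership.Propositional.Properties as ∈P
import Data.List.Relation.Unary.Unique.Propositional.Properties as UP
import Data.Vec.Properties as VP

-- The block weights come from the generating function: (H(tz) - tH(z))/(1 - t) = 1 - Σ_{m≥2} t(1 +
-- ... + t^{m-2}) h_m z^m, and 1 + ... + t^{m-2} is h_{m-2}(1,t). So a block has one factor t of its
-- own and m - 2 marks of weight 1 or t. A tiling with k fixed points and l blocks carries n' = n -
-- 2l - k marks. Its t-degrees l + b, with b marks of weight t, are symmetric about l + n'/2 = (n -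
-- k)/2 for every l, so the contributions of different l may be added; for one l unimodality is that
-- of the permutation characters of 𝔖_{n'} on b-subsets. The obstacle is primitivity. Words and
-- tilings agree only through traces, so primitive ones cannot be matched directly, and Möbius
-- inversion introduces signs. The twist is therefore an autocorrelation: its sum over the
-- stabiliser of a periodic word is zero, it needs no roots of unity, and it turns twisted counts
-- into sums of squares. The multiplicities obtained are nonnegative rationals; that they are
-- integers follows separately from unitriangularity of Kostka numbers.

infixr 1 _»_
_»_ : {A : Set} {x y z : A} -> x == y -> y == z -> x == z
_»_ = trans

-- Rational arithmetic.

infixl 6 _#_ _⊝_
infixl 7 _&_
infix 8 ~_

-- Sealing the operations keeps Agda from unfolding the normalisation of fractions.
opaque
 _#_ _&_ : ℚ -> ℚ -> ℚ
 _#_ = ℚ._+_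
 _&_ = ℚ._*_

 ~_ : ℚ -> ℚ
 ~_ = ℚ.-_

_⊝_ : ℚ -> ℚ -> ℚ
x ⊝ y = x # ~ y

opaque
 unfolding _#_

 #-co : ∀ x y -> x # y == y # x
 #-co = ℚP.+-comm
 #-as : ∀ x y z -> (x # y) # z == x # (y # z)
 #-as = ℚP.+-assoc
 #-idˡ : ∀ x -> 0q # x == x
 #-idˡ = ℚP.+-identityˡ
 #-idʳ : ∀ x -> x # 0q == x
 #-idʳ = ℚP.+-identityʳ
 &-co : ∀ x y -> x & y == y & x
 &-co = ℚP.*-comm
 &-as : ∀ x y z -> (x & y) & z == x & (y & z)
 &-as = ℚP.*-assoc
 &-idˡ : ∀ x -> 1q & x == x
 &-idˡ = ℚP.*-identityˡ
 &-idʳ : ∀ x -> x & 1q == x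
 &-idʳ = ℚP.*-identityʳ
 &-zeroˡ : ∀ x -> 0q & x == 0q
 &-zeroˡ = ℚP.*-zeroˡ
 &-zeroʳ : ∀ x -> x & 0q == 0q
 &-zeroʳ = ℚP.*-zeroʳ
 &-distribˡ : ∀ x y z -> x & (y # z) == x & y # x & z
 &-distribˡ = ℚP.*-distribˡ-+
 &-distribʳ : ∀ x y z -> (y # z) & x == y & x # z & x
 &-distribʳ = ℚP.*-distribʳ-+
 ~-invʳ : ∀ x -> x # ~ x == 0q
 ~-invʳ = ℚP.+-inverseʳ

 #-mo-≤ : ∀ {x y u v} -> x ≤ᵠ y -> u ≤ᵠ v -> x # u ≤ᵠ y # v
 #-mo-≤ = ℚP.+-mono-≤
 #-mo-<-≤ : ∀ {x y u v} -> x <ᵠ y -> u ≤ᵠ v -> x # u <ᵠ y # v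
 #-mo-<-≤ = ℚP.+-mono-<-≤
 #-≥0 : ∀ {x y} -> 0q ≤ᵠ x -> 0q ≤ᵠ y -> 0q ≤ᵠ x # y
 #-≥0 = ℚP.+-mono-≤
 &-≥0 : ∀ {x y} -> 0q ≤ᵠ x -> 0q ≤ᵠ y -> 0q ≤ᵠ x & y
 &-≥0 {x} {y} p q = ℚP.nonNegative⁻¹ (x & y) ⦃ ℚP.nonNeg*nonNeg⇒nonNeg x ⦃ nonNegative p ⦄ y ⦃ nonNegative q ⦄ ⦄
 &->0 : ∀ {x y} -> 0q <ᵠ x -> 0q <ᵠ y -> 0q <ᵠ x & y
 &->0 {x} {y} p q = ℚP.positive⁻¹ (x & y) ⦃ ℚP.pos*pos⇒pos x ⦃ positive p ⦄ y ⦃ positive q ⦄ ⦄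
 ~-an : ∀ {x y} -> x ≤ᵠ y -> ~ y ≤ᵠ ~ x
 ~-an = ℚP.neg-antimono-≤

 -- The value at 0 is irrelevant.
 _⁻¹ : ℚ -> ℚ
 x ⁻¹ with x ℚP.≟ 0q
 ... | yes _ = 0q
 ... | no ¬p = ℚ.1/_ x ⦃ ℚ.≢-nonZero ¬p ⦄

 &-⁻¹ : ∀ {x} -> x ≢ 0q -> x & x ⁻¹ == 1q
 &-⁻¹ {x} ¬p with x ℚP.≟ 0q
 ... | yes p = absurd p ¬p
 ... | no ¬q = ℚP.*-inverseʳ x ⦃ ℚ.≢-nonZero ¬q ⦄

 ⁻¹->0 : ∀ {x} -> 0q <ᵠ x -> 0q <ᵠ x ⁻¹
 ⁻¹->0 {x} p with x ℚP.≟ 0q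
 ... | yes rfl = absurd rfl (ℚP.<⇒≢ p)
 ... | no ¬q = ℚP.positive⁻¹ _ ⦃ ℚP.1/pos⇒pos x ⦃ positive p ⦄ ⦄

ℚ-ri : AlmostCommutativeRing Level.zero Level.zero
ℚ-ri = fromCommutativeRing ℚP.+-*-commutativeRing (\ x -> dec⇒maybe (0q ℚP.≟ x))

opaque
 unfolding _#_

 &-#-4 : ∀ a b c d -> (a # b) # (c # d) == (a # c) # (b # d)
 &-#-4 = slv ℚ-ri

 &-sw : ∀ a b c -> a & (b & c) == b & (a & c)
 &-sw = slv ℚ-ri

 &-4 : ∀ a b c d -> (a & b) & (c & d) == (a & c) & (b & d)
 &-4 = slv ℚ-ri

 #-&-su : ∀ a b -> b # a & b == (1q # a) & b
 #-&-su = slv ℚ-ri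

-- Finite sums and indicators.

module _ where
 open ≡-Reasoning

 ∑ : {A : Set} -> List A -> (A -> ℚ) -> ℚ
 ∑ [] f = 0q
 ∑ (x ∷ xs) f = f x # ∑ xs f

 module _ {A : Set} where

  ∑-cong∈ : (xs : List A) {f g : A -> ℚ} -> (∀ {a} -> a ∈ xs -> f a == g a) -> ∑ xs f == ∑ xs g
  ∑-cong∈ [] eq = rfl
  ∑-cong∈ (x ∷ xs) eq = ap2 _#_ (eq (here rfl)) (∑-cong∈ xs (eq ∘ there))

  ∑-co : (xs : List A) {f g : A -> ℚ} -> (∀ a -> f a == g a) -> ∑ xs f == ∑ xs g
  ∑-co xs eq = ∑-cong∈ xs (\ {a} _ -> eq a)

  ∑-0 : (xs : List A) -> ∑ xs (\ _ -> 0q) == 0q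
  ∑-0 [] = rfl
  ∑-0 (x ∷ xs) = #-idˡ _ » ∑-0 xs

  ∑-# : (xs : List A) (f g : A -> ℚ) -> ∑ xs (\ a -> f a # g a) == ∑ xs f # ∑ xs g
  ∑-# [] f g = sym (#-idˡ 0q)
  ∑-# (x ∷ xs) f g = cg ((f x # g x) #_) (∑-# xs f g) » &-#-4 (f x) (g x) (∑ xs f) (∑ xs g)

  ∑-*ˡ : (xs : List A) (c : ℚ) (f : A -> ℚ) -> ∑ xs (\ a -> c & f a) == c & ∑ xs f
  ∑-*ˡ [] c f = sym (&-zeroʳ c)
  ∑-*ˡ (x ∷ xs) c f = cg (c & f x #_) (∑-*ˡ xs c f) » sym (&-distribˡ c _ _)

  ∑-++ : (xs ys : List A) (f : A -> ℚ) -> ∑ (xs ++ ys) f == ∑ xs f # ∑ ys f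
  ∑-++ [] ys f = sym (#-idˡ _)
  ∑-++ (x ∷ xs) ys f = cg (f x #_) (∑-++ xs ys f) » sym (#-as (f x) _ _)

  ∑-≥0 : (xs : List A) {f : A -> ℚ} -> (∀ a -> 0q ≤ᵠ f a) -> 0q ≤ᵠ ∑ xs f
  ∑-≥0 [] p = ℚP.≤-refl
  ∑-≥0 (x ∷ xs) p = #-≥0 (p x) (∑-≥0 xs p)

 ∑-ma : {A B : Set} (h : A -> B) (xs : List A) (f : B -> ℚ) -> ∑ (mapL h xs) f == ∑ xs (f ∘ h)
 ∑-ma h [] f = rfl
 ∑-ma h (x ∷ xs) f = cg (f (h x) #_) (∑-ma h xs f)

 ∑-cM : {A B : Set} (h : A -> List B) (xs : List A) (f : B -> ℚ) ->
  ∑ (concatMap h xs) f == ∑ xs (\ a -> ∑ (h a) f)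
 ∑-cM h [] f = rfl
 ∑-cM h (x ∷ xs) f = ∑-++ (h x) _ f » cg (∑ (h x) f #_) (∑-cM h xs f)

 ∑-sw : {A B : Set} (xs : List A) (ys : List B) (f : A -> B -> ℚ) ->
  ∑ xs (\ a -> ∑ ys (\ b -> f a b)) == ∑ ys (\ b -> ∑ xs (\ a -> f a b))
 ∑-sw [] ys f = sym (∑-0 ys)
 ∑-sw (x ∷ xs) ys f = cg (∑ ys (f x) #_) (∑-sw xs ys f) » sym (∑-# ys _ _)

 ∑-ca : {A B C : Set} (h : A -> B -> C) (xs : List A) (ys : List B) (f : C -> ℚ) ->
  ∑ (cartesianProductWith h xs ys) f == ∑ xs (\ a -> ∑ ys (\ b -> f (h a b)))
 ∑-ca h [] ys f = rfl
 ∑-ca h (x ∷ xs) ys f =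
  ∑-++ (mapL (h x) ys) _ f » ap2 _#_ (∑-ma (h x) ys f) (∑-ca h xs ys f)

opaque
 δ : {P : Set} -> Dec P -> ℚ
 δ (yes _) = 1q
 δ (no _) = 0q

module _ {P Q : Set} where
 opaque
  unfolding δ

  δ-⇔ : (p : Dec P) (q : Dec Q) -> (P -> Q) -> (Q -> P) -> δ p == δ q
  δ-⇔ (yes p) (yes q) f g = rfl
  δ-⇔ (yes p) (no ¬q) f g = absurd (f p) ¬q
  δ-⇔ (no ¬p) (yes q) f g = absurd (g q) ¬p
  δ-⇔ (no ¬p) (no ¬q) f g = rfl

  δ-× : (p : Dec P) (q : Dec Q) -> δ (p ×-dec q) == δ p & δ q
  δ-× (yes _) (yes _) = sym (&-idˡ 1q)
  δ-× (yes _) (no _) = sym (&-idˡ 0q)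
  δ-× (no _) (yes _) = sym (&-zeroˡ 1q)
  δ-× (no _) (no _) = sym (&-zeroˡ 0q)

module _ {P : Set} where
 opaque
  unfolding δ

  δ-ye : (p : Dec P) -> P -> δ p == 1q
  δ-ye (yes _) _ = rfl
  δ-ye (no ¬p) p = absurd p ¬p

  δ-no : (p : Dec P) -> ¬ P -> δ p == 0q
  δ-no (yes p) ¬p = absurd p ¬p
  δ-no (no _) _ = rfl

  δ-≥0 : (p : Dec P) -> 0q ≤ᵠ δ p
  δ-≥0 (yes _) = ℚP.nonNegative⁻¹ 1q
  δ-≥0 (no _) = ℚP.≤-refl

  δ-co : (p : Dec P) {x y : ℚ} -> (P -> x == y) -> δ p & x == δ p & y
  δ-co (yes p) eq = cg (1q &_) (eq p)
  δ-co (no _) {x} {y} eq = &-zeroˡ x » sym (&-zeroˡ y)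

  δ-* : (p : Dec P) {x y : ℚ} -> (P -> x == y) -> (¬ P -> y == 0q) -> δ p & x == y
  δ-* (yes p) f g = &-idˡ _ » f p
  δ-* (no ¬p) f g = &-zeroˡ _ » sym (g ¬p)

  δ-id : (p : Dec P) -> δ p & δ p == δ p
  δ-id (yes _) = &-idˡ 1q
  δ-id (no _) = &-zeroˡ 0q

-- Finite types and sums over them.

record Fi (A : Set) : Set where
 field
  els : List A
  eq? : DecidableEquality A
  com : ∀ a -> a ∈ els
  unique : Unique els

open Fi ⦃ ... ⦄ public

opaque
 Ʃ : {A : Set} -> ⦃ Fi A ⦄ -> (A -> ℚ) -> ℚ
 Ʃ f = ∑ els f

∑-δ-∉ : {A : Set} (_≟_ : DecidableEquality A) (xs : List A) (a : A) (f : A -> ℚ) ->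
 All (a ≢_) xs -> ∑ xs (\ b -> δ (b ≟ a) & f b) == 0q
∑-δ-∉ _≟_ [] a f [] = rfl
∑-δ-∉ _≟_ (x ∷ xs) a f (p ∷ ps) =
 ap2 _#_ (δ-* (x ≟ a) (\ e -> absurd (sym e) p) (\ _ -> rfl)) (∑-δ-∉ _≟_ xs a f ps) » #-idˡ 0q

∑-δ : {A : Set} (_≟_ : DecidableEquality A) (xs : List A) (a : A) (f : A -> ℚ) ->
 Unique xs -> a ∈ xs -> ∑ xs (\ b -> δ (b ≟ a) & f b) == f a
∑-δ _≟_ (x ∷ xs) a f (u ∷ us) (here rfl) =
 ap2 _#_ (cg (_& f x) (δ-ye (x ≟ a) rfl) » &-idˡ _) (∑-δ-∉ _≟_ xs a f u) »
  #-idʳ _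
∑-δ _≟_ (x ∷ xs) a f (u ∷ us) (there m) =
 ap2 _#_ (δ-* (x ≟ a) (\ { rfl -> absurd rfl (lookupAll u m) }) (\ _ -> rfl)) (∑-δ _≟_ xs a f us m) »
  #-idˡ _
 where open import Data.List.Relation.Unary.All using () renaming (lookup to lookupAll)

module _ {A : Set} ⦃ _ : Fi A ⦄ where

 opaque
  unfolding Ʃ

  Ʃ-co : {f g : A -> ℚ} -> (∀ a -> f a == g a) -> Ʃ f == Ʃ g
  Ʃ-co = ∑-co els

  Ʃ-δ : (a : A) (f : A -> ℚ) -> Ʃ (\ b -> δ (eq? b a) & f b) == f a
  Ʃ-δ a f = ∑-δ eq? els a f unique (com a)

  Ʃ-0 : {f : A -> ℚ} -> (∀ a -> f a == 0q) -> Ʃ f == 0q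
  Ʃ-0 p = Ʃ-co p » ∑-0 els

  Ʃ-# : (f g : A -> ℚ) -> Ʃ (\ a -> f a # g a) == Ʃ f # Ʃ g
  Ʃ-# = ∑-# els

  Ʃ-*ˡ : (c : ℚ) (f : A -> ℚ) -> Ʃ (\ a -> c & f a) == c & Ʃ f
  Ʃ-*ˡ = ∑-*ˡ els

  Ʃ-*ʳ : (c : ℚ) (f : A -> ℚ) -> Ʃ (\ a -> f a & c) == Ʃ f & c
  Ʃ-*ʳ c f = Ʃ-co (\ a -> &-co (f a) c) » Ʃ-*ˡ c f » &-co c _

  Ʃ-≥0 : {f : A -> ℚ} -> (∀ a -> 0q ≤ᵠ f a) -> 0q ≤ᵠ Ʃ f
  Ʃ-≥0 = ∑-≥0 els

 Ʃ-δ' : (a : A) (f : A -> ℚ) -> Ʃ (\ b -> δ (eq? a b) & f b) == f a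
 Ʃ-δ' a f = Ʃ-co (\ b -> cg (_& f b) (δ-⇔ (eq? a b) (eq? b a) sym sym)) » Ʃ-δ a f

 -- Only the support matters: P holds at most at a.
 Ʃ-po : {P : A -> Set} (P? : ∀ b -> Dec (P b)) (a : A) (f : A -> ℚ) ->
  P a -> (∀ b -> P b -> b == a) -> Ʃ (\ b -> δ (P? b) & f b) == f a
 Ʃ-po P? a f pa on =
  Ʃ-co (\ b -> cg (_& f b) (δ-⇔ (P? b) (eq? b a) (on b) (\ { rfl -> pa }))) » Ʃ-δ a f

module _ {A B : Set} ⦃ _ : Fi A ⦄ ⦃ _ : Fi B ⦄ where

 opaque
  unfolding Ʃ

  Ʃ-sw : (f : A -> B -> ℚ) -> Ʃ (\ a -> Ʃ (\ b -> f a b)) == Ʃ (\ b -> Ʃ (\ a -> f a b))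
  Ʃ-sw = ∑-sw els els

 Ʃ-& : (f : A -> ℚ) (g : B -> ℚ) -> Ʃ (\ a -> Ʃ (\ b -> f a & g b)) == Ʃ f & Ʃ g
 Ʃ-& f g = Ʃ-co (\ a -> Ʃ-*ˡ (f a) g) » Ʃ-*ʳ (Ʃ g) f

 -- Change of variable when `φ` and `ψ` are mutually inverse only between the two supports. Outside
 -- the supports both maps may return junk, which many of the bijections below do.
 Ʃ-re : {P : A -> Set} {Q : B -> Set} (P? : ∀ a -> Dec (P a)) (Q? : ∀ b -> Dec (Q b))
  (φ : A -> B) (ψ : B -> A) -> (∀ a -> P a -> Q (φ a)) -> (∀ b -> Q b -> P (ψ b)) ->
  (∀ a -> P a -> ψ (φ a) == a) -> (∀ b -> Q b -> φ (ψ b) == b) -> (f : B -> ℚ) ->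
  Ʃ (\ a -> δ (P? a) & f (φ a)) == Ʃ (\ b -> δ (Q? b) & f b)
 Ʃ-re {P} {Q} P? Q? φ ψ pq qp ψφ φψ f = begin
  Ʃ (\ a -> δ (P? a) & f (φ a))
   ≡⟨ Ʃ-co (\ a -> cg (δ (P? a) &_) (sym (Ʃ-δ (φ a) f))) ⟩
  Ʃ (\ a -> δ (P? a) & Ʃ (\ b -> δ (eq? b (φ a)) & f b))
   ≡⟨ Ʃ-co (\ a -> sym (Ʃ-*ˡ (δ (P? a)) _)) ⟩
  Ʃ (\ a -> Ʃ (\ b -> δ (P? a) & (δ (eq? b (φ a)) & f b)))
   ≡⟨ Ʃ-sw _ ⟩
  Ʃ (\ b -> Ʃ (\ a -> δ (P? a) & (δ (eq? b (φ a)) & f b)))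
   ≡⟨ Ʃ-co (\ b -> Ʃ-co (\ a -> lem a b) » Ʃ-δ (ψ b) _ » rfl) ⟩
  Ʃ (\ b -> δ (Q? b) & f b) ∎
  where
  open ≡-Reasoning
  lem : ∀ a b -> δ (P? a) & (δ (eq? b (φ a)) & f b) == δ (eq? a (ψ b)) & (δ (Q? b) & f b)
  lem a b = begin
   δ (P? a) & (δ (eq? b (φ a)) & f b) ≡⟨ &-as (δ (P? a)) _ _ ⟨
   δ (P? a) & δ (eq? b (φ a)) & f b ≡⟨ cg (_& f b) (δ-× (P? a) (eq? b (φ a))) ⟨
   δ (P? a ×-dec eq? b (φ a)) & f b ≡⟨ cg (_& f b) (δ-⇔ _ (eq? a (ψ b) ×-dec Q? b)
    (\ { (p , rfl) -> sym (ψφ a p) , pq a p }) (\ { (rfl , q) -> qp b q , sym (φψ b q) })) ⟩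
   δ (eq? a (ψ b) ×-dec Q? b) & f b ≡⟨ cg (_& f b) (δ-× (eq? a (ψ b)) (Q? b)) ⟩
   δ (eq? a (ψ b)) & δ (Q? b) & f b ≡⟨ &-as (δ (eq? a (ψ b))) _ _ ⟩
   δ (eq? a (ψ b)) & (δ (Q? b) & f b) ∎

 Ʃ-bi : (φ : A -> B) (ψ : B -> A) -> (∀ a -> ψ (φ a) == a) -> (∀ b -> φ (ψ b) == b) -> (f : B -> ℚ) ->
  Ʃ (f ∘ φ) == Ʃ f
 Ʃ-bi φ ψ ψφ φψ f =
  Ʃ-co (\ a -> sym (yes& (f (φ a)))) »
   Ʃ-re (\ _ -> yes tt) (\ _ -> yes tt) φ ψ _ _ (\ a _ -> ψφ a) (\ b _ -> φψ b) f »
    Ʃ-co (\ b -> yes& (f b))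
  where
  yes& : ∀ x -> δ (yes tt) & x == x
  yes& x = cg (_& x) (δ-ye (yes tt) tt) » &-idˡ x

ve : {A : Set} -> List A -> ∀ n -> List (Vec A n)
ve xs zr = [] ∷ []
ve xs (suc n) = cartesianProductWith _∷_ xs (ve xs n)

instance
 Fi-Fi : ∀ {n} -> Fi (Fin n)
 Fi-Fi {n} = record { els = allFin n;eq? = _≟F_;com = ∈P.∈-allFin;unique = UP.allFin⁺ n }

 Fi-Bo : Fi Bool
 Fi-Bo = record
  { els = true ∷ false ∷ [];eq? = _≟B_
  ;com = \ { true -> here rfl;false -> there (here rfl) }
  ;unique = ((\ ()) ∷ []) ∷ [] ∷ [] }
  where open import Data.Bool using () renaming (_≟_ to _≟B_)

 Fi-× : {A B : Set} -> ⦃ Fi A ⦄ -> ⦃ Fi B ⦄ -> Fi (A × B)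
 Fi-× = record
  { els = cartesianProductWith _,_ els els
  ;eq? = ×-≡-dec eq? eq?
  ;com = \ { (a , b) -> ∈P.∈-cartesianProductWith⁺ _,_ (com a) (com b) }
  ;unique = UP.cartesianProductWith⁺ _,_ (\ { rfl -> rfl , rfl }) unique unique }

 Fi-Ve : {A : Set} {n : ℕ} -> ⦃ Fi A ⦄ -> Fi (Vec A n)
 Fi-Ve {A} {n} = record { els = ve els n;eq? = VP.≡-dec eq?;com = comp;unique = uniq n }
  where
  comp : ∀ {n} (v : Vec A n) -> v ∈ ve els n
  comp [] = here rfl
  comp (a ∷ v) = ∈P.∈-cartesianProductWith⁺ _∷_ (com a) (comp v)
  uniq : ∀ n -> Unique (ve els n)
  uniq zr = [] ∷ []
  uniq (suc n) = UP.cartesianProductWith⁺ _∷_ VP.∷-injective unique (uniq n)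

opaque
 unfolding Ʃ

 Ʃ-× : {A B : Set} ⦃ _ : Fi A ⦄ ⦃ _ : Fi B ⦄ (f : A × B -> ℚ) -> Ʃ f == Ʃ (\ a -> Ʃ (\ b -> f (a , b)))
 Ʃ-× f = ∑-ca _,_ els els f

 Ʃ-∷ : {A : Set} {n : ℕ} ⦃ _ : Fi A ⦄ (f : Vec A (suc n) -> ℚ) -> Ʃ f == Ʃ (\ a -> Ʃ (\ v -> f (a ∷ v)))
 Ʃ-∷ f = ∑-ca _∷_ els els f

-- The proof is irrelevant, so equality is decided on the values alone; `pr'` recomputes it from the
-- decision procedure.
record Sub {A : Set} {P : A -> Set} (P? : ∀ a -> Dec (P a)) : Set where
 constructor sub
 field
  val : A
  .prf : P val
open Sub public

module _ {A : Set} {P : A -> Set} (P? : ∀ a -> Dec (P a)) where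

 Su-≡ : {x y : Sub P?} -> val x == val y -> x == y
 Su-≡ rfl = rfl

 pr' : (x : Sub P?) -> P (val x)
 pr' (sub v p) = recompute (P? v) p

 su : List A -> List (Sub P?)
 su [] = []
 su (x ∷ xs) with P? x
 ... | yes p = sub x p ∷ su xs
 ... | no _ = su xs

 ∈-su : ∀ {xs} (x : Sub P?) -> val x ∈ xs -> x ∈ su xs
 ∈-su {y ∷ ys} x m with P? y
 ∈-su x (here rfl) | yes p = here rfl
 ∈-su x (there m) | yes p = there (∈-su x m)
 ∈-su x (here rfl) | no ¬p = absurd (pr' x) ¬p
 ∈-su x (there m) | no ¬p = ∈-su x m

 su-un : ∀ {xs} -> Unique xs -> Unique (su xs)
 su-un {[]} [] = []
 su-un {x ∷ xs} (u ∷ us) with P? x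
 ... | yes p = fr u ∷ su-un us
  where
  fr : ∀ {ys} -> All (x ≢_) ys -> All (sub x p ≢_) (su ys)
  fr {[]} [] = []
  fr {y ∷ ys} (n ∷ ns) with P? y
  ... | yes q = (\ e -> n (cg val e)) ∷ fr ns
  ... | no _ = fr ns
 ... | no _ = su-un us

 ∑-su : (xs : List A) (f : A -> ℚ) -> ∑ (su xs) (f ∘ val) == ∑ xs (\ a -> δ (P? a) & f a)
 ∑-su [] f = rfl
 ∑-su (x ∷ xs) f with P? x
 ... | yes p = ap2 _#_ (sym (δ-* (yes p) (\ _ -> rfl) (\ ¬p -> absurd p ¬p))) (∑-su xs f)
 ... | no ¬p = ∑-su xs f » sym (cg (_# rest) (δ-* (no ¬p) (\ p -> absurd p ¬p) (\ _ -> rfl)) » #-idˡ _)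
  where rest = ∑ xs (\ a -> δ (P? a) & f a)

instance
 Fi-Su : {A : Set} {P : A -> Set} {P? : ∀ a -> Dec (P a)} -> ⦃ Fi A ⦄ -> Fi (Sub P?)
 Fi-Su {P? = P?} = record
  { els = su P? els
  ;eq? = \ x y -> map′ (Su-≡ P?) (cg val) (eq? (val x) (val y))
  ;com = \ x -> ∈-su P? x (com (val x))
  ;unique = su-un P? unique }

-- Natural numbers inside the rationals, and positivity.

ι : ℕ -> ℚ
ι zr = 0q
ι (suc n) = 1q # ι n

ι-+ : ∀ m n -> ι (m + n) == ι m # ι n
ι-+ zr n = sym (#-idˡ _)
ι-+ (suc m) n = cg (1q #_) (ι-+ m n) » sym (#-as 1q (ι m) (ι n))

ι-* : ∀ m n -> ι (m * n) == ι m & ι n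
ι-* zr n = sym (&-zeroˡ _)
ι-* (suc m) n = ι-+ n (m * n) » cg (ι n #_) (ι-* m n) » #-&-su (ι m) (ι n)

ι-≥0 : ∀ n -> 0q ≤ᵠ ι n
ι-≥0 zr = ℚP.≤-refl
ι-≥0 (suc n) = #-≥0 (ℚP.nonNegative⁻¹ 1q) (ι-≥0 n)

ι-mo : ∀ {m n} -> m ≤ n -> ι m ≤ᵠ ι n
ι-mo {n = n} z≤n = ι-≥0 n
ι-mo (s≤s p) = #-mo-≤ (ℚP.≤-refl {1q}) (ι-mo p)

ι-mo-< : ∀ {m n} -> m < n -> ι m <ᵠ ι n
ι-mo-< {m} {suc n} (s≤s p) = ℚP.<-≤-trans (subst (_<ᵠ 1q # ι m) (#-idˡ (ι m)) (#-mo-<-≤ (ℚP.positive⁻¹ 1q) (ℚP.≤-refl {ι m}))) (#-mo-≤ (ℚP.≤-refl {1q}) (ι-mo p))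

ι-in : ∀ {m n} -> ι m == ι n -> m == n
ι-in {m} {n} e with <-cmp m n
... | tri< p _ _ = absurd e (ℚP.<⇒≢ (ι-mo-< p))
... | tri≈ _ p _ = p
... | tri> _ _ p = absurd (sym e) (ℚP.<⇒≢ (ι-mo-< p))

opaque
 unfolding _#_

 sq-≥0 : ∀ x -> 0q ≤ᵠ x & x
 sq-≥0 x with ℚP.≤-total 0q x
 ... | inl p = &-≥0 p p
 ... | inr p = subst (0q ≤ᵠ_) (ne-ne x) (&-≥0 (~-an p) (~-an p))
  where
  ne-ne : ∀ x -> (~ x) & (~ x) == x & x
  ne-ne = slv ℚ-ri

 sq≡0 : ∀ x -> x & x == 0q -> x == 0q
 sq≡0 x e with x ℚP.≟ 0q
 ... | yes p = p
 ... | no ¬p = begin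
  x ≡⟨ &-idʳ x ⟨
  x & 1q ≡⟨ cg (x &_) (&-⁻¹ ¬p) ⟨
  x & (x & x ⁻¹) ≡⟨ &-as x x _ ⟨
  x & x & x ⁻¹ ≡⟨ cg (_& x ⁻¹) e ⟩
  0q & x ⁻¹ ≡⟨ &-zeroˡ (x ⁻¹) ⟩
  0q ∎
  where open ≡-Reasoning

 ⊝≡0 : ∀ x y -> x # ~ y == 0q -> x == y
 ⊝≡0 x y e = lem x y » cg (_# y) e » #-idˡ y
  where
  lem : ∀ x y -> x == x # ~ y # y
  lem = slv ℚ-ri

 ≤-#ˡ : ∀ {x y} -> 0q ≤ᵠ y -> x ≤ᵠ y # x
 ≤-#ˡ {x} {y} p = subst (_≤ᵠ y # x) (#-idˡ x) (ℚP.+-monoˡ-≤ x p)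

 ≤-#ʳ : ∀ {x y} -> 0q ≤ᵠ y -> x ≤ᵠ x # y
 ≤-#ʳ {x} {y} p = subst (_≤ᵠ x # y) (#-idʳ x) (ℚP.+-monoʳ-≤ x p)

1>0 : 0q <ᵠ 1q
1>0 = ℚP.positive⁻¹ 1q

&-ca->0 : ∀ {c x} -> 0q <ᵠ c -> 0q ≤ᵠ c & x -> 0q ≤ᵠ x
&-ca->0 {c} {x} p q = subst (0q ≤ᵠ_) eq (&-≥0 (ℚP.<⇒≤ (⁻¹->0 p)) q)
 where
 eq : c ⁻¹ & (c & x) == x
 eq = sym (&-as _ c x) » cg (_& x) (&-co _ c » &-⁻¹ (\ e -> ℚP.<⇒≢ p (sym e))) » &-idˡ x

&-ca : ∀ {c x y} -> c ≢ 0q -> c & x == c & y -> x == y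
&-ca {c} {x} {y} ne e = eq x » cg (c ⁻¹ &_) e » sym (eq y)
 where
 eq : ∀ z -> z == c ⁻¹ & (c & z)
 eq z = sym (sym (&-as _ c z) » cg (_& z) (&-co _ c » &-⁻¹ ne) » &-idˡ z)

∑-≥term : {A : Set} (xs : List A) {f : A -> ℚ} -> (∀ a -> 0q ≤ᵠ f a) -> ∀ {a} -> a ∈ xs -> f a ≤ᵠ ∑ xs f
∑-≥term (x ∷ xs) p (here rfl) = ≤-#ʳ (∑-≥0 xs p)
∑-≥term (x ∷ xs) p (there m) = ℚP.≤-trans (∑-≥term xs p m) (≤-#ˡ (p x))

module _ {A : Set} ⦃ _ : Fi A ⦄ where

 opaque
  unfolding Ʃ

  Ʃ-≥term : {f : A -> ℚ} -> (∀ a -> 0q ≤ᵠ f a) -> ∀ a -> f a ≤ᵠ Ʃ f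
  Ʃ-≥term p a = ∑-≥term els p (com a)

 Ʃ->0 : {f : A -> ℚ} -> (∀ a -> 0q ≤ᵠ f a) -> ∀ a -> 0q <ᵠ f a -> 0q <ᵠ Ʃ f
 Ʃ->0 p a q = ℚP.<-≤-trans q (Ʃ-≥term p a)

 Ʃ-ze : {f : A -> ℚ} -> (∀ a -> 0q ≤ᵠ f a) -> Ʃ f == 0q -> ∀ a -> f a == 0q
 Ʃ-ze {f} p e a = ℚP.≤-antisym (subst (f a ≤ᵠ_) e (Ʃ-≥term p a)) (p a)

 Ʃ-co₂ : {B : Set} ⦃ _ : Fi B ⦄ {f g : A -> B -> ℚ} -> (∀ a b -> f a b == g a b) ->
  Ʃ (\ a -> Ʃ (f a)) == Ʃ (\ a -> Ʃ (g a))
 Ʃ-co₂ eq = Ʃ-co (\ a -> Ʃ-co (eq a))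

-- Finite groups, representations and Schur orthogonality.

module _ {X : Set} ⦃ _ : Fi X ⦄ where
 open ≡-Reasoning

 -- The sum of the squared entries of E - v vᵀ/d is tr E² - 2 (v·Ev)/d + (v·v)²/d² = 1 - 2 + 1 = 0.
 -- This replaces the argument that a projection of trace one has a one-dimensional image, and needs
 -- no bases.
 ra-on : (E : X -> X -> ℚ) (v : X -> ℚ) (d : ℚ) -> d ≢ 0q ->
  (∀ x y -> E x y == E y x) -> (∀ x y -> Ʃ (\ z -> E x z & E z y) == E x y) ->
  Ʃ (\ x -> E x x) == 1q -> (∀ x -> Ʃ (\ y -> E x y & v y) == v x) -> Ʃ (\ x -> v x & v x) == d ->
  ∀ x y -> E x y == d ⁻¹ & (v x & v y)
 ra-on E v d d≢0 E-sy E-id E-tr Ev v² x y =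
  ⊝≡0 _ _ (sq≡0 _ (Ʃ-ze (\ y -> sq-≥0 (F x y)) (Ʃ-ze (\ x -> Ʃ-≥0 (\ y -> sq-≥0 (F x y))) tota x) y))
  where
  F : X -> X -> ℚ
  F x y = E x y # ~ (d ⁻¹ & (v x & v y))
  opaque
   unfolding _#_
   exp : ∀ e c a b -> (e # ~ (c & (a & b))) & (e # ~ (c & (a & b)))
    == e & e # (~ (c # c) & (a & (e & b)) # c & c & (a & a & (b & b)))
   exp = slv ℚ-ri
   coll : ∀ c d -> 1q # (~ (c # c) & d # c & c & (d & d)) == (1q # ~ (d & c)) & (1q # ~ (d & c))
   coll = slv ℚ-ri
  ƩE² : Ʃ (\ x -> Ʃ (\ y -> E x y & E x y)) == 1q
  ƩE² = Ʃ-co (\ x -> Ʃ-co (\ y -> cg (E x y &_) (E-sy x y)) » E-id x x) » E-tr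
  ƩvEv : Ʃ (\ x -> Ʃ (\ y -> v x & (E x y & v y))) == d
  ƩvEv = Ʃ-co (\ x -> Ʃ-*ˡ (v x) _ » cg (v x &_) (Ev x)) » v²
  Ʃvv : Ʃ (\ x -> Ʃ (\ y -> v x & v x & (v y & v y))) == d & d
  Ʃvv = Ʃ-& _ _ » ap2 _&_ v² v²
  tota : Ʃ (\ x -> Ʃ (\ y -> F x y & F x y)) == 0q
  tota = begin
   Ʃ (\ x -> Ʃ (\ y -> F x y & F x y))
    ≡⟨ Ʃ-co₂ (\ x y -> exp (E x y) (d ⁻¹) (v x) (v y)) ⟩
   Ʃ (\ x -> Ʃ (\ y -> E x y & E x y # (c' & (v x & (E x y & v y)) # c″ & (v x & v x & (v y & v y)))))
    ≡⟨ Ʃ-co (\ x -> Ʃ-# _ _ » cg (Ʃ (\ y -> E x y & E x y) #_)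
     (Ʃ-# _ _ » ap2 _#_ (Ʃ-*ˡ c' _) (Ʃ-*ˡ c″ _))) ⟩
   Ʃ (\ x -> Ʃ (\ y -> E x y & E x y) # (c' & Ʃ (\ y -> v x & (E x y & v y)) # c″ & Ʃ (\ y -> v x & v x & (v y & v y))))
    ≡⟨ trans (Ʃ-# _ _) (ap2 _#_ ƩE² (Ʃ-# _ _ »
     ap2 _#_ (Ʃ-*ˡ c' _ » cg (c' &_) ƩvEv) (Ʃ-*ˡ c″ _ » cg (c″ &_) Ʃvv))) ⟩
   1q # (c' & d # c″ & (d & d))
    ≡⟨ coll (d ⁻¹) d ⟩
   (1q # ~ (d & d ⁻¹)) & (1q # ~ (d & d ⁻¹))
    ≡⟨ cg (\ z -> (1q # ~ z) & (1q # ~ z)) (&-⁻¹ d≢0) ⟩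
   (1q # ~ 1q) & (1q # ~ 1q)
    ≡⟨ cg (_& (1q # ~ 1q)) (~-invʳ 1q) ⟩
   0q & (1q # ~ 1q)
    ≡⟨ &-zeroˡ _ ⟩
   0q ∎
   where
   c' = ~ (d ⁻¹ # d ⁻¹)
   c″ = d ⁻¹ & d ⁻¹

record FG : Set₁ where
 infixl 7 _∙_
 field
  G : Set
  ⦃ finite ⦄ : Fi G
  _∙_ : G -> G -> G
  ε : G
  inv : G -> G
  assoc : ∀ g h k -> (g ∙ h) ∙ k == g ∙ (h ∙ k)
  idˡ : ∀ g -> ε ∙ g == g
  idʳ : ∀ g -> g ∙ ε == g
  invˡ : ∀ g -> inv g ∙ g == ε
  invʳ : ∀ g -> g ∙ inv g == ε

 open ≡-Reasoning

 in-cancelˡ : ∀ g h -> inv g ∙ (g ∙ h) == h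
 in-cancelˡ g h = sym (assoc _ g h) » cg (_∙ h) (invˡ g) » idˡ h

 in-cancelʳ : ∀ g h -> g ∙ (inv g ∙ h) == h
 in-cancelʳ g h = sym (assoc g _ h) » cg (_∙ h) (invʳ g) » idˡ h

 cancelʳ-inv : ∀ g h -> (h ∙ g) ∙ inv g == h
 cancelʳ-inv g h = assoc h g _ » cg (h ∙_) (invʳ g) » idʳ h

 cancelʳ-inv′ : ∀ g h -> (h ∙ inv g) ∙ g == h
 cancelʳ-inv′ g h = assoc h _ g » cg (h ∙_) (invˡ g) » idʳ h

 in-un : ∀ g h -> g ∙ h == ε -> h == inv g
 in-un g h e = sym (in-cancelˡ g h) » cg (inv g ∙_) e » idʳ _

 in-in : ∀ g -> inv (inv g) == g
 in-in g = sym (in-un (inv g) g (invˡ g))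

 inv-∙ : ∀ g h -> inv (g ∙ h) == inv h ∙ inv g
 inv-∙ g h = sym (in-un (g ∙ h) (inv h ∙ inv g)
  (assoc g h _ » cg (g ∙_) (in-cancelʳ h (inv g)) » invʳ g))

 Ʃ-left : ∀ h (f : G -> ℚ) -> Ʃ (\ g -> f (h ∙ g)) == Ʃ f
 Ʃ-left h f = Ʃ-bi (h ∙_) (inv h ∙_) (in-cancelˡ h) (in-cancelʳ h) f

 Ʃ-right : ∀ h (f : G -> ℚ) -> Ʃ (\ g -> f (g ∙ h)) == Ʃ f
 Ʃ-right h f = Ʃ-bi (_∙ h) (_∙ inv h) (cancelʳ-inv h) (cancelʳ-inv′ h) f

 Ʃ-in : (f : G -> ℚ) -> Ʃ (\ g -> f (inv g)) == Ʃ f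
 Ʃ-in f = Ʃ-bi inv inv in-in in-in f

 Ʃ-con : ∀ h (f : G -> ℚ) -> Ʃ (\ g -> f (h ∙ g ∙ inv h)) == Ʃ f
 Ʃ-con h f = Ʃ-left h (\ g -> f (g ∙ inv h)) » Ʃ-right (inv h) f

 order : ℚ
 order = Ʃ {G} (\ _ -> 1q)

 order>0 : 0q <ᵠ order
 order>0 = Ʃ->0 (\ _ -> ℚP.nonNegative⁻¹ 1q) ε (ℚP.positive⁻¹ 1q)

 order≢0 : order ≢ 0q
 order≢0 e = ℚP.<⇒≢ order>0 (sym e)

 Ʃ-const : ∀ c -> Ʃ {G} (\ _ -> c) == order & c
 Ʃ-const c = Ʃ-co (\ _ -> sym (&-idˡ c)) » Ʃ-*ʳ c _

 Cl : (G -> ℚ) -> Set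
 Cl φ = ∀ g h -> φ (h ∙ g ∙ inv h) == φ g

 cla-com : ∀ {φ} -> Cl φ -> ∀ g h -> φ (g ∙ h) == φ (h ∙ g)
 cla-com {φ} c g h = sym (c (g ∙ h) h) »
  cg φ (cg (_∙ inv h) (sym (assoc h g h)) » cancelʳ-inv h (h ∙ g))

 ⟪_,_⟫ : (G -> ℚ) -> (G -> ℚ) -> ℚ
 ⟪ φ , ψ ⟫ = Ʃ (\ g -> φ g & ψ g)

 ⟪⟫-comm : ∀ φ ψ -> ⟪ φ , ψ ⟫ == ⟪ ψ , φ ⟫
 ⟪⟫-comm φ ψ = Ʃ-co (\ g -> &-co (φ g) (ψ g))

 -- Up to the positive scalar `c`, a sum of autocorrelations of rational functions on the group. The
 -- scalar allows group orders to be kept as factors instead of being divided out.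
 record PosDef (φ : G -> ℚ) : Set₁ where
  field
   J : Set
   ⦃ fJ ⦄ : Fi J
   a : J -> G -> ℚ
   c : ℚ
   c>0 : 0q <ᵠ c
   au : ∀ g -> c & φ g == Ʃ (\ j -> Ʃ (\ h -> a j h & a j (h ∙ g)))

 -- Writing the variable of the second autocorrelation as m ∙ s, with s the variable of the first,
 -- the sum over the group element separates, and each m contributes the square of a
 -- cross-correlation.
 PosDef-pair : ∀ {φ ψ} -> PosDef φ -> PosDef ψ -> 0q ≤ᵠ ⟪ φ , ψ ⟫
 PosDef-pair {φ} {ψ} P Q = &-ca->0 (&->0 P.c>0 Q.c>0)
  (subst (0q ≤ᵠ_) (sym eq) (Ʃ-≥0 (\ j -> Ʃ-≥0 (\ k -> Ʃ-≥0 (\ m -> sq-≥0 _)))))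
  where
  module P = PosDef P
  module Q = PosDef Q
  instance
   fP = P.fJ
   fQ = Q.fJ
  su-sq : ∀ j k -> Ʃ (\ g -> Ʃ (\ h -> P.a j h & P.a j (h ∙ g)) & Ʃ (\ h -> Q.a k h & Q.a k (h ∙ g)))
   == Ʃ (\ m -> Ʃ (\ s -> P.a j s & Q.a k (m ∙ s)) & Ʃ (\ s -> P.a j s & Q.a k (m ∙ s)))
  su-sq j k = begin
   Ʃ (\ g -> Ʃ (\ h -> a h & a (h ∙ g)) & Ʃ (\ h -> b h & b (h ∙ g)))
    ≡⟨ Ʃ-co (\ g -> Ʃ-*ʳ _ _) ⟨
   Ʃ (\ g -> Ʃ (\ s -> a s & a (s ∙ g) & Ʃ (\ h -> b h & b (h ∙ g))))
    ≡⟨ Ʃ-co₂ (\ g s -> cg (a s & a (s ∙ g) &_) (Ʃ-right s (\ h -> b h & b (h ∙ g)))) ⟨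
   Ʃ (\ g -> Ʃ (\ s -> a s & a (s ∙ g) & Ʃ (\ m -> b (m ∙ s) & b (m ∙ s ∙ g))))
    ≡⟨ Ʃ-sw _ ⟩
   Ʃ (\ s -> Ʃ (\ g -> a s & a (s ∙ g) & Ʃ (\ m -> b (m ∙ s) & b (m ∙ s ∙ g))))
    ≡⟨ Ʃ-co₂ (\ s g -> sym (Ʃ-*ˡ _ _) » Ʃ-co (\ m ->
     &-4 (a s) _ _ _ » cg (\ z -> a s & b (m ∙ s) & (a (s ∙ g) & b z)) (assoc m s g))) ⟩
   Ʃ (\ s -> Ʃ (\ g -> Ʃ (\ m -> a s & b (m ∙ s) & (a (s ∙ g) & b (m ∙ (s ∙ g))))))
    ≡⟨ Ʃ-co (\ s -> Ʃ-left s (\ t -> Ʃ (\ m -> a s & b (m ∙ s) & (a t & b (m ∙ t))))) ⟩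
   Ʃ (\ s -> Ʃ (\ t -> Ʃ (\ m -> a s & b (m ∙ s) & (a t & b (m ∙ t)))))
    ≡⟨ Ʃ-co (\ s -> Ʃ-sw _) ⟩
   Ʃ (\ s -> Ʃ (\ m -> Ʃ (\ t -> a s & b (m ∙ s) & (a t & b (m ∙ t)))))
    ≡⟨ Ʃ-sw _ ⟩
   Ʃ (\ m -> Ʃ (\ s -> Ʃ (\ t -> a s & b (m ∙ s) & (a t & b (m ∙ t)))))
    ≡⟨ Ʃ-co (\ m -> Ʃ-& _ _) ⟩
   Ʃ (\ m -> Ʃ (\ s -> a s & b (m ∙ s)) & Ʃ (\ s -> a s & b (m ∙ s))) ∎
   where
   a = P.a j
   b = Q.a k
  eq : P.c & Q.c & ⟪ φ , ψ ⟫ == Ʃ (\ j -> Ʃ (\ k -> Ʃ (\ m ->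
   Ʃ (\ s -> P.a j s & Q.a k (m ∙ s)) & Ʃ (\ s -> P.a j s & Q.a k (m ∙ s)))))
  eq = begin
   P.c & Q.c & ⟪ φ , ψ ⟫
    ≡⟨ Ʃ-*ˡ _ _ ⟨
   Ʃ (\ g -> P.c & Q.c & (φ g & ψ g))
    ≡⟨ Ʃ-co (\ g -> &-4 P.c Q.c (φ g) (ψ g) » ap2 _&_ (P.au g) (Q.au g)) ⟩
   Ʃ (\ g -> Ʃ (\ j -> Ʃ (\ h -> P.a j h & P.a j (h ∙ g))) & Ʃ (\ k -> Ʃ (\ h -> Q.a k h & Q.a k (h ∙ g))))
    ≡⟨ Ʃ-co (\ g -> Ʃ-& _ _) ⟨
   Ʃ (\ g -> Ʃ (\ j -> Ʃ (\ k -> Ʃ (\ h -> P.a j h & P.a j (h ∙ g)) & Ʃ (\ h -> Q.a k h & Q.a k (h ∙ g)))))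
    ≡⟨ Ʃ-sw _ ⟩
   Ʃ (\ j -> Ʃ (\ g -> Ʃ (\ k -> Ʃ (\ h -> P.a j h & P.a j (h ∙ g)) & Ʃ (\ h -> Q.a k h & Q.a k (h ∙ g)))))
    ≡⟨ Ʃ-co (\ j -> Ʃ-sw _ » Ʃ-co (su-sq j)) ⟩
   _ ∎

 -- An orthogonal representation in which `ρ ε` need only be idempotent: the space is the image of
 -- this projection. A subrepresentation is then cut out by another projection on the same
 -- coordinates, and no basis of it has to be found.
 record Rep (φ : G -> ℚ) : Set₁ where
  field
   I : Set
   ⦃ fI ⦄ : Fi I
   ρ : G -> I -> I -> ℚ
   ρ-∙ : ∀ g h i j -> ρ (g ∙ h) i j == Ʃ (\ k -> ρ g i k & ρ h k j)
   ρ-inv : ∀ g i j -> ρ (inv g) i j == ρ g j i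
   ρ-trace : ∀ g -> Ʃ (\ i -> ρ g i i) == φ g

  ρ-εʳ : ∀ g i j -> Ʃ (\ k -> ρ g i k & ρ ε k j) == ρ g i j
  ρ-εʳ g i j = sym (ρ-∙ g ε i j) » cg (\ z -> ρ z i j) (idʳ g)

  ρ-ε-sym : ∀ i j -> ρ ε i j == ρ ε j i
  ρ-ε-sym i j = cg (\ z -> ρ z i j) (in-un ε ε (idˡ ε)) » ρ-inv ε i j

  tra-com : ∀ g h -> φ (g ∙ h) == φ (h ∙ g)
  tra-com g h = begin
   φ (g ∙ h) ≡⟨ ρ-trace _ ⟨
   Ʃ (\ i -> ρ (g ∙ h) i i) ≡⟨ Ʃ-co (\ i -> ρ-∙ g h i i) ⟩
   Ʃ (\ i -> Ʃ (\ k -> ρ g i k & ρ h k i)) ≡⟨ Ʃ-sw _ ⟩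
   Ʃ (\ k -> Ʃ (\ i -> ρ g i k & ρ h k i)) ≡⟨ Ʃ-co₂ (\ k i -> &-co (ρ g i k) (ρ h k i)) ⟩
   Ʃ (\ k -> Ʃ (\ i -> ρ h k i & ρ g i k)) ≡⟨ Ʃ-co (\ i -> ρ-∙ h g i i) ⟨
   Ʃ (\ i -> ρ (h ∙ g) i i) ≡⟨ ρ-trace _ ⟩
   φ (h ∙ g) ∎

  tr-cl : Cl φ
  tr-cl g h = tra-com (h ∙ g) (inv h) » cg φ (in-cancelˡ h g)

  tr-in : ∀ g -> φ (inv g) == φ g
  tr-in g = sym (ρ-trace _) » Ʃ-co (\ i -> ρ-inv g i i) » ρ-trace g

 -- The functions are the matrix entries. By orthogonality the sum over i of the products of entries
 -- of `ρ h` and `ρ (h ∙ g)` in column j is the diagonal entry of `ρ g`.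
 Rep⇒PosDef : ∀ {φ} -> Rep φ -> PosDef φ
 Rep⇒PosDef {φ} R = record
  { J = I × I;a = \ { (i , j) g -> ρ g i j };c = order;c>0 = order>0;au = corr }
  where
  open Rep R
  instance
   fI' = fI
  corr : ∀ g -> order & φ g == Ʃ (\ ((i , j) : I × I) -> Ʃ (\ h -> ρ h i j & ρ (h ∙ g) i j))
  corr g = sym (begin
   Ʃ (\ ((i , j) : I × I) -> Ʃ (\ h -> ρ h i j & ρ (h ∙ g) i j))
    ≡⟨ Ʃ-× _ ⟩
   Ʃ (\ i -> Ʃ (\ j -> Ʃ (\ h -> ρ h i j & ρ (h ∙ g) i j)))
    ≡⟨ Ʃ-sw _ ⟩
   Ʃ (\ j -> Ʃ (\ i -> Ʃ (\ h -> ρ h i j & ρ (h ∙ g) i j)))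
    ≡⟨ Ʃ-co (\ j -> Ʃ-sw _) ⟩
   Ʃ (\ j -> Ʃ (\ h -> Ʃ (\ i -> ρ h i j & ρ (h ∙ g) i j)))
    ≡⟨ Ʃ-co₂ (\ j h -> Ʃ-co (\ i -> cg (_& ρ (h ∙ g) i j) (sym (ρ-inv h j i))) »
     sym (ρ-∙ (inv h) (h ∙ g) j j) » cg (\ z -> ρ z j j) (in-cancelˡ h g)) ⟩
   Ʃ (\ j -> Ʃ (\ h -> ρ g j j))
    ≡⟨ Ʃ-co (\ j -> Ʃ-const _) ⟩
   Ʃ (\ j -> order & ρ g j j)
    ≡⟨ Ʃ-*ˡ order _ » cg (order &_) (ρ-trace g) ⟩
   order & φ g ∎)

module Sc (𝔾 : FG) where
 open FG 𝔾
 open ≡-Reasoning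
 instance
  fG = finite

 module Irr {χ : G -> ℚ} (R : Rep χ) (norm : ⟪ χ , χ ⟫ == order) where
  open Rep R renaming (ρ to τ;ρ-∙ to τ-∙;ρ-inv to τ-inv;ρ-trace to τ-trace;ρ-εʳ to τ-εʳ;ρ-ε-sym to τ-ε-sym)
  instance
   fI' = fI

  d : ℚ
  d = χ ε

  Ʃε² : Ʃ (\ i -> Ʃ (\ k -> τ ε i k & τ ε i k)) == d
  Ʃε² = Ʃ-co (\ i -> Ʃ-co (\ k -> cg (τ ε i k &_) (τ-ε-sym i k)) » τ-εʳ ε i i) » τ-trace ε

  -- The dimension is also the sum of the squared entries of the symmetric idempotent `τ ε`. If it
  -- vanished, `τ ε` and with it the whole character would vanish, against `norm`.
  d≢0 : d ≢ 0q
  d≢0 d≡0 = order≢0 (sym norm » Ʃ-0 (\ g -> cg (_& χ g) (χ≡0 g) » &-zeroˡ _))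
   where
   ε≡0 : ∀ i k -> τ ε i k == 0q
   ε≡0 i k = sq≡0 _ (Ʃ-ze (\ k -> sq-≥0 _) (Ʃ-ze (\ i -> Ʃ-≥0 (\ k -> sq-≥0 _)) (Ʃε² » d≡0) i) k)
   χ≡0 : ∀ g -> χ g == 0q
   χ≡0 g = sym (τ-trace g) » Ʃ-0 (\ i -> sym (τ-εʳ g i i) »
    Ʃ-0 (\ k -> cg (τ g i k &_) (ε≡0 k i) » &-zeroʳ _))

  -- The projection of V ⊗ V onto its invariants. Its trace is the norm of χ divided by the order,
  -- hence 1, and the identity of V, here `τ ε`, is an invariant: `norm` thus takes the place of
  -- irreducibility.
  E : I × I -> I × I -> ℚ
  E (i , k) (j , l) = order ⁻¹ & Ʃ (\ g -> τ g i j & τ g k l)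

  v : I × I -> ℚ
  v (i , k) = τ ε i k

  order⁻¹-& : ∀ x -> order ⁻¹ & (order & x) == x
  order⁻¹-& x = sym (&-as _ _ x) » cg (_& x) (&-co _ _ » &-⁻¹ order≢0) » &-idˡ x

  E-sy : ∀ x y -> E x y == E y x
  E-sy (i , k) (j , l) = cg (order ⁻¹ &_) (sym (Ʃ-in _) » Ʃ-co (\ g -> ap2 _&_ (τ-inv g i j) (τ-inv g k l)))

  E-id : ∀ x y -> Ʃ (\ z -> E x z & E z y) == E x y
  E-id (i , k) (m , p) = begin
   Ʃ (\ z -> E (i , k) z & E z (m , p))
    ≡⟨ Ʃ-co (\ { (j , l) -> &-4 o _ o _ }) ⟩
   Ʃ (\ { (j , l) -> o & o & (Ʃ (\ g -> τ g i j & τ g k l) & Ʃ (\ h -> τ h j m & τ h l p)) })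
    ≡⟨ Ʃ-co (\ { (j , l) -> cg (o & o &_) (sym (Ʃ-& _ _) » Ʃ-co₂ (\ g h -> &-4 _ _ _ _)) }) ⟩
   Ʃ (\ { (j , l) -> o & o & Ʃ (\ g -> Ʃ (\ h -> (τ g i j & τ h j m) & (τ g k l & τ h l p))) })
    ≡⟨ Ʃ-× _ ⟩
   Ʃ (\ j -> Ʃ (\ l -> o & o & Ʃ (\ g -> Ʃ (\ h -> (τ g i j & τ h j m) & (τ g k l & τ h l p)))))
    ≡⟨ trans (Ʃ-co (\ j -> Ʃ-*ˡ _ _)) (Ʃ-*ˡ _ _) ⟩
   o & o & Ʃ (\ j -> Ʃ (\ l -> Ʃ (\ g -> Ʃ (\ h -> (τ g i j & τ h j m) & (τ g k l & τ h l p)))))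
    ≡⟨ cg (o & o &_) (Ʃ-co (\ j -> Ʃ-sw _) » Ʃ-sw _) ⟩
   o & o & Ʃ (\ g -> Ʃ (\ j -> Ʃ (\ l -> Ʃ (\ h -> (τ g i j & τ h j m) & (τ g k l & τ h l p)))))
    ≡⟨ cg (o & o &_) (Ʃ-co (\ g -> Ʃ-co (\ j -> Ʃ-sw _) » Ʃ-sw _)) ⟩
   o & o & Ʃ (\ g -> Ʃ (\ h -> Ʃ (\ j -> Ʃ (\ l -> (τ g i j & τ h j m) & (τ g k l & τ h l p)))))
    ≡⟨ cg (o & o &_) (Ʃ-co₂ (\ g h -> Ʃ-& _ _ » ap2 _&_ (sym (τ-∙ g h i m)) (sym (τ-∙ g h k p)))) ⟩
   o & o & Ʃ (\ g -> Ʃ (\ h -> τ (g ∙ h) i m & τ (g ∙ h) k p))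
    ≡⟨ cg (o & o &_) (Ʃ-co (\ g -> Ʃ-left g (\ h -> τ h i m & τ h k p)) » Ʃ-const _) ⟩
   o & o & (order & Ʃ (\ h -> τ h i m & τ h k p))
    ≡⟨ trans (&-as o o _) (cg (o &_) (order⁻¹-& _)) ⟩
   E (i , k) (m , p) ∎
   where o = order ⁻¹

  E-tra : Ʃ (\ x -> E x x) == 1q
  E-tra = begin
   Ʃ (\ x -> E x x) ≡⟨ Ʃ-× _ ⟩
   Ʃ (\ i -> Ʃ (\ k -> o & Ʃ (\ g -> τ g i i & τ g k k))) ≡⟨ trans (Ʃ-co (\ i -> Ʃ-*ˡ o _)) (Ʃ-*ˡ o _) ⟩
   o & Ʃ (\ i -> Ʃ (\ k -> Ʃ (\ g -> τ g i i & τ g k k))) ≡⟨ cg (o &_) (Ʃ-co (\ j -> Ʃ-sw _) » Ʃ-sw _) ⟩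
   o & Ʃ (\ g -> Ʃ (\ i -> Ʃ (\ k -> τ g i i & τ g k k))) ≡⟨ cg (o &_) (Ʃ-co (\ g -> Ʃ-& _ _ » ap2 _&_ (τ-trace g) (τ-trace g))) ⟩
   o & ⟪ χ , χ ⟫ ≡⟨ cg (o &_) (norm » sym (&-idʳ order)) ⟩
   o & (order & 1q) ≡⟨ order⁻¹-& 1q ⟩
   1q ∎
   where o = order ⁻¹

  τ-co-ε : ∀ g i k -> Ʃ (\ j -> Ʃ (\ l -> τ g i j & τ g k l & τ ε j l)) == τ ε i k
  τ-co-ε g i k = begin
   Ʃ (\ j -> Ʃ (\ l -> τ g i j & τ g k l & τ ε j l))
    ≡⟨ Ʃ-co₂ (\ j l -> &-as _ _ _ » cg (τ g i j &_) (cg (τ g k l &_) (τ-ε-sym j l))) ⟩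
   Ʃ (\ j -> Ʃ (\ l -> τ g i j & (τ g k l & τ ε l j)))
    ≡⟨ Ʃ-co (\ j -> Ʃ-*ˡ _ _ » cg (τ g i j &_) (τ-εʳ g k j » sym (τ-inv g j k))) ⟩
   Ʃ (\ j -> τ g i j & τ (inv g) j k)
    ≡⟨ trans (sym (τ-∙ g (inv g) i k)) (cg (\ z -> τ z i k) (invʳ g)) ⟩
   τ ε i k ∎

  E-v : ∀ x -> Ʃ (\ y -> E x y & v y) == v x
  E-v (i , k) = begin
   Ʃ (\ y -> E (i , k) y & v y)
    ≡⟨ Ʃ-× _ ⟩
   Ʃ (\ j -> Ʃ (\ l -> o & Ʃ (\ g -> τ g i j & τ g k l) & τ ε j l))
    ≡⟨ Ʃ-co₂ (\ j l -> &-as o _ _ » cg (o &_) (sym (Ʃ-*ʳ _ _))) ⟩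
   Ʃ (\ j -> Ʃ (\ l -> o & Ʃ (\ g -> τ g i j & τ g k l & τ ε j l)))
    ≡⟨ trans (Ʃ-co (\ j -> Ʃ-*ˡ o _)) (Ʃ-*ˡ o _) ⟩
   o & Ʃ (\ j -> Ʃ (\ l -> Ʃ (\ g -> τ g i j & τ g k l & τ ε j l)))
    ≡⟨ cg (o &_) (Ʃ-co (\ j -> Ʃ-sw _) » Ʃ-sw _) ⟩
   o & Ʃ (\ g -> Ʃ (\ j -> Ʃ (\ l -> τ g i j & τ g k l & τ ε j l)))
    ≡⟨ cg (o &_) (Ʃ-co (\ g -> τ-co-ε g i k) » Ʃ-const _) ⟩
   o & (order & τ ε i k)
    ≡⟨ order⁻¹-& _ ⟩
   τ ε i k ∎
   where o = order ⁻¹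

  -- Schur orthogonality: `ra-on` identifies the averaging projection `E` with the rank one
  -- projection on `v`.
  sch : ∀ i k j l -> Ʃ (\ g -> τ g i j & τ g k l) == order & (d ⁻¹ & (τ ε i k & τ ε j l))
  sch i k j l = sym (sym (&-as _ _ _) » cg (_& Ʃ _) (&-⁻¹ order≢0) » &-idˡ _) »
   cg (order &_) (ra-on E v d d≢0 E-sy E-id E-tra E-v (Ʃ-× _ » Ʃε²) (i , k) (j , l))

  -- Schur's lemma for the operator Σ φ(g) τ(g): a class function does not change when g is averaged
  -- over its conjugates, and the averaged products of matrix entries are given by `sch`.
  av : ∀ φ -> Cl φ -> ∀ i k -> Ʃ (\ g -> φ g & τ g i k) == d ⁻¹ & ⟪ φ , χ ⟫ & τ ε i k
  av φ cl i k = &-ca order≢0 (begin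
   order & Ʃ (\ g -> φ g & τ g i k)
    ≡⟨ Ʃ-const _ ⟨
   Ʃ (\ h -> Ʃ (\ g -> φ g & τ g i k))
    ≡⟨ Ʃ-co (\ h -> Ʃ-con h (\ g -> φ g & τ g i k)) ⟨
   Ʃ (\ h -> Ʃ (\ g -> φ (h ∙ g ∙ inv h) & τ (h ∙ g ∙ inv h) i k))
    ≡⟨ Ʃ-co₂ (\ h g -> ap2 _&_ (cl g h) (exp h g)) ⟩
   Ʃ (\ h -> Ʃ (\ g -> φ g & Ʃ (\ j -> Ʃ (\ l -> τ g j l & (τ h i j & τ h k l)))))
    ≡⟨ Ʃ-sw _ ⟩
   Ʃ (\ g -> Ʃ (\ h -> φ g & Ʃ (\ j -> Ʃ (\ l -> τ g j l & (τ h i j & τ h k l)))))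
    ≡⟨ Ʃ-co (\ g -> Ʃ-*ˡ (φ g) _ » cg (φ g &_) (Ʃ-sw _ » Ʃ-co (\ j -> Ʃ-sw _))) ⟩
   Ʃ (\ g -> φ g & Ʃ (\ j -> Ʃ (\ l -> Ʃ (\ h -> τ g j l & (τ h i j & τ h k l)))))
    ≡⟨ Ʃ-co (\ g -> cg (φ g &_) (Ʃ-co₂ (\ j l -> Ʃ-*ˡ _ _ » cg (τ g j l &_) (sch i k j l)))) ⟩
   Ʃ (\ g -> φ g & Ʃ (\ j -> Ʃ (\ l -> τ g j l & (order & (d ⁻¹ & (τ ε i k & τ ε j l))))))
    ≡⟨ Ʃ-co (\ g -> cg (φ g &_) (Ʃ-co₂ (\ j l -> shu (τ g j l) (d ⁻¹) (τ ε i k) (τ ε j l) order))) ⟩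
   Ʃ (\ g -> φ g & Ʃ (\ j -> Ʃ (\ l -> order & (d ⁻¹ & τ ε i k) & (τ g j l & τ ε j l))))
    ≡⟨ Ʃ-co (\ g -> cg (φ g &_) (Ʃ-co (\ j -> Ʃ-*ˡ _ _) » Ʃ-*ˡ _ _ » cg (order & (d ⁻¹ & τ ε i k) &_) (traceε g))) ⟩
   Ʃ (\ g -> φ g & (order & (d ⁻¹ & τ ε i k) & χ g))
    ≡⟨ Ʃ-co (\ g -> &-sw (φ g) _ (χ g)) ⟩
   Ʃ (\ g -> order & (d ⁻¹ & τ ε i k) & (φ g & χ g))
    ≡⟨ Ʃ-*ˡ _ _ ⟩
   order & (d ⁻¹ & τ ε i k) & ⟪ φ , χ ⟫
    ≡⟨ fin order (d ⁻¹) (τ ε i k) ⟪ φ , χ ⟫ ⟩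
   order & (d ⁻¹ & ⟪ φ , χ ⟫ & τ ε i k) ∎)
   where
   opaque
    unfolding _#_
    shu : ∀ a b c e o -> a & (o & (b & (c & e))) == o & (b & c) & (a & e)
    shu = slv ℚ-ri
    fin : ∀ o b c f -> o & (b & c) & f == o & (b & f & c)
    fin = slv ℚ-ri
    rot : ∀ a b c -> a & b & c == b & (a & c)
    rot = slv ℚ-ri
   traceε : ∀ g -> Ʃ (\ j -> Ʃ (\ l -> τ g j l & τ ε j l)) == χ g
   traceε g = Ʃ-co (\ j -> Ʃ-co (\ l -> cg (τ g j l &_) (τ-ε-sym j l)) » τ-εʳ g j j) » τ-trace g
   exp : ∀ h g -> τ (h ∙ g ∙ inv h) i k == Ʃ (\ j -> Ʃ (\ l -> τ g j l & (τ h i j & τ h k l)))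
   exp h g = begin
    τ (h ∙ g ∙ inv h) i k
     ≡⟨ τ-∙ (h ∙ g) (inv h) i k ⟩
    Ʃ (\ l -> τ (h ∙ g) i l & τ (inv h) l k)
     ≡⟨ Ʃ-co (\ l -> ap2 _&_ (τ-∙ h g i l) (τ-inv h l k) » sym (Ʃ-*ʳ _ _)) ⟩
    Ʃ (\ l -> Ʃ (\ j -> τ h i j & τ g j l & τ h k l))
     ≡⟨ Ʃ-sw _ ⟩
    Ʃ (\ j -> Ʃ (\ l -> τ h i j & τ g j l & τ h k l))
     ≡⟨ Ʃ-co₂ (\ j l -> rot (τ h i j) (τ g j l) (τ h k l)) ⟩
    _ ∎

  convolution : ∀ φ -> Cl φ -> ∀ h -> Ʃ (\ g -> φ g & χ (inv g ∙ h)) == d ⁻¹ & ⟪ φ , χ ⟫ & χ h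
  convolution φ cl h = begin
   Ʃ (\ g -> φ g & χ (inv g ∙ h))
    ≡⟨ Ʃ-co (\ g -> cg (φ g &_) (sym (τ-trace _) » Ʃ-co (\ i -> τ-∙ (inv g) h i i »
     Ʃ-co (\ k -> cg (_& τ h k i) (τ-inv g i k))))) ⟩
   Ʃ (\ g -> φ g & Ʃ (\ i -> Ʃ (\ k -> τ g k i & τ h k i)))
    ≡⟨ Ʃ-co (\ g -> sym (Ʃ-*ˡ _ _) » Ʃ-co (\ i -> sym (Ʃ-*ˡ _ _) » Ʃ-co (\ k -> sym (&-as _ _ _)))) ⟩
   Ʃ (\ g -> Ʃ (\ i -> Ʃ (\ k -> φ g & τ g k i & τ h k i)))
    ≡⟨ trans (Ʃ-sw _) (Ʃ-co (\ i -> Ʃ-sw _)) ⟩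
   Ʃ (\ i -> Ʃ (\ k -> Ʃ (\ g -> φ g & τ g k i & τ h k i)))
    ≡⟨ Ʃ-co₂ (\ i k -> Ʃ-*ʳ _ _ » cg (_& τ h k i) (av φ cl k i) » rot (d ⁻¹ & ⟪ φ , χ ⟫) _ _) ⟩
   Ʃ (\ i -> Ʃ (\ k -> d ⁻¹ & ⟪ φ , χ ⟫ & (τ h k i & τ ε k i)))
    ≡⟨ trans (Ʃ-co (\ i -> Ʃ-*ˡ _ _)) (Ʃ-*ˡ _ _) ⟩
   d ⁻¹ & ⟪ φ , χ ⟫ & Ʃ (\ i -> Ʃ (\ k -> τ h k i & τ ε k i))
    ≡⟨ cg (d ⁻¹ & ⟪ φ , χ ⟫ &_) (Ʃ-sw _ » Ʃ-co (\ k -> Ʃ-co (\ i ->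
     cg (τ h k i &_) (τ-ε-sym k i)) » τ-εʳ h k k) » τ-trace h) ⟩
   d ⁻¹ & ⟪ φ , χ ⟫ & χ h ∎
   where
   opaque
    unfolding _#_
    rot : ∀ a b c -> a & b & c == a & (c & b)
    rot = slv ℚ-ri

 -- With q = d / order, the operator q Σ_h χ(h) ρ(h) is the projection on the χ-isotypic part; it
 -- commutes with the group because χ is a class function and is idempotent by `convolution`.
 -- Multiplying by the complementary projection removes the `k` copies of χ.
 split : ∀ {φ χ} -> Rep φ -> Rep χ -> ⟪ χ , χ ⟫ == order -> (k : ℚ) -> ⟪ φ , χ ⟫ == order & k ->
  Rep (\ g -> φ g # ~ (k & χ g))
 split {φ} {χ} V W norm k φχ = record
  { I = I;ρ = ρ';ρ-∙ = mu;ρ-inv = transp;ρ-trace = tr }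
  where
  open Rep V
  instance
   fI' = fI
  module W = Rep W
  open Irr W norm using (d;d≢0;convolution;order⁻¹-&)
  opaque
   unfolding _#_
   mu-al : ∀ a q s t u -> a # ~ (q & s) # (~ (q & t) # q & q & u) == (a # ~ (q & t)) # (q & q & u # ~ (q & s))
   mu-al = slv ℚ-ri
   pro : ∀ q a s b t -> (a # ~ (q & s)) & (b # ~ (q & t)) == a & b # ~ q & (a & t) # (~ q & (s & b) # q & q & (s & t))
   pro = slv ℚ-ri
   neg& : ∀ q s -> ~ q & s == ~ (q & s)
   neg& = slv ℚ-ri
   qd : ∀ q a n s -> q & q & (a & n & s) == q & a & n & (q & s)
   qd = slv ℚ-ri
   dist : ∀ q b c e -> q & b & (c & e) == (q & c) & (b & e)
   dist = slv ℚ-ri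
  q : ℚ
  q = d & order ⁻¹
  q-ca : ∀ x -> q & (d ⁻¹ & (order & x)) == x
  q-ca x = &-4 d _ _ _ » cg (_& _) (&-⁻¹ d≢0) » &-idˡ _ » order⁻¹-& x
  S : G -> I -> I -> ℚ
  S g i j = Ʃ (\ h -> χ h & ρ (g ∙ h) i j)
  ρ' : G -> I -> I -> ℚ
  ρ' g i j = ρ g i j # ~ (q & S g i j)
  χ-co : ∀ g h -> χ (g ∙ h ∙ inv g) == χ h
  χ-co g h = W.tr-cl h g
  ρS : ∀ g g' i j -> Ʃ (\ k -> ρ g i k & S g' k j) == S (g ∙ g') i j
  ρS g g' i j = begin
   Ʃ (\ k -> ρ g i k & S g' k j)
    ≡⟨ Ʃ-co (\ k -> sym (Ʃ-*ˡ _ _) » Ʃ-co (\ h -> &-sw _ _ _)) ⟩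
   Ʃ (\ k -> Ʃ (\ h -> χ h & (ρ g i k & ρ (g' ∙ h) k j)))
    ≡⟨ Ʃ-sw _ ⟩
   Ʃ (\ h -> Ʃ (\ k -> χ h & (ρ g i k & ρ (g' ∙ h) k j)))
    ≡⟨ Ʃ-co (\ h -> Ʃ-*ˡ _ _ » cg (χ h &_) (sym (ρ-∙ g (g' ∙ h) i j) » cg (\ z -> ρ z i j) (sym (assoc g g' h)))) ⟩
   S (g ∙ g') i j ∎
  Sρ : ∀ g g' i j -> Ʃ (\ k -> S g i k & ρ g' k j) == S (g ∙ g') i j
  Sρ g g' i j = begin
   Ʃ (\ k -> S g i k & ρ g' k j)
    ≡⟨ Ʃ-co (\ k -> sym (Ʃ-*ʳ _ _) » Ʃ-co (\ h -> &-as _ _ _)) ⟩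
   Ʃ (\ k -> Ʃ (\ h -> χ h & (ρ (g ∙ h) i k & ρ g' k j)))
    ≡⟨ Ʃ-sw _ ⟩
   Ʃ (\ h -> Ʃ (\ k -> χ h & (ρ (g ∙ h) i k & ρ g' k j)))
    ≡⟨ Ʃ-co (\ h -> Ʃ-*ˡ _ _ » cg (χ h &_) (sym (ρ-∙ (g ∙ h) g' i j))) ⟩
   Ʃ (\ h -> χ h & ρ (g ∙ h ∙ g') i j)
    ≡⟨ Ʃ-con g' (\ h -> χ h & ρ (g ∙ h ∙ g') i j) ⟨
   Ʃ (\ h -> χ (g' ∙ h ∙ inv g') & ρ (g ∙ (g' ∙ h ∙ inv g') ∙ g') i j)
    ≡⟨ Ʃ-co (\ h -> ap2 _&_ (χ-co g' h) (cg (\ z -> ρ z i j) (reg h))) ⟩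
   S (g ∙ g') i j ∎
   where
   reg : ∀ h -> g ∙ (g' ∙ h ∙ inv g') ∙ g' == g ∙ g' ∙ h
   reg h = assoc g _ g' » cg (g ∙_) (cancelʳ-inv′ g' (g' ∙ h)) » sym (assoc g g' h)
  SS : ∀ g g' i j -> q & q & Ʃ (\ k -> S g i k & S g' k j) == q & S (g ∙ g') i j
  SS g g' i j = begin
   q & q & Ʃ (\ k -> S g i k & S g' k j)
    ≡⟨ cg (q & q &_) (Ʃ-co (\ k -> sym (Ʃ-*ˡ _ _) » Ʃ-co (\ h -> &-sw _ _ _))) ⟩
   q & q & Ʃ (\ k -> Ʃ (\ h -> χ h & (S g i k & ρ (g' ∙ h) k j)))
    ≡⟨ cg (q & q &_) (Ʃ-sw _ » Ʃ-co (\ h -> Ʃ-*ˡ _ _ » cg (χ h &_) (Sρ g (g' ∙ h) i j))) ⟩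
   q & q & Ʃ (\ h -> χ h & Ʃ (\ h' -> χ h' & ρ (g ∙ (g' ∙ h) ∙ h') i j))
    ≡⟨ cg (q & q &_) (Ʃ-co (\ h -> cg (χ h &_) (sym (Ʃ-left (inv h) _) » Ʃ-co (\ m ->
     cg (χ (inv h ∙ m) &_) (cg (\ z -> ρ z i j) (reg h m)))))) ⟩
   q & q & Ʃ (\ h -> χ h & Ʃ (\ m -> χ (inv h ∙ m) & ρ (g ∙ g' ∙ m) i j))
    ≡⟨ cg (q & q &_) (Ʃ-co (\ h -> sym (Ʃ-*ˡ _ _)) » Ʃ-sw _) ⟩
   q & q & Ʃ (\ m -> Ʃ (\ h -> χ h & (χ (inv h ∙ m) & ρ (g ∙ g' ∙ m) i j)))
    ≡⟨ cg (q & q &_) (Ʃ-co (\ m -> Ʃ-co (\ h -> sym (&-as _ _ _)) » Ʃ-*ʳ _ _ »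
     cg (_& ρ (g ∙ g' ∙ m) i j) (convolution χ W.tr-cl m))) ⟩
   q & q & Ʃ (\ m -> d ⁻¹ & ⟪ χ , χ ⟫ & χ m & ρ (g ∙ g' ∙ m) i j)
    ≡⟨ cg (q & q &_) (Ʃ-co (\ m -> &-as _ _ _) » Ʃ-*ˡ _ _) ⟩
   q & q & (d ⁻¹ & ⟪ χ , χ ⟫ & S (g ∙ g') i j)
    ≡⟨ qd q (d ⁻¹) ⟪ χ , χ ⟫ _ ⟩
   q & d ⁻¹ & ⟪ χ , χ ⟫ & (q & S (g ∙ g') i j)
    ≡⟨ cg (_& (q & S (g ∙ g') i j)) one ⟩
   1q & (q & S (g ∙ g') i j)
    ≡⟨ &-idˡ _ ⟩
   q & S (g ∙ g') i j ∎
   where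
   one : q & d ⁻¹ & ⟪ χ , χ ⟫ == 1q
   one = cg (q & d ⁻¹ &_) (norm » sym (&-idʳ order)) » &-as q _ _ » q-ca 1q
   reg : ∀ h m -> g ∙ (g' ∙ h) ∙ (inv h ∙ m) == g ∙ g' ∙ m
   reg h m = cg (_∙ (inv h ∙ m)) (sym (assoc g g' h)) »
    assoc (g ∙ g') h _ » cg (g ∙ g' ∙_) (in-cancelʳ h m)
  mu : ∀ g h i j -> ρ' (g ∙ h) i j == Ʃ (\ k -> ρ' g i k & ρ' h k j)
  mu g h i j = sym (begin
   Ʃ (\ k -> ρ' g i k & ρ' h k j)
    ≡⟨ Ʃ-co (\ k -> pro q (ρ g i k) (S g i k) (ρ h k j) (S h k j)) ⟩
   Ʃ (\ k -> ρ g i k & ρ h k j # ~ q & (ρ g i k & S h k j) # (~ q & (S g i k & ρ h k j) # q & q & (S g i k & S h k j)))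
    ≡⟨ Ʃ-# _ _ » ap2 _#_ (Ʃ-# _ _) (Ʃ-# _ _) ⟩
   Ʃ (\ k -> ρ g i k & ρ h k j) # Ʃ (\ k -> ~ q & (ρ g i k & S h k j)) #
    (Ʃ (\ k -> ~ q & (S g i k & ρ h k j)) # Ʃ (\ k -> q & q & (S g i k & S h k j)))
    ≡⟨ ap2 _#_ (ap2 _#_ (sym (ρ-∙ g h i j)) (Ʃ-*ˡ _ _ » cg (~ q &_) (ρS g h i j) » neg& q _))
     (ap2 _#_ (Ʃ-*ˡ _ _ » cg (~ q &_) (Sρ g h i j) » neg& q _) (Ʃ-*ˡ _ _)) ⟩
   ρ (g ∙ h) i j # ~ (q & S (g ∙ h) i j) # (~ (q & S (g ∙ h) i j) # q & q & Ʃ (\ k -> S g i k & S h k j))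
    ≡⟨ mu-al _ q _ _ _ ⟩
   ρ' (g ∙ h) i j # (q & q & Ʃ (\ k -> S g i k & S h k j) # ~ (q & S (g ∙ h) i j))
    ≡⟨ cg (\ z -> ρ' (g ∙ h) i j # (z # ~ (q & S (g ∙ h) i j))) (SS g h i j) ⟩
   ρ' (g ∙ h) i j # (q & S (g ∙ h) i j # ~ (q & S (g ∙ h) i j))
    ≡⟨ cg (ρ' (g ∙ h) i j #_) (~-invʳ _) » #-idʳ _ ⟩
   ρ' (g ∙ h) i j ∎)
  transp : ∀ g i j -> ρ' (inv g) i j == ρ' g j i
  transp g i j = ap2 (\ x y -> x # ~ (q & y)) (ρ-inv g i j) (begin
   Ʃ (\ h -> χ h & ρ (inv g ∙ h) i j)
    ≡⟨ Ʃ-in _ ⟨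
   Ʃ (\ h -> χ (inv h) & ρ (inv g ∙ inv h) i j)
    ≡⟨ Ʃ-co (\ h -> ap2 _&_ (W.tr-in h) (cg (\ z -> ρ z i j) (sym (inv-∙ h g)) » ρ-inv _ i j)) ⟩
   Ʃ (\ h -> χ h & ρ (h ∙ g) j i)
    ≡⟨ Ʃ-con g (\ h -> χ h & ρ (h ∙ g) j i) ⟨
   Ʃ (\ h -> χ (g ∙ h ∙ inv g) & ρ (g ∙ h ∙ inv g ∙ g) j i)
    ≡⟨ Ʃ-co (\ h -> ap2 _&_ (χ-co g h) (cg (\ z -> ρ z j i) (cancelʳ-inv′ g (g ∙ h)))) ⟩
   S g j i ∎)
  tr : ∀ g -> Ʃ (\ i -> ρ' g i i) == φ g # ~ (k & χ g)
  tr g = Ʃ-# _ _ » ap2 _#_ (ρ-trace g) (Ʃ-co (\ i -> sym (neg& q _)) » Ʃ-*ˡ _ _ »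
   neg& q _ » (cg ~_ eq))
   where
   eq : q & Ʃ (\ i -> S g i i) == k & χ g
   eq = begin
    q & Ʃ (\ i -> Ʃ (\ h -> χ h & ρ (g ∙ h) i i))
     ≡⟨ cg (q &_) (Ʃ-sw _ » Ʃ-co (\ h -> Ʃ-*ˡ _ _ » cg (χ h &_) (ρ-trace _))) ⟩
    q & Ʃ (\ h -> χ h & φ (g ∙ h))
     ≡⟨ cg (q &_) (sym (Ʃ-left (inv g) _) » Ʃ-co (\ m -> ap2 _&_
      (sym (W.tr-in _) » cg χ (inv-∙ _ _ » cg (inv m ∙_) (in-in g)))
      (cg φ (in-cancelʳ g m)) » &-co _ _)) ⟩
    q & Ʃ (\ m -> φ m & χ (inv m ∙ g))
     ≡⟨ cg (q &_) (convolution φ tr-cl g) ⟩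
    q & (d ⁻¹ & ⟪ φ , χ ⟫ & χ g)
     ≡⟨ sym (&-as q _ _) ⟩
    q & (d ⁻¹ & ⟪ φ , χ ⟫) & χ g
     ≡⟨ cg (_& χ g) (cg (\ z -> q & (d ⁻¹ & z)) φχ » q-ca k) ⟩
    k & χ g ∎

open import Data.Fin using (punchIn;punchOut)
open import Data.Fin.Properties using (punchIn-punchOut;punchOut-punchIn;punchInᵢ≢i;punchOut-cong)
import Data.List

-- A twisted orbit count.

module OC (𝔾 : FG) (X 𝒜 : Set) ⦃ _ : Fi X ⦄ ⦃ _ : Fi 𝒜 ⦄ where
 open FG 𝔾
 open ≡-Reasoning
 instance
  fG = finite

 module _ (_◃_ : X -> G -> X) (◃-∙ : ∀ x g h -> x ◃ (g ∙ h) == (x ◃ g) ◃ h) (◃-ε : ∀ x -> x ◃ ε == x)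
  (ty : X -> 𝒜) (ty-◃ : ∀ x g -> ty (x ◃ g) == ty x)
  (tran : ∀ x y -> ty x == ty y -> ∃ \ g -> x ◃ g == y)
  {Va : 𝒜 -> Set} (va? : ∀ A -> Dec (Va A))
  (sec : ∀ A -> Va A -> X) (ty-sec : ∀ A v -> ty (sec A v) == A) (valid-ty : ∀ x -> Va (ty x))
  (γ : X -> X) (γ' : 𝒜 -> 𝒜) (ty-γ : ∀ x -> ty (γ x) == γ' (ty x)) where

  ◃-ca : ∀ {x y} g -> x ◃ g == y -> x == y ◃ inv g
  ◃-ca {x} g rfl = sym (◃-ε x) » cg (x ◃_) (sym (invʳ g)) » ◃-∙ x g (inv g)

  -- The elements carrying x to y form a coset of the stabiliser of x, and stabilisers in one orbit
  -- are conjugate. The two translations by `p` and `q` make this explicit.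
  tra : ∀ x y z u -> ty x == ty y -> ty z == ty u -> ty x == ty z ->
   Ʃ (\ g -> δ (eq? (x ◃ g) y)) == Ʃ (\ g -> δ (eq? (z ◃ g) u))
  tra x y z u xy zu xz with tran z x (sym xz) | tran y u (sym xy » xz » zu)
  ... | p , zp | q , yq = Ʃ-co (\ g -> δ-⇔ _ _ (to g) (from g)) »
   Ʃ-left p (\ g -> δ (eq? (z ◃ (g ∙ q)) u)) » Ʃ-right q (\ g -> δ (eq? (z ◃ g) u))
   where
   eqn : ∀ g -> z ◃ (p ∙ g ∙ q) == (x ◃ g) ◃ q
   eqn g = ◃-∙ z (p ∙ g) q » cg (_◃ q) (◃-∙ z p g » cg (_◃ g) zp)
   to : ∀ g -> x ◃ g == y -> z ◃ (p ∙ g ∙ q) == u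
   to g e = eqn g » cg (_◃ q) e » yq
   from : ∀ g -> z ◃ (p ∙ g ∙ q) == u -> x ◃ g == y
   from g e = ◃-ca q (sym (eqn g) » e) » sym (◃-ca q yq)

  -- Burnside's lemma with a relabelling γ. An element g with x ◃ g = γ x exists only if γ' fixes
  -- the type of x, and then there are as many as stabilisers of x; summed over one orbit the
  -- stabilisers give `order`.
  or-co : (Ψ : 𝒜 -> ℚ) -> Ʃ (\ g -> Ʃ (\ x -> δ (eq? (x ◃ g) (γ x)) & Ψ (ty x)))
   == order & Ʃ (\ A -> δ (va? A) & (δ (eq? (γ' A) A) & Ψ A))
  or-co Ψ = begin
   Ʃ (\ g -> Ʃ (\ x -> δ (eq? (x ◃ g) (γ x)) & Ψ (ty x)))
    ≡⟨ trans (Ʃ-sw _) (Ʃ-co (\ x -> Ʃ-*ʳ _ _)) ⟩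
   Ʃ (\ x -> Ʃ (\ g -> δ (eq? (x ◃ g) (γ x))) & Ψ (ty x))
    ≡⟨ Ʃ-co (\ x -> fib x) ⟩
   Ʃ (\ x -> s x & Φ (ty x))
    ≡⟨ Ʃ-co (\ x -> cg (s x &_) (sym (Ʃ-δ' (ty x) Φ))) ⟩
   Ʃ (\ x -> s x & Ʃ (\ A -> δ (eq? (ty x) A) & Φ A))
    ≡⟨ trans (Ʃ-co (\ x -> sym (Ʃ-*ˡ _ _))) (Ʃ-sw _) ⟩
   Ʃ (\ A -> Ʃ (\ x -> s x & (δ (eq? (ty x) A) & Φ A)))
    ≡⟨ Ʃ-co (\ A -> Ʃ-co (\ x -> sym (&-as _ _ _)) » Ʃ-*ʳ _ _ » cg (_& Φ A) (tota A)) ⟩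
   Ʃ (\ A -> δ (va? A) & order & Φ A)
    ≡⟨ trans (Ʃ-co (\ A -> cg (_& Φ A) (&-co _ _) » &-as _ _ _)) (Ʃ-*ˡ _ _) ⟩
   order & Ʃ (\ A -> δ (va? A) & Φ A) ∎
   where
   Φ : 𝒜 -> ℚ
   Φ A = δ (eq? (γ' A) A) & Ψ A
   s : X -> ℚ
   s x = Ʃ (\ g -> δ (eq? (x ◃ g) x))
   fib : ∀ x -> Ʃ (\ g -> δ (eq? (x ◃ g) (γ x))) & Ψ (ty x) == s x & Φ (ty x)
   fib x with eq? (γ' (ty x)) (ty x)
   ... | yes e = ap2 _&_ (tra x (γ x) x x (sym (ty-γ x » e)) rfl rfl)
    (sym (cg (_& Ψ (ty x)) (δ-ye (yes e) e) » &-idˡ _))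
   ... | no ¬e = cg (_& Ψ (ty x)) (Ʃ-0 (\ g -> δ-no _ (\ q -> ¬e
    (sym (ty-γ x) » cg ty (sym q) » ty-◃ x g)))) » &-zeroˡ _ »
    sym (cg (s x &_) (cg (_& Ψ (ty x)) (δ-no (no ¬e) ¬e) » &-zeroˡ _) » &-zeroʳ _)
   tota : ∀ A -> Ʃ (\ x -> s x & δ (eq? (ty x) A)) == δ (va? A) & order
   tota A with va? A
   ... | no ¬v = Ʃ-0 (\ x -> cg (s x &_) (δ-no _ (\ { rfl -> ¬v (valid-ty x) })) » &-zeroʳ _) »
    sym (cg (_& order) (δ-no (no ¬v) ¬v) » &-zeroˡ _)
   ... | yes v = begin
    Ʃ (\ x -> s x & δ (eq? (ty x) A))
     ≡⟨ Ʃ-co (\ x -> &-co _ _ » δ-co (eq? (ty x) A) (\ e ->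
      tra x x x₀ x rfl (ty-sec A v » sym e) (e » sym (ty-sec A v))) » sym (Ʃ-*ˡ _ _)) ⟩
    Ʃ (\ x -> Ʃ (\ g -> δ (eq? (ty x) A) & δ (eq? (x₀ ◃ g) x)))
     ≡⟨ trans (Ʃ-sw _) (Ʃ-co (\ g -> Ʃ-co (\ x -> &-co _ _) » Ʃ-δ' (x₀ ◃ g) _ »
      δ-ye _ (ty-◃ x₀ g » ty-sec A v))) ⟩
    order
     ≡⟨ trans (cg (_& order) (δ-ye (yes v) v)) (&-idˡ _) ⟨
    δ (yes v) & order ∎
    where x₀ = sec A v

-- Permutations acting on words, and the content of a word.

lo-ex : {A : Set} {n : ℕ} {u v : Vec A n} -> (∀ i -> lk u i == lk v i) -> u == v
lo-ex {u = u} {v} eq = sym (tabulate∘lookup u) » tabulate-cong eq » tabulate∘lookup v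

module _ {n : ℕ} where

 Inv : Vec (Fin n) n × Vec (Fin n) n -> Set
 Inv (f , g) = (∀ i -> lk f (lk g i) == i) × (∀ i -> lk g (lk f i) == i)

 opaque
  in? : ∀ fg -> Dec (Inv fg)
  in? (f , g) = all? (\ i -> lk f (lk g i) ≟F i) ×-dec all? (\ i -> lk g (lk f i) ≟F i)

-- Both directions are stored, so that inverting needs no search. The laws sit in an irrelevant
-- field, which makes permutations finite with pointwise equality.
Pe : ℕ -> Set
Pe n = Sub (in? {n})

infix 20 _·_ _·⁻_
opaque
 _·_ _·⁻_ : ∀ {n} -> Pe n -> Fin n -> Fin n
 p · i = lk (fst (val p)) i
 p ·⁻ i = lk (snd (val p)) i

module _ {n : ℕ} where

 opaque
  unfolding _·_

  ··⁻ : (p : Pe n) -> ∀ i -> p · (p ·⁻ i) == i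
  ··⁻ p = fst (pr' in? p)

  ·⁻· : (p : Pe n) -> ∀ i -> p ·⁻ (p · i) == i
  ·⁻· p = snd (pr' in? p)

  ·-in : (p : Pe n) -> ∀ {i j} -> p · i == p · j -> i == j
  ·-in p {i} {j} e = sym (·⁻· p i) » cg (p ·⁻_) e » ·⁻· p j

  pe-ex : {p q : Pe n} -> (∀ i -> p · i == q · i) -> p == q
  pe-ex {p} {q} eq = Su-≡ in? (ap2 _,_ (lo-ex eq) (lo-ex (\ i ->
   ·-in p (··⁻ p i » sym (eq (q ·⁻ i) » ··⁻ q i)))))

  mP : (f g : Fin n -> Fin n) -> (∀ i -> f (g i) == i) -> (∀ i -> g (f i) == i) -> Pe n
  mP f g fg gf = sub (tab f , tab g)
   ( (\ i -> lk-tab f _ » cg f (lk-tab g i) » fg i)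
   , (\ i -> lk-tab g _ » cg g (lk-tab f i) » gf i) )

  mP-· : ∀ f g fg gf i -> mP f g fg gf · i == f i
  mP-· f g fg gf i = lk-tab f i

 opaque
  inveₚ : Pe n -> Pe n
  inveₚ p = mP (p ·⁻_) (p ·_) (·⁻· p) (··⁻ p)

  inₚ-· : ∀ p i -> inveₚ p · i == p ·⁻ i
  inₚ-· p i = mP-· (p ·⁻_) (p ·_) (·⁻· p) (··⁻ p) i

  compo : Pe n -> Pe n -> Pe n
  compo p q = mP (\ i -> p · (q · i)) (\ i -> q ·⁻ (p ·⁻ i))
   (\ i -> cg (p ·_) (··⁻ q _) » ··⁻ p i) (\ i -> cg (q ·⁻_) (·⁻· p _) » ·⁻· q i)

  co-· : ∀ p q i -> compo p q · i == p · (q · i)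
  co-· p q i = mP-· _ _ _ _ i

  ideₚ : Pe n
  ideₚ = mP id id (\ _ -> rfl) (\ _ -> rfl)

  idₚ-· : ∀ i -> ideₚ · i == i
  idₚ-· i = mP-· _ _ _ _ i

 Sym : FG
 Sym = record
  { G = Pe n
  ;_∙_ = compo
  ;ε = ideₚ
  ;inv = inveₚ
  ;assoc = \ p q r -> pe-ex (\ i -> co-· (compo p q) r i » co-· p q _ »
   sym (co-· p (compo q r) i » cg (p ·_) (co-· q r i)))
  ;idˡ = \ p -> pe-ex (\ i -> co-· ideₚ p i » idₚ-· _)
  ;idʳ = \ p -> pe-ex (\ i -> co-· p ideₚ i » cg (p ·_) (idₚ-· i))
  ;invˡ = \ p -> pe-ex (\ i -> co-· (inveₚ p) p i »
   inₚ-· p _ » ·⁻· p i » sym (idₚ-· i))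
  ;invʳ = \ p -> pe-ex (\ i -> co-· p (inveₚ p) i »
   cg (p ·_) (inₚ-· p i) » ··⁻ p i » sym (idₚ-· i))
  }

module _ {n : ℕ} where
 open FG (Sym {n}) public using () renaming (_∙_ to _∙ₚ_;ε to idₚ;inv to invₚ)

 ∙-· : (p q : Pe n) -> ∀ i -> (p ∙ₚ q) · i == p · (q · i)
 ∙-· = co-·

 id-· : ∀ i -> idₚ · i == i
 id-· = idₚ-·

 in-· : (p : Pe n) -> ∀ i -> invₚ p · i == p ·⁻ i
 in-· = inₚ-·

 _▹_ : {Z : Set} -> Vec Z n -> Pe n -> Vec Z n
 w ▹ p = tab (\ i -> lk w (p · i))

 ▹-lo : {Z : Set} (w : Vec Z n) (p : Pe n) -> ∀ i -> lk (w ▹ p) i == lk w (p · i)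
 ▹-lo w p i = lk-tab (\ i -> lk w (p · i)) i

 ▹-∙ : {Z : Set} (w : Vec Z n) (p q : Pe n) -> w ▹ (p ∙ₚ q) == (w ▹ p) ▹ q
 ▹-∙ w p q = lo-ex (\ i -> ▹-lo w _ i » cg (lk w) (∙-· p q i) »
  sym (▹-lo (w ▹ p) q i » ▹-lo w p _))

 ▹-id : {Z : Set} (w : Vec Z n) -> w ▹ idₚ == w
 ▹-id w = lo-ex (\ i -> ▹-lo w _ i » cg (lk w) (id-· i))

module _ {n : ℕ} (i : Fin (suc n)) (p : Pe n) where

 private
  f g : Fin (suc n) -> Fin (suc n)
  f zr = i
  f (suc j) = punchIn i (p · j)
  g k with i ≟F k
  ... | yes _ = zr
  ... | no ne = suc (p ·⁻ punchOut ne)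
  fg : ∀ k -> f (g k) == k
  fg k with i ≟F k
  ... | yes e = e
  ... | no ne = cg (punchIn i) (··⁻ p _) » punchIn-punchOut ne
  gf : ∀ k -> g (f k) == k
  gf zr with i ≟F i
  ... | yes _ = rfl
  ... | no ne = absurd rfl ne
  gf (suc j) with i ≟F punchIn i (p · j)
  ... | yes e = absurd (sym e) (punchInᵢ≢i i _)
  ... | no ne = cg suc (cg (p ·⁻_) (punchOut-cong i {i≢k = punchInᵢ≢i i (p · j) ∘ sym} rfl » punchOut-punchIn i) » ·⁻· p j)

 inₚ : Pe (suc n)
 inₚ = mP f g fg gf

 inₚ-ze : inₚ · zr == i
 inₚ-ze = mP-· f g fg gf zr

 inₚ-su : ∀ j -> inₚ · suc j == punchIn i (p · j)
 inₚ-su j = mP-· f g fg gf (suc j)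

module _ {Z : Set} ⦃ _ : Fi Z ⦄ where

 cnt : ∀ {n} -> Vec Z n -> Z -> ℕ
 cnt [] z = 0
 cnt (x ∷ w) z with eq? x z
 ... | yes _ = suc (cnt w z)
 ... | no _ = cnt w z

 cn-he : ∀ {n} z (w : Vec Z n) -> cnt (z ∷ w) z == suc (cnt w z)
 cn-he z w with eq? z z
 ... | yes _ = rfl
 ... | no ne = absurd rfl ne

 cn-th : ∀ {n} {x z} (w : Vec Z n) -> x ≢ z -> cnt (x ∷ w) z == cnt w z
 cn-th {x = x} {z} w ne with eq? x z
 ... | yes e = absurd e ne
 ... | no _ = rfl

 cn-∷ : ∀ {n m} x (u : Vec Z n) (v : Vec Z m) z -> cnt u z == cnt v z -> cnt (x ∷ u) z == cnt (x ∷ v) z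
 cn-∷ x u v z e with eq? x z
 ... | yes _ = cg suc e
 ... | no _ = e

 cn-∷⁻ : ∀ {n m} x (u : Vec Z n) (v : Vec Z m) z -> cnt (x ∷ u) z == cnt (x ∷ v) z -> cnt u z == cnt v z
 cn-∷⁻ x u v z e with eq? x z
 ... | yes _ = suc-injective e
 ... | no _ = e

 rA : ∀ {n} -> Vec Z (suc n) -> Fin (suc n) -> Vec Z n
 rA w i = tab (\ j -> lk w (punchIn i j))

 cn-sw : ∀ {n} x y (w : Vec Z n) z -> cnt (x ∷ y ∷ w) z == cnt (y ∷ x ∷ w) z
 cn-sw x y w z with eq? x z | eq? y z
 ... | yes rfl | yes rfl = rfl
 ... | yes rfl | no f = cg suc (cn-th w f) » sym (cn-he x w)
 ... | no e | yes rfl = cn-he y w » cg suc (sym (cn-th w e))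
 ... | no e | no f = cn-th w f » sym (cn-th w e)

 cn-rA : ∀ {n} (w : Vec Z (suc n)) i z -> cnt (lk w i ∷ rA w i) z == cnt w z
 cn-rA (x ∷ w) zr z = cg (\ v -> cnt (x ∷ v) z) (tabulate∘lookup w)
 cn-rA {suc n} (x ∷ w) (suc i) z = cn-sw (lk w i) x (rA w i) z »
  cn-∷ x (lk w i ∷ rA w i) w z (cn-rA w i z)

 find : ∀ {n} (w : Vec Z n) z {m} -> cnt w z == suc m -> ∃ \ i -> lk w i == z
 find (x ∷ w) z e with eq? x z
 ... | yes p = zr , p
 ... | no _ = let i , q = find w z e in suc i , q

 -- The head of the second word is located in the first one and deleted there; `inₚ` reinserts the
 -- deleted place into the permutation found for the tails.
 sa-co : ∀ {n} (u v : Vec Z n) -> (∀ z -> cnt u z == cnt v z) -> ∃ \ (p : Pe n) -> u ▹ p == v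
 sa-co {zr} [] [] eq = idₚ , rfl
 sa-co {suc n} u (z ∷ v) eq with find u z (eq z » cn-he z v)
 ... | i , rfl with sa-co (rA u i) v (\ y -> cn-∷⁻ (lk u i) (rA u i) v y
  (cn-rA u i y » eq y))
 ... | p , rfl = inₚ i p , lo-ex
  (\ { zr -> ▹-lo u (inₚ i p) zr » cg (lk u) (inₚ-ze i p)
   ;(suc j) -> ▹-lo u (inₚ i p) (suc j) » cg (lk u) (inₚ-su i p j) »
    sym (▹-lo (rA u i) p j » lk-tab (\ j -> lk u (punchIn i j)) (p · j)) })

 cn-≤ : ∀ {n} (w : Vec Z n) z -> cnt w z ≤ n
 cn-≤ [] z = z≤n
 cn-≤ (x ∷ w) z with eq? x z
 ... | yes _ = s≤s (cn-≤ w z)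
 ... | no _ = ≤t (cn-≤ w z) (n≤1+n _)

opaque
 unfolding Ʃ

 ∑-ta : {A : Set} {n : ℕ} (h : Fin n -> A) (f : A -> ℚ) -> ∑ (Data.List.tabulate h) f == ∑ (allFin n) (f ∘ h)
 ∑-ta {n = zr} h f = rfl
 ∑-ta {n = suc n} h f = cg (f (h zr) #_) (∑-ta (h ∘ suc) f » sym (∑-ta suc (f ∘ h)))

 Ʃ-Fi : {n : ℕ} (f : Fin (suc n) -> ℚ) -> Ʃ f == f zr # Ʃ (f ∘ suc)
 Ʃ-Fi f = cg (f zr #_) (∑-ta suc f)

 Ʃ-Fin0 : (f : Fin 0 -> ℚ) -> Ʃ f == 0q
 Ʃ-Fin0 f = rfl

Ʃ-pe : {n : ℕ} (p : Pe n) (f : Fin n -> ℚ) -> Ʃ (\ i -> f (p · i)) == Ʃ f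
Ʃ-pe p f = Ʃ-bi (p ·_) (p ·⁻_) (·⁻· p) (··⁻ p) f

module _ {Z : Set} ⦃ _ : Fi Z ⦄ where

 cn-Ʃ : ∀ {n} (w : Vec Z n) z -> ι (cnt w z) == Ʃ (\ i -> δ (eq? (lk w i) z))
 cn-Ʃ [] z = sym (Ʃ-Fin0 _)
 cn-Ʃ (x ∷ w) z with eq? x z in e
 ... | yes p = ap2 _#_ (sym (cg δ e » δ-ye (yes p) p)) (cn-Ʃ w z) » sym (Ʃ-Fi _)
 ... | no ¬p = cn-Ʃ w z » sym (#-idˡ _) »
  cg (_# Ʃ (\ i -> δ (eq? (lk w i) z))) (sym (cg δ e » δ-no (no ¬p) ¬p)) » sym (Ʃ-Fi _)

 cn-▹ : ∀ {n} (w : Vec Z n) (p : Pe n) z -> cnt (w ▹ p) z == cnt w z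
 cn-▹ w p z = ι-in (cn-Ʃ (w ▹ p) z » Ʃ-co (\ i -> cg (\ y -> δ (eq? y z)) (▹-lo w p i)) »
  Ʃ-pe p (\ i -> δ (eq? (lk w i) z)) » sym (cn-Ʃ w z))

open import Data.Nat.Properties using (m⊔n≤o⇒m≤o;m⊔n≤o⇒n≤o;⊔-lub;m≤n⊓o⇒m≤n;m≤n⊓o⇒m≤o;⊓-glb;m⊓n≤m;m+n≤o⇒m≤o;m+n≤o⇒n≤o;m∸n≤m;∸-monoʳ-≤;m∸[m∸n]≡n;m+n≤o⇒m≤o∸n;n≤0⇒n≡0;m≤n⇒m≤o+n;≤-pred;m≤n⇒m∸n≡0)
open import Data.Nat.Tactic.RingSolver using () renaming (solve-∀ to ℕ-ring)
import Data.Vec as V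

-- Horizontal strips and the local rule of RSK.

«_¦ : ∀ {n} -> Vec ℕ n -> ℕ
« [] ¦ = 0
« x ∷ v ¦ = x + « v ¦

-- Interlacing m₁ ≥ n₁ ≥ m₂ ≥ n₂ ≥ ..., that is, the skew shape is a horizontal strip. Shapes have a
-- fixed number of parts, zeros included.
St : ∀ {R} -> Vec ℕ R -> Vec ℕ R -> Set
St [] [] = ⊤
St (m ∷ []) (n ∷ _) = n ≤ m
St (m ∷ m' ∷ μ) (n ∷ ν) = n ≤ m × m' ≤ n × St (m' ∷ μ) ν

str? : ∀ {R} (μ ν : Vec ℕ R) -> Dec (St μ ν)
str? [] [] = yes tt
str? (m ∷ []) (n ∷ _) = n ≤?ℕ m
str? (m ∷ m' ∷ μ) (n ∷ ν) = n ≤?ℕ m ×-dec m' ≤?ℕ n ×-dec str? (m' ∷ μ) ν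

st-he : ∀ {R m n} {μ ν : Vec ℕ R} -> St (m ∷ μ) (n ∷ ν) -> n ≤ m
st-he {μ = []} p = p
st-he {μ = _ ∷ _} (p , _ , _) = p

st-si : ∀ {R} (μ ν : Vec ℕ R) -> St μ ν -> « ν ¦ ≤ « μ ¦
st-si [] [] _ = z≤n
st-si (m ∷ []) (n ∷ []) p = +-monoˡ-≤ 0 p
st-si (m ∷ m' ∷ μ) (n ∷ ν) (p , q , s) = +-mono-≤ p (st-si (m' ∷ μ) ν s)

la : ∀ {R} -> ℕ -> Vec ℕ R -> ℕ
la x [] = x
la x (y ∷ v) = la y v

st-la : ∀ {R} m (μ : Vec ℕ R) n ν -> St (m ∷ μ) (n ∷ ν) -> la n ν ≤ la m μ
st-la m [] n [] p = p
st-la m (m' ∷ μ) n (n' ∷ ν) (_ , _ , s) = st-la m' μ n' ν s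

-- The common strips over, resp. under, two shapes: all parts but the first, resp. the last,
-- range over the same intervals [n' ⊔ r' , n ⊓ r]; `toggle` and `untoggle` reflect these intervals.
Up : ∀ {k} -> ℕ -> ℕ -> Vec ℕ k -> Vec ℕ k -> Vec ℕ k -> Set
Up n r [] [] [] = ⊤
Up n r (n' ∷ ν) (r' ∷ ρ) (m' ∷ μ) = n' ⊔ r' ≤ m' × m' ≤ n ⊓ r × Up n' r' ν ρ μ

Do : ∀ {k} -> ℕ -> ℕ -> Vec ℕ k -> Vec ℕ k -> Vec ℕ (suc k) -> Set
Do n r [] [] (s ∷ []) = s ≤ n ⊓ r
Do n r (n' ∷ ν) (r' ∷ ρ) (s ∷ σ) = s ≤ n ⊓ r × n' ⊔ r' ≤ s × Do n' r' ν ρ σ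

togg : ∀ {k} -> ℕ -> ℕ -> Vec ℕ k -> Vec ℕ k -> Vec ℕ k -> Vec ℕ (suc k)
-- The last part of a common lower strip has no interval to be reflected in; it is 0 as soon as one
-- of the two shapes ends in 0.
togg n r [] [] [] = 0 ∷ []
togg n r (n' ∷ ν) (r' ∷ ρ) (m' ∷ μ) = ((n' ⊔ r') + (n ⊓ r) ∸ m') ∷ togg n' r' ν ρ μ

unt : ∀ {k} -> ℕ -> ℕ -> Vec ℕ k -> Vec ℕ k -> Vec ℕ (suc k) -> Vec ℕ k
unt n r [] [] (s ∷ []) = []
unt n r (n' ∷ ν) (r' ∷ ρ) (s ∷ σ) = ((n' ⊔ r') + (n ⊓ r) ∸ s) ∷ unt n' r' ν ρ σ

up⇒strips : ∀ {k} m n r (μ ν ρ : Vec ℕ k) -> n ⊔ r ≤ m -> Up n r ν ρ μ -> St (m ∷ μ) (n ∷ ν) × St (m ∷ μ) (r ∷ ρ)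
up⇒strips m n r [] [] [] p u = m⊔n≤o⇒m≤o n r p , m⊔n≤o⇒n≤o n r p
up⇒strips m n r (m' ∷ μ) (n' ∷ ν) (r' ∷ ρ) p (a , b , u) =
 let s , t = up⇒strips m' n' r' μ ν ρ a u in
 (m⊔n≤o⇒m≤o n r p , m≤n⊓o⇒m≤n n r b , s) , (m⊔n≤o⇒n≤o n r p , m≤n⊓o⇒m≤o n r b , t)

strips⇒up : ∀ {k} m n r (μ ν ρ : Vec ℕ k) -> St (m ∷ μ) (n ∷ ν) -> St (m ∷ μ) (r ∷ ρ) -> n ⊔ r ≤ m × Up n r ν ρ μ
strips⇒up m n r [] [] [] p q = ⊔-lub p q , tt
strips⇒up m n r (m' ∷ μ) (n' ∷ ν) (r' ∷ ρ) (p , a , s) (q , b , t) =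
 let c , u = strips⇒up m' n' r' μ ν ρ s t in ⊔-lub p q , c , ⊓-glb a b , u

down⇒strips : ∀ {k} n r (ν ρ : Vec ℕ k) σ -> Do n r ν ρ σ -> St (n ∷ ν) σ × St (r ∷ ρ) σ
down⇒strips n r [] [] (s ∷ []) p = m≤n⊓o⇒m≤n n r p , m≤n⊓o⇒m≤o n r p
down⇒strips n r (n' ∷ ν) (r' ∷ ρ) (s ∷ σ) (p , q , d) =
 let a , b = down⇒strips n' r' ν ρ σ d in
 (m≤n⊓o⇒m≤n n r p , m⊔n≤o⇒m≤o n' r' q , a) , (m≤n⊓o⇒m≤o n r p , m⊔n≤o⇒n≤o n' r' q , b)

strips⇒down : ∀ {k} n r (ν ρ : Vec ℕ k) σ -> St (n ∷ ν) σ -> St (r ∷ ρ) σ -> Do n r ν ρ σ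
strips⇒down n r [] [] (s ∷ []) p q = ⊓-glb p q
strips⇒down n r (n' ∷ ν) (r' ∷ ρ) (s ∷ σ) (p , a , u) (q , b , v) =
 ⊓-glb p q , ⊔-lub a b , strips⇒down n' r' ν ρ σ u v

re-≤ : ∀ {lo hi x} -> lo ≤ x -> x ≤ hi -> lo + hi ∸ x ≤ hi × lo ≤ lo + hi ∸ x
re-≤ {lo} {hi} {x} p q =
 ≤t (∸-monoʳ-≤ (lo + hi) p) (≤r (m+n∸m≡n lo hi)) ,
 m+n≤o⇒m≤o∸n lo (+-monoʳ-≤ lo q)

re-re : ∀ {lo hi x} -> x ≤ hi -> lo + hi ∸ (lo + hi ∸ x) == x
re-re {lo} {hi} q = m∸[m∸n]≡n (m≤n⇒m≤o+n lo q)

to-do : ∀ {k} n r (ν ρ μ : Vec ℕ k) -> Up n r ν ρ μ -> Do n r ν ρ (togg n r ν ρ μ)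
to-do n r [] [] [] _ = z≤n
to-do n r (n' ∷ ν) (r' ∷ ρ) (m' ∷ μ) (a , b , u) =
 let p , q = re-≤ a b in p , q , to-do n' r' ν ρ μ u

un-up : ∀ {k} n r (ν ρ : Vec ℕ k) σ -> Do n r ν ρ σ -> Up n r ν ρ (unt n r ν ρ σ)
un-up n r [] [] (s ∷ []) _ = tt
un-up n r (n' ∷ ν) (r' ∷ ρ) (s ∷ σ) (a , b , d) =
 let p , q = re-≤ b a in q , p , un-up n' r' ν ρ σ d

un-to : ∀ {k} n r (ν ρ μ : Vec ℕ k) -> Up n r ν ρ μ -> unt n r ν ρ (togg n r ν ρ μ) == μ
un-to n r [] [] [] _ = rfl
un-to n r (n' ∷ ν) (r' ∷ ρ) (m' ∷ μ) (a , b , u) =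
 ap2 _∷_ (re-re {n' ⊔ r'} b) (un-to n' r' ν ρ μ u)

to-un : ∀ {k} n r (ν ρ : Vec ℕ k) σ -> la n ν == 0 -> Do n r ν ρ σ -> togg n r ν ρ (unt n r ν ρ σ) == σ
to-un n r [] [] (s ∷ []) e p =
 cg (_∷ []) (sym (n≤0⇒n≡0 (≤t p (≤t (m⊓n≤m n r) (≤r e)))))
to-un n r (n' ∷ ν) (r' ∷ ρ) (s ∷ σ) e (a , b , d) =
 ap2 _∷_ (re-re {n' ⊔ r'} a) (to-un n' r' ν ρ σ e d)

⊔-+-⊓ : ∀ m n -> (m ⊔ n) + (m ⊓ n) == m + n
⊔-+-⊓ m n with ≤-total m n
... | inl p = ap2 _+_ (m≤n⇒m⊔n≡n p) (m≤n⇒m⊓n≡m p) » +-comm n m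
 where open import Data.Nat.Properties using (m≤n⇒m⊔n≡n;m≤n⇒m⊓n≡m)
... | inr p = ap2 _+_ (m≥n⇒m⊔n≡m p) (m≥n⇒m⊓n≡n p)
 where open import Data.Nat.Properties using (m≥n⇒m⊔n≡m;m≥n⇒m⊓n≡n)

-- Each reflection keeps the sum of a part and its mirror image equal to maximum plus minimum of the
-- neighbouring parts, and max(n,r) + min(n,r) = n + r; these equations add up over the rows.
to-si : ∀ {k} n r (ν ρ μ : Vec ℕ k) -> la n ν == 0 -> Up n r ν ρ μ ->
 « togg n r ν ρ μ ¦ + « n ⊔ r ∷ μ ¦ == « n ∷ ν ¦ + « r ∷ ρ ¦
to-si n r [] [] [] rfl _ = solve0 r
 where
 solve0 : ∀ r -> r + 0 == r + 0
 solve0 r = rfl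
to-si n r (n' ∷ ν) (r' ∷ ρ) (m' ∷ μ) e (a , b , u) = begin
 (x + τ) + ((n ⊔ r) + (m' + « μ ¦)) ≡⟨ reg x τ (n ⊔ r) m' « μ ¦ ⟩
 (x + m') + ((n ⊔ r) + (τ + « μ ¦)) ≡⟨ cg (_+ ((n ⊔ r) + (τ + « μ ¦))) (m∸n+n≡m (m≤n⇒m≤o+n (n' ⊔ r') b)) ⟩
 ((n' ⊔ r') + (n ⊓ r)) + ((n ⊔ r) + (τ + « μ ¦))
  ≡⟨ re' (n' ⊔ r') (n ⊓ r) (n ⊔ r) τ « μ ¦ ⟩
 ((n ⊔ r) + (n ⊓ r)) + (τ + ((n' ⊔ r') + « μ ¦))
  ≡⟨ ap2 _+_ (⊔-+-⊓ n r) (to-si n' r' ν ρ μ e u) ⟩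
 (n + r) + ((n' + « ν ¦) + (r' + « ρ ¦)) ≡⟨ regroup″ n r (n' + « ν ¦) (r' + « ρ ¦) ⟩
 (n + (n' + « ν ¦)) + (r + (r' + « ρ ¦)) ∎
 where
 open ≡-Reasoning
 x = (n' ⊔ r') + (n ⊓ r) ∸ m'
 τ = « togg n' r' ν ρ μ ¦
 reg : ∀ x t m y z -> (x + t) + (m + (y + z)) == (x + y) + (m + (t + z))
 reg = ℕ-ring
 re' : ∀ a b c t z -> (a + b) + (c + (t + z)) == (c + b) + (t + (a + z))
 re' = ℕ-ring
 regroup″ : ∀ a b c d -> (a + b) + (c + d) == (a + c) + (b + d)
 regroup″ = ℕ-ring

module Shap (B R' : ℕ) where

 R : ℕ
 R = suc R'

 Row : ℕ -> Set
 Row L = Vec (Fin (suc B)) L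

 Sh : Set
 Sh = Row R

 ℕs : ∀ {L} -> Row L -> Vec ℕ L
 ℕs = V.map tn

 cla : ℕ -> Fin (suc B)
 cla x with x ≤?ℕ B
 ... | yes p = fromℕ< (s≤s p)
 ... | no _ = zr

 toℕ-cl : ∀ {x} -> x ≤ B -> tn (cla x) == x
 toℕ-cl {x} p with x ≤?ℕ B
 ... | yes q = tn-fr (s≤s q)
 ... | no ¬q = absurd p ¬q

 cV : ∀ {L} -> Vec ℕ L -> Row L
 cV = V.map cla

 ℕs-cV : ∀ {L} (v : Vec ℕ L) -> « v ¦ ≤ B -> ℕs (cV v) == v
 ℕs-cV [] _ = rfl
 ℕs-cV (x ∷ v) p = ap2 _∷_ (toℕ-cl (m+n≤o⇒m≤o x p)) (ℕs-cV v (m+n≤o⇒n≤o x p))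

 ℕs-in : ∀ {L} {u v : Row L} -> ℕs u == ℕs v -> u == v
 ℕs-in {u = []} {[]} _ = rfl
 ℕs-in {u = x ∷ u} {y ∷ v} e = ap2 _∷_ (tn-inj (cg V.head e)) (ℕs-in (cg V.tail e))

 module LR (ν ρ : Vec ℕ R) (a b : ℕ) (νb : « ν ¦ + b ≤ B) where

  Ov : Sh -> Set
  Ov μ = St (ℕs μ) ν × « ℕs μ ¦ == « ν ¦ + b × St (ℕs μ) ρ × « ρ ¦ + a == « ℕs μ ¦

  ov? : ∀ μ -> Dec (Ov μ)
  ov? μ = str? (ℕs μ) ν ×-dec « ℕs μ ¦ ≟ℕ « ν ¦ + b ×-dec str? (ℕs μ) ρ ×-dec « ρ ¦ + a ≟ℕ « ℕs μ ¦

  Un : Fin (suc B) × Sh -> Set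
  Un (k , σ) = tn k ≤ a × St ν (ℕs σ) × « ℕs σ ¦ + (a ∸ tn k) == « ν ¦ ×
   tn k ≤ b × St ρ (ℕs σ) × « ρ ¦ == « ℕs σ ¦ + (b ∸ tn k)

  un? : ∀ kσ -> Dec (Un kσ)
  un? (k , σ) = tn k ≤?ℕ a ×-dec str? ν (ℕs σ) ×-dec « ℕs σ ¦ + (a ∸ tn k) ≟ℕ « ν ¦ ×-dec
   tn k ≤?ℕ b ×-dec str? ρ (ℕs σ) ×-dec « ρ ¦ ≟ℕ « ℕs σ ¦ + (b ∸ tn k)

 -- One square of a growth diagram. The shapes ν and ρ stay; the upper shape corresponds to the
 -- lower shape together with the excess k of the upper first row over the larger of the two middle
 -- ones. This k becomes an entry of the matrix in RSK.
 module LRP (n r : ℕ) (ν ρ : Vec ℕ R') (a b : ℕ) (νb : « n ∷ ν ¦ + b ≤ B) (ν-last : la n ν == 0) where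
  open LR (n ∷ ν) (r ∷ ρ) a b νb

  φℕ : Vec ℕ R -> ℕ × Vec ℕ R
  φℕ (m ∷ μ) = m ∸ (n ⊔ r) , togg n r ν ρ μ

  ψℕ : ℕ -> Vec ℕ R -> Vec ℕ R
  ψℕ k σ = (n ⊔ r) + k ∷ unt n r ν ρ σ

  φ : Sh -> Fin (suc B) × Sh
  φ μ = cla (fst (φℕ (ℕs μ))) , cV (snd (φℕ (ℕs μ)))

  ψ : Fin (suc B) × Sh -> Sh
  ψ (k , σ) = cV (ψℕ (tn k) (ℕs σ))

  module Fwd (m : ℕ) (μ : Vec ℕ R') (s : St (m ∷ μ) (n ∷ ν)) (e : « m ∷ μ ¦ == « n ∷ ν ¦ + b)
   (t : St (m ∷ μ) (r ∷ ρ)) (f : « r ∷ ρ ¦ + a == « m ∷ μ ¦) where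
   k = m ∸ (n ⊔ r)
   σ = togg n r ν ρ μ
   u : n ⊔ r ≤ m × Up n r ν ρ μ
   u = strips⇒up m n r μ ν ρ s t
   str : St (n ∷ ν) σ × St (r ∷ ρ) σ
   str = down⇒strips n r ν ρ σ (to-do n r ν ρ μ (snd u))
   mk : (n ⊔ r) + k == m
   mk = m+[n∸m]≡n (fst u)
   si : « σ ¦ + « m ∷ μ ¦ == « n ∷ ν ¦ + « r ∷ ρ ¦ + k
   si = cg (\ z -> « σ ¦ + (z + « μ ¦)) (sym mk) » (lem « σ ¦ (n ⊔ r) k « μ ¦) »
    cg (_+ k) (to-si n r ν ρ μ ν-last (snd u))
    where
    lem : ∀ s c k m -> s + ((c + k) + m) == s + (c + m) + k
    lem = ℕ-ring
   σa : « σ ¦ + a == « n ∷ ν ¦ + k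
   σa = +-cancelʳ-≡ « r ∷ ρ ¦ _ _ ((lem « σ ¦ a « r ∷ ρ ¦) » cg (« σ ¦ +_) f » si » (le' « n ∷ ν ¦ « r ∷ ρ ¦ k))
    where
    lem : ∀ s a r -> s + a + r == s + (r + a)
    lem = ℕ-ring
    le' : ∀ n r k -> n + r + k == n + k + r
    le' = ℕ-ring
   σb : « σ ¦ + b == « r ∷ ρ ¦ + k
   σb = +-cancelʳ-≡ « n ∷ ν ¦ _ _ ((lem « σ ¦ b « n ∷ ν ¦) » cg (« σ ¦ +_) (sym e) » si » (le' « n ∷ ν ¦ « r ∷ ρ ¦ k))
    where
    lem : ∀ s a r -> s + a + r == s + (r + a)
    lem = ℕ-ring
    le' : ∀ n r k -> n + r + k == r + k + n
    le' = ℕ-ring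
   k≤a : k ≤ a
   k≤a = +-cancelˡ-≤ « n ∷ ν ¦ _ _ (≤t (≤r (sym σa)) (+-monoˡ-≤ a (st-si (n ∷ ν) σ (fst str))))
   k≤b : k ≤ b
   k≤b = +-cancelˡ-≤ « r ∷ ρ ¦ _ _ (≤t (≤r (sym σb)) (+-monoˡ-≤ b (st-si (r ∷ ρ) σ (snd str))))
   shif : ∀ {x y c} -> x + c == y + k -> k ≤ c -> x + (c ∸ k) == y
   shif {x} {y} {c} e p = +-cancelʳ-≡ k _ _ (+-assoc x _ k » cg (x +_) (m∸n+n≡m p) » e)
   k≤B : k ≤ B
   k≤B = ≤t k≤b (m+n≤o⇒n≤o « n ∷ ν ¦ νb)
   σ≤B : « σ ¦ ≤ B
   σ≤B = ≤t (st-si (n ∷ ν) σ (fst str)) (m+n≤o⇒m≤o « n ∷ ν ¦ νb)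
   und : Un (cla k , cV σ)
   und rewrite toℕ-cl k≤B | ℕs-cV σ σ≤B =
    k≤a , fst str , shif σa k≤a , k≤b , snd str , sym (shif σb k≤b)
   ba : ψ (cla k , cV σ) == cV (m ∷ μ)
   ba = cg cV (ap2 _∷_ (cg ((n ⊔ r) +_) (toℕ-cl k≤B) » mk)
    (cg (unt n r ν ρ) (ℕs-cV σ σ≤B) » un-to n r ν ρ μ (snd u)))

  fwd : ∀ μ -> Ov μ -> Un (φ μ)
  fwd (m ∷ μ) (s , e , t , f) = Fwd.und (tn m) (ℕs μ) s e t f

  ψφ : ∀ μ -> Ov μ -> ψ (φ μ) == μ
  ψφ (m ∷ μ) o@(s , e , t , f) = ℕs-in (cg ℕs (Fwd.ba (tn m) (ℕs μ) s e t f) »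
   ℕs-cV _ (≤t (≤r e) νb))

  module Bwd (k : ℕ) (σ : Vec ℕ R) (k≤a : k ≤ a) (s : St (n ∷ ν) σ) (e : « σ ¦ + (a ∸ k) == « n ∷ ν ¦)
   (k≤b : k ≤ b) (t : St (r ∷ ρ) σ) (f : « r ∷ ρ ¦ == « σ ¦ + (b ∸ k)) where
   μ = unt n r ν ρ σ
   m = (n ⊔ r) + k
   dn : Do n r ν ρ σ
   dn = strips⇒down n r ν ρ σ s t
   up : Up n r ν ρ μ
   up = un-up n r ν ρ σ dn
   tog : togg n r ν ρ μ == σ
   tog = to-un n r ν ρ σ ν-last dn
   str : St (m ∷ μ) (n ∷ ν) × St (m ∷ μ) (r ∷ ρ)
   str = up⇒strips m n r μ ν ρ (m≤m+n (n ⊔ r) k) up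
   si : « σ ¦ + « m ∷ μ ¦ == « n ∷ ν ¦ + « r ∷ ρ ¦ + k
   si = (lem « σ ¦ (n ⊔ r) k « μ ¦) » cg (_+ k) (cg (\ z -> « z ¦ + « n ⊔ r ∷ μ ¦) (sym tog) »
    to-si n r ν ρ μ ν-last up)
    where
    lem : ∀ s c k m -> s + ((c + k) + m) == s + (c + m) + k
    lem = ℕ-ring
   sizeν : « m ∷ μ ¦ == « n ∷ ν ¦ + b
   sizeν = +-cancelˡ-≡ « σ ¦ _ _ (si » cg (\ z -> « n ∷ ν ¦ + z + k) f »
    (lem « n ∷ ν ¦ « σ ¦ (b ∸ k) k) » cg (\ z -> « σ ¦ + (« n ∷ ν ¦ + z)) (m∸n+n≡m k≤b))
    where
    lem : ∀ n s b k -> n + (s + b) + k == s + (n + (b + k))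
    lem = ℕ-ring
   sizeρ : « r ∷ ρ ¦ + a == « m ∷ μ ¦
   sizeρ = sym (+-cancelˡ-≡ « σ ¦ _ _ (si » cg (\ z -> z + « r ∷ ρ ¦ + k) (sym e) »
    (lem « r ∷ ρ ¦ « σ ¦ (a ∸ k) k) » cg (\ z -> « σ ¦ + (« r ∷ ρ ¦ + z)) (m∸n+n≡m k≤a)))
    where
    lem : ∀ n s b k -> (s + b) + n + k == s + (n + (b + k))
    lem = ℕ-ring
   m≤B : « m ∷ μ ¦ ≤ B
   m≤B = ≤t (≤r sizeν) νb
   ov : Ov (cV (m ∷ μ))
   ov rewrite toℕ-cl (m+n≤o⇒m≤o m m≤B) | ℕs-cV μ (m+n≤o⇒n≤o m m≤B) = fst str , sizeν , snd str , sizeρ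
   ba : φ (cV (m ∷ μ)) == (cla k , cV σ)
   ba rewrite toℕ-cl (m+n≤o⇒m≤o m m≤B) | ℕs-cV μ (m+n≤o⇒n≤o m m≤B) | m+n∸m≡n (n ⊔ r) k | tog = rfl

  cl-toℕ : ∀ i -> cla (tn i) == i
  cl-toℕ i = tn-inj (toℕ-cl (≤-pred (toℕ<n i)))

  cV-ℕs : ∀ {L} (v : Row L) -> cV (ℕs v) == v
  cV-ℕs [] = rfl
  cV-ℕs (x ∷ v) = ap2 _∷_ (cl-toℕ x) (cV-ℕs v)

  bwd : ∀ kσ -> Un kσ -> Ov (ψ kσ)
  bwd (k , σ) (a , b , c , d , e , f) = Bwd.ov (tn k) (ℕs σ) a b c d e f

  φψ : ∀ kσ -> Un kσ -> φ (ψ kσ) == kσ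
  φψ (k , σ) (a , b , c , d , e , f) = Bwd.ba (tn k) (ℕs σ) a b c d e f » ap2 _,_ (cl-toℕ k) (cV-ℕs σ)

  lo-ru : (c : ℚ) -> Ʃ (\ μ -> δ (ov? μ) & c) == Ʃ (\ kσ -> δ (un? kσ) & c)
  lo-ru c = Ʃ-re ov? un? φ ψ fwd bwd ψφ φψ (\ _ -> c)

-- Kostka numbers, the Pieri rule and RSK.

open import Data.Vec using (_∷ʳ_)

opaque
 unfolding Ʃ

 Ʃ-[] : {A : Set} ⦃ _ : Fi A ⦄ (f : Vec A 0 -> ℚ) -> Ʃ f == f []
 Ʃ-[] f = #-idʳ _

Le : ∀ {L} -> Vec ℕ L -> Vec ℕ L -> Set
Le [] [] = ⊤
Le (x ∷ u) (y ∷ v) = x ≤ y × Le u v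

le? : ∀ {L} (u v : Vec ℕ L) -> Dec (Le u v)
le? [] [] = yes tt
le? (x ∷ u) (y ∷ v) = x ≤?ℕ y ×-dec le? u v

infixl 6 _∸ᵥ_ _+ᵥ_
_∸ᵥ_ _+ᵥ_ : ∀ {L} -> Vec ℕ L -> Vec ℕ L -> Vec ℕ L
_∸ᵥ_ = V.zipWith _∸_
_+ᵥ_ = V.zipWith _+_

0ᵥ : ∀ {L} -> Vec ℕ L
0ᵥ = V.replicate _ 0

«0¦ : ∀ {L} -> « 0ᵥ {L} ¦ == 0
«0¦ {zr} = rfl
«0¦ {suc L} = «0¦ {L}

«¦≡0 : ∀ {L} (v : Vec ℕ L) -> « v ¦ == 0 -> v == 0ᵥ
«¦≡0 [] _ = rfl
«¦≡0 (zr ∷ v) e = cg (0 ∷_) («¦≡0 v e)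

«+¦ : ∀ {L} (u v : Vec ℕ L) -> « u +ᵥ v ¦ == « u ¦ + « v ¦
«+¦ [] [] = rfl
«+¦ (x ∷ u) (y ∷ v) = cg (x + y +_) («+¦ u v) » (lem x y « u ¦ « v ¦)
 where
 lem : ∀ a b c d -> a + b + (c + d) == a + c + (b + d)
 lem = ℕ-ring

+ᵥ-∸ᵥ : ∀ {L} (u v w : Vec ℕ L) -> u +ᵥ v == w -> Le u w × v == w ∸ᵥ u
+ᵥ-∸ᵥ [] [] [] _ = tt , rfl
+ᵥ-∸ᵥ (x ∷ u) (y ∷ v) (_ ∷ _) rfl =
 let l , e = +ᵥ-∸ᵥ u v _ rfl in (m≤m+n x y , l) , ap2 _∷_ (sym (m+n∸m≡n x y)) e

∸ᵥ-+ᵥ : ∀ {L} (u v w : Vec ℕ L) -> Le u w -> v == w ∸ᵥ u -> u +ᵥ v == w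
∸ᵥ-+ᵥ [] [] [] _ _ = rfl
∸ᵥ-+ᵥ (x ∷ u) (y ∷ v) (z ∷ w) (p , l) rfl = ap2 _∷_ (m+[n∸m]≡n p) (∸ᵥ-+ᵥ u v w l rfl)

st-0 : ∀ {R} -> St (0ᵥ {R}) 0ᵥ
st-0 {zr} = tt
st-0 {suc zr} = z≤n
st-0 {suc (suc R)} = z≤n , z≤n , st-0 {suc R}

st-la-si : ∀ {R} m (μ : Vec ℕ R) ν -> St (m ∷ μ) ν -> la m μ ≤ m × suc R * la m μ ≤ « m ∷ μ ¦
st-la-si m [] (n ∷ []) p = ≤= , ≤=
st-la-si m (m' ∷ μ) (n ∷ ν) (p , q , s) =
 let l , t = st-la-si m' μ ν s ;l' = ≤t l (≤t q p) in l' , +-mono-≤ l' t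

De : ∀ {R} -> Vec ℕ R -> Set
De [] = ⊤
De (x ∷ []) = ⊤
De (x ∷ y ∷ v) = y ≤ x × De (y ∷ v)

de? : ∀ {R} (v : Vec ℕ R) -> Dec (De v)
de? [] = yes tt
de? (x ∷ []) = yes tt
de? (x ∷ y ∷ v) = y ≤?ℕ x ×-dec de? (y ∷ v)

st-de : ∀ {R} (μ ν : Vec ℕ R) -> St μ ν -> De μ
st-de [] [] _ = tt
st-de (m ∷ []) (n ∷ _) _ = tt
st-de (m ∷ m' ∷ μ) (n ∷ ν) (p , q , s) = ≤t q p , st-de (m' ∷ μ) ν s

de-0 : ∀ {R} -> De (0ᵥ {R})
de-0 {zr} = tt
de-0 {suc zr} = tt
de-0 {suc (suc R)} = z≤n , de-0 {suc R}

Head≤ : ∀ {R} -> ℕ -> Vec ℕ R -> Set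
Head≤ a [] = ⊤
Head≤ a (x ∷ v) = x ≤ a

de-ta : ∀ {R} x (v : Vec ℕ R) -> De (x ∷ v) -> Head≤ x v × De v
de-ta x [] _ = tt , tt
de-ta x (y ∷ v) (p , d) = p , d

reverseᵥ : ∀ {A : Set} {n} -> Vec A n -> Vec A n
reverseᵥ [] = []
reverseᵥ (x ∷ v) = reverseᵥ v ∷ʳ x

«∷ʳ¦ : ∀ {n} (v : Vec ℕ n) x -> « v ∷ʳ x ¦ == « v ¦ + x
«∷ʳ¦ [] x = +-comm x 0
«∷ʳ¦ (y ∷ v) x = cg (y +_) («∷ʳ¦ v x) » sym (+-assoc y _ x)

«reverse¦ : ∀ {n} (v : Vec ℕ n) -> « reverseᵥ v ¦ == « v ¦
«reverse¦ [] = rfl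
«reverse¦ (x ∷ v) = «∷ʳ¦ (reverseᵥ v) x » cg (_+ x) («reverse¦ v) » +-comm _ x

module Ko (B R' : ℕ) where
 open Shap B R' public
 open ≡-Reasoning

 Step : ∀ {R} -> Vec ℕ R -> Vec ℕ R -> ℕ -> Set
 Step μ ν a = St μ ν × « ν ¦ + a == « μ ¦

 step? : ∀ {R} (μ ν : Vec ℕ R) a -> Dec (Step μ ν a)
 step? μ ν a = str? μ ν ×-dec « ν ¦ + a ≟ℕ « μ ¦

 -- Kostka numbers; the head of the content is the number of occurrences of the largest letter.
 KR : ∀ {R N} -> Vec ℕ R -> Vec ℕ N -> ℚ
 KR μ [] = δ (« μ ¦ ≟ℕ 0)
 KR μ (a ∷ α) = Ʃ (\ ν -> δ (step? μ (ℕs ν) a) & KR (ℕs ν) α)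

 KR-si : ∀ {R N} (μ : Vec ℕ R) (α : Vec ℕ N) -> « μ ¦ ≢ « α ¦ -> KR μ α == 0q
 KR-si μ [] ne = δ-no _ ne
 KR-si μ (a ∷ α) ne = Ʃ-0 (\ ν -> δ-* (step? μ (ℕs ν) a)
  (\ { (_ , e) -> KR-si (ℕs ν) α (\ f -> ne (sym e » cg (_+ a) f » +-comm _ a)) }) (\ _ -> rfl))

 KR-de : ∀ {R N} (μ : Vec ℕ R) (α : Vec ℕ N) -> ¬ De μ -> KR μ α == 0q
 KR-de μ [] nd = δ-no _ (\ e -> nd (subst De (sym («¦≡0 μ e)) de-0))
 KR-de μ (a ∷ α) nd = Ʃ-0 (\ ν -> δ-* (step? μ (ℕs ν) a) (\ { (s , _) -> absurd (st-de μ _ s) nd }) (\ _ -> rfl))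

 -- In a decreasing sequence of R parts a nonzero last part forces the size to be at least R.
 KR-la : ∀ {N} m (μ : Vec ℕ R') (α : Vec ℕ N) -> « m ∷ μ ¦ < R -> la m μ ≢ 0 -> KR (m ∷ μ) α == 0q
 KR-la m μ [] p ne = δ-no _ (\ e -> ne (la-0 («¦≡0 (m ∷ μ) e)))
  where
  la-0' : ∀ R -> la 0 (0ᵥ {R}) == 0
  la-0' zr = rfl
  la-0' (suc R) = la-0' R
  la-0 : m ∷ μ == 0ᵥ -> la m μ == 0
  la-0 rfl = la-0' R'
 KR-la m μ (a ∷ α) p ne = Ʃ-0 (\ ν -> δ-* (step? (m ∷ μ) (ℕs ν) a) (\ { (s , _) ->
  absurd (≤t (larg (la m μ) ne) (snd (st-la-si m μ (ℕs ν) s))) (<⇒≱ p) }) (\ _ -> rfl))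
  where
  larg : ∀ l -> l ≢ 0 -> R ≤ R * l
  larg zr ne = absurd rfl ne
  larg (suc l) _ = ≤t (m≤m+n R (R * l)) (≤r (sym (*-comm R (suc l) » cg (R +_) (*-comm l R))))

 0ʳ : ∀ {L} -> Row L
 0ʳ = V.replicate _ zr

 ℕs-0 : ∀ {L} -> ℕs (0ʳ {L}) == 0ᵥ
 ℕs-0 {zr} = rfl
 ℕs-0 {suc L} = cg (0 ∷_) ℕs-0

 on-0 : ∀ {L} (v : Row L) -> « ℕs v ¦ == 0 -> v == 0ʳ
 on-0 v e = ℕs-in («¦≡0 (ℕs v) e » sym ℕs-0)

 -- Both sides are the scalar product of s_ν h_b with h_β: on the left by Pieri, on the right by
 -- moving h_b to the other side. The induction on β pushes the added strip past the strip of one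
 -- letter by the local rule, which splits off the part `k` of it.
 pi : ∀ {L} n (ν : Vec ℕ R') b (β : Vec ℕ L) -> la n ν == 0 -> « n ∷ ν ¦ + b ≤ B ->
  Ʃ {Sh} (\ μ -> δ (str? (ℕs μ) (n ∷ ν) ×-dec « ℕs μ ¦ ≟ℕ « n ∷ ν ¦ + b) & KR (ℕs μ) β)
  == Ʃ {Row L} (\ k -> δ (« ℕs k ¦ ≟ℕ b ×-dec le? (ℕs k) β) & KR (n ∷ ν) (β ∸ᵥ ℕs k))
 pi n ν b [] l p with « n ∷ ν ¦ ≟ℕ 0 | b ≟ℕ 0
 ... | yes e | yes rfl = Ʃ-po _ 0ʳ (\ μ -> KR (ℕs μ) []) (subst2 St (sym ℕs-0) (sym n0) st-0 ,
  trans (cg «_¦ (ℕs-0 {R}) » «0¦ {R}) (sym (+-comm _ 0 » e)))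
  (\ { μ (_ , q) -> on-0 μ (q » +-comm _ 0 » e) }) »
  δ-ye _ (cg «_¦ (ℕs-0 {R}) » «0¦ {R}) »
  sym (Ʃ-[] {Fin (suc B)} _ » ap2 _&_ (δ-ye _ (rfl , tt)) (δ-ye _ e) » &-idˡ _)
  where n0 = «¦≡0 (n ∷ ν) e
 ... | yes e | no ¬b = Ʃ-0 (\ μ -> δ-* (str? (ℕs μ) (n ∷ ν) ×-dec « ℕs μ ¦ ≟ℕ « n ∷ ν ¦ + b)
  (\ { (_ , q) -> δ-no _ (\ z -> ¬b (sym (cg (_+ b) e) » sym q » z)) }) (\ _ -> rfl)) »
  sym (Ʃ-[] {Fin (suc B)} _ » cg (_& _) (δ-no _ (\ { (q , _) -> ¬b (sym q) })) » &-zeroˡ _)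
 ... | no ¬e | _ = Ʃ-0 (\ μ -> δ-* (str? (ℕs μ) (n ∷ ν) ×-dec « ℕs μ ¦ ≟ℕ « n ∷ ν ¦ + b)
  (\ { (_ , q) -> δ-no _ (\ z -> ¬e (n≤0⇒n≡0 (≤t (m≤m+n _ b) (≤r (sym q » z))))) }) (\ _ -> rfl)) »
  sym (Ʃ-[] {Fin (suc B)} _ » cg (_ &_) (δ-no _ ¬e) » &-zeroʳ _)
 pi {suc L} n ν b (a ∷ α) l p = begin
  Ʃ (\ μ -> δ (ab μ) & Ʃ (\ ρ -> δ (step? (ℕs μ) (ℕs ρ) a) & KR (ℕs ρ) α))
   ≡⟨ Ʃ-co (\ μ -> sym (Ʃ-*ˡ _ _) » Ʃ-co (\ ρ -> sym (&-as _ _ _) » cg (_& KR (ℕs ρ) α) (me μ ρ))) ⟩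
  Ʃ (\ μ -> Ʃ (\ ρ -> δ (O.ov? ρ μ) & KR (ℕs ρ) α))
   ≡⟨ Ʃ-sw _ ⟩
  Ʃ (\ ρ -> Ʃ (\ μ -> δ (O.ov? ρ μ) & KR (ℕs ρ) α))
   ≡⟨ Ʃ-co (\ ρ -> ru ρ) ⟩
  Ʃ (\ ρ -> Ʃ (\ kσ -> δ (O.un? ρ kσ) & KR (ℕs ρ) α))
   ≡⟨ Ʃ-co (\ ρ -> Ʃ-× _) ⟩
  Ʃ (\ ρ -> Ʃ (\ k -> Ʃ (\ σ -> δ (O.un? ρ (k , σ)) & KR (ℕs ρ) α)))
   ≡⟨ trans (Ʃ-sw _) (Ʃ-co (\ k -> Ʃ-sw _)) ⟩
  Ʃ (\ k -> Ʃ (\ σ -> Ʃ (\ ρ -> δ (O.un? ρ (k , σ)) & KR (ℕs ρ) α)))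
   ≡⟨ Ʃ-co₂ (\ k σ -> inn k σ) ⟩
  Ʃ (\ k -> Ʃ (\ σ -> δ (low k σ) & Ʃ (\ k' -> δ (rest k k') & KR (ℕs σ) (α ∸ᵥ ℕs k'))))
   ≡⟨ Ʃ-co₂ (\ k σ -> sym (Ʃ-*ˡ _ _) » Ʃ-co (\ k' -> reg k σ k')) ⟩
  Ʃ (\ k -> Ʃ (\ σ -> Ʃ (\ k' -> δ (fu k k') & (δ (step? (n ∷ ν) (ℕs σ) (a ∸ tn k)) & KR (ℕs σ) (α ∸ᵥ ℕs k')))))
   ≡⟨ Ʃ-co (\ k -> Ʃ-sw _ » Ʃ-co (\ k' -> Ʃ-*ˡ _ _)) ⟩
  Ʃ (\ k -> Ʃ (\ k' -> δ (fu k k') & KR (n ∷ ν) (a ∸ tn k ∷ α ∸ᵥ ℕs k')))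
   ≡⟨ Ʃ-∷ {Fin (suc B)} {L} _ ⟨
  _ ∎
  where
  ab : (μ : Sh) -> Dec _
  ab μ = str? (ℕs μ) (n ∷ ν) ×-dec « ℕs μ ¦ ≟ℕ « n ∷ ν ¦ + b
  module O (ρ : Sh) = LR (n ∷ ν) (ℕs ρ) a b p
  rest : (k : Fin (suc B)) (k' : Row L) -> Dec _
  rest k k' = tn k + « ℕs k' ¦ ≟ℕ b ×-dec le? (ℕs k') α
  low : (k : Fin (suc B)) (σ : Sh) -> Dec _
  low k σ = tn k ≤?ℕ a ×-dec step? (n ∷ ν) (ℕs σ) (a ∸ tn k)
  fu : (k : Fin (suc B)) (k' : Row L) -> Dec _
  fu k k' = tn k + « ℕs k' ¦ ≟ℕ b ×-dec (tn k ≤?ℕ a ×-dec le? (ℕs k') α)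
  me : ∀ μ ρ -> δ (ab μ) & δ (step? (ℕs μ) (ℕs ρ) a) == δ (O.ov? ρ μ)
  me μ ρ = sym (δ-× _ _) » δ-⇔ _ _ (\ { ((s , e) , t , f) -> s , e , t , f }) (\ { (s , e , t , f) -> (s , e) , t , f })
  ru : ∀ ρ -> Ʃ (\ μ -> δ (O.ov? ρ μ) & KR (ℕs ρ) α) == Ʃ (\ kσ -> δ (O.un? ρ kσ) & KR (ℕs ρ) α)
  ru (r ∷ ρ) = LRP.lo-ru n (tn r) ν (ℕs ρ) a b p l (KR (ℕs (r ∷ ρ)) α)
  inn : ∀ k σ -> Ʃ (\ ρ -> δ (O.un? ρ (k , σ)) & KR (ℕs ρ) α)
   == δ (low k σ) & Ʃ (\ k' -> δ (rest k k') & KR (ℕs σ) (α ∸ᵥ ℕs k'))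
  inn k (s ∷ σ) = Ʃ-co (\ ρ -> cg (_& KR (ℕs ρ) α) (sp₁ ρ) » &-as _ _ _) »
   Ʃ-*ˡ _ _ » δ-co (low k (s ∷ σ)) (\ { (ka , st , e) -> ih st e })
   where
   upp : (ρ : Sh) -> Dec _
   upp ρ = tn k ≤?ℕ b ×-dec (str? (ℕs ρ) (ℕs (s ∷ σ)) ×-dec « ℕs ρ ¦ ≟ℕ « ℕs (s ∷ σ) ¦ + (b ∸ tn k))
   sp₁ : ∀ ρ -> δ (O.un? ρ (k , s ∷ σ)) == δ (low k (s ∷ σ)) & δ (upp ρ)
   sp₁ ρ = δ-⇔ _ (low k (s ∷ σ) ×-dec upp ρ)
    (\ { (x , y , z , u , v , w) -> (x , y , z) , u , v , w }) (\ { ((x , y , z) , u , v , w) -> x , y , z , u , v , w }) »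
    δ-× (low k (s ∷ σ)) (upp ρ)
   ih : St (n ∷ ν) (ℕs (s ∷ σ)) -> « ℕs (s ∷ σ) ¦ + (a ∸ tn k) == « n ∷ ν ¦ ->
    Ʃ (\ ρ -> δ (upp ρ) & KR (ℕs ρ) α) == Ʃ (\ k' -> δ (rest k k') & KR (ℕs (s ∷ σ)) (α ∸ᵥ ℕs k'))
   ih st e with tn k ≤?ℕ b
   ... | no ¬kb = Ʃ-0 (\ ρ -> cg (_& KR (ℕs ρ) α) (δ-no _ (\ { (q , _) -> ¬kb q })) » &-zeroˡ _) »
    sym (Ʃ-0 (\ k' -> cg (_& KR (ℕs (s ∷ σ)) (α ∸ᵥ ℕs k')) (δ-no _ (\ { (q , _) -> ¬kb (m+n≤o⇒m≤o _ (≤r q)) })) » &-zeroˡ _))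
   ... | yes kb = Ʃ-co (\ ρ -> cg (_& KR (ℕs ρ) α) (δ-⇔ _ _ snd (\ q -> kb , q))) »
    pi (tn s) (ℕs σ) (b ∸ tn k) α
     (n≤0⇒n≡0 (≤t (st-la n ν (tn s) (ℕs σ) st) (≤r l)))
     (≤t (+-mono-≤ (st-si (n ∷ ν) _ st) (m∸n≤m b (tn k))) p) »
     Ʃ-co (\ k' -> cg (_& KR (ℕs (s ∷ σ)) (α ∸ᵥ ℕs k')) (δ-⇔ _ _
      (\ { (q , y) -> trans (cg (tn k +_) q) (m+[n∸m]≡n kb) , y })
      (\ { (q , y) -> sym (cg (_∸ tn k) (sym q) » m+n∸m≡n (tn k) _) , y })))
  reg : ∀ k σ k' -> δ (low k σ) & (δ (rest k k') & KR (ℕs σ) (α ∸ᵥ ℕs k'))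
   == δ (fu k k') & (δ (step? (n ∷ ν) (ℕs σ) (a ∸ tn k)) & KR (ℕs σ) (α ∸ᵥ ℕs k'))
  reg k σ k' = sym (&-as _ _ _) » cg (_& KR (ℕs σ) (α ∸ᵥ ℕs k'))
   (sym (δ-× (low k σ) (rest k k')) » δ-⇔ _ (fu k k' ×-dec step? (n ∷ ν) (ℕs σ) (a ∸ tn k))
    (\ { ((x , y) , z , u) -> (z , x , u) , y }) (\ { ((z , x , u) , y) -> (x , y) , z , u }) »
    δ-× (fu k k') (step? (n ∷ ν) (ℕs σ) (a ∸ tn k))) » &-as _ _ _

 colsum : ∀ {K L} -> Vec (Row L) K -> Vec ℕ L
 colsum [] = 0ᵥ
 colsum (k ∷ A) = ℕs k +ᵥ colsum A

 rowsum : ∀ {K L} -> Vec (Row L) K -> Vec ℕ K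
 rowsum [] = []
 rowsum (k ∷ A) = « ℕs k ¦ ∷ rowsum A

 ≡ᵥ? : ∀ {n} (u v : Vec ℕ n) -> Dec (u == v)
 ≡ᵥ? = VP.≡-dec _≟ℕ_
  where import Data.Vec.Properties as VP

 ma? : ∀ {K L} (α : Vec ℕ K) (β : Vec ℕ L) (A : Vec (Row L) K) -> Dec (rowsum A == α × colsum A == β)
 ma? α β A = ≡ᵥ? (rowsum A) α ×-dec ≡ᵥ? (colsum A) β

 mat : ∀ {K L} -> Vec ℕ K -> Vec ℕ L -> ℚ
 mat {K} {L} α β = Ʃ {Vec (Row L) K} (\ A -> δ (ma? α β A))

 ma-∷ : ∀ {K L} a (α : Vec ℕ K) (β : Vec ℕ L) ->
  mat (a ∷ α) β == Ʃ {Row L} (\ k -> δ (« ℕs k ¦ ≟ℕ a ×-dec le? (ℕs k) β) & mat α (β ∸ᵥ ℕs k))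
 ma-∷ {K} {L} a α β = Ʃ-∷ {Row L} {K} _ » Ʃ-co (\ k -> Ʃ-co (\ A ->
  δ-⇔ _ ((« ℕs k ¦ ≟ℕ a ×-dec le? (ℕs k) β) ×-dec ma? α (β ∸ᵥ ℕs k) A)
   (\ { (rfl , e) -> let l , f = +ᵥ-∸ᵥ (ℕs k) (colsum A) β e in (rfl , l) , rfl , f })
   (\ { ((rfl , l) , rfl , f) -> rfl , ∸ᵥ-+ᵥ (ℕs k) (colsum A) β l f }) »
  δ-× (« ℕs k ¦ ≟ℕ a ×-dec le? (ℕs k) β) (ma? α (β ∸ᵥ ℕs k) A)) » Ʃ-*ˡ _ _)

 KR-0 : ∀ {N} (β : Vec ℕ N) -> KR (0ᵥ {R}) β == δ (≡ᵥ? 0ᵥ β)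
 KR-0 β with ≡ᵥ? 0ᵥ β
 KR-0 {N} β | no ¬e = KR-si 0ᵥ β (\ e -> ¬e (sym («¦≡0 β (sym e » «0¦ {R})))) » sym (δ-no (no ¬e) ¬e)
 KR-0 {N} .0ᵥ | yes rfl = go N » sym (δ-ye (yes rfl) rfl)
  where
  go : ∀ N -> KR (0ᵥ {R}) (0ᵥ {N}) == 1q
  go zr = δ-ye _ («0¦ {R})
  go (suc N) = Ʃ-po (\ ν -> step? (0ᵥ {R}) (ℕs ν) 0) 0ʳ (\ ν -> KR (ℕs ν) (0ᵥ {N}))
   (subst (St 0ᵥ) (sym ℕs-0) st-0 , trans (+-comm _ 0) (cg «_¦ (ℕs-0 {R})))
   (\ { ν (_ , e) -> on-0 ν (sym (+-comm _ 0) » e » «0¦ {R}) }) »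
   cg (\ z -> KR z (0ᵥ {N})) (ℕs-0 {R}) » go N

 -- The strip of the largest letter of the first tableau is passed to the second one by `pi` and
 -- leaves behind one row of the matrix. Having more rows than cells makes the last part of every
 -- relevant shape 0, as `pi` demands.
 rsk : B < R -> ∀ {K L} (α : Vec ℕ K) (β : Vec ℕ L) -> « α ¦ ≤ B ->
  Ʃ {Sh} (\ μ -> KR (ℕs μ) α & KR (ℕs μ) β) == mat α β
 rsk B<R [] β p = Ʃ-co (\ μ -> cg (_& KR (ℕs μ) β) (δ-⇔ _ (eq? μ 0ʳ) (on-0 μ)
  (\ { rfl -> cg «_¦ (ℕs-0 {R}) » «0¦ {R} }))) »
  Ʃ-δ 0ʳ _ » cg (\ z -> KR z β) ℕs-0 » KR-0 β »
   sym (Ʃ-[] _ » δ-⇔ _ _ snd (\ e -> rfl , e))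
 rsk B<R {suc K} {L} (a ∷ α) β p = begin
  Ʃ (\ μ -> Ʃ (\ ν -> δ (step? (ℕs μ) (ℕs ν) a) & KR (ℕs ν) α) & KR (ℕs μ) β)
   ≡⟨ Ʃ-co (\ μ -> sym (Ʃ-*ʳ _ _) » Ʃ-co (\ ν -> rot (δ (step? (ℕs μ) (ℕs ν) a)) _ _)) ⟩
  Ʃ (\ μ -> Ʃ (\ ν -> KR (ℕs ν) α & (δ (step? (ℕs μ) (ℕs ν) a) & KR (ℕs μ) β)))
   ≡⟨ trans (Ʃ-sw _) (Ʃ-co (\ ν -> Ʃ-*ˡ _ _)) ⟩
  Ʃ (\ ν -> KR (ℕs ν) α & Ʃ (\ μ -> δ (step? (ℕs μ) (ℕs ν) a) & KR (ℕs μ) β))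
   ≡⟨ Ʃ-co ap-pi ⟩
  Ʃ (\ ν -> KR (ℕs ν) α & Ʃ (\ k -> δ (ch k) & KR (ℕs ν) (β ∸ᵥ ℕs k)))
   ≡⟨ Ʃ-co (\ ν -> sym (Ʃ-*ˡ _ _) » Ʃ-co (\ k -> &-sw _ _ _)) ⟩
  Ʃ (\ ν -> Ʃ (\ k -> δ (ch k) & (KR (ℕs ν) α & KR (ℕs ν) (β ∸ᵥ ℕs k))))
   ≡⟨ trans (Ʃ-sw _) (Ʃ-co (\ k -> Ʃ-*ˡ _ _)) ⟩
  Ʃ (\ k -> δ (ch k) & Ʃ (\ ν -> KR (ℕs ν) α & KR (ℕs ν) (β ∸ᵥ ℕs k)))
   ≡⟨ Ʃ-co (\ k -> cg (δ (ch k) &_) (rsk B<R α (β ∸ᵥ ℕs k) (m+n≤o⇒n≤o a p))) ⟩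
  Ʃ (\ k -> δ (ch k) & mat α (β ∸ᵥ ℕs k))
   ≡⟨ ma-∷ a α β ⟨
  mat (a ∷ α) β ∎
  where
  ch : (k : Row L) -> Dec _
  ch k = « ℕs k ¦ ≟ℕ a ×-dec le? (ℕs k) β
  opaque
   unfolding _#_
   rot : ∀ x y z -> x & y & z == y & (x & z)
   rot = slv ℚ-ri
  ap-pi : ∀ ν -> KR (ℕs ν) α & Ʃ (\ μ -> δ (step? (ℕs μ) (ℕs ν) a) & KR (ℕs μ) β)
   == KR (ℕs ν) α & Ʃ (\ k -> δ (ch k) & KR (ℕs ν) (β ∸ᵥ ℕs k))
  ap-pi (n ∷ ν) with « ℕs (n ∷ ν) ¦ ≟ℕ « α ¦ | la (tn n) (ℕs ν) ≟ℕ 0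
  ... | no ¬e | _ = cg (_& _) (KR-si (ℕs (n ∷ ν)) α ¬e) » &-zeroˡ _ »
   sym (cg (_& _) (KR-si (ℕs (n ∷ ν)) α ¬e) » &-zeroˡ _)
  ... | yes e | no ¬l = cg (_& _) z » &-zeroˡ _ » sym (cg (_& _) z » &-zeroˡ _)
   where
   z : KR (ℕs (n ∷ ν)) α == 0q
   z = KR-la (tn n) (ℕs ν) α (≤-<-trans (≤t (≤r e) (m+n≤o⇒n≤o a p)) B<R) ¬l
  ... | yes e | yes l = cg (KR (ℕs (n ∷ ν)) α &_) (Ʃ-co (\ μ -> cg (_& KR (ℕs μ) β) (δ-⇔ _ _ (\ { (s , q) -> s , sym q }) (\ { (s , q) -> s , sym q }))) »
   pi (tn n) (ℕs ν) a β l (≤t (≤r (cg (_+ a) e » +-comm _ a)) p))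

 -- The entry appended at the end counts the smallest letter, all of whose copies lie in the first
 -- row; that row is too short.
 KR-sm : ∀ {R N} m (ρ : Vec ℕ R) (γ : Vec ℕ N) a -> m < a -> KR (m ∷ ρ) (γ ∷ʳ a) == 0q
 KR-sm {R₁} m ρ [] a m<a = Ʃ-0 (\ ν -> δ-* (step? (m ∷ ρ) (ℕs ν) a)
  (\ { (s , e) -> δ-no _ (\ z -> <≢ m<a (bad (ℕs ν) s e z)) }) (\ _ -> rfl))
  where
  ze : ∀ {R} m (ρ : Vec ℕ R) n ν -> n == 0 -> ν == 0ᵥ -> St (m ∷ ρ) (n ∷ ν) -> ρ == 0ᵥ
  ze m [] n [] _ _ _ = rfl
  ze m (x ∷ ρ) n (n' ∷ ν) rfl rfl (_ , q , s) with n≤0⇒n≡0 q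
  ... | rfl = cg (0 ∷_) (ze 0 ρ 0 _ rfl rfl s)
  bad : ∀ ν -> St (m ∷ ρ) ν -> « ν ¦ + a == m + « ρ ¦ -> « ν ¦ == 0 -> m == a
  bad (n ∷ ν) s e z with «¦≡0 (n ∷ ν) z
  ... | eq with ze m ρ n ν (cg V.head eq) (cg V.tail eq) s
  ... | rfl = sym (cg (_+ a) (sym z) » e » cg (m +_) («0¦ {R₁}) » +-idr m)
 KR-sm m ρ (g ∷ γ) a m<a = Ʃ-0 (\ { (n ∷ ν) -> δ-* (step? (m ∷ ρ) (ℕs (n ∷ ν)) g)
  (\ { (s , _) -> KR-sm (tn n) (ℕs ν) γ a (≤-<-trans (st-he {μ = ρ} s) m<a) }) (\ _ -> rfl) })

 -- The smallest letter fills the first row completely, and deleting that row leaves a tableau on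
 -- the remaining shape in the other letters. The first row of every intermediate shape is therefore
 -- frozen at a.
 KR-ro : ∀ {R N} a (ρ : Vec ℕ R) (γ : Vec ℕ N) -> a ≤ B -> Head≤ a ρ -> KR (a ∷ ρ) (γ ∷ʳ a) == KR ρ γ
 KR-ro {R₁} a ρ [] aB h with « ρ ¦ ≟ℕ 0
 ... | no ¬z = Ʃ-0 (\ ν -> δ-* (step? (a ∷ ρ) (ℕs ν) a)
  (\ { (s , e) -> δ-no _ (\ z -> ¬z (+-cancelˡ-≡ a _ _ (sym e » cg (_+ a) z » sym (+-idr a)))) }) (\ _ -> rfl)) »
  sym (δ-no (no ¬z) ¬z)
 ... | yes z = Ʃ-co (\ ν -> sym (δ-× (step? (a ∷ ρ) (ℕs ν) a) (« ℕs ν ¦ ≟ℕ 0)) »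
  sym (&-idʳ _) » cg (_& 1q) (δ-⇔ _ (eq? ν 0ʳ) (\ { (_ , e) -> on-0 ν e }) (\ { rfl -> ok , trans (cg «_¦ (ℕs-0 {suc R₁})) («0¦ {suc R₁}) }))) »
  Ʃ-δ 0ʳ (\ _ -> 1q) » sym (δ-ye (yes z) z)
  where
  strip0 : ∀ {R} a -> St (a ∷ 0ᵥ {R}) 0ᵥ
  strip0 {zr} a = z≤n
  strip0 {suc R} a = z≤n , z≤n , strip0 {R} 0
  ok : Step (a ∷ ρ) (ℕs (0ʳ {suc R₁})) a
  ok = subst2 St (cg (a ∷_) (sym («¦≡0 ρ z))) (sym ℕs-0) (strip0 a) ,
   trans (cg (_+ a) (cg «_¦ (ℕs-0 {suc R₁}) » «0¦ {suc R₁})) (sym (cg (a +_) z » +-idr a))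
 KR-ro {R₁} a ρ (g ∷ γ) aB h = begin
  Ʃ (\ ν -> δ (step? (a ∷ ρ) (ℕs ν) g) & KR (ℕs ν) (γ ∷ʳ a))
   ≡⟨ Ʃ-∷ {Fin (suc B)} {R₁} _ ⟩
  Ʃ (\ n -> Ʃ (\ ν -> δ (step? (a ∷ ρ) (tn n ∷ ℕs ν) g) & KR (tn n ∷ ℕs ν) (γ ∷ʳ a)))
   ≡⟨ Ʃ-co (\ n -> on n) ⟩
  Ʃ (\ n -> δ (eq? n a') & Ʃ (\ ν -> δ (step? (a ∷ ρ) (tn n ∷ ℕs ν) g) & KR (tn n ∷ ℕs ν) (γ ∷ʳ a)))
   ≡⟨ Ʃ-δ a' _ ⟩
  Ʃ (\ ν -> δ (step? (a ∷ ρ) (tn a' ∷ ℕs ν) g) & KR (tn a' ∷ ℕs ν) (γ ∷ʳ a))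
   ≡⟨ Ʃ-co (\ ν -> cg (\ z -> δ (step? (a ∷ ρ) (z ∷ ℕs ν) g) & KR (z ∷ ℕs ν) (γ ∷ʳ a)) (toℕ-cl aB)) ⟩
  Ʃ (\ ν -> δ (step? (a ∷ ρ) (a ∷ ℕs ν) g) & KR (a ∷ ℕs ν) (γ ∷ʳ a))
   ≡⟨ Ʃ-co (\ ν -> cg (_& KR (a ∷ ℕs ν) (γ ∷ʳ a)) (δ-⇔ _ (step? ρ (ℕs ν) g) (dow ρ (ℕs ν)) (up ρ (ℕs ν) h)) »
    δ-co (step? ρ (ℕs ν) g) (\ { (s , _) -> KR-ro a (ℕs ν) γ aB (be ρ (ℕs ν) s h) })) ⟩
  Ʃ (\ ν -> δ (step? ρ (ℕs ν) g) & KR (ℕs ν) γ) ∎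
  where
  a' = cla a
  on : ∀ n -> Ʃ (\ ν -> δ (step? (a ∷ ρ) (tn n ∷ ℕs ν) g) & KR (tn n ∷ ℕs ν) (γ ∷ʳ a))
   == δ (eq? n a') & Ʃ (\ ν -> δ (step? (a ∷ ρ) (tn n ∷ ℕs ν) g) & KR (tn n ∷ ℕs ν) (γ ∷ʳ a))
  on n = sym (δ-* (eq? n a') (\ _ -> rfl) (\ ne -> Ʃ-0 (\ ν -> δ-* (step? (a ∷ ρ) (tn n ∷ ℕs ν) g)
   (\ { (s , _) -> KR-sm (tn n) (ℕs ν) γ a (≤∧≢⇒< (st-he {μ = ρ} s)
    (\ e -> ne (tn-inj (e » sym (toℕ-cl aB))))) }) (\ _ -> rfl))))
  dow : ∀ {R} (ρ ν : Vec ℕ R) -> Step (a ∷ ρ) (a ∷ ν) g -> Step ρ ν g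
  dow [] [] (_ , e) = tt , +-cancelˡ-≡ a _ _ (sym (+-assoc a _ g) » e)
  dow (x ∷ ρ) (n ∷ ν) ((_ , _ , s) , e) = s , +-cancelˡ-≡ a _ _ (sym (+-assoc a _ g) » e)
  up : ∀ {R} (ρ ν : Vec ℕ R) -> Head≤ a ρ -> Step ρ ν g -> Step (a ∷ ρ) (a ∷ ν) g
  up [] [] h (_ , e) = ≤= , trans (+-assoc a _ g) (cg (a +_) e)
  up (x ∷ ρ) (n ∷ ν) h (s , e) = (≤= , h , s) , trans (+-assoc a _ g) (cg (a +_) e)
  be : ∀ {R} (ρ ν : Vec ℕ R) -> St ρ ν -> Head≤ a ρ -> Head≤ a ν
  be [] [] _ _ = tt
  be (x ∷ ρ) (n ∷ ν) s h = ≤t (st-he {μ = ρ} s) h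

 Lex : ∀ {R} -> Row R -> Row R -> Set
 Lex [] [] = ⊥
 Lex (x ∷ u) (y ∷ v) = tn x < tn y ⊎ (x == y × Lex u v)

 -- The reversed shape gives the smallest letter the largest multiplicity, so that `KR-ro` peels off
 -- the rows one by one. Together with `KR-le` this is unitriangularity of the Kostka matrix in
 -- lexicographic order.
 KR-di : ∀ {R} (μ : Row R) -> De (ℕs μ) -> KR (ℕs μ) (reverseᵥ (ℕs μ)) == 1q
 KR-di [] _ = δ-ye _ rfl
 KR-di (x ∷ μ) d = let h , d' = de-ta (tn x) (ℕs μ) d in
  trans (KR-ro (tn x) (ℕs μ) (reverseᵥ (ℕs μ)) (≤-pred (toℕ<n x)) h) (KR-di μ d')

 KR-le : ∀ {R} (μ ν : Row R) -> De (ℕs μ) -> Lex μ ν -> KR (ℕs μ) (reverseᵥ (ℕs ν)) == 0q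
 KR-le [] [] d ()
 KR-le (x ∷ μ) (y ∷ ν) d (inl p) = KR-sm (tn x) (ℕs μ) (reverseᵥ (ℕs ν)) (tn y) p
 KR-le (x ∷ μ) (.x ∷ ν) d (inr (rfl , l)) = let h , d' = de-ta (tn x) (ℕs μ) d in
  trans (KR-ro (tn x) (ℕs μ) (reverseᵥ (ℕs ν)) (≤-pred (toℕ<n x)) h) (KR-le μ ν d' l)

-- Two-rowed arrays and matrices.

open import Data.List using (filter)
open import Data.List.Properties using (++-assoc)
import Data.List as L
import Data.List.Relation.Unary.All as All
import Data.List.Relation.Unary.AllPairs.Properties as APP

«¦-Ʃ : ∀ {n} (v : Vec ℕ n) -> ι « v ¦ == Ʃ (\ i -> ι (lk v i))
«¦-Ʃ [] = sym (Ʃ-Fin0 _)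
«¦-Ʃ (x ∷ v) = (ι-+ x « v ¦) » cg (ι x #_) («¦-Ʃ v) » sym (Ʃ-Fi _)

con : ∀ {K n} -> Vec (Fin K) n -> Vec ℕ K
con w = tab (cnt w)

co-▹ : ∀ {K n} (w : Vec (Fin K) n) (p : Pe n) -> con (w ▹ p) == con w
co-▹ w p = tabulate-cong (cn-▹ w p)

«content¦ : ∀ {K n} (w : Vec (Fin K) n) -> « con w ¦ == n
«content¦ {K} {n} w = ι-in (begin
 ι « con w ¦ ≡⟨ «¦-Ʃ (con w) ⟩
 Ʃ (\ k -> ι (lk (con w) k)) ≡⟨ Ʃ-co (\ k -> cg ι (lk-tab (cnt w) k) » cn-Ʃ w k) ⟩
 Ʃ (\ k -> Ʃ (\ i -> δ (eq? (lk w i) k))) ≡⟨ Ʃ-sw _ ⟩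
 Ʃ (\ i -> Ʃ (\ k -> δ (eq? (lk w i) k))) ≡⟨ Ʃ-co (\ i -> Ʃ-co (\ k -> sym (&-idʳ _)) » Ʃ-δ' (lk w i) (\ _ -> 1q)) ⟩
 Ʃ (\ (i : Fin n) -> 1q) ≡⟨ ones n ⟩
 ι n ∎)
 where
 open ≡-Reasoning
 ones : ∀ n -> Ʃ (\ (i : Fin n) -> 1q) == ι n
 ones zr = Ʃ-Fin0 _
 ones (suc n) = Ʃ-Fi _ » cg (1q #_) (ones n)

module _ {Z : Set} ⦃ _ : Fi Z ⦄ (c : Z -> ℕ) where

 vo : List Z -> ℕ
 vo [] = 0
 vo (z ∷ zs) = c z + vo zs

 sp : (zs : List Z) -> Vec Z (vo zs)
 sp [] = []
 sp (z ∷ zs) = V.replicate (c z) z V.++ sp zs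

 vo-∑ : ∀ zs -> ι (vo zs) == ∑ zs (ι ∘ c)
 vo-∑ [] = rfl
 vo-∑ (z ∷ zs) = ι-+ (c z) _ » cg (ι (c z) #_) (vo-∑ zs)

 cn-++ : ∀ {m n} (u : Vec Z m) (v : Vec Z n) z -> cnt (u V.++ v) z == cnt u z + cnt v z
 cn-++ [] v z = rfl
 cn-++ (x ∷ u) v z with eq? x z
 ... | yes _ = cg suc (cn-++ u v z)
 ... | no _ = cn-++ u v z

 cn-re : ∀ m (x z : Z) -> ι (cnt (V.replicate m x) z) == δ (eq? x z) & ι m
 cn-re zr x z = sym (&-zeroʳ _)
 cn-re (suc m) x z with eq? x z in e
 ... | yes p = cg (1q #_) (cn-re m x z » cg (\ d -> δ d & ι m) e) »
  cg (1q #_) (cg (_& ι m) (δ-ye (yes p) p) » &-idˡ _) »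
   sym (cg (_& (1q # ι m)) (δ-ye (yes p) p) » &-idˡ _)
 ... | no ¬p = cn-re m x z » cg (\ d -> δ d & ι m) e »
  cg (_& ι m) (δ-no (no ¬p) ¬p) » &-zeroˡ _ »
   sym (cg (_& (1q # ι m)) (δ-no (no ¬p) ¬p) » &-zeroˡ _)

 cn-sp : ∀ zs z -> ι (cnt (sp zs) z) == ∑ zs (\ y -> δ (eq? y z) & ι (c y))
 cn-sp [] z = rfl
 cn-sp (y ∷ zs) z = cg ι (cn-++ (V.replicate (c y) y) (sp zs) z) »
  ι-+ (cnt (V.replicate (c y) y) z) _ » ap2 _#_ (cn-re (c y) y z) (cn-sp zs z)

 opaque
  unfolding Ʃ

  spe : ∀ {n} -> Ʃ (ι ∘ c) == ι n -> ∃ \ (x : Vec Z n) -> ∀ z -> cnt x z == c z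
  spe {n} e with ι-in {vo els} {n} (vo-∑ els » e)
  ... | rfl = sp els , \ z -> ι-in (cn-sp els z » ∑-δ eq? els z (ι ∘ c) unique (com z))

Ʃ-zi : {A B : Set} {n : ℕ} ⦃ _ : Fi A ⦄ ⦃ _ : Fi B ⦄ (F : Vec A n -> Vec B n -> ℚ) ->
 Ʃ (\ x -> F (V.map fst x) (V.map snd x)) == Ʃ (\ w -> Ʃ (\ v -> F w v))
Ʃ-zi F = Ʃ-bi (\ x -> V.map fst x , V.map snd x) (\ { (w , v) -> V.zip w v })
 (\ x -> sym (VP.map-<,>-zip fst snd x) » VP.map-id x) (\ { (w , v) -> ap2 _,_ (VP.map-proj₁-zip w v) (VP.map-proj₂-zip w v) })
 (\ { (w , v) -> F w v }) » Ʃ-× _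

-- Pairs of words, i.e. two-rowed arrays, up to simultaneous permutation of the places are matrices.
module Ar (n B : ℕ) (n≤B : n ≤ B) (R' K L : ℕ) where
 open Ko B R'
 open FG (Sym {n}) using (order;finite)
 open ≡-Reasoning

 Z : Set
 Z = Fin K × Fin L

 Ma : Set
 Ma = Vec (Row L) K

 en : Ma -> Z -> ℕ
 en A (k , l) = tn (lk (lk A k) l)

 ty : Vec Z n -> Ma
 ty x = tab (\ k -> tab (\ l -> cla (cnt x (k , l))))

 en-ty : ∀ x z -> en (ty x) z == cnt x z
 en-ty x (k , l) = cg (\ r -> tn (lk r l)) (lk-tab (\ k -> tab (\ l -> cla (cnt x (k , l)))) k) »
  cg tn (lk-tab (\ l -> cla (cnt x (k , l))) l) » toℕ-cl (≤t (cn-≤ x (k , l)) n≤B)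

 ma-ex : ∀ {A A'} -> (∀ z -> en A z == en A' z) -> A == A'
 ma-ex eq = lo-ex (\ k -> lo-ex (\ l -> tn-inj (eq (k , l))))

 Fu : Ma -> Set
 Fu A = « rowsum A ¦ == n

 lo-ro : ∀ {K} (A : Vec (Row L) K) k -> lk (rowsum A) k == « ℕs (lk A k) ¦
 lo-ro (r ∷ A) zr = rfl
 lo-ro (r ∷ A) (suc k) = lo-ro A k

 loo-col : ∀ {K} (A : Vec (Row L) K) l -> ι (lk (colsum A) l) == Ʃ (\ k -> ι (tn (lk (lk A k) l)))
 loo-col [] l = cg ι (VP.lookup-replicate l 0) » sym (Ʃ-Fin0 _)
 loo-col (r ∷ A) l = cg ι (VP.lookup-zipWith _+_ l (ℕs r) (colsum A) » cg (_+ lk (colsum A) l) (VP.lookup-map l tn r)) »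
  ι-+ (tn (lk r l)) _ » cg (ι (tn (lk r l)) #_) (loo-col A l) » sym (Ʃ-Fi _)

 ro-en : ∀ A k -> ι (lk (rowsum A) k) == Ʃ (\ l -> ι (en A (k , l)))
 ro-en A k = cg ι (lo-ro A k) » «¦-Ʃ (ℕs (lk A k)) »
  Ʃ-co (\ l -> cg ι (VP.lookup-map l tn (lk A k)))

 proj₁s : Vec Z n -> Vec (Fin K) n
 proj₁s = V.map fst

 proj₂s : Vec Z n -> Vec (Fin L) n
 proj₂s = V.map snd

 cn-pr₁ : ∀ x k -> ι (cnt (proj₁s x) k) == Ʃ (\ l -> ι (cnt x (k , l)))
 cn-pr₁ x k = cn-Ʃ (proj₁s x) k » sym (Ʃ-co (\ l -> cn-Ʃ x (k , l)) » Ʃ-sw _ »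
  Ʃ-co (\ i -> Ʃ-co (\ l -> δ-⇔ (eq? (lk x i) (k , l))
   (eq? (snd (lk x i)) l ×-dec eq? (fst (lk x i)) k) (\ e -> cg snd e , cg fst e)
   (\ { (rfl , rfl) -> rfl }) » δ-× (eq? (snd (lk x i)) l) _) » Ʃ-δ' (snd (lk x i)) (\ _ -> δ (eq? (fst (lk x i)) k)) »
   cg (\ y -> δ (eq? y k)) (sym (VP.lookup-map i fst x))))

 cn-pr₂ : ∀ x l -> ι (cnt (proj₂s x) l) == Ʃ (\ k -> ι (cnt x (k , l)))
 cn-pr₂ x l = cn-Ʃ (proj₂s x) l » sym (Ʃ-co (\ k -> cn-Ʃ x (k , l)) » Ʃ-sw _ »
  Ʃ-co (\ i -> Ʃ-co (\ k -> δ-⇔ (eq? (lk x i) (k , l))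
   (eq? (fst (lk x i)) k ×-dec eq? (snd (lk x i)) l) (\ e -> cg fst e , cg snd e)
   (\ { (rfl , rfl) -> rfl }) » δ-× (eq? (fst (lk x i)) k) _) » Ʃ-δ' (fst (lk x i)) (\ _ -> δ (eq? (snd (lk x i)) l)) »
   cg (\ y -> δ (eq? y l)) (sym (VP.lookup-map i snd x))))

 ro-ty : ∀ x -> rowsum (ty x) == con (proj₁s x)
 ro-ty x = lo-ex (\ k -> ι-in (ro-en (ty x) k » Ʃ-co (\ l -> cg ι (en-ty x (k , l))) »
  sym (cn-pr₁ x k) » cg ι (sym (lk-tab (cnt (proj₁s x)) k))))

 co-ty : ∀ x -> colsum (ty x) == con (proj₂s x)
 co-ty x = lo-ex (\ l -> ι-in (loo-col (ty x) l » Ʃ-co (\ k -> cg ι (en-ty x (k , l))) »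
  sym (cn-pr₂ x l) » cg ι (sym (lk-tab (cnt (proj₂s x)) l))))

 fu-ty : ∀ x -> Fu (ty x)
 fu-ty x = cg «_¦ (ro-ty x) » «content¦ (proj₁s x)

 fu-sp : ∀ A -> Fu A -> ∃ \ (x : Vec Z n) -> ∀ z -> cnt x z == en A z
 fu-sp A f = spe (en A) (Ʃ-× _ » Ʃ-co (\ k -> sym (ro-en A k)) »
  sym («¦-Ʃ (rowsum A)) » cg ι f)

 module _ (q : Pe K) where

  mR : Ma -> Ma
  mR = _▹ invₚ q

  rel : Vec Z n -> Vec Z n
  rel = V.map (\ { (k , l) -> q · k , l })

  ty-re : ∀ x -> ty (rel x) == mR (ty x)
  ty-re x = ma-ex (\ { (k , l) -> en-ty (rel x) (k , l) » sym
   (cg (\ r -> tn (lk r l)) (▹-lo (ty x) (invₚ q) k) » en-ty x (invₚ q · k , l) » ι-in (cn-Ʃ x _ » Ʃ-co (\ i ->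
    δ-⇔ _ (eq? (rela (lk x i)) (k , l)) (fw (lk x i)) (bw (lk x i)) »
     cg (\ y -> δ (eq? y (k , l))) (sym (VP.lookup-map i rela x))) »
    sym (cn-Ʃ (rel x) (k , l)))) })
   where
   rela : Z -> Z
   rela (k , l) = q · k , l
   fw : ∀ {k l} (y : Z) -> y == (invₚ q · k , l) -> rela y == (k , l)
   fw {k} {l} _ rfl = cg (_, l) (cg (q ·_) (in-· q k) » ··⁻ q k)
   bw : ∀ {k l} (y : Z) -> rela y == (k , l) -> y == (invₚ q · k , l)
   bw (k , l) rfl = cg (_, l) (sym (in-· q (q · k) » ·⁻· q k))

  -- The twisted orbit count with matrices as types: permuting the places of an array does not
  -- change its matrix of multiplicities, and relabelling the first row of letters by q permutes the
  -- rows of the matrix.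
  arra : (Ψ : Ma -> ℚ) -> Ʃ (\ (g : Pe n) -> Ʃ (\ x -> δ (eq? (x ▹ g) (rel x)) & Ψ (ty x)))
   == order & Ʃ (\ A -> δ (« rowsum A ¦ ≟ℕ n) & (δ (eq? (mR A) A) & Ψ A))
  arra = OC.or-co Sym (Vec Z n) Ma _▹_ ▹-∙ ▹-id ty
   (\ x g -> ma-ex (\ z -> en-ty (x ▹ g) z » cn-▹ x g z » sym (en-ty x z)))
   (\ x y e -> sa-co x y (\ z -> sym (en-ty x z) » cg (\ A -> en A z) e » en-ty y z))
   (\ A -> « rowsum A ¦ ≟ℕ n) (\ A f -> fst (fu-sp A f))
   (\ A f -> ma-ex (\ z -> en-ty (fst (fu-sp A f)) z » snd (fu-sp A f) z))
   fu-ty rel mR ty-re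

  ar' : (Ψ : Vec ℕ K -> Vec ℕ L -> ℚ) ->
   Ʃ (\ (g : Pe n) -> Ʃ (\ w -> Ʃ (\ v -> δ (eq? (w ▹ g) (V.map (q ·_) w)) & δ (eq? (v ▹ g) v) & Ψ (con w) (con v))))
   == order & Ʃ (\ A -> δ (« rowsum A ¦ ≟ℕ n) & (δ (eq? (mR A) A) & Ψ (rowsum A) (colsum A)))
  ar' Ψ = Ʃ-co (\ g -> sym (Ʃ-zi _) » Ʃ-co (\ x -> ap2 _&_
   (sym (δ-× _ _) » δ-⇔ _ (eq? (x ▹ g) (rel x)) (to g x) (from g x))
   (ap2 Ψ (sym (ro-ty x)) (sym (co-ty x))))) »
   arra (\ A -> Ψ (rowsum A) (colsum A))
   where
   to : ∀ g x -> proj₁s x ▹ g == V.map (q ·_) (proj₁s x) × proj₂s x ▹ g == proj₂s x -> x ▹ g == rel x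
   to g x (e , f) = lo-ex (\ i -> ▹-lo x g i » ap2 _,_ (a i) (b i) » sym (VP.lookup-map i _ x))
    where
    a : ∀ i -> fst (lk x (g · i)) == q · fst (lk x i)
    a i = sym (VP.lookup-map (g · i) fst x) » sym (▹-lo (proj₁s x) g i) »
     cg (\ v -> lk v i) e » VP.lookup-map i (q ·_) (proj₁s x) » cg (q ·_) (VP.lookup-map i fst x)
    b : ∀ i -> snd (lk x (g · i)) == snd (lk x i)
    b i = sym (VP.lookup-map (g · i) snd x) » sym (▹-lo (proj₂s x) g i) »
     cg (\ v -> lk v i) f » VP.lookup-map i snd x
   from : ∀ g x -> x ▹ g == rel x -> proj₁s x ▹ g == V.map (q ·_) (proj₁s x) × proj₂s x ▹ g == proj₂s x
   from g x e = lo-ex (\ i -> ▹-lo (proj₁s x) g i » VP.lookup-map (g · i) fst x »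
    cg fst (c i) » cg (q ·_) (sym (VP.lookup-map i fst x)) » sym (VP.lookup-map i (q ·_) (proj₁s x))) ,
    lo-ex (\ i -> ▹-lo (proj₂s x) g i » VP.lookup-map (g · i) snd x »
     cg snd (c i) » sym (VP.lookup-map i snd x))
    where
    c : ∀ i -> lk x (g · i) == (q · fst (lk x i) , snd (lk x i))
    c i = sym (▹-lo x g i) » cg (\ v -> lk v i) e » VP.lookup-map i _ x

-- The irreducible characters of the symmetric group.

import Data.Fin.Properties as FinP

∑-fil : {A : Set} {P : A -> Set} (P? : ∀ a -> Dec (P a)) (xs : List A) (f : A -> ℚ) ->
 ∑ (filter P? xs) f == ∑ xs (\ a -> δ (P? a) & f a)
∑-fil P? [] f = rfl
∑-fil P? (x ∷ xs) f with P? x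
... | yes p = ap2 _#_ (sym (δ-* (yes p) (\ _ -> rfl) (\ ¬p -> absurd p ¬p))) (∑-fil P? xs f)
... | no ¬p = ∑-fil P? xs f » sym (cg (_# ∑ xs (\ a -> δ (P? a) & f a))
 (δ-* (no ¬p) (\ p -> absurd p ¬p) (\ _ -> rfl)) » #-idˡ _)

∑-zero∈ : {A : Set} (xs : List A) {f : A -> ℚ} -> (∀ {a} -> a ∈ xs -> f a == 0q) -> ∑ xs f == 0q
∑-zero∈ xs p = ∑-cong∈ xs p » ∑-0 xs

module Lexi (B R' : ℕ) where
 open Ko B R'

 private
  lif : ∀ {R} {x : Fin (suc B)} (vs : List (Row R)) -> AllPairs Lex vs -> AllPairs Lex (mapL (x ∷_) vs)
  lif [] [] = []
  lif (v ∷ vs) (p ∷ ps) = li' p ∷ lif vs ps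
   where
   li' : ∀ {R} {x : Fin (suc B)} {v : Row R} {vs} -> All (Lex v) vs -> All (Lex (x ∷ v)) (mapL (x ∷_) vs)
   li' [] = []
   li' (l ∷ ls) = inr (rfl , l) ∷ li' ls

  be : ∀ {R} {x : Fin (suc B)} (v : Row R) xs (vs : List (Row R)) -> All (\ y -> tn x < tn y) xs ->
   All (Lex (x ∷ v)) (cartesianProductWith _∷_ xs vs)
  be v [] vs [] = []
  be v (y ∷ xs) vs (p ∷ ps) = All++ (hea vs) (be v xs vs ps)
   where
   open import Data.List.Relation.Unary.All.Properties using () renaming (++⁺ to All++)
   hea : ∀ vs -> All (Lex (_ ∷ v)) (mapL (y ∷_) vs)
   hea [] = []
   hea (u ∷ vs) = inl p ∷ hea vs

  pr-le : ∀ {R} xs (vs : List (Row R)) -> AllPairs (\ x y -> tn x < tn y) xs -> AllPairs Lex vs ->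
   AllPairs Lex (cartesianProductWith _∷_ xs vs)
  pr-le [] vs [] qs = []
  pr-le (x ∷ xs) vs (p ∷ ps) qs = APP.++⁺ (lif vs qs) (pr-le xs vs ps qs) (ac vs)
   where
   ac : ∀ us -> All (\ u -> All (Lex u) (cartesianProductWith _∷_ xs vs)) (mapL (x ∷_) us)
   ac [] = []
   ac (u ∷ us) = be u xs vs p ∷ ac us

 ve-le : ∀ R -> AllPairs Lex (ve (allFin (suc B)) R)
 ve-le zr = [] ∷ []
 ve-le (suc R) = pr-le (allFin (suc B)) (ve (allFin (suc B)) R) (APP.tabulate⁺-< (\ p -> p)) (ve-le R)

module Ch (n : ℕ) where
 open Ko n n public
 open Lexi n n
 open FG (Sym {n}) public using (order;order≢0;order>0;⟪_,_⟫;⟪⟫-comm;Rep;PosDef;Rep⇒PosDef;PosDef-pair)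
 open Sc (Sym {n}) using (split)
 open ≡-Reasoning

 ClassFun : Set
 ClassFun = Pe n -> ℚ

 -- The character of the permutation representation on words of content `α`; its Frobenius
 -- characteristic is h_α.
 M : ∀ {K} -> Vec ℕ K -> ClassFun
 M {K} α g = Ʃ (\ (w : Vec (Fin K) n) -> δ (≡ᵥ? (con w) α) & δ (eq? (w ▹ g) w))

 id-mR : ∀ {K} {Y : Set} (A : Vec Y K) -> A ▹ invₚ idₚ == A
 id-mR A = lo-ex (\ k -> ▹-lo A (invₚ idₚ) k » cg (lk A) (in-· idₚ k » sym (id-· _) » ··⁻ idₚ k))

 M-gr : ∀ {K L} (α : Vec ℕ K) (β : Vec ℕ L) -> « α ¦ == n -> ⟪ M α , M β ⟫ == order & mat α β
 M-gr {K} {L} α β e = begin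
  Ʃ (\ g -> M α g & M β g)
   ≡⟨ Ʃ-co (\ g -> sym (Ʃ-& _ _) » Ʃ-co₂ (\ w v -> sw w v g)) ⟩
  Ʃ (\ g -> Ʃ (\ (w : Vec (Fin K) n) -> Ʃ (\ (v : Vec (Fin L) n) -> δ (eq? (w ▹ g) (V.map (idₚ {K} ·_) w)) & δ (eq? (v ▹ g) v) & Ψ (con w) (con v))))
   ≡⟨ ar' idₚ Ψ ⟩
  order & Ʃ (\ A -> δ (« rowsum A ¦ ≟ℕ n) & (δ (eq? (mR idₚ A) A) & Ψ (rowsum A) (colsum A)))
   ≡⟨ cg (order &_) (Ʃ-co (\ A -> cg (\ z -> δ (« rowsum A ¦ ≟ℕ n) & (z & Ψ (rowsum A) (colsum A)))
    (δ-ye _ (id-mR A)) » cg (δ (« rowsum A ¦ ≟ℕ n) &_) (&-idˡ _ » sym (δ-× _ _)) »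
    sym (δ-× _ _) » δ-⇔ _ (ma? α β A) snd (\ { (p , q) -> trans (cg «_¦ p) e , p , q }))) ⟩
  order & mat α β ∎
  where
  open Ar n n ≤= n K L
  Ψ : Vec ℕ K -> Vec ℕ L -> ℚ
  Ψ a b = δ (≡ᵥ? a α) & δ (≡ᵥ? b β)
  ma-id : ∀ (v : Vec (Fin K) n) -> V.map (idₚ ·_) v == v
  ma-id v = VP.map-cong id-· v » VP.map-id v
  opaque
   unfolding _#_
   rea : ∀ a b c d -> (a & b) & (c & d) == b & d & (a & c)
   rea = slv ℚ-ri
  sw : ∀ (w : Vec (Fin K) n) (v : Vec (Fin L) n) g -> (δ (≡ᵥ? (con w) α) & δ (eq? (w ▹ g) w)) & (δ (≡ᵥ? (con v) β) & δ (eq? (v ▹ g) v))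
   == δ (eq? (w ▹ g) (V.map (idₚ {K} ·_) w)) & δ (eq? (v ▹ g) v) & Ψ (con w) (con v)
  sw w v g = rea _ _ _ _ » cg (\ z -> δ (eq? (w ▹ g) z) & δ (eq? (v ▹ g) v) & Ψ (con w) (con v)) (sym (ma-id w))

 M-re : ∀ {K} (α : Vec ℕ K) -> Rep (M α)
 M-re {K} α = record
  { I = Vec (Fin K) n
  ;ρ = \ g w u -> δ (≡ᵥ? (con w) α) & δ (eq? (w ▹ g) u)
  ;ρ-∙ = \ g h w u -> sym (Ʃ-co (\ v -> rea _ (δ (eq? (w ▹ g) v)) _ _) » Ʃ-δ' (w ▹ g) _ »
   sym (&-as _ _ _) » ap2 _&_ (cg (\ z -> δ (≡ᵥ? (con w) α) & δ (≡ᵥ? z α)) (co-▹ w g) » δ-id _)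
    (cg (\ z -> δ (eq? z u)) (sym (▹-∙ w g h))))
  ;ρ-inv = \ g w u -> sym (δ-× _ _) » δ-⇔ _ (≡ᵥ? (con u) α ×-dec eq? (u ▹ g) w) (to g w u) (from g w u) » δ-× _ _
  ;ρ-trace = \ g -> rfl }
  where
  opaque
   unfolding _#_
   rea : ∀ a b c d -> (a & b) & (c & d) == b & (a & (c & d))
   rea = slv ℚ-ri
  open FG (Sym {n}) using (invˡ;invʳ)
  to : ∀ g (w u : Vec (Fin K) n) -> con w == α × w ▹ invₚ g == u -> con u == α × u ▹ g == w
  to g w _ (e , rfl) = trans (co-▹ w _) e , trans (sym (▹-∙ w (invₚ g) g)) (cg (w ▹_) (invˡ g) » ▹-id w)
  from : ∀ g (w u : Vec (Fin K) n) -> con u == α × u ▹ g == w -> con w == α × w ▹ invₚ g == u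
  from g _ u (e , rfl) = trans (co-▹ u _) e , trans (sym (▹-∙ u g (invₚ g))) (cg (u ▹_) (invʳ g) » ▹-id u)

 ⟪⟫-re : ∀ φ k χ ψ -> ⟪ (\ g -> φ g # ~ (k & χ g)) , ψ ⟫ == ⟪ φ , ψ ⟫ # ~ (k & ⟪ χ , ψ ⟫)
 ⟪⟫-re φ k χ ψ = Ʃ-co (\ g -> dist (φ g) k (χ g) (ψ g)) » Ʃ-# _ _ »
  cg (⟪ φ , ψ ⟫ #_) (Ʃ-*ˡ _ _ » neg k _)
  where
  opaque
   unfolding _#_
   dist : ∀ a k b c -> (a # ~ (k & b)) & c == a & c # ~ k & (b & c)
   dist = slv ℚ-ri
   neg : ∀ k x -> ~ k & x == ~ (k & x)
   neg = slv ℚ-ri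

 La : Set
 La = Sh × ClassFun

 Ort : La -> La -> Set
 Ort (_ , χ) (_ , χ') = ⟪ χ , χ' ⟫ == 0q

 record Or (xs : List La) : Set where
  field
   norms : All (\ (_ , χ) -> ⟪ χ , χ ⟫ == order) xs
   orth : AllPairs Ort xs

 Co : (Sh -> ℚ) -> ClassFun -> List La -> Set
 Co k φ = All (\ (μ , χ) -> ⟪ φ , χ ⟫ == order & k μ)

 -- The Gram-Schmidt residue with respect to characters already constructed, `k` giving the
 -- multiplicities.
 resi : (Sh -> ℚ) -> ClassFun -> List La -> ClassFun
 resi k φ [] = φ
 resi k φ ((μ , χ) ∷ xs) = resi k (\ g -> φ g # ~ (k μ & χ g)) xs

 re-va : ∀ k φ xs g -> resi k φ xs g == φ g # ~ ∑ xs (\ (μ , χ) -> k μ & χ g)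
 re-va k φ [] g = sym (#-idʳ _) » cg (φ g #_) (sym neg0)
  where
  opaque
   unfolding _#_
   neg0 : ~ 0q == 0q
   neg0 = rfl
 re-va k φ ((μ , χ) ∷ xs) g = re-va k _ xs g » lem (φ g) (k μ & χ g) _
  where
  opaque
   unfolding _#_
   lem : ∀ a b c -> a # ~ b # ~ c == a # ~ (b # c)
   lem = slv ℚ-ri

 ne-co : ∀ {k φ μ χ xs} -> All (Ort (μ , χ)) xs -> Co k φ xs ->
  Co k (\ g -> φ g # ~ (k μ & χ g)) xs
 ne-co [] [] = []
 ne-co {k} {φ} {μ} {χ} (_∷_ {x = _ , χ'} o os) (c ∷ cs) =
  trans (⟪⟫-re φ (k μ) χ χ') (ap2 (\ x y -> x # ~ (k μ & y)) c o » lem _ (k μ)) ∷ ne-co os cs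
  where
  opaque
   unfolding _#_
   lem : ∀ a k -> a # ~ (k & 0q) == a
   lem = slv ℚ-ri

 res-rep : ∀ {k φ xs} -> Rep φ -> All (\ (_ , χ) -> Rep χ) xs -> Or xs -> Co k φ xs -> Rep (resi k φ xs)
 res-rep R [] _ [] = R
 res-rep {k} {φ} {(μ , χ) ∷ xs} R (r ∷ rs) record { norms = n ∷ ns;orth = o ∷ os } (c ∷ cs) =
  res-rep (split R r n (k μ) c) rs (record { norms = ns;orth = os }) (ne-co o cs)

 re-pa : ∀ k φ xs ψ -> ⟪ resi k φ xs , ψ ⟫ == ⟪ φ , ψ ⟫ # ~ ∑ xs (\ (μ , χ) -> k μ & ⟪ χ , ψ ⟫)
 re-pa k φ [] ψ = sym (#-idʳ _) » cg (⟪ φ , ψ ⟫ #_) (sym neg0)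
  where
  opaque
   unfolding _#_
   neg0 : ~ 0q == 0q
   neg0 = rfl
 re-pa k φ ((μ , χ) ∷ xs) ψ = re-pa k _ xs ψ » cg (_# ~ ∑ xs (\ (μ , χ) -> k μ & ⟪ χ , ψ ⟫)) (⟪⟫-re φ (k μ) χ ψ) » lem _ (k μ & ⟪ χ , ψ ⟫) _
  where
  opaque
   unfolding _#_
   lem : ∀ a b c -> a # ~ b # ~ c == a # ~ (b # c)
   lem = slv ℚ-ri

 re-⊥ : ∀ {k φ xs} -> Or xs -> Co k φ xs -> All (\ (_ , χ) -> ⟪ resi k φ xs , χ ⟫ == 0q) xs
 re-⊥ {k} {φ} {[]} _ _ = []
 re-⊥ {k} {φ} {(μ , χ) ∷ xs} record { norms = n ∷ ns;orth = o ∷ os } (c ∷ cs) =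
  trans (re-pa k φ' xs χ) (ap2 (\ x y -> x # ~ y) (⟪⟫-re φ (k μ) χ χ » ap2 (\ x y -> x # ~ (k μ & y)) c n » lem order (k μ)) (va o) » lem0)
  ∷ re-⊥ (record { norms = ns;orth = os }) (ne-co o cs)
  where
  φ' = \ g -> φ g # ~ (k μ & χ g)
  va : ∀ {xs} -> All (Ort (μ , χ)) xs -> ∑ xs (\ (ν , ψ) -> k ν & ⟪ ψ , χ ⟫) == 0q
  va [] = rfl
  va {(ν , ψ) ∷ xs} (o ∷ os) = ap2 _#_ (cg (k ν &_) (⟪⟫-comm ψ χ » o) » &-zeroʳ _) (va os) » #-idˡ _
  opaque
   unfolding _#_
   lem : ∀ o k -> o & k # ~ (k & o) == 0q
   lem = slv ℚ-ri
   lem0 : 0q # ~ 0q == 0q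
   lem0 = rfl

 IP : Sh -> Set
 IP μ = De (ℕs μ) × « ℕs μ ¦ == n

 iP? : ∀ μ -> Dec (IP μ)
 iP? μ = de? (ℕs μ) ×-dec « ℕs μ ¦ ≟ℕ n

 opaque
  unfolding Ʃ

  par : List Sh
  par = filter iP? (ve (allFin (suc n)) (suc n))

  pa-le : AllPairs Lex par
  pa-le = APP.filter⁺ iP? (ve-le (suc n))

  pa-IP : All IP par
  pa-IP = all-filter iP? (ve (allFin (suc n)) (suc n))
   where open import Data.List.Relation.Unary.All.Properties using (all-filter)

  Ʃ-pa : (f : Sh -> ℚ) -> (∀ μ -> ¬ IP μ -> f μ == 0q) -> Ʃ f == ∑ par f
  Ʃ-pa f z = sym (∑-fil iP? (ve (allFin (suc n)) (suc n)) f »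
   ∑-co (ve (allFin (suc n)) (suc n)) (\ μ -> δ-* (iP? μ) (\ _ -> rfl) (z μ)))

 KR-no-pa : ∀ {N} μ (α : Vec ℕ N) -> « α ¦ == n -> ¬ IP μ -> KR (ℕs μ) α == 0q
 KR-no-pa μ α e np with de? (ℕs μ) | « ℕs μ ¦ ≟ℕ n
 ... | no nd | _ = KR-de (ℕs μ) α nd
 ... | yes d | no ns = KR-si (ℕs μ) α (\ f -> ns (f » e))
 ... | yes d | yes s = absurd (d , s) np

 rs-pa : ∀ {K L} (α : Vec ℕ K) (β : Vec ℕ L) -> « α ¦ == n -> ∑ par (\ μ -> KR (ℕs μ) α & KR (ℕs μ) β) == mat α β
 rs-pa α β e = sym (Ʃ-pa _ (\ μ np -> cg (_& KR (ℕs μ) β) (KR-no-pa μ α e np) » &-zeroˡ _)) »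
  rsk (n<1+n n) α β (≤r e)

 lab : List La -> List Sh
 lab = mapL fst

 -- The data for a final segment of the lexicographically increasing list of partitions. The values
 -- `pairs` on all permutation characters are carried along because they supply the coefficients for
 -- the next subtraction.
 record Ir (ps : List Sh) : Set₁ where
  field
   chars : List La
   labe : lab chars == ps
   reps : All (\ (_ , χ) -> Rep χ) chars
   nor : Or chars
   pairs : ∀ {K} (α : Vec ℕ K) -> « α ¦ == n -> All (\ (μ , χ) -> ⟪ χ , M α ⟫ == order & KR (ℕs μ) α) chars

 -- By unitriangularity the permutation character of content ν consists of the new character once
 -- and of Kostka multiples of characters of larger partitions. These exist already, and `split`
 -- keeps the residue a representation. The argument `pre` holds the smaller partitions, needed to
 -- see that they contribute nothing.
 bu : ∀ pre ps -> pre ++ ps == par -> Ir ps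
 bu pre [] _ = record { chars = [];labe = rfl;reps = [];nor = record { norms = [];orth = [] };pairs = \ _ _ -> [] }
 bu pre (ν ∷ ps) eq = record
  { chars = (ν , χ) ∷ chars
  ;labe = cg (ν ∷_) labe
  ;reps = res-rep (M-re ν̂) reps nor coefs ∷ reps
  ;nor = record { norms = norm ∷ Or.norms nor;orth = or' ∷ Or.orth nor }
  ;pairs = \ α e -> pair α e ∷ pairs α e }
  where
  open Ir (bu (pre ++ ν ∷ []) ps (++-assoc pre (ν ∷ []) ps » eq))
  ν̂ = reverseᵥ (ℕs ν)
  open import Data.List.Relation.Unary.All.Properties using (++⁻ʳ;++⁻ˡ)
  ν-pa : IP ν
  ν-pa = All.head (++⁻ʳ pre (subst (All IP) (sym eq) pa-IP))
  ν̂-si : « ν̂ ¦ == n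
  ν̂-si = «reverse¦ (ℕs ν) » snd ν-pa
  k : Sh -> ℚ
  k μ = KR (ℕs μ) ν̂
  coefs : Co k (M ν̂) chars
  coefs = All.map (\ {x} p -> ⟪⟫-comm (M ν̂) (snd x) » p) (pairs ν̂ ν̂-si)
  χ = resi k (M ν̂) chars
  or' : All (Ort (ν , χ)) chars
  or' = re-⊥ nor coefs
  bef : ∀ pre -> pre ++ ν ∷ ps == par -> All (\ μ -> Lex μ ν × De (ℕs μ)) pre
  bef pre eq = zA (go pre (subst (AllPairs Lex) (sym eq) pa-le)) (All.map fst (++⁻ˡ pre (subst (All IP) (sym eq) pa-IP)))
   where
   zA : ∀ {xs} {P Q : Sh -> Set} -> All P xs -> All Q xs -> All (\ x -> P x × Q x) xs
   zA [] [] = []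
   zA (p ∷ ps) (q ∷ qs) = (p , q) ∷ zA ps qs
   go : ∀ pre -> AllPairs Lex (pre ++ ν ∷ ps) -> All (\ μ -> Lex μ ν) pre
   go [] _ = []
   go (x ∷ pre) (p ∷ ap) = All.head (++⁻ʳ pre p) ∷ go pre ap
  ∑-la : ∀ xs (f : Sh -> ℚ) -> ∑ xs (\ (μ , _) -> f μ) == ∑ (lab xs) f
  ∑-la xs f = sym (∑-ma fst xs f)
  -- Only ν and the shapes after it contribute to the RSK sum.
  ma-sp : ∀ {K} (α : Vec ℕ K) -> mat ν̂ α == KR (ℕs ν) α # ∑ chars (\ (μ , _) -> k μ & KR (ℕs μ) α)
  ma-sp α = begin
   mat ν̂ α
    ≡⟨ rs-pa ν̂ α ν̂-si ⟨
   ∑ par F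
    ≡⟨ cg (\ xs -> ∑ xs F) eq ⟨
   ∑ (pre ++ ν ∷ ps) F
    ≡⟨ trans (∑-++ pre (ν ∷ ps) F) (cg (_# (F ν # ∑ ps F)) (∑-zero∈ pre (\ m ->
     let l , d = All.lookup (bef pre eq) m in trans (cg (_& _) (KR-le _ ν d l)) (&-zeroˡ _)))) ⟩
   0q # (F ν # ∑ ps F)
    ≡⟨ trans (#-idˡ _) (ap2 _#_ (cg (_& KR (ℕs ν) α) (KR-di ν (fst ν-pa)) » &-idˡ _)
     (cg (\ xs -> ∑ xs F) (sym labe) » sym (∑-la chars F))) ⟩
   KR (ℕs ν) α # ∑ chars (\ (μ , _) -> F μ) ∎
   where
   F : Sh -> ℚ
   F μ = k μ & KR (ℕs μ) α
  pair : ∀ {K} (α : Vec ℕ K) -> « α ¦ == n -> ⟪ χ , M α ⟫ == order & KR (ℕs ν) α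
  pair α e = begin
   ⟪ χ , M α ⟫
    ≡⟨ re-pa k (M ν̂) chars (M α) ⟩
   ⟪ M ν̂ , M α ⟫ # ~ ∑ chars (\ (μ , χ) -> k μ & ⟪ χ , M α ⟫)
    ≡⟨ ap2 (\ x y -> x # ~ y) (M-gr ν̂ α ν̂-si » cg (order &_) (ma-sp α))
     (∑-cong∈ chars (\ {x} m -> cg (k (fst x) &_) (All.lookup (pairs α e) m) » &-sw _ _ _) » ∑-*ˡ chars order _) ⟩
   order & (KR (ℕs ν) α # S) # ~ (order & S)
    ≡⟨ lem order (KR (ℕs ν) α) S ⟩
   order & KR (ℕs ν) α ∎
   where
   S = ∑ chars (\ (μ , _) -> k μ & KR (ℕs μ) α)
   opaque
    unfolding _#_
    lem : ∀ o x s -> o & (x # s) # ~ (o & s) == o & x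
    lem = slv ℚ-ri
  norm : ⟪ χ , χ ⟫ == order
  norm = begin
   ⟪ χ , χ ⟫
    ≡⟨ re-pa k (M ν̂) chars χ ⟩
   ⟪ M ν̂ , χ ⟫ # ~ ∑ chars (\ (μ , ψ) -> k μ & ⟪ ψ , χ ⟫)
    ≡⟨ ap2 (\ x y -> x # ~ y) (⟪⟫-comm (M ν̂) χ » pair ν̂ ν̂-si)
     (∑-zero∈ chars (\ {x} m -> cg (k (fst x) &_) (⟪⟫-comm (snd x) χ » All.lookup or' m) » &-zeroʳ _)) ⟩
   order & KR (ℕs ν) ν̂ # ~ 0q
    ≡⟨ cg (\ x -> order & x # ~ 0q) (KR-di ν (fst ν-pa)) ⟩
   order & 1q # ~ 0q
    ≡⟨ lem order ⟩
   order ∎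
   where
   opaque
    unfolding _#_
    lem : ∀ o -> o & 1q # ~ 0q == o
    lem = slv ℚ-ri

 ir : Ir par
 ir = bu [] par rfl

 open Ir ir public

 -- RSK says that the norm of `M α` is the sum of the squares of its coefficients; the residue left
 -- by the known characters therefore has norm zero.
 young : ∀ {K} (α : Vec ℕ K) -> « α ¦ == n -> ∀ g -> M α g == ∑ chars (\ (μ , χ) -> KR (ℕs μ) α & χ g)
 young α e g = ⊝≡0 _ _ (sym (re-va k (M α) chars g) » sq≡0 _ (Ʃ-ze (\ g -> sq-≥0 (D g)) no-0 g))
  where
  k : Sh -> ℚ
  k μ = KR (ℕs μ) α
  D = resi k (M α) chars
  coefs : Co k (M α) chars
  coefs = All.map (\ {x} p -> ⟪⟫-comm (M α) (snd x) » p) (pairs α e)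
  opaque
   unfolding _#_
   lem : ∀ x -> x # ~ x == 0q
   lem = slv ℚ-ri
   lem0 : ∀ x -> x # ~ 0q == x
   lem0 = slv ℚ-ri
  no-0 : ⟪ D , D ⟫ == 0q
  no-0 = begin
   ⟪ D , D ⟫
    ≡⟨ re-pa k (M α) chars D ⟩
   ⟪ M α , D ⟫ # ~ ∑ chars (\ (μ , χ) -> k μ & ⟪ χ , D ⟫)
    ≡⟨ cg (\ y -> ⟪ M α , D ⟫ # ~ y) (∑-zero∈ chars (\ {x} m -> cg (k (fst x) &_)
     (⟪⟫-comm (snd x) D » All.lookup (re-⊥ nor coefs) m) » &-zeroʳ _)) ⟩
   ⟪ M α , D ⟫ # ~ 0q
    ≡⟨ trans (lem0 _) (⟪⟫-comm (M α) D » re-pa k (M α) chars (M α)) ⟩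
   ⟪ M α , M α ⟫ # ~ ∑ chars (\ (μ , χ) -> k μ & ⟪ χ , M α ⟫)
    ≡⟨ ap2 (\ x y -> x # ~ y) (M-gr α α e)
     (∑-cong∈ chars (\ {x} m -> cg (k (fst x) &_) (All.lookup (pairs α e) m) » &-sw _ _ _) »
     ∑-*ˡ chars order _ » cg (order &_) (sym (∑-ma fst chars (\ μ -> k μ & k μ)) »
      cg (\ xs -> ∑ xs (\ μ -> k μ & k μ)) labe » rs-pa α α e)) ⟩
   order & mat α α # ~ (order & mat α α)
    ≡⟨ lem _ ⟩
   0q ∎

-- Cycles, rotations and itineraries.

open import Data.Nat.Divisibility using (_∣_;divides;∣-trans;m≤n⇒m!∣n!;∣n⇒∣m*n;m∣m*n;∣⇒≤;_∣?_;∣-refl;∣m∣n⇒∣m+n;∣m+n∣m⇒∣n)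
open import Data.Nat.DivMod using (_/_;_%_;m≡m%n+[m/n]*n;m%n<n;m/n*n≡m)
open import Data.Nat using (_!)
import Data.Fin as F

-- Congruence of natural numbers, free of subtraction.
infix 4 _≈[_]_
record _≈[_]_ (a L b : ℕ) : Set where
 constructor co-by
 field
  {u v} : ℕ
  eqn : a + u * L == b + v * L

≈-ref : ∀ {L a} -> a ≈[ L ] a
≈-ref = co-by {u = 0} {v = 0} rfl

≈-re : ∀ {L a b} -> a == b -> a ≈[ L ] b
≈-re rfl = ≈-ref

≈-sy : ∀ {L a b} -> a ≈[ L ] b -> b ≈[ L ] a
≈-sy (co-by {u} {v} e) = co-by {u = v} {v = u} (sym e)

≈-tr : ∀ {L a b c} -> a ≈[ L ] b -> b ≈[ L ] c -> a ≈[ L ] c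
≈-tr {L} {a} {b} {c} (co-by {u} {v} e) (co-by {u'} {v'} e') = co-by {u = u + u'} {v = v + v'} $
 trans (lem a u u' L) (cg (_+ u' * L) e » le' b v u' L » cg (_+ v * L) e' » sym (lem″ c v v' L))
 where
 lem : ∀ a u w L -> a + (u + w) * L == (a + u * L) + w * L
 lem = ℕ-ring
 le' : ∀ b v w L -> b + v * L + w * L == b + w * L + v * L
 le' = ℕ-ring
 lem″ : ∀ c v w L -> c + (v + w) * L == c + w * L + v * L
 lem″ = ℕ-ring

≈-+ : ∀ {L a b c d} -> a ≈[ L ] b -> c ≈[ L ] d -> a + c ≈[ L ] b + d
≈-+ {L} {a} {b} {c} {d} (co-by {u} {v} e) (co-by {u'} {v'} e') = co-by {u = u + u'} {v = v + v'} $
 trans (lem a c u u' L) (ap2 _+_ e e' » sym (lem b d v v' L))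
 where
 lem : ∀ a c u w L -> a + c + (u + w) * L == (a + u * L) + (c + w * L)
 lem = ℕ-ring

≈-cancelʳ : ∀ {L a b} c -> a + c ≈[ L ] b + c -> a ≈[ L ] b
≈-cancelʳ {L} {a} {b} c (co-by {u} {v} e) = co-by {u = u} {v = v} $ +-cancelʳ-≡ c _ _ (lem a u L c » e » sym (lem b v L c))
 where
 lem : ∀ a u L c -> a + u * L + c == a + c + u * L
 lem = ℕ-ring

≈-sc : ∀ {ℓ a b} c -> a ≈[ ℓ ] b -> c * a ≈[ c * ℓ ] c * b
≈-sc {ℓ} {a} {b} c (co-by {u} {v} e) = co-by {u = u} {v = v} $ trans (lem c a u ℓ) (cg (c *_) e » sym (lem c b v ℓ))
 where
 lem : ∀ c a u l -> c * a + u * (c * l) == c * (a + u * l)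
 lem = ℕ-ring

lea : {P : ℕ -> Set} -> (∀ m -> Dec (P m)) -> ∀ b -> P b -> ∃ \ m -> m ≤ b × P m × (∀ k -> k < m -> ¬ P k)
lea P? zr p = 0 , z≤n , p , \ _ ()
lea P? (suc b) p with P? 0
... | yes q = 0 , z≤n , q , \ _ ()
... | no ¬q = let m , l , q , min = lea (P? ∘ suc) b p in
 suc m , s≤s l , q , \ { zr _ -> ¬q;(suc k) (s≤s l) -> min k l }

lF : ∀ {n} {P : Fin n -> Set} -> (∀ i -> Dec (P i)) -> ∃ P -> ∃ \ i -> P i × (∀ j -> P j -> tn i ≤ tn j)
lF {suc n} {P} P? (i , p) with P? zr
... | yes q = zr , q , \ _ _ -> z≤n
lF {suc n} {P} P? (zr , p) | no ¬q = absurd p ¬q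
lF {suc n} {P} P? (suc i , p) | no ¬q = let j , q , min = lF (P? ∘ suc) (i , p) in
 suc j , q , \ { zr r -> absurd r ¬q;(suc k) r -> s≤s (min k r) }

n∣n! : ∀ k n -> suc k ≤ n -> suc k ∣ n !
n∣n! k n p = ∣-trans (m∣m*n (k !)) (m≤n⇒m!∣n! p)

module _ {n : ℕ} (π : Pe n) where

 it : ℕ -> Fin n -> Fin n
 it zr x = x
 it (suc m) x = π · it m x

 it-+ : ∀ a b x -> it (a + b) x == it a (it b x)
 it-+ zr b x = rfl
 it-+ (suc a) b x = cg (π ·_) (it-+ a b x)

 ite-com : ∀ a b x -> it a (it b x) == it b (it a x)
 ite-com a b x = sym (it-+ a b x) » cg (\ m -> it m x) (+-comm a b) » it-+ b a x

 it-su : ∀ m x -> it m (π · x) == it (suc m) x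
 it-su m x = ite-com m 1 x

 ite-inj : ∀ m {x y} -> it m x == it m y -> x == y
 ite-inj zr e = e
 ite-inj (suc m) e = ite-inj m (·-in π e)

 it-* : ∀ q {m x} -> it m x == x -> it (q * m) x == x
 it-* zr e = rfl
 it-* (suc q) {m} {x} e = it-+ m (q * m) x » cg (it m) (it-* q e) » e

 ret : ∀ x -> ∃ \ k -> suc k ≤ n × it (suc k) x == x
 ret x with FinP.pigeonhole (n<1+n n) (\ (i : Fin (suc n)) -> it (tn i) x)
 ... | i , j , i<j , e with tn j ∸ tn i in d
 ... | zr = absurd (≤t (≤r (sym (m+[n∸m]≡n (<⇒≤ i<j)))) (≤r (cg (tn i +_) d » +-idr _))) (<⇒≱ i<j)
 ... | suc k = k , ≤t (≤t (≤r (sym d)) (m∸n≤m (tn j) (tn i))) (≤-pred (toℕ<n j)) ,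
  ite-inj (tn i) (sym (it-+ (tn i) (suc k) x) » cg (\ m -> it m x)
   (cg (tn i +_) (sym d) » m+[n∸m]≡n (<⇒≤ i<j)) » sym e)

 opaque
  fir : ∀ x -> ∃ \ m -> m ≤ fst (ret x) × it (suc m) x == x × (∀ k -> k < m -> it (suc k) x ≢ x)
  fir x = lea (\ m -> it (suc m) x ≟F x) (fst (ret x)) (snd (snd (ret x)))

 le-1 : Fin n -> ℕ
 le-1 x = fst (fir x)

 len : Fin n -> ℕ
 len x = suc (le-1 x)

 len≤n : ∀ x -> len x ≤ n
 len≤n x = ≤t (s≤s (fst (snd (fir x)))) (fst (snd (ret x)))

 it-le : ∀ x -> it (len x) x == x
 it-le x = fst (snd (snd (fir x)))

 le-mi : ∀ x k -> suc k < len x -> it (suc k) x ≢ x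
 le-mi x k (s≤s p) = snd (snd (snd (fir x))) k p

 len∣ : ∀ m x -> it m x == x -> len x ∣ m
 len∣ m x e with m % len x in r
 ... | zr = divides (m / len x) (m≡m%n+[m/n]*n m (len x) » cg (_+ m / len x * len x) r)
 ... | suc k = absurd ba (le-mi x k (≤t (s≤s (≤r (sym r))) (m%n<n m (len x))))
  where
  ba : it (suc k) x == x
  ba = cg (it (suc k)) (sym (it-* (m / len x) (it-le x))) » sym (it-+ (suc k) (m / len x * len x) x) »
   cg (\ z -> it z x) (sym (m≡m%n+[m/n]*n m (len x) » cg (_+ m / len x * len x) r)) » e

 ∣len : ∀ m x -> len x ∣ m -> it m x == x
 ∣len m x (divides q e) = cg (\ z -> it z x) e » it-* q (it-le x)

 it-! : ∀ x -> it (n !) x == x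
 it-! x = ∣len (n !) x (n∣n! (le-1 x) n (len≤n x))

 it-≈ : ∀ a b x -> it a x == it b x -> a ≈[ len x ] b
 it-≈ a b x e with ≤-total a b
 ... | inl p with len∣ (b ∸ a) x (ite-inj a (sym (it-+ a (b ∸ a) x) » cg (\ z -> it z x) (m+[n∸m]≡n p) » sym e))
 ... | divides q f = co-by {u = q} {v = 0} $ trans (cg (a +_) (sym f) » m+[n∸m]≡n p) (sym (+-idr b))
 it-≈ a b x e | inr p with len∣ (a ∸ b) x (ite-inj b (sym (it-+ b (a ∸ b) x) » cg (\ z -> it z x) (m+[n∸m]≡n p) » e))
 ... | divides q f = co-by {u = 0} {v = q} $ sym (cg (b +_) (sym f) » m+[n∸m]≡n p » sym (+-idr a))

 le-it : ∀ m x -> len (it m x) == len x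
 le-it m x = ∣-antisym (len∣ (len x) (it m x) (ite-com (len x) m x » cg (it m) (it-le x)))
  (len∣ (len (it m x)) x (ite-inj m (ite-com m (len (it m x)) x » it-le (it m x))))
  where open import Data.Nat.Divisibility using (∣-antisym)

 infix 4 _⇝_
 _⇝_ : Fin n -> Fin n -> Set
 x ⇝ y = ∃ \ (m : Fin n) -> it (tn m) x == y

 _⇝?_ : ∀ x y -> Dec (x ⇝ y)
 x ⇝? y = any? (\ m -> it (tn m) x ≟F y)

 it-% : ∀ m x -> it (m % len x) x == it m x
 it-% m x = cg (it (m % len x)) (sym (it-* (m / len x) (it-le x))) »
  sym (it-+ (m % len x) (m / len x * len x) x) » cg (\ z -> it z x) (sym (m≡m%n+[m/n]*n m (len x)))

 ⇝-in : ∀ m x -> x ⇝ it m x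
 ⇝-in m x = fromℕ< p , trans (cg (\ z -> it z x) (tn-fr p)) (it-% m x)
  where p = ≤t (m%n<n m (len x)) (len≤n x)

 ⇝-in' : ∀ m {x y} -> it m x == y -> x ⇝ y
 ⇝-in' m {x} rfl = ⇝-in m x

 ⇝-re : ∀ x -> x ⇝ x
 ⇝-re x = ⇝-in 0 x

 ⇝-tr : ∀ {x y z} -> x ⇝ y -> y ⇝ z -> x ⇝ z
 ⇝-tr {x} (a , rfl) (b , rfl) = ⇝-in' (tn b + tn a) (it-+ (tn b) (tn a) x)

 ⇝-sy : ∀ {x y} -> x ⇝ y -> y ⇝ x
 -- Adding len x · m - m further steps to the m steps already made completes m full turns.
 ⇝-sy {x} (m , rfl) = ⇝-in' (len x * tn m ∸ tn m) (sym (it-+ (len x * tn m ∸ tn m) (tn m) x) »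
  cg (\ z -> it z x) (m∸n+n≡m (m≤m+n (tn m) _)) » ∣len (len x * tn m) x (m∣m*n (tn m)))

 ⇝-le : ∀ {x y} -> x ⇝ y -> len y == len x
 ⇝-le {x} (m , rfl) = le-it (tn m) x

 opaque
  rootΣ : ∀ x -> ∃ \ r -> r ⇝ x × (∀ j -> j ⇝ x -> tn r ≤ tn j)
  rootΣ x = lF (_⇝? x) (x , ⇝-re x)

 roo : Fin n -> Fin n
 roo x = fst (rootΣ x)

 root⇝ : ∀ x -> roo x ⇝ x
 root⇝ x = fst (snd (rootΣ x))

 ro-co : ∀ {x y} -> x ⇝ y -> roo x == roo y
 ro-co {x} {y} p = tn-inj (≤-antisym
  (snd (snd (rootΣ x)) (roo y) (⇝-tr (root⇝ y) (⇝-sy p)))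
  (snd (snd (rootΣ y)) (roo x) (⇝-tr (root⇝ x) p)))

 ro-ro : ∀ x -> roo (roo x) == roo x
 ro-ro x = ro-co (root⇝ x)

 root≡⇒⇝ : ∀ {x y} -> roo x == roo y -> x ⇝ y
 root≡⇒⇝ {x} {y} e = ⇝-tr (⇝-sy (root⇝ x)) (subst (_⇝ y) (sym e) (root⇝ y))

 iR? : ∀ x -> Dec (roo x == x)
 iR? x = roo x ≟F x

 opaque
  -- One step on a cycle of length ℓ is measured as n!/ℓ modulo n!. Rotations of cycles of different
  -- lengths can then be added in a single cyclic group.
  we : Fin n -> ℕ
  we x = n ! / len x

  weight*len : ∀ x -> we x * len x == n !
  weight*len x = m/n*n≡m (n∣n! (le-1 x) n (len≤n x))

  we-⇝ : ∀ {x y} -> x ⇝ y -> we y == we x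
  we-⇝ {x} {y} p = cg (\ ℓ -> (n !) / suc ℓ) (suc-injective (⇝-le p))

 dist : ∀ {c x} -> c ⇝ x -> ℕ
 dist {c} {x} (m , _) = we c * tn m

 di-≈ : ∀ {c x} (p : c ⇝ x) m -> it m c == x -> dist p ≈[ n ! ] we c * m
 di-≈ {c} {x} (k , e) m f = subst (\ L -> we c * tn k ≈[ L ] we c * m) (weight*len c)
  (≈-sc (we c) (it-≈ (tn k) m c (e » sym f)))

 -- The angle of a point, measured from the least point of its cycle.
 ph : Fin n -> ℕ
 ph x = dist (root⇝ x)

 ph-≈ : ∀ x m r -> roo x == r -> it m r == x -> ph x ≈[ n ! ] we x * m
 ph-≈ x m _ rfl e = subst (\ w -> ph x ≈[ n ! ] w * m) (sym (we-⇝ (root⇝ x))) (di-≈ (root⇝ x) m e)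

module _ {n : ℕ} where

 co : Pe n -> Pe n -> Pe n
 co g π = g ∙ₚ π ∙ₚ invₚ g

 con-· : ∀ g π x -> co g π · (g · x) == g · (π · x)
 con-· g π x = ∙-· (g ∙ₚ π) (invₚ g) (g · x) » cg ((g ∙ₚ π) ·_) (in-· g _ » ·⁻· g x) » ∙-· g π x

 co-it : ∀ g π m x -> it (co g π) m (g · x) == g · it π m x
 co-it g π zr x = rfl
 co-it g π (suc m) x = cg (co g π ·_) (co-it g π m x) » con-· g π _

 open FG (Sym {n}) using () renaming (assoc to ∙-assoc;inv-∙ to inv-∙ₚ;idˡ to ∙-idˡ;idʳ to ∙-idʳ;invʳ to ∙-invʳ;invˡ to ∙-invˡ;cancelʳ-inv to ∙-cancelʳ;cancelʳ-inv′ to ∙-cancelʳ′) public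

 co-∙ : ∀ h g π -> co (h ∙ₚ g) π == co h (co g π)
 co-∙ h g π = cg (h ∙ₚ g ∙ₚ π ∙ₚ_) (inv-∙ₚ h g) » sym (∙-assoc _ _ _) »
  cg (_∙ₚ invₚ h) (cg (_∙ₚ invₚ g) (∙-assoc h g π) » ∙-assoc h (g ∙ₚ π) (invₚ g))

 co-fi : ∀ g π -> g ∙ₚ π == π ∙ₚ g -> co g π == π
 co-fi g π e = cg (_∙ₚ invₚ g) e » ∙-cancelʳ g π

 fi-co : ∀ g π -> co g π == π -> g ∙ₚ π == π ∙ₚ g
 fi-co g π e = sym (∙-cancelʳ′ g (g ∙ₚ π)) » cg (_∙ₚ g) e

 con-len : ∀ g π x -> len (co g π) (g · x) == len π x
 con-len g π x = ∣-antisym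
  (len∣ (co g π) (len π x) (g · x) (co-it g π (len π x) x » cg (g ·_) (it-le π x)))
  (len∣ π (len (co g π) (g · x)) x (·-in g (sym (co-it g π (len (co g π) (g · x)) x) » it-le (co g π) (g · x))))
  where open import Data.Nat.Divisibility using (∣-antisym)

 co-⇝ : ∀ g π {x y} -> _⇝_ π x y -> _⇝_ (co g π) (g · x) (g · y)
 co-⇝ g π {x} (m , rfl) = ⇝-in' (co g π) (tn m) (co-it g π (tn m) x)

 co-⇝⁻ : ∀ g π {x y} -> _⇝_ (co g π) (g · x) (g · y) -> _⇝_ π x y
 co-⇝⁻ g π {x} (m , e) = ⇝-in' π (tn m) (·-in g (sym (co-it g π (tn m) x) » e))

 opaque
  unfolding we

  co-we : ∀ g π x -> we (co g π) (g · x) == we π x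
  co-we g π x = cg (\ ℓ -> (n !) / suc ℓ) (suc-injective (con-len g π x))

 co-in : ∀ g (π : Pe n) -> co (invₚ g) (co g π) == π
 co-in g π = sym (co-∙ (invₚ g) g π) » cg (\ h -> co h π) (∙-invˡ g) »
  co-fi idₚ π (∙-idˡ π » sym (∙-idʳ π))

 co-in⁻ : ∀ g (π : Pe n) -> co g (co (invₚ g) π) == π
 co-in⁻ g π = sym (co-∙ g (invₚ g) π) » cg (\ h -> co h π) (∙-invʳ g) »
  co-fi idₚ π (∙-idˡ π » sym (∙-idʳ π))

open import Data.Nat.Primality using (Prime;prime?;euclidsLemma;prime⇒nonTrivial;prime⇒nonZero;prime⇒irreducible)
open import Data.Nat.Properties using (*-cancelʳ-≡;*-cancelˡ-≡;_!≢0)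
open import Data.Nat.Divisibility using (*-cancelˡ-∣;∣1⇒≡1)
open import Data.List using (upTo)

wh : {P : Set} -> Dec P -> ℕ -> ℕ
wh (yes _) a = a
wh (no _) a = 0

ι-wh : {P : Set} (p : Dec P) (a : ℕ) -> ι (wh p a) == δ p & ι a
ι-wh (yes p) a = sym (cg (_& ι a) (δ-ye (yes p) p) » &-idˡ _)
ι-wh (no ¬p) a = sym (cg (_& ι a) (δ-no (no ¬p) ¬p) » &-zeroˡ _)

opaque
 sF : ∀ {n} -> (Fin n -> ℕ) -> ℕ
 sF f = « tab f ¦

 ι-sF : ∀ {n} (f : Fin n -> ℕ) -> ι (sF f) == Ʃ (ι ∘ f)
 ι-sF f = «¦-Ʃ (tab f) » Ʃ-co (\ i -> cg ι (lk-tab f i))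

 sF-co : ∀ {n} {f g : Fin n -> ℕ} -> (∀ i -> f i == g i) -> sF f == sF g
 sF-co p = cg «_¦ (tabulate-cong p)

 sF-≈ : ∀ {L n} {f g : Fin n -> ℕ} -> (∀ i -> f i ≈[ L ] g i) -> sF f ≈[ L ] sF g
 sF-≈ {n = zr} p = ≈-ref
 sF-≈ {n = suc n} p = ≈-+ (p zr) (sF-≈ (p ∘ suc))

 sF-+ : ∀ {n} (f g : Fin n -> ℕ) -> sF (\ i -> f i + g i) == sF f + sF g
 sF-+ {zr} f g = rfl
 sF-+ {suc n} f g = cg (f zr + g zr +_) (sF-+ (f ∘ suc) (g ∘ suc)) » lem (f zr) (g zr) _ _
  where
  lem : ∀ a b c d -> a + b + (c + d) == a + c + (b + d)
  lem = ℕ-ring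

module _ {n : ℕ} where

 roots : Pe n -> (Fin n -> ℕ) -> ℕ
 roots π f = sF (\ x -> wh (iR? π x) (f x))

 ro-≈ : ∀ {L} π {f g} -> (∀ x -> roo π x == x -> f x ≈[ L ] g x) -> roots π f ≈[ L ] roots π g
 ro-≈ π {f} {g} p = sF-≈ (\ x -> go x (iR? π x))
  where
  go : ∀ x (d : Dec (roo π x == x)) -> wh d (f x) ≈[ _ ] wh d (g x)
  go x (yes r) = p x r
  go x (no _) = ≈-ref

 ro-+ : ∀ π f g -> roots π (\ x -> f x + g x) == roots π f + roots π g
 ro-+ π f g = sF-co (\ x -> go x (iR? π x)) » sF-+ _ _
  where
  go : ∀ x (d : Dec (roo π x == x)) -> wh d (f x + g x) == wh d (f x) + wh d (g x)
  go x (yes _) = rfl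
  go x (no _) = rfl

 roo-con : ∀ g π b -> roots π (\ x -> b (roo (co g π) (g · x))) == roots (co g π) b
 roo-con g π b = ι-in (ι-sF _ » Ʃ-co (\ x -> ι-wh (iR? π x) _) »
  Ʃ-re (iR? π) (iR? π') (\ x -> roo π' (g · x)) (\ z -> roo π (g ·⁻ z))
   (\ x _ -> ro-ro π' (g · x)) (\ z _ -> ro-ro π (g ·⁻ z)) fwd bwd (ι ∘ b) »
  sym (ι-sF _ » Ʃ-co (\ x -> ι-wh (iR? π' x) _)))
  where
  π' : Pe n
  π' = co g π
  fwd : ∀ x -> roo π x == x -> roo π (g ·⁻ roo π' (g · x)) == x
  fwd x r = ro-co π (co-⇝⁻ g π (subst (\ z -> _⇝_ π' z (g · x)) (sym (··⁻ g _)) (root⇝ π' (g · x)))) » r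
  bwd : ∀ z -> roo π' z == z -> roo π' (g · roo π (g ·⁻ z)) == z
  bwd z r = ro-co π' (subst (_⇝_ π' (g · roo π (g ·⁻ z))) (··⁻ g z) (co-⇝ g π (root⇝ π (g ·⁻ z)))) » r

 -- The total rotation of g, seen as a map from the cycles of π to those of its conjugate.
 ro : Pe n -> Pe n -> ℕ
 ro π g = roots π (\ x -> ph (co g π) (g · x))

 ph-co : ∀ h π y -> ph (co h π) (h · y) ≈[ n ! ] ph π y + ph (co h π) (h · roo π y)
 ph-co h π y = ≈-tr (ph-≈ π″ (h · y) (m + k) s e₁ e₂)
  (≈-re (*-distribˡ-+ (we π″ (h · y)) m k » ap2 _+_
   (cg (_* m) (co-we h π y » we-⇝ π (root⇝ π y)))
   (cg (_* k) (co-we h π y » we-⇝ π (root⇝ π y) » sym (co-we h π (roo π y)) »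
    we-⇝ π″ (root⇝ π″ (h · roo π y))))))
  where
  π″ : Pe n
  π″ = co h π
  s : Fin n
  s = roo π″ (h · roo π y)
  m = tn (fst (root⇝ π y))
  k = tn (fst (root⇝ π″ (h · roo π y)))
  e₁ : roo π″ (h · y) == s
  e₁ = sym (ro-co π″ (co-⇝ h π (root⇝ π y)))
  e₂ : it π″ (m + k) s == h · y
  e₂ = it-+ π″ m k s » cg (it π″ m) (snd (root⇝ π″ (h · roo π y))) »
   co-it h π m (roo π y) » cg (h ·_) (snd (root⇝ π y))

 -- A cocycle law. The angle of h y is the angle of y plus the angle of the image under h of the
 -- root of y; the second summand depends on the cycle only, so by `roo-con` it may be summed over
 -- the cycles of the conjugate.
 ro-∙ : ∀ π g h -> ro π (h ∙ₚ g) ≈[ n ! ] ro π g + ro (co g π) h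
 ro-∙ π g h = ≈-tr (ro-≈ π (\ x _ -> step x)) (≈-re (ro-+ π (\ x -> ph (co g π) (g · x)) (\ x -> b (roo (co g π) (g · x))) »
  cg (ro π g +_) (roo-con g π b)))
  where
  b : Fin n -> ℕ
  b z = ph (co h (co g π)) (h · z)
  step : ∀ x -> ph (co (h ∙ₚ g) π) ((h ∙ₚ g) · x) ≈[ n ! ]
   ph (co g π) (g · x) + ph (co h (co g π)) (h · roo (co g π) (g · x))
  step x = ≈-tr (≈-re (ap2 (ph {n}) (co-∙ h g π) (∙-· h g x))) (ph-co h (co g π) (g · x))

 -- Here q is another angular coordinate, one that g preserves. It differs from the angle measured
 -- from the root by the coordinate of the root, and since g permutes the cycles these differences
 -- cancel in the sum.
 ro-tr : ∀ π g -> co g π == π -> (q : Fin n -> ℕ) -> (∀ x -> q (π · x) ≈[ n ! ] q x + we π x) ->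
  (∀ x -> q (g · x) ≈[ n ! ] q x) -> ro π g ≈[ n ! ] 0
 ro-tr π g fix q q-π q-g = ≈-sy (≈-cancelʳ (roots π q)
  (≈-tr (ro-≈ π (\ x _ -> ≈-tr (≈-sy (q-g x)) (key x)))
   (≈-re (ro-+ π (\ x -> q (roo (co g π) (g · x))) (\ x -> ph (co g π) (g · x)) »
    +-comm (roots π (\ x -> q (roo (co g π) (g · x)))) (ro π g) » cg (ro π g +_)
    (roo-con g π q » cg (\ ρ -> roots ρ q) fix)))))
  where
  q-it : ∀ m x -> q (it π m x) ≈[ n ! ] q x + we π x * m
  q-it zr x = ≈-re (sym (cg (q x +_) (*-zeroʳ (we π x)) » +-idr _))
  q-it (suc m) x = ≈-tr (q-π _) (≈-tr (≈-+ (q-it m x) (≈-re (we-⇝ π (⇝-in π m x))))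
   (≈-re (lem (q x) (we π x) m)))
   where
   lem : ∀ a w m -> a + w * m + w == a + w * suc m
   lem = ℕ-ring
  key : ∀ x -> q (g · x) ≈[ n ! ] q (roo (co g π) (g · x)) + ph (co g π) (g · x)
  key x rewrite fix = let m , e = root⇝ π (g · x) in
   subst (\ z -> q z ≈[ n ! ] q (roo π (g · x)) + ph π (g · x)) e (q-it (tn m) (roo π (g · x)))

 module _ {Y : Set} ⦃ _ : Fi Y ⦄ (π : Pe n) (D : Vec Y n) where

  -- Agreement of the letters read along the cycles. Since the n!-th power of π is the identity, n!
  -- steps decide it for all times, as `itin` shows.
  record It (y z : Fin n) : Set where
   constructor iti
   field
    ag : ∀ (m : Fin (n !)) -> lk D (it π (tn m) y) == lk D (it π (tn m) z)

  opaque
   it? : ∀ y z -> Dec (It y z)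
   it? y z = map′ iti It.ag (all? (\ m -> eq? (lk D (it π (tn m) y)) (lk D (it π (tn m) z))))

  itin : ∀ {y z} -> It y z -> ∀ m -> lk D (it π m y) == lk D (it π m z)
  itin {y} {z} (iti p) m = subst2 (\ u v -> lk D u == lk D v) (red y) (red z) (subst (\ k -> lk D (it π k y) == lk D (it π k z)) (tn-fr l) (p (fromℕ< l)))
   where
   instance nz = n !≢0
   l : m % (n !) < n !
   l = m%n<n m (n !)
   red : ∀ x -> it π (m % (n !)) x == it π m x
   red x = cg (it π (m % (n !))) (sym (it-* π (m / (n !)) (it-! π x))) »
    sym (it-+ π (m % (n !)) (m / (n !) * (n !)) x) » cg (\ k -> it π k x) (sym (m≡m%n+[m/n]*n m (n !)))

  it-in : ∀ {y z} -> (∀ m -> lk D (it π m y) == lk D (it π m z)) -> It y z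
  it-in p = iti (\ m -> p (tn m))

  it-re : ∀ {y} -> It y y
  it-re = iti (\ _ -> rfl)

  it-sy : ∀ {y z} -> It y z -> It z y
  it-sy (iti p) = iti (\ m -> sym (p m))

  it-tr : ∀ {x y z} -> It x y -> It y z -> It x z
  it-tr (iti p) (iti q) = iti (\ m -> p m » q m)

  it-it : ∀ {y z} k -> It y z -> It (it π k y) (it π k z)
  it-it {y} {z} k p = it-in (\ m -> subst2 (\ u v -> lk D u == lk D v) (it-+ π m k y) (it-+ π m k z) (itin p (m + k)))

  -- Every cycle carries a primitive necklace. Different cycles may carry the same one.
  Pr : Set
  Pr = ∀ y z -> _⇝_ π y z -> It y z -> y == z

  NP : Set
  NP = ∃ \ y -> ∃ \ z -> _⇝_ π y z × It y z × y ≢ z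

  opaque
   pr-or-no : Pr ⊎ NP
   pr-or-no with any? (\ y -> any? (\ z -> (_⇝?_ π y z ×-dec it? y z) ×-dec ¬? (y ≟F z)))
   ... | yes (y , z , (a , b) , c) = inr (y , z , a , b , c)
   ... | no ¬p = inl (\ y z a b -> case (y ≟F z) of \ { (yes e) -> e;(no ne) -> absurd (y , z , (a , b) , ne) ¬p })

   pr? : Dec Pr
   pr? with pr-or-no
   ... | inl p = yes p
   ... | inr (y , z , a , b , ne) = no (\ p -> ne (p y z a b))

  Sta : Pe n -> Set
  Sta g = co g π == π × D ▹ g == D

  opaque
   st? : ∀ g -> Dec (Sta g)
   st? g = eq? (co g π) π ×-dec eq? (D ▹ g) D

  module _ {g} (st : Sta g) where

   sta-ite : ∀ m x -> it π m (g · x) == g · it π m x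
   sta-ite m x = cg (\ ρ -> it ρ m (g · x)) (sym (fst st)) » co-it g π m x

   st-lo : ∀ x -> lk D (g · x) == lk D x
   st-lo x = sym (▹-lo D g x) » cg (\ E -> lk E x) (snd st)

   sta-iti : ∀ x -> It (g · x) x
   sta-iti x = it-in (\ m -> cg (lk D) (sta-ite m x) » st-lo _)

   st-⇝ : ∀ {x y} -> _⇝_ π x y -> _⇝_ π (g · x) (g · y)
   st-⇝ {x} {y} p = subst (\ ρ -> _⇝_ ρ (g · x) (g · y)) (fst st) (co-⇝ g π p)

   st-⇝⁻ : ∀ {x y} -> _⇝_ π (g · x) (g · y) -> _⇝_ π x y
   st-⇝⁻ {x} {y} p = co-⇝⁻ g π (subst (\ ρ -> _⇝_ ρ (g · x) (g · y)) (sym (fst st)) p)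

  -- The representative of a cycle used here depends on its itineraries only.
  module Ca (prim : Pr) where

   Me : Fin n -> Fin n -> Set
   Me x r = ∃ \ y -> _⇝_ π x y × It y r

   opaque
    -- The minimum ranges over points of any cycle whose itinerary occurs on the cycle of x. Cycles
    -- with equal necklaces thus receive the same label, and the base point chosen from it is
    -- respected by permutations that exchange such cycles.
    label : ∀ x -> ∃ \ r -> Me x r × (∀ r' -> Me x r' -> tn r ≤ tn r')
    label x = lF (\ r -> any? (\ y -> _⇝?_ π x y ×-dec it? y r)) (x , x , ⇝-re π x , it-re)

   ca : Fin n -> Fin n
   ca x = fst (fst (snd (label x)))

   ca-⇝ : ∀ x -> _⇝_ π x (ca x)
   ca-⇝ x = fst (snd (fst (snd (label x))))

   ca-un : ∀ x x' y -> (∀ r -> Me x r -> Me x' r) -> (∀ r -> Me x' r -> Me x r) ->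
    _⇝_ π x' y -> It y (ca x) -> ca x' == y
   ca-un x x' y f b p i with label x | label x'
   ... | r , (c , xc , cr) , m | r' , (c' , xc' , cr') , m'
    with tn-inj (≤-antisym (m r' (b r' (c' , xc' , cr'))) (m' r (f r (c , xc , cr))))
   ... | rfl = prim c' y (⇝-tr π (⇝-sy π xc') p) (it-tr cr' (it-sy (it-tr i cr)))

   ca-π : ∀ x -> ca (π · x) == ca x
   ca-π x = ca-un x (π · x) (ca x)
    (\ { r (y , p , i) -> y , ⇝-tr π (⇝-sy π (⇝-in π 1 x)) p , i })
    (\ { r (y , p , i) -> y , ⇝-tr π (⇝-in π 1 x) p , i })
    (⇝-tr π (⇝-sy π (⇝-in π 1 x)) (ca-⇝ x)) it-re

   ca-st : ∀ {g} -> Sta g -> ∀ x -> ca (g · x) == g · ca x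
   ca-st {g} st x = ca-un x (g · x) (g · ca x)
    (\ { r (y , p , i) -> g · y , st-⇝ st p , it-tr (sta-iti st y) i })
    (\ { r (y , p , i) -> g ·⁻ y , st-⇝⁻ st (subst (_⇝_ π (g · x)) (sym (··⁻ g y)) p) ,
     it-tr (it-sy (subst (\ z -> It z (g ·⁻ y)) (··⁻ g y) (sta-iti st (g ·⁻ y)))) i })
    (st-⇝ st (ca-⇝ x)) (sta-iti st (ca x))

   -- Angles measured from the canonical point `ca x` instead of the root form a coordinate that the
   -- stabiliser preserves.
   rot-sta : ∀ {g} -> Sta g -> ro π g ≈[ n ! ] 0
   rot-sta {g} st = ro-tr π g (fst st) q q-π q-g
    where
    from : ∀ x -> _⇝_ π (ca x) x
    from x = ⇝-sy π (ca-⇝ x)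
    q : Fin n -> ℕ
    q x = dist π (from x)
    reac : ∀ x -> it π (tn (fst (from x))) (ca x) == x
    reac x = snd (from x)
    we-ca : ∀ x -> we π (ca x) == we π x
    we-ca x = we-⇝ π (ca-⇝ x)
    q-π : ∀ x -> q (π · x) ≈[ n ! ] q x + we π x
    q-π x = ≈-tr (di-≈ π (from (π · x)) (suc m) (cg (it π (suc m)) (ca-π x) » cg (π ·_) (reac x)))
     (≈-re (cg (_* suc m) (cg (we π) (ca-π x)) » lem (we π (ca x)) m »
      cg (q x +_) (we-ca x)))
     where
     m = tn (fst (from x))
     lem : ∀ w m -> w * suc m == w * m + w
     lem = ℕ-ring
    q-g : ∀ x -> q (g · x) ≈[ n ! ] q x
    q-g x = ≈-tr (di-≈ π (from (g · x)) m (cg (it π m) (ca-st st x) » sta-ite st m (ca x) » cg (g ·_) (reac x)))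
     (≈-re (cg (_* m) (we-ca (g · x) » wg » sym (we-ca x))))
     where
     m = tn (fst (from x))
     wg : we π (g · x) == we π x
     wg = cg (\ ρ -> we ρ (g · x)) (sym (fst st)) » co-we g π x

-- Rotating a periodic cycle.

open import Data.Nat.GCD using (gcd;gcd[m,n]∣m;gcd[m,n]∣n;gcd-GCD;module Bézout)
open import Data.Nat.Primality.Factorisation using (factorise)
open import Data.Nat using (≢-nonZero;≢-nonZero⁻¹)
import Data.Nat.ListAction as LA

pr-di : ∀ q -> q ≢ 0 -> q ≢ 1 -> ∃ \ p -> Prime p × p ∣ q
pr-di q q≢0 q≢1 with factorise q ⦃ ≢-nonZero q≢0 ⦄
... | record { factors = [];isFactorisation = e } = absurd e q≢1
... | record { factors = p ∷ ps;isFactorisation = rfl;factorsPrime = pp ∷ _ } = p , pp , m∣m*n (LA.product ps)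

module _ {n : ℕ} {Y : Set} ⦃ _ : Fi Y ⦄ (π : Pe n) (D : Vec Y n) where

 -- The permutation `g₀` turns the single cycle of y by its period f and fixes everything else. It
 -- stabilises the word, and its rotation is the p-th part of n!.
 module PaRo (y : Fin n) (f p : ℕ) (fp : f * p == len π y) (p≢0 : p ≢ 0)
  (per : ∀ m -> lk D (it π (m + f) y) == lk D (it π m y)) where

  f≤ : f ≤ len π y
  f≤ = ≤t (m≤m*n f p ⦃ ≢-nonZero p≢0 ⦄) (≤r fp)
   where open import Data.Nat.Properties using (m≤m*n)

  tu : ℕ -> Fin n -> Fin n
  tu k u with _⇝?_ π y u
  ... | yes _ = it π k u
  ... | no _ = u

  tu-ye : ∀ k {u} -> _⇝_ π y u -> tu k u == it π k u
  tu-ye k {u} p with _⇝?_ π y u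
  ... | yes _ = rfl
  ... | no ¬p = absurd p ¬p

  tu-no : ∀ k {u} -> ¬ _⇝_ π y u -> tu k u == u
  tu-no k {u} ¬p with _⇝?_ π y u
  ... | yes p = absurd p ¬p
  ... | no _ = rfl

  tu-tu : ∀ a b -> a + b == len π y -> ∀ u -> tu a (tu b u) == u
  tu-tu a b e u with _⇝?_ π y u
  ... | yes q = tu-ye a (⇝-tr π q (⇝-in π b u)) » sym (it-+ π a b u) »
   cg (\ k -> it π k u) (e » sym (⇝-le π q)) » it-le π u
  ... | no ¬q = tu-no a ¬q

  g₀ : Pe n
  g₀ = mP (tu f) (tu (len π y ∸ f)) (tu-tu f _ (m+[n∸m]≡n f≤)) (tu-tu _ f (m∸n+n≡m f≤))

  g₀-· : ∀ u -> g₀ · u == tu f u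
  g₀-· = mP-· _ _ _ _

  g₀-co : ∀ u -> g₀ · (π · u) == π · (g₀ · u)
  g₀-co u = g₀-· (π · u) » lem (_⇝?_ π y u) » cg (π ·_) (sym (g₀-· u))
   where
   lem : Dec (_⇝_ π y u) -> tu f (π · u) == π · tu f u
   lem (yes q) = tu-ye f (⇝-tr π q (⇝-in π 1 u)) » it-su π f u » cg (π ·_) (sym (tu-ye f q))
   lem (no ¬q) = tu-no f (\ q -> ¬q (⇝-tr π q (⇝-sy π (⇝-in π 1 u)))) » cg (π ·_) (sym (tu-no f ¬q))

  g₀-fi : co g₀ π == π
  g₀-fi = co-fi g₀ π (pe-ex (\ u -> ∙-· g₀ π u » g₀-co u » sym (∙-· π g₀ u)))

  g₀-D : D ▹ g₀ == D
  g₀-D = lo-ex (\ u -> ▹-lo D g₀ u » cg (lk D) (g₀-· u) » lem u (_⇝?_ π y u))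
   where
   lem : ∀ u -> Dec (_⇝_ π y u) -> lk D (tu f u) == lk D u
   lem u (yes q@(m , rfl)) = cg (lk D) (tu-ye f q » sym (it-+ π f (tn m) y) »
    cg (\ k -> it π k y) (+-comm f (tn m))) » per (tn m)
   lem u (no ¬q) = cg (lk D) (tu-no f ¬q)

  g₀-ro : ro π g₀ ≈[ n ! ] we π y * f
  g₀-ro = ≈-tr (ro-≈ π (\ x r -> step x r (_⇝?_ π y x))) (≈-re sin)
   where
   part : Fin n -> ℕ
   part x = wh (_⇝?_ π y x) (we π y * f)
   step : ∀ x -> roo π x == x -> (d : Dec (_⇝_ π y x)) -> ph (co g₀ π) (g₀ · x) ≈[ n ! ] wh d (we π y * f)
   step x r (yes q) = ≈-tr (≈-re (ap2 (ph {n}) g₀-fi (g₀-· x » tu-ye f q)))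
    (≈-tr (ph-≈ π (it π f x) f x (sym (ro-co π (⇝-in π f x)) » r) rfl)
     (≈-re (cg (_* f) (we-⇝ π (⇝-tr π q (⇝-in π f x))))))
   step x r (no ¬q) = ≈-tr (≈-re (ap2 (ph {n}) g₀-fi (g₀-· x » tu-no f ¬q)))
    (≈-tr (ph-≈ π x 0 x r rfl) (≈-re (*-zeroʳ (we π x))))
   sin : roots π part == we π y * f
   sin = ι-in (ι-sF _ » Ʃ-co (\ x -> ι-wh (iR? π x) _ » cg (δ (iR? π x) &_) (ι-wh (_⇝?_ π y x) _) »
    sym (&-as _ _ _) » cg (_& ι (we π y * f)) (sym (δ-× (iR? π x) (_⇝?_ π y x)) »
     δ-⇔ _ (eq? x (roo π y)) (\ { (r , q) -> sym r » sym (ro-co π q) })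
      (\ { rfl -> ro-ro π y , ⇝-sy π (root⇝ π y) }))) »
    Ʃ-δ (roo π y) (\ _ -> ι (we π y * f)))

 module _ where

  Peri : Fin n -> ℕ -> Set
  Peri y k = ∀ m -> lk D (it π (m + k) y) == lk D (it π m y)

  pe-* : ∀ y x k -> Peri y k -> Peri y (x * k)
  pe-* y zr k P m = cg (\ z -> lk D (it π z y)) (+-idr m)
  pe-* y (suc x) k P m = cg (\ z -> lk D (it π z y)) (lem m k (x * k)) » P (m + x * k) » pe-* y x k P m
   where
   lem : ∀ m k z -> m + (k + z) == m + z + k
   lem = ℕ-ring

  pe-gc : ∀ y k ℓ -> Peri y k -> Peri y ℓ -> Peri y (gcd k ℓ)
  pe-gc y k ℓ P Q with Bézout.identity (gcd-GCD k ℓ)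
  ... | Bézout.Identity.+- a b e = \ m -> trans (sym (pe-* y b ℓ Q (m + gcd k ℓ))) (cg (\ z -> lk D (it π z y))
   (+-assoc m _ _ » cg (m +_) e) » pe-* y a k P m)
  ... | Bézout.Identity.-+ a b e = \ m -> trans (sym (pe-* y a k P (m + gcd k ℓ))) (cg (\ z -> lk D (it π z y))
   (+-assoc m _ _ » cg (m +_) e) » pe-* y b ℓ Q m)

  record PR : Set where
   field
    p : ℕ
    prime : Prime p
    p≤n : p ≤ n
    g : Pe n
    stab : Sta π D g
    shif : ℕ
    rot : ro π g ≈[ n ! ] shif
    sh-* : shif * p == n !

  -- An itinerary that recurs after k steps has the period e = gcd(k, ℓ) by Bézout, a proper divisor
  -- of the cycle length ℓ. A prime p dividing ℓ/e turns this into the period ℓ/p.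
  pr-ro : NP π D -> PR
  pr-ro (y , _ , (k , rfl) , i , y≢z) = record
   { p = p;prime = pp;p≤n = ≤t p≤ℓ (len≤n π y);g = R.g₀;stab = R.g₀-fi , R.g₀-D
   ;shif = we π y * (q′ * e);rot = R.g₀-ro
   ;sh-* = *-assoc (we π y) (q′ * e) p » cg (we π y *_) qep » weight*len π y }
   where
   ℓ = len π y
   e = gcd (tn k) ℓ
   pe-k : Peri y (tn k)
   pe-k m = cg (lk D) (it-+ π m (tn k) y) » sym (itin π D i m)
   pe-ℓ : Peri y ℓ
   pe-ℓ m = cg (lk D) (it-+ π m ℓ y » cg (it π m) (it-le π y))
   open _∣_ (gcd[m,n]∣n (tn k) ℓ) using () renaming (quotient to q;equality to ℓ≡)
   q≢0 : q ≢ 0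
   q≢0 z with trans ℓ≡ (cg (_* e) z)
   ... | ()
   q≢1 : q ≢ 1
   q≢1 o = y≢z (sym (∣len π (tn k) y (subst (_∣ tn k) (sym (ℓ≡ » cg (_* e) o » *-identityˡ e)) (gcd[m,n]∣m (tn k) ℓ))))
   pd = pr-di q q≢0 q≢1
   p = fst pd
   pp = fst (snd pd)
   open _∣_ (snd (snd pd)) using () renaming (quotient to q′;equality to q≡)
   qep : q′ * e * p == ℓ
   qep = lem q′ e p » sym (ℓ≡ » cg (_* e) q≡)
    where
    lem : ∀ a b c -> a * b * c == a * c * b
    lem = ℕ-ring
   p≢0 : p ≢ 0
   p≢0 z = q≢0 (q≡ » cg (q′ *_) z » *-zeroʳ q′)
   p≤ℓ : p ≤ ℓ
   p≤ℓ = ∣⇒≤ (divides (q′ * e) (sym qep))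
   module R = PaRo y (q′ * e) p qep p≢0 (pe-* y q′ e (pe-gc y (tn k) ℓ pe-k pe-ℓ))

-- The twist on the integers modulo n!.

S : ℕ -> (ℕ -> ℚ) -> ℚ
S zr F = 0q
S (suc m) F = F 0 # S m (F ∘ suc)

S-Ʃ : ∀ m F -> Ʃ (\ (s : Fin m) -> F (tn s)) == S m F
S-Ʃ zr F = Ʃ-Fin0 _
S-Ʃ (suc m) F = Ʃ-Fi _ » cg (F 0 #_) (S-Ʃ m (F ∘ suc))

S-co : ∀ m {F G} -> (∀ k -> F k == G k) -> S m F == S m G
S-co zr p = rfl
S-co (suc m) p = ap2 _#_ (p 0) (S-co m (p ∘ suc))

S-ne : ∀ m F -> S m (F ∘ suc) # F 0 == S m F # F m
S-ne zr F = rfl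
S-ne (suc m) F = #-co _ (F 0) » cg (F 0 #_) (#-co (F 1) _ » S-ne m (F ∘ suc)) » sym (#-as (F 0) _ _)

S-⊝ : ∀ m F G -> S m (\ k -> F k # ~ G k) == S m F # ~ S m G
S-⊝ m F G = S-~ m » rfl
 where
 opaque
  unfolding _#_
  z : 0q == 0q # ~ 0q
  z = rfl
  lem : ∀ a b c d -> a # ~ b # (c # ~ d) == (a # c) # ~ (b # d)
  lem = slv ℚ-ri
 S-~' : ∀ m F G -> S m (\ k -> F k # ~ G k) == S m F # ~ S m G
 S-~' zr F G = z
 S-~' (suc m) F G = cg (F 0 # ~ G 0 #_) (S-~' m (F ∘ suc) (G ∘ suc)) » lem (F 0) (G 0) _ _
 S-~ : ∀ m -> S m (\ k -> F k # ~ G k) == S m F # ~ S m G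
 S-~ m = S-~' m F G

S-0 : ∀ m {F} -> (∀ k -> F k == 0q) -> S m F == 0q
S-0 zr p = rfl
S-0 (suc m) p = ap2 _#_ (p 0) (S-0 m (p ∘ suc)) » #-idˡ 0q

S-con : ∀ m c -> S m (\ _ -> c) == ι m & c
S-con zr c = sym (&-zeroˡ c)
S-con (suc m) c = cg (c #_) (S-con m c) » #-&-su (ι m) c

module Perio (L : ℕ) where

 Per : (ℕ -> ℚ) -> Set
 Per F = ∀ a -> F (a + L) == F a

 per-* : ∀ {F} -> Per F -> ∀ u a -> F (a + u * L) == F a
 per-* {F} P zr a = cg F (+-idr a)
 per-* {F} P (suc u) a = cg F (lem a u L) » P (a + u * L) » per-* P u a
  where
  lem : ∀ a u L -> a + (L + u * L) == a + u * L + L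
  lem = ℕ-ring

 pe-≈ : ∀ {F} -> Per F -> ∀ {a b} -> a ≈[ L ] b -> F a == F b
 pe-≈ {F} P {a} {b} (co-by {u} {v} e) = sym (per-* P u a) » cg F e » per-* P v b

 S-ro : ∀ F -> Per F -> ∀ c -> S L (\ s -> F (s + c)) == S L F
 S-ro F P zr = S-co L (\ s -> cg F (+-idr s))
 S-ro F P (suc c) = S-co L (\ s -> cg F (+-suc s c)) » #-ca (S-ne L G » cg (S L G #_) (cg F (+-comm L c) » P c)) » S-ro F P c
  where
  G : ℕ -> ℚ
  G s = F (s + c)
  opaque
   unfolding _#_
   lem : ∀ a c -> a == a # c # ~ c
   lem = slv ℚ-ri
  #-ca : ∀ {a b c} -> a # c == b # c -> a == b
  #-ca {a} {b} {c} e = lem a c » cg (_# ~ c) e » sym (lem b c)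

module Tw (n : ℕ) where

 L : ℕ
 L = n !

 open Perio L

 _÷_ : ℕ -> ℕ -> ℕ
 a ÷ zr = 0
 a ÷ suc k = a / suc k

 ÷-* : ∀ {p} -> p ≢ 0 -> p ≤ n -> (L ÷ p) * p == L
 ÷-* {zr} z _ = absurd rfl z
 ÷-* {suc k} _ l = m/n*n≡m (n∣n! k n l)

 -- The unit mass at 0 modulo L, convolved with one difference 1 - [L/p] for each p of the list: a
 -- Möbius function of the cyclic group of order L.
 Zf : List ℕ -> ℕ -> ℚ
 Zf [] a = δ (L ∣? a)
 Zf (p ∷ ps) a = Zf ps a # ~ Zf ps (a + L ÷ p)

 Zf-pe : ∀ ps -> Per (Zf ps)
 Zf-pe [] a = δ-⇔ _ _ (\ d -> ∣m+n∣m⇒∣n (subst (L ∣_) (+-comm a L) d) ∣-refl) (\ d -> ∣m∣n⇒∣m+n d ∣-refl)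
 Zf-pe (p ∷ ps) a = ap2 (\ x y -> x # ~ y) (Zf-pe ps a) (cg (Zf ps) (lem a L (L ÷ p)) » Zf-pe ps (a + L ÷ p))
  where
  lem : ∀ a b c -> a + b + c == a + c + b
  lem = ℕ-ring

 -- The difference belonging to p telescopes around the subgroup of order p; the remaining
 -- differences commute with translations.
 Zf-ki : ∀ ps {p} -> p ∈ ps -> p ≢ 0 -> p ≤ n -> ∀ a -> S p (\ k -> Zf ps (a + k * (L ÷ p))) == 0q
 Zf-ki (p ∷ ps) (here rfl) p≢0 p≤n a = begin
  S p (\ k -> F k # ~ Zf ps (a + k * (L ÷ p) + L ÷ p)) ≡⟨ S-co p (\ k -> cg (\ z -> F k # ~ Zf ps z) (lem a k (L ÷ p))) ⟩
  S p (\ k -> F k # ~ F (suc k)) ≡⟨ S-⊝ p F (F ∘ suc) ⟩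
  S p F # ~ S p (F ∘ suc) ≡⟨ alg (S p F) (S p (F ∘ suc)) (F 0) ⟩
  (S p F # F 0) # ~ (S p (F ∘ suc) # F 0) ≡⟨ cg (\ z -> (S p F # F 0) # ~ z) (S-ne p F) ⟩
  (S p F # F 0) # ~ (S p F # F p) ≡⟨ cg (\ z -> (S p F # z) # ~ (S p F # F p)) F0 ⟩
  (S p F # F p) # ~ (S p F # F p) ≡⟨ ~-invʳ _ ⟩
  0q ∎
  where
  open ≡-Reasoning
  F : ℕ -> ℚ
  F k = Zf ps (a + k * (L ÷ p))
  lem : ∀ a k c -> a + k * c + c == a + suc k * c
  lem = ℕ-ring
  opaque
   unfolding _#_
   alg : ∀ x y z -> x # ~ y == (x # z) # ~ (y # z)
   alg = slv ℚ-ri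
  F0 : F 0 == F p
  F0 = cg (Zf ps) (+-idr a) » sym (cg (\ z -> Zf ps (a + z)) (*-comm p _ » ÷-* p≢0 p≤n) » Zf-pe ps a)
 Zf-ki (q ∷ ps) {p} (there m) p≢0 p≤n a = S-⊝ p (\ k -> Zf ps (a + k * (L ÷ p))) (\ k -> Zf ps (a + k * (L ÷ p) + L ÷ q)) »
  ap2 (\ x y -> x # ~ y) (Zf-ki ps m p≢0 p≤n a)
   (S-co p (\ k -> cg (Zf ps) (lem a (k * (L ÷ p)) (L ÷ q))) » Zf-ki ps m p≢0 p≤n (a + L ÷ q)) » ~-invʳ 0q
  where
  lem : ∀ a b c -> a + b + c == a + c + b
  lem = ℕ-ring

 Sm : ℕ -> Set
 Sm p = Prime p × p ≤ n

 -- Every difference displaces the support by L/p, which becomes a multiple of L after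
 -- multiplication by p; hence the product of the primes sends the whole support into the multiples
 -- of L.
 Zf-su : ∀ ps -> All Sm ps -> ∀ a -> ¬ (L ∣ a * LA.product ps) -> Zf ps a == 0q
 Zf-su [] _ a nd = δ-no _ (\ d -> nd (subst (L ∣_) (sym (*-identityʳ a)) d))
 Zf-su (p ∷ ps) ((pp , p≤n) ∷ sm) a nd = ap2 (\ x y -> x # ~ y)
  (Zf-su ps sm a (\ d -> nd (subst (L ∣_) (lem a p P) (∣n⇒∣m*n p d))))
  (Zf-su ps sm (a + L ÷ p) (\ d -> nd (∣m+n∣m⇒∣n (subst (L ∣_) (le' d) (∣n⇒∣m*n p d)) (m∣m*n P)))) »
  ~-invʳ 0q
  where
  P = LA.product ps
  lem : ∀ a p P -> p * (a * P) == a * (p * P)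
  lem = ℕ-ring
  lem″ : ∀ a c p P -> p * ((a + c) * P) == c * p * P + a * (p * P)
  lem″ = ℕ-ring
  le' : L ∣ (a + L ÷ p) * P -> p * ((a + L ÷ p) * P) == L * P + a * (p * P)
  le' _ = lem″ a (L ÷ p) p P » cg (\ z -> z * P + a * (p * P)) (÷-* (≢-nonZero⁻¹ p ⦃ prime⇒nonZero pp ⦄) p≤n)

 prime∣product : ∀ {p} ps -> Prime p -> All Prime ps -> p ∣ LA.product ps -> p ∈ ps
 prime∣product [] pp _ d = absurd (∣1⇒≡1 d) (nonTrivial⇒≢1 ⦃ prime⇒nonTrivial pp ⦄)
  where open import Data.Nat using (nonTrivial⇒≢1)
 prime∣product {p} (q ∷ ps) pp (qq ∷ qs) d with euclidsLemma q (LA.product ps) pp d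
 ... | inr d' = there (prime∣product ps pp qs d')
 ... | inl d' with prime⇒irreducible qq d'
 ... | inl one = absurd one (nonTrivial⇒≢1 ⦃ prime⇒nonTrivial pp ⦄)
  where open import Data.Nat using (nonTrivial⇒≢1)
 ... | inr e = here e

 -- The subtracted term lives at L/p. Multiplied by the other primes it cannot become a multiple of
 -- L, for p would have to divide their product; by `Zf-su` it vanishes.
 Zf-0 : ∀ ps -> All Sm ps -> Unique ps -> Zf ps 0 == 1q
 Zf-0 [] _ _ = δ-ye _ (divides 0 rfl)
 Zf-0 (p ∷ ps) ((pp , p≤n) ∷ sm) (u ∷ us) = ap2 (\ x y -> x # ~ y) (Zf-0 ps sm us) (Zf-su ps sm (L ÷ p) nd) » alg
  where
  opaque
   unfolding _#_
   alg : 1q # ~ 0q == 1q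
   alg = rfl
  p≢0 : p ≢ 0
  p≢0 = ≢-nonZero⁻¹ p ⦃ prime⇒nonZero pp ⦄
  Lp≢0 : L ÷ p ≢ 0
  Lp≢0 z = ≢-nonZero⁻¹ L ⦃ n !≢0 ⦄ (sym (÷-* p≢0 p≤n) » cg (_* p) z)
  nd : ¬ (L ∣ (L ÷ p) * LA.product ps)
  nd d = All.lookup u (prime∣product ps pp (All.map fst sm)
   (*-cancelˡ-∣ (L ÷ p) ⦃ ≢-nonZero Lp≢0 ⦄ (subst (_∣ (L ÷ p) * LA.product ps) (sym (÷-* p≢0 p≤n)) d))) rfl

 sm? : ∀ p -> Dec (Sm p)
 sm? p = prime? p ×-dec p ≤?ℕ n

 opaque
  pri : List ℕ
  pri = filter sm? (upTo (suc n))

  pr-sm : All Sm pri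
  pr-sm = all-filter sm? (upTo (suc n))
   where open import Data.List.Relation.Unary.All.Properties using (all-filter)

  pr-un : Unique pri
  pr-un = UP.filter⁺ sm? (UP.upTo⁺ (suc n))

  ∈-pr : ∀ {p} -> Sm p -> p ∈ pri
  ∈-pr s = ∈P.∈-filter⁺ sm? (∈P.∈-upTo⁺ (s≤s (snd s))) s

 ζ : ℕ -> ℚ
 ζ = Zf pri

 -- The autocorrelation serves as the twist instead of `ζ` itself: sums over cosets of subgroups of
 -- prime order still vanish, its value at 0 is positive, and it is what makes `twisted-posdef` a
 -- sum of squares.
 ε : ℕ -> ℚ
 ε r = S L (\ s -> ζ s & ζ (s + r))

 ζ-≈ : ∀ s {a b} -> a ≈[ L ] b -> ζ (s + a) == ζ (s + b)
 ζ-≈ s p = pe-≈ (Zf-pe pri) (≈-+ (≈-ref {a = s}) p)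

 ε-≈ : ∀ {a b} -> a ≈[ L ] b -> ε a == ε b
 ε-≈ p = S-co L (\ s -> cg (ζ s &_) (ζ-≈ s p))

 ε-shift : ∀ a r -> S L (\ s -> ζ (s + a) & ζ (s + (a + r))) == ε r
 ε-shift a r = S-co L (\ s -> cg (\ z -> ζ (s + a) & ζ z) (sym (+-assoc s a r))) »
  S-ro (\ s -> ζ s & ζ (s + r)) (\ b -> ap2 _&_ (Zf-pe pri b) (cg ζ (lem b L r) » Zf-pe pri (b + r))) a
  where
  lem : ∀ a b c -> a + b + c == a + c + b
  lem = ℕ-ring

 ε0>0 : 0q <ᵠ ε 0
 ε0>0 = subst (0q <ᵠ_) (S-Ʃ L (\ s -> ζ s & ζ (s + 0))) (Ʃ->0 (\ s -> subst (\ z -> 0q ≤ᵠ ζ (tn s) & ζ z) (sym (+-idr (tn s))) (sq-≥0 (ζ (tn s))))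
  (fromℕ< L>0) (subst (0q <ᵠ_) (sym eq) 1>0))
  where
  L>0 : 0 < L
  L>0 = n≢0⇒n>0 (≢-nonZero⁻¹ L ⦃ n !≢0 ⦄)
   where open import Data.Nat.Properties using (n≢0⇒n>0)
  eq : ζ (tn (fromℕ< L>0)) & ζ (tn (fromℕ< L>0) + 0) == 1q
  eq = cg (\ z -> ζ z & ζ (z + 0)) (tn-fr L>0) » ap2 _&_ z z » &-idˡ 1q
   where
   z : ζ 0 == 1q
   z = Zf-0 pri pr-sm pr-un

 ε-ki : ∀ {p} -> Prime p -> p ≤ n -> ∀ r -> S p (\ k -> ε (k * (L ÷ p) + r)) == 0q
 ε-ki {p} pp p≤n r = begin
  S p (\ k -> S L (\ s -> ζ s & ζ (s + (k * (L ÷ p) + r))))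
   ≡⟨ S-Ʃ p _ ⟨
  Ʃ (\ (k : Fin p) -> S L (\ s -> ζ s & ζ (s + (tn k * (L ÷ p) + r))))
   ≡⟨ Ʃ-co (\ k -> S-Ʃ L (\ s -> ζ s & ζ (s + (tn k * (L ÷ p) + r)))) ⟨
  Ʃ (\ (k : Fin p) -> Ʃ (\ (s : Fin L) -> ζ (tn s) & ζ (tn s + (tn k * (L ÷ p) + r))))
   ≡⟨ Ʃ-sw _ ⟩
  Ʃ (\ (s : Fin L) -> Ʃ (\ (k : Fin p) -> ζ (tn s) & ζ (tn s + (tn k * (L ÷ p) + r))))
   ≡⟨ Ʃ-0 (\ s -> Ʃ-*ˡ (ζ (tn s)) _ » cg (ζ (tn s) &_) (Ʃ-co (\ k -> cg ζ (lem (tn s) (tn k * (L ÷ p)) r)) »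
    S-Ʃ p (\ k -> ζ (tn s + r + k * (L ÷ p))) »
     Zf-ki pri (∈-pr (pp , p≤n)) (≢-nonZero⁻¹ p ⦃ prime⇒nonZero pp ⦄) p≤n (tn s + r)) » &-zeroʳ _) ⟩
  0q ∎
  where
  open ≡-Reasoning
  lem : ∀ s k r -> s + (k + r) == s + r + k
  lem = ℕ-ring

 module _ {Y : Set} ⦃ _ : Fi Y ⦄ (π : Pe n) (D : Vec Y n) where
  open FG (Sym {n}) using (Ʃ-right)

  stabiliser : ℚ
  stabiliser = Ʃ (\ g -> δ (st? π D g))

  -- For a primitive word every stabilising permutation has rotation 0. For a periodic one, right
  -- multiplication by an element of rotation L/p shows that shifting the argument of ε by L/p does
  -- not change the sum, while the p shifts of this kind add up to 0 by `ε-ki`.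
  twisted-sum : Ʃ (\ g -> δ (st? π D g) & ε (ro π g)) == δ (pr? π D) & (ε 0 & stabiliser)
  twisted-sum with pr-or-no π D
  ... | inl prim = Ʃ-co (\ g -> δ-co (st? π D g) (\ st -> ε-≈ (Ca.rot-sta π D prim st)) » &-co _ _) »
   Ʃ-*ˡ (ε 0) _ » sym (cg (_& (ε 0 & stabiliser)) (δ-ye (pr? π D) prim) » &-idˡ _)
  ... | inr np@(y , z , a , b , ne) = Ʃ-co (\ g -> rfl) » T0≡0 » sym (cg (_& (ε 0 & stabiliser)) (δ-no (pr? π D) (\ p -> ne (p y z a b))) » &-zeroˡ _)
   where
   open PR (pr-ro π D np)
   p≢0 : p ≢ 0
   p≢0 = ≢-nonZero⁻¹ p ⦃ prime⇒nonZero prime ⦄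
   shift≡ : shif == L ÷ p
   shift≡ = *-cancelʳ-≡ shif (L ÷ p) p ⦃ prime⇒nonZero prime ⦄ (sh-* » sym (÷-* p≢0 p≤n))
   T : ℕ -> ℚ
   T c = Ʃ (\ h -> δ (st? π D h) & ε (c + ro π h))
   T-st : ∀ c -> T (L ÷ p + c) == T c
   T-st c = Ʃ-co (\ h -> δ-co (st? π D h) (\ st -> ε-≈ (ro-eq h)) »
    cg (_& ε (c + ro π (h ∙ₚ g))) (δ-⇔ (st? π D h) (st? π D (h ∙ₚ g)) (fw h) (bw h))) »
    Ʃ-right g (\ h -> δ (st? π D h) & ε (c + ro π h))
    where
    ro-eq : ∀ h -> L ÷ p + c + ro π h ≈[ L ] c + ro π (h ∙ₚ g)
    ro-eq h = ≈-tr (≈-re (cg (\ z -> z + c + ro π h) (sym shift≡) » lem shif c (ro π h)))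
     (≈-+ (≈-ref {a = c}) (≈-sy (≈-tr (ro-∙ π g h) (≈-+ rot (≈-re (cg (\ ρ -> ro ρ h) (fst stab)))))))
     where
     lem : ∀ s c r -> s + c + r == c + (s + r)
     lem = ℕ-ring
    fw : ∀ h -> Sta π D h -> Sta π D (h ∙ₚ g)
    fw h (a , b) = trans (co-∙ h g π) (cg (co h) (fst stab) » a) , trans (▹-∙ D h g) (cg (_▹ g) b » snd stab)
    bw : ∀ h -> Sta π D (h ∙ₚ g) -> Sta π D h
    bw h (a , b) = trans (cg (co h) (sym (fst stab))) (sym (co-∙ h g π) » a) ,
     trans (sym (▹-id (D ▹ h))) (cg ((D ▹ h) ▹_) (sym (∙-invʳ g)) » ▹-∙ (D ▹ h) g (invₚ g) »
      cg (_▹ invₚ g) (sym (▹-∙ D h g) » b » sym (snd stab)) » sym (▹-∙ D g (invₚ g)) » cg (D ▹_) (∙-invʳ g) » ▹-id D)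
   T-mu : ∀ k -> T (k * (L ÷ p)) == T 0
   T-mu zr = rfl
   T-mu (suc k) = T-st (k * (L ÷ p)) » T-mu k
   T0≡0 : T 0 == 0q
   T0≡0 = &-ca {ι p} (\ e -> p≢0 (ι-in e)) (sym (S-con p (T 0)) » S-co p (\ k -> sym (T-mu k)) »
    sym (S-Ʃ p (\ k -> T (k * (L ÷ p)))) » Ʃ-sw _ » Ʃ-0 (\ h -> Ʃ-*ˡ _ _ » cg (δ (st? π D h) &_) (S-Ʃ p (\ k -> ε (k * (L ÷ p) + ro π h)) » ε-ki prime p≤n (ro π h)) » &-zeroʳ _) »
     sym (&-zeroʳ _))

-- Standard bicoloured words and the Gessel-Reutenauer correspondence.

open import Data.Nat.Properties using (<-asym;*-monoʳ-≤;n≢0⇒n>0;*-cancelˡ-≤)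
open import Relation.Nullary.Decidable using (_→-dec_)
open import Data.Bool.Properties using () renaming (_≟_ to _≟B_)

opaque
 unfolding _#_

 ⊝-≥0 : ∀ {x y} -> x ≤ᵠ y -> 0q ≤ᵠ y # ~ x
 ⊝-≥0 {x} {y} p = subst (_≤ᵠ y # ~ x) (~-invʳ x) (ℚP.+-monoˡ-≤ (~ x) p)

 ⊝->0 : ∀ {x y} -> 0q <ᵠ y # ~ x -> x <ᵠ y
 ⊝->0 {x} {y} p = subst2 _<ᵠ_ (#-idˡ x) (lem y x) (ℚP.+-monoˡ-< x p)
  where
  lem : ∀ y x -> y # ~ x # x == y
  lem = slv ℚ-ri

 Ʃ-⊝ : {A : Set} ⦃ _ : Fi A ⦄ (f g : A -> ℚ) -> Ʃ (\ a -> f a # ~ g a) == Ʃ f # ~ Ʃ g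
 Ʃ-⊝ f g = Ʃ-# f (\ a -> ~ g a) » cg (Ʃ f #_) (Ʃ-co (\ a -> neg (g a)) » Ʃ-*ˡ (~ 1q) g » sym (neg (Ʃ g)))
  where
  neg : ∀ x -> ~ x == (~ 1q) & x
  neg = slv ℚ-ri

 1⊝0 : 1q # ~ 0q == 1q
 1⊝0 = rfl

module _ {A : Set} ⦃ _ : Fi A ⦄ {P Q : A -> Set} (P? : ∀ a -> Dec (P a)) (Q? : ∀ a -> Dec (Q a)) where

 δ-mo : (∀ a -> P a -> Q a) -> ∀ a -> δ (P? a) ≤ᵠ δ (Q? a)
 δ-mo pq a with P? a
 ... | yes p = subst2 _≤ᵠ_ (sym (δ-ye (yes p) p)) (sym (δ-ye (Q? a) (pq a p))) ℚP.≤-refl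
 ... | no ¬p = subst (_≤ᵠ δ (Q? a)) (sym (δ-no (no ¬p) ¬p)) (δ-≥0 (Q? a))

 ca-< : (∀ a -> P a -> Q a) -> ∀ a -> Q a -> ¬ P a -> Ʃ (\ a -> δ (P? a)) <ᵠ Ʃ (\ a -> δ (Q? a))
 ca-< pq a q ¬p = ⊝->0 (subst (0q <ᵠ_) (Ʃ-⊝ _ _) (Ʃ->0 (\ b -> ⊝-≥0 (δ-mo pq b)) a
  (subst (0q <ᵠ_) (sym (ap2 (\ x y -> x # ~ y) (δ-ye (Q? a) q) (δ-no (P? a) ¬p) » 1⊝0)) 1>0)))

ones : ∀ n -> Ʃ (\ (i : Fin n) -> 1q) == ι n
ones zr = Ʃ-Fin0 _
ones (suc n) = Ʃ-Fi _ » cg (1q #_) (ones n)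

ι-ca-< : ∀ {m n} -> ι m <ᵠ ι n -> m < n
ι-ca-< {m} {n} p with <-cmp m n
... | tri< q _ _ = q
... | tri≈ _ rfl _ = absurd rfl (ℚP.<⇒≢ p)
... | tri> _ _ q = absurd (ι-mo-< q) (ℚP.<-asym p)

module _ {n : ℕ} where

 car : {P : Fin n -> Set} -> (∀ i -> Dec (P i)) -> ℕ
 car P? = sF (\ i -> wh (P? i) 1)

 ι-ca : {P : Fin n -> Set} (P? : ∀ i -> Dec (P i)) -> ι (car P?) == Ʃ (\ i -> δ (P? i))
 ι-ca P? = ι-sF _ » Ʃ-co (\ i -> ι-wh (P? i) 1 » cg (δ (P? i) &_) (#-idʳ 1q) » &-idʳ _)

 In : (Fin n -> Set) -> Set
 In P = ∀ i j -> tn i < tn j -> P j -> P i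

 -- Initial segments are nested, and a proper inclusion would show in the cardinalities. Comparing
 -- sizes in this way replaces the bookkeeping of positions.
 do-un : {P Q : Fin n -> Set} (P? : ∀ a -> Dec (P a)) (Q? : ∀ a -> Dec (Q a)) -> In P -> In Q ->
  Ʃ (\ a -> δ (P? a)) == Ʃ (\ a -> δ (Q? a)) -> ∀ j -> P j -> Q j
 do-un {P} {Q} P? Q? dP dQ e j p with Q? j
 ... | yes q = q
 ... | no ¬q = absurd (sym e) (ℚP.<⇒≢ (ca-< Q? P? Q⊆P j p ¬q))
  where
  Q⊆P : ∀ a -> Q a -> P a
  Q⊆P a q with <-cmp (tn a) (tn j)
  ... | tri< l _ _ = dP a j l p
  ... | tri≈ _ f _ = subst P (sym (tn-inj f)) p
  ... | tri> _ _ l = absurd (dQ j a l q) ¬q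

 sa-or : (p q : Pe n) -> (∀ i j -> tn (p · i) < tn (p · j) -> tn (q · i) < tn (q · j)) ->
  (∀ i j -> tn (q · i) < tn (q · j) -> tn (p · i) < tn (p · j)) -> p == q
 sa-or p q f g = pe-ex (\ i -> tn-inj (≤-antisym (bo p q g f i) (bo q p f g i)))
  where
  bo : (p q : Pe n) -> (∀ i j -> tn (q · i) < tn (q · j) -> tn (p · i) < tn (p · j)) ->
   (∀ i j -> tn (p · i) < tn (p · j) -> tn (q · i) < tn (q · j)) -> ∀ i -> tn (p · i) ≤ tn (q · i)
  bo p q f g i = ≮⇒≥ (\ l -> <-irrefl rfl (do-un (\ u -> tn u <?ℕ tn (p · i)) (\ u -> tn u <?ℕ tn (q · i))
   (\ a b -> <-trans) (\ a b -> <-trans)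
   (sym (Ʃ-pe p _) » Ʃ-co (\ j -> δ-⇔ _ _ (g j i) (f j i)) » Ʃ-pe q _) (q · i) l))

 opaque
  -- As a word, an injective map uses every letter exactly once and so has the content of the
  -- identity; `sa-co` then provides the permutation.
  bi : (f : Fin n -> Fin n) -> (∀ {i j} -> f i == f j -> i == j) -> ∃ \ (p : Pe n) -> ∀ i -> p · i == f i
  bi f inj = let p , e = sa-co (tab id) (tab f) (\ z -> ι-in (cn-on id id z (z , rfl) » sym (cn-on f inj z (sur z)))) in
   p , \ i -> trans (sym (lk-tab id (p · i))) (sym (▹-lo (tab id) p i) » cg (\ v -> lk v i) e » lk-tab f i)
   where
   cn-on : (f : Fin n -> Fin n) -> (∀ {i j} -> f i == f j -> i == j) -> ∀ z -> (∃ \ i -> f i == z) -> ι (cnt (tab f) z) == 1q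
   cn-on f inj z (i , rfl) = cn-Ʃ (tab f) (f i) » Ʃ-co (\ j -> sym (&-idʳ _) » cg (_& 1q)
    (δ-⇔ _ (eq? j i) (\ e -> inj (sym (lk-tab f j) » e)) (\ { rfl -> lk-tab f i }))) » Ʃ-δ i (\ _ -> 1q)
   sur : ∀ z -> ∃ \ i -> f i == z
   sur z with any? (\ i -> f i ≟F z)
   ... | yes r = r
   ... | no ¬r = absurd (Ʃ-co (\ i -> rfl) » tota » sym (ones n))
    (ℚP.<⇒≢ (subst2 _<ᵠ_ rfl (Ʃ-co (\ z -> δ-ye (yes tt) tt)) (ca-< (\ z -> any? (\ i -> f i ≟F z)) (\ _ -> yes tt) _ z tt ¬r)))
    where
    tota : Ʃ (\ z -> δ (any? (\ i -> f i ≟F z))) == ι n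
    tota = Ʃ-co (\ z -> im z) » Ʃ-sw _ » Ʃ-co (\ i -> Ʃ-co (\ z -> sym (&-idʳ _)) » Ʃ-δ' (f i) (\ _ -> 1q)) » ones n
     where
     im : ∀ z -> δ (any? (\ i -> f i ≟F z)) == Ʃ (\ i -> δ (eq? (f i) z))
     im z with any? (\ i -> f i ≟F z)
     ... | yes (i , e) = δ-ye (yes (i , e)) (i , e) » sym (Ʃ-co (\ j -> sym (&-idʳ _) » cg (_& 1q)
      (δ-⇔ _ (eq? j i) (\ e' -> inj (e' » sym e)) (\ { rfl -> e }))) » Ʃ-δ i (\ _ -> 1q))
     ... | no ¬p = δ-no (no ¬p) ¬p » sym (Ʃ-0 (\ i -> δ-no _ (\ e -> ¬p (i , e))))

  ranki : {_≺_ : Fin n -> Fin n -> Set} (≺? : ∀ i j -> Dec (i ≺ j)) -> (∀ i -> ¬ i ≺ i) ->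
   (∀ {i j k} -> i ≺ j -> j ≺ k -> i ≺ k) -> (∀ i j -> i ≢ j -> i ≺ j ⊎ j ≺ i) ->
   ∃ \ (h : Pe n) -> ∀ i j -> i ≺ j -> tn (h · i) < tn (h · j)
  ranki {_≺_} ≺? irr tr tot = let p , e = bi r r-in in
   p , \ i j l -> subst2 _<_ (sym (tn-fr (rank<n i)) » cg tn (sym (e i))) (sym (tn-fr (rank<n j)) » cg tn (sym (e j))) (ra-< l)
   where
   ra : Fin n -> ℕ
   ra i = car (\ j -> ≺? j i)
   ra-< : ∀ {i j} -> i ≺ j -> ra i < ra j
   ra-< {i} {j} l = ι-ca-< (subst2 _<ᵠ_ (sym (ι-ca (\ k -> ≺? k i))) (sym (ι-ca (\ k -> ≺? k j)))
    (ca-< (\ k -> ≺? k i) (\ k -> ≺? k j) (\ k m -> tr m l) i l (irr i)))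
   rank<n : ∀ i -> ra i < n
   rank<n i = ι-ca-< (subst2 _<ᵠ_ (sym (ι-ca (\ k -> ≺? k i))) (Ʃ-co (\ z -> δ-ye (yes tt) tt) » ones n)
    (ca-< (\ k -> ≺? k i) (\ _ -> yes tt) _ i tt (irr i)))
   r : Fin n -> Fin n
   r i = fromℕ< (rank<n i)
   r-in : ∀ {i j} -> r i == r j -> i == j
   r-in {i} {j} e with i ≟F j
   ... | yes f = f
   ... | no ne with trans (sym (tn-fr (rank<n i))) (cg tn e » tn-fr (rank<n j)) | tot i j ne
   ... | f | inl l = absurd f (<≢ (ra-< l))
   ... | f | inr l = absurd (sym f) (<≢ (ra-< l))

-- A local rule for words on the cycles of a permutation: `E` relates a letter to the next one on
-- its cycle, `F` restricts the letter on a fixed point.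
record Lo (Y : Set) : Set₁ where
 field
  E : Y -> Y -> Set
  E? : ∀ x y -> Dec (E x y)
  F : Y -> Set
  F? : ∀ x -> Dec (F x)

module _ {n : ℕ} {Y : Set} (ℓ : Lo Y) where
 open Lo ℓ

 VA : Pe n -> Vec Y n -> Fin n -> Set
 VA π D i = (π · i == i -> F (lk D i)) × (π · i ≢ i -> E (lk D i) (lk D (π · i)))

 Va : Pe n -> Vec Y n -> Set
 Va π D = ∀ i -> VA π D i

 opaque
  va? : ∀ π D -> Dec (Va π D)
  va? π D = all? (\ i -> ((π · i ≟F i) →-dec F? (lk D i)) ×-dec (¬? (π · i ≟F i) →-dec E? (lk D i) (lk D (π · i))))

module _ {n : ℕ} {Y : Set} where

 mo-lo : (D : Vec Y n) (g : Pe n) -> ∀ i -> lk (D ▹ invₚ g) (g · i) == lk D i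
 mo-lo D g i = ▹-lo D (invₚ g) (g · i) » cg (lk D) (in-· g _ » ·⁻· g i)

 mo-it : (π : Pe n) (D : Vec Y n) (g : Pe n) -> ∀ m i ->
  lk (D ▹ invₚ g) (it (co g π) m (g · i)) == lk D (it π m i)
 mo-it π D g m i = cg (lk (D ▹ invₚ g)) (co-it g π m i) » mo-lo D g _

 mo-va : (ℓ : Lo Y) -> ∀ π D g -> Va ℓ (co g π) (D ▹ invₚ g) -> Va ℓ π D
 mo-va ℓ π D g v i = (\ e -> subst F (mo-lo D g i) (fst (v (g · i)) (con-· g π i » cg (g ·_) e))) ,
  (\ ne -> subst2 E (mo-lo D g i) (cg (lk (D ▹ invₚ g)) (con-· g π i) » mo-lo D g (π · i))
   (snd (v (g · i)) (\ e -> ne (·-in g (sym (con-· g π i) » e)))))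
  where open Lo ℓ

 ▹-in : (D : Vec Y n) (g : Pe n) -> (D ▹ invₚ g) ▹ g == D
 ▹-in D g = sym (▹-∙ D (invₚ g) g) » cg (D ▹_) (∙-invˡ g) » ▹-id D

 ▹-in' : (D : Vec Y n) (g : Pe n) -> (D ▹ g) ▹ invₚ g == D
 ▹-in' D g = sym (▹-∙ D g (invₚ g)) » cg (D ▹_) (∙-invʳ g) » ▹-id D

 module _ ⦃ _ : Fi Y ⦄ where

  mov-iti : ∀ π (D : Vec Y n) g {i j} -> It (co g π) (D ▹ invₚ g) (g · i) (g · j) -> It π D i j
  mov-iti π D g {i} {j} (iti p) = iti $ \ m -> trans (sym (mo-it π D g (tn m) i)) (p m » mo-it π D g (tn m) j)

  mo-it⁻ : ∀ π (D : Vec Y n) g {i j} -> It π D i j -> It (co g π) (D ▹ invₚ g) (g · i) (g · j)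
  mo-it⁻ π D g {i} {j} (iti p) = iti $ \ m -> trans (mo-it π D g (tn m) i) (p m » sym (mo-it π D g (tn m) j))

  mo-pr : ∀ π (D : Vec Y n) g -> Pr (co g π) (D ▹ invₚ g) -> Pr π D
  mo-pr π D g P y z p i = ·-in g (P (g · y) (g · z) (co-⇝ g π p) (mo-it⁻ π D g i))

module Stan (n N : ℕ) where

 Z : Set
 Z = Fin N × Bool

 -- A letter marked true is a barred one; barred letters precede their unbarred versions.
 code : Z -> ℕ
 code (a , true) = 2 * tn a
 code (a , false) = suc (2 * tn a)

 code-mono : ∀ x y -> code x ≤ code y -> tn (fst x) ≤ tn (fst y)
 code-mono (a , true) (b , true) p = *-cancelˡ-≤ 2 p
 code-mono (a , false) (b , true) p = *-cancelˡ-≤ 2 (≤t (n≤1+n _) p)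
 code-mono (a , true) (b , false) p = ha p
  where
  ha : ∀ {a b} -> 2 * a ≤ suc (2 * b) -> a ≤ b
  ha {a} {b} p = ≮⇒≥ (\ q -> <-irrefl rfl (≤t (≤t (≤r (lem b)) (*-monoʳ-≤ 2 q)) p))
   where
   lem : ∀ b -> suc (suc (2 * b)) == 2 * suc b
   lem = ℕ-ring
 code-mono (a , false) (b , false) (s≤s p) = *-cancelˡ-≤ 2 p

 code-inj : ∀ x y -> code x == code y -> x == y
 code-inj x y e with tn-inj (≤-antisym (code-mono x y (≤r e)) (code-mono y x (≤r (sym e))))
 code-inj (a , true) (_ , true) e | rfl = rfl
 code-inj (a , false) (_ , false) e | rfl = rfl
 code-inj (a , true) (_ , false) e | rfl = absurd e (<≢ (n<1+n _))
 code-inj (a , false) (_ , true) e | rfl = absurd (sym e) (<≢ (n<1+n _))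

 -- What remains of the excedance condition after conjugation: letters rise weakly along the cycle
 -- after a barred place and fall weakly after an unbarred one, and a fixed point is not an
 -- excedance.
 bicoloured : Lo Z
 bicoloured = record
  { E = \ { (a , true) (b , _) -> tn a ≤ tn b;(a , false) (b , _) -> tn b ≤ tn a }
  ;E? = \ { (a , true) (b , _) -> tn a ≤?ℕ tn b;(a , false) (b , _) -> tn b ≤?ℕ tn a }
  ;F = \ { (a , c) -> c == false }
  ;F? = \ { (a , c) -> c ≟B false } }

 Increasing : Pe n -> Vec Z n -> Fin n -> Fin n -> Set
 Increasing σ D i j = code (lk D i) < code (lk D j) ⊎ (lk D i == lk D j × tn (σ · i) < tn (σ · j))

 Coloured : Pe n -> Vec Z n -> Fin n -> Set
 Coloured σ D i = (snd (lk D i) == true -> tn i < tn (σ · i)) × (tn i < tn (σ · i) -> snd (lk D i) == true)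

 -- These pairs are the terms of the fundamental quasisymmetric functions: places are sorted by
 -- letter, barred copies first, ties being decided by the value of σ, and the bars sit exactly on
 -- the excedances.
 Standard : Pe n -> Vec Z n -> Set
 Standard σ D = (∀ i j -> tn i < tn j -> Increasing σ D i j) × (∀ i -> Coloured σ D i)

 opaque
  standard? : ∀ σ D -> Dec (Standard σ D)
  standard? σ D = all? (\ i -> all? (\ j -> (tn i <?ℕ tn j) →-dec
   (code (lk D i) <?ℕ code (lk D j) ⊎-dec (eq? (lk D i) (lk D j) ×-dec tn (σ · i) <?ℕ tn (σ · j)))))
   ×-dec all? (\ i -> ((snd (lk D i) ≟B true) →-dec (tn i <?ℕ tn (σ · i))) ×-dec ((tn i <?ℕ tn (σ · i)) →-dec (snd (lk D i) ≟B true)))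

 module Ord (π : Pe n) (D : Vec Z n) where

  at : ℕ -> Fin n -> Z
  at m i = lk D (it π m i)

  record Lt (i j : Fin n) : Set where
   constructor lt
   field
    m : ℕ
    sa : ∀ k -> k < m -> at k i == at k j
    less : code (at m i) < code (at m j)

  opaque
   tri : ∀ i j -> Lt i j ⊎ It π D i j ⊎ Lt j i
   tri i j with it? π D i j
   ... | yes p = inr (inl p)
   ... | no ¬p with any? (\ (m : Fin (n !)) -> ¬? (eq? (at (tn m) i) (at (tn m) j)))
   ... | no ¬d = absurd (iti (\ m -> case eq? (at (tn m) i) (at (tn m) j) of \ { (yes e) -> e;(no ne) -> absurd (m , ne) ¬d })) ¬p
   ... | yes (d , ne) with lea (\ m -> ¬? (eq? (at m i) (at m j))) (tn d) ne
   ... | m , _ , q , min with <-cmp (code (at m i)) (code (at m j))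
   ... | tri< l _ _ = inl (lt m (\ k p -> case eq? (at k i) (at k j) of \ { (yes e) -> e;(no r) -> absurd r (min k p) }) l)
   ... | tri≈ _ e _ = absurd (code-inj _ _ e) q
   ... | tri> _ _ l = inr (inr (lt m (\ k p -> case eq? (at k j) (at k i) of \ { (yes e) -> e;(no r) -> absurd (r ∘ sym) (min k p) }) l))

  lt-it : ∀ {i j} -> Lt i j -> ¬ It π D i j
  lt-it (lt m s l) p = <≢ l (cg code (itin π D p m))

  lt-ir : ∀ {i} -> ¬ Lt i i
  lt-ir p = lt-it p (it-re π D)

  lt-tr : ∀ {i j k} -> Lt i j -> Lt j k -> Lt i k
  lt-tr {i} {j} {k} (lt m s l) (lt m' s' l') with <-cmp m m'
  ... | tri< p _ _ = lt m (\ a q -> s a q » s' a (<-trans q p)) (subst (\ z -> code (at m i) < code z) (s' m p) l)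
  ... | tri≈ _ rfl _ = lt m (\ a q -> s a q » s' a q) (<-trans l l')
  ... | tri> _ _ p = lt m' (\ a q -> s a (<-trans q p) » s' a q) (subst (\ z -> code z < code (at m' k)) (sym (s m' p)) l')

  lt-as : ∀ {i j} -> Lt i j -> ¬ Lt j i
  lt-as p q = lt-ir (lt-tr p q)

  lt-itinʳ : ∀ {i j k} -> Lt i j -> It π D j k -> Lt i k
  lt-itinʳ {i} (lt m s l) p = lt m (\ a q -> s a q » itin π D p a) (subst (\ z -> code (at m i) < code z) (itin π D p m) l)

  lt-itinˡ : ∀ {i j k} -> It π D i j -> Lt j k -> Lt i k
  lt-itinˡ {k = k} p (lt m s l) = lt m (\ a q -> itin π D p a » s a q) (subst (\ z -> code z < code (at m k)) (sym (itin π D p m)) l)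

  opaque
   lt? : ∀ i j -> Dec (Lt i j)
   lt? i j with tri i j
   ... | inl p = yes p
   ... | inr (inl p) = no (\ q -> lt-it q p)
   ... | inr (inr p) = no (lt-as p)

  lt-sh : ∀ {i j} -> lk D i == lk D j -> Lt i j -> Lt (π · i) (π · j)
  lt-sh e (lt zr s l) = absurd (cg code e) (<≢ l)
  lt-sh {i} {j} e (lt (suc m) s l) = lt m
   (\ k q -> subst2 (\ u v -> lk D u == lk D v) (sym (it-su π k i)) (sym (it-su π k j)) (s (suc k) (s≤s q)))
   (subst2 (\ u v -> code (lk D u) < code (lk D v)) (sym (it-su π m i)) (sym (it-su π m j)) l)

  it-π : ∀ {i j} -> It π D i j -> It π D (π · i) (π · j)
  it-π = it-it π D 1

  it-π⁻ : ∀ {i j} -> It π D (π · i) (π · j) -> It π D i j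
  it-π⁻ {i} {j} p = subst2 (It π D) (ba i) (ba j) (it-it π D q p)
   where
   -- The power n! - 1 of π is its inverse.
   q = pred (n !)
   ba : ∀ i -> it π q (π · i) == i
   ba i = it-su π q i » cg (\ k -> it π k i) (suc-pred (n !) ⦃ n !≢0 ⦄) » it-! π i
    where open import Data.Nat.Properties using (suc-pred)

  module _ (std : Standard π D) where

   -- A tie between two letters passes the comparison on to the images under π. Places sorted by
   -- first letters are therefore sorted by whole itineraries.
   st-≮ : ∀ {i j} -> tn i < tn j -> ¬ Lt j i
   st-≮ {i} {j} i<j (lt m s l) = bad m i j i<j s l
    where
    bad : ∀ m i j -> tn i < tn j -> (∀ k -> k < m -> at k j == at k i) -> ¬ code (at m j) < code (at m i)
    bad zr i j p _ l with fst std i j p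
    ... | inl l' = <-asym l l'
    ... | inr (e , _) = <≢ l (cg code (sym e))
    bad (suc m) i j p s l with fst std i j p
    ... | inl l' = <≢ l' (cg code (sym (s 0 (s≤s z≤n))))
    ... | inr (_ , q) = bad m (π · i) (π · j) q
     (\ k r -> subst2 (\ u v -> lk D u == lk D v) (sym (it-su π k j)) (sym (it-su π k i)) (s (suc k) (s≤s r)))
     (subst2 (\ u v -> code (lk D u) < code (lk D v)) (sym (it-su π m j)) (sym (it-su π m i)) l)

   st-< : ∀ {i j} -> tn i < tn j -> Lt i j ⊎ It π D i j
   st-< {i} {j} p with tri i j
   ... | inl l = inl l
   ... | inr (inl e) = inr e
   ... | inr (inr l) = absurd l (st-≮ p)

   lt⇒< : ∀ {i j} -> Lt i j -> tn i < tn j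
   lt⇒< {i} {j} l with <-cmp (tn i) (tn j)
   ... | tri< p _ _ = p
   ... | tri≈ _ e _ = absurd (subst (Lt i) (sym (tn-inj e)) l) lt-ir
   ... | tri> _ _ p = absurd l (st-≮ p)

   st-it : ∀ {i j} m -> It π D i j -> tn i < tn j -> tn (it π m i) < tn (it π m j)
   st-it zr e p = p
   st-it {i} {j} (suc m) e p with fst std _ _ (st-it m e p)
   ... | inl l = absurd (cg code (itin π D e m)) (<≢ l)
   ... | inr (_ , q) = q

   st-it⁻ : ∀ {i j} -> It π D i j -> tn (π · i) < tn (π · j) -> tn i < tn j
   st-it⁻ {i} {j} e p with <-cmp (tn i) (tn j)
   ... | tri< q _ _ = q
   ... | tri≈ _ f _ = absurd (cg (\ k -> tn (π · k)) (tn-inj f)) (<≢ p)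
   ... | tri> _ _ q = absurd (st-it 1 (it-sy π D e) q) (<-asym p)

   -- Between points of equal itinerary π preserves the order. If y and its image under the k-th
   -- power were different, iterating that power would move y strictly in one direction, yet after
   -- n! rounds it is back.
   st-pr : Pr π D
   st-pr y _ (k , rfl) e with <-cmp (tn y) (tn (it π (tn k) y))
   ... | tri≈ _ f _ = tn-inj f
   ... | tri< p _ _ = ⊥-elim (<-irrefl rfl (subst (tn y <_) (cg tn loo) (cli (pred (n !)))))
    where
    K = tn k
    cli : ∀ m -> tn y < tn (it π (suc m * K) y)
    cli zr = subst (\ z -> tn y < tn (it π z y)) (sym (+-idr K)) p
    cli (suc m) = <-trans (cli m) (subst (\ z -> tn (it π (suc m * K) y) < tn z) (sym (it-+ π (suc m * K) K y) »
     cg (\ z -> it π z y) (+-comm (suc m * K) K)) (st-it (suc m * K) e p))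
    loo : it π (suc (pred (n !)) * K) y == y
    loo = cg (\ z -> it π (z * K) y) (suc-pred (n !) ⦃ n !≢0 ⦄) » cg (\ z -> it π z y) (*-comm (n !) K) » it-* π K (it-! π y)
     where open import Data.Nat.Properties using (suc-pred)
   ... | tri> _ _ p = ⊥-elim (<-irrefl rfl (subst (_< tn y) (cg tn loo) (fal (pred (n !)))))
    where
    K = tn k
    fal : ∀ m -> tn (it π (suc m * K) y) < tn y
    fal zr = subst (\ z -> tn (it π z y) < tn y) (sym (+-idr K)) p
    fal (suc m) = <-trans (subst (\ z -> tn z < tn (it π (suc m * K) y)) (sym (it-+ π (suc m * K) K y) »
     cg (\ z -> it π z y) (+-comm (suc m * K) K)) (st-it (suc m * K) (it-sy π D e) p)) (fal m)
    loo : it π (suc (pred (n !)) * K) y == y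
    loo = cg (\ z -> it π (z * K) y) (suc-pred (n !) ⦃ n !≢0 ⦄) » cg (\ z -> it π z y) (*-comm (n !) K) » it-* π K (it-! π y)
     where open import Data.Nat.Properties using (suc-pred)

   std-let : ∀ {i j} -> tn i ≤ tn j -> tn (fst (lk D i)) ≤ tn (fst (lk D j))
   std-let {i} {j} p with tn i ≟ℕ tn j
   ... | yes e = ≤r (cg (\ k -> tn (fst (lk D k))) (tn-inj e))
   ... | no ne with fst std i j (≤∧≢⇒< p ne)
   ... | inl l = code-mono (lk D i) (lk D j) (<⇒≤ l)
   ... | inr (e , _) = ≤r (cg (tn ∘ fst) e)

   st-va : Va bicoloured π D
   st-va i with lk D i in eq
   ... | a , true = (\ e -> absurd (cg tn (sym e)) (<≢ i<)) , \ _ -> lett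
    where
    i< : tn i < tn (π · i)
    i< = fst (snd std i) (cg snd eq)
    lett : tn a ≤ tn (fst (lk D (π · i)))
    lett = subst (\ z -> tn (fst z) ≤ tn (fst (lk D (π · i)))) eq (std-let (<⇒≤ i<))
   ... | a , false = (\ _ -> rfl) , \ _ -> subst (\ z -> tn (fst (lk D (π · i))) ≤ tn (fst z)) eq (std-let (≮⇒≥ ≮i))
    where
    ≮i : ¬ tn i < tn (π · i)
    ≮i p with trans (sym (cg snd eq)) (snd (snd std i) p)
    ... | ()

module Stand (n N : ℕ) where
 open Stan n N public
 open ≡-Reasoning

 module _ (π : Pe n) (D : Vec Z n) (k : Pe n) where
  private
   π' = co k π
   D' = D ▹ invₚ k
   module O = Ord π D
   module O' = Ord π' D'

  lt-mo : ∀ {i j} -> O.Lt i j -> O'.Lt (k · i) (k · j)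
  lt-mo {i} {j} (O.lt m s l) = O'.lt m (\ a p -> mo-it π D k a i » s a p » sym (mo-it π D k a j))
   (subst2 (\ u v -> code u < code v) (sym (mo-it π D k m i)) (sym (mo-it π D k m j)) l)

  lt-mo⁻ : ∀ {i j} -> O'.Lt (k · i) (k · j) -> O.Lt i j
  lt-mo⁻ {i} {j} (O'.lt m s l) = O.lt m (\ a p -> sym (mo-it π D k a i) » s a p » mo-it π D k a j)
   (subst2 (\ u v -> code u < code v) (mo-it π D k m i) (mo-it π D k m j) l)

  -- The points preceding i and those preceding k i in the two orders are initial segments of equal
  -- size, hence the same set. It follows that k i and i have equal itineraries, so k fixes the
  -- word, and the two permutations turn out to order their values alike.
  module Uni (std : Standard π D) (std' : Standard π' D') where

   Be Be' : Fin n -> Fin n -> Set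
   Be i j = O.Lt j i ⊎ It π D j i
   Be' i j = O'.Lt j i ⊎ It π' D' j i

   opaque
    be? : ∀ i j -> Dec (Be i j)
    be? i j = O.lt? j i ⊎-dec it? π D j i

    be'? : ∀ i j -> Dec (Be' i j)
    be'? i j = O'.lt? j i ⊎-dec it? π' D' j i

   lt-in : ∀ i -> In (\ j -> O.Lt j i)
   lt-in i a b p l with O.st-< std p
   ... | inl q = O.lt-tr q l
   ... | inr e = O.lt-itinˡ e l

   lt-in' : ∀ i -> In (\ j -> O'.Lt j i)
   lt-in' i a b p l with O'.st-< std' p
   ... | inl q = O'.lt-tr q l
   ... | inr e = O'.lt-itinˡ e l

   be-in : ∀ i -> In (Be i)
   be-in i a b p (inl l) = inl (lt-in i a b p l)
   be-in i a b p (inr f) with O.st-< std p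
   ... | inl q = inl (O.lt-itinʳ q f)
   ... | inr e = inr (it-tr π D e f)

   be-in' : ∀ i -> In (Be' i)
   be-in' i a b p (inl l) = inl (lt-in' i a b p l)
   be-in' i a b p (inr f) with O'.st-< std' p
   ... | inl q = inl (O'.lt-itinʳ q f)
   ... | inr e = inr (it-tr π' D' e f)

   Below⇒ : ∀ i j -> Be' (k · i) j -> Be i j
   Below⇒ i = do-un (be'? (k · i)) (be? i) (be-in' (k · i)) (be-in i)
    (sym (Ʃ-pe k (\ j -> δ (be'? (k · i) j))) » Ʃ-co (\ j -> δ-⇔ (be'? (k · i) (k · j)) (be? i j) (ba j) (fo j)))
    where
    ba : ∀ j -> Be' (k · i) (k · j) -> Be i j
    ba j (inl l) = inl (lt-mo⁻ l)
    ba j (inr e) = inr (mov-iti π D k e)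
    fo : ∀ j -> Be i j -> Be' (k · i) (k · j)
    fo j (inl l) = inl (lt-mo l)
    fo j (inr e) = inr (mo-it⁻ π D k e)

   lt⇒ : ∀ i j -> O.Lt j i -> O'.Lt j (k · i)
   lt⇒ i = do-un (\ j -> O.lt? j i) (\ j -> O'.lt? j (k · i)) (lt-in i) (lt-in' (k · i))
    (sym (sym (Ʃ-pe k (\ j -> δ (O'.lt? j (k · i)))) » Ʃ-co (\ j -> δ-⇔ (O'.lt? (k · j) (k · i)) (O.lt? j i) lt-mo⁻ lt-mo)))

   it-k : ∀ i -> It π D (k · i) i
   it-k i = dec (Below⇒ i (k · i) (inr (it-re π' D')))
    where
    dec : Be i (k · i) -> It π D (k · i) i
    dec (inr e) = e
    dec (inl l) = absurd (lt⇒ i (k · i) l) O'.lt-ir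

   D-fi : D ▹ k == D
   D-fi = lo-ex (\ i -> ▹-lo D k i » itin π D (it-k i) 0)

   sa-se : ∀ m i -> lk D' (it π' m i) == lk D (it π m i)
   sa-se m i = cg (\ z -> lk D' (it π' m z)) (sym (··⁻ k i)) » mo-it π D k m (k ·⁻ i) »
    sym (itin π D (it-k (k ·⁻ i)) m) » cg (\ z -> lk D (it π m z)) (··⁻ k i)

   shi : ∀ m i -> lk D' (it π' m (π' · i)) == lk D (it π m (π · i))
   shi m i = cg (lk D') (it-su π' m i) » sa-se (suc m) i » cg (lk D) (sym (it-su π m i))

   -- Values are compared by their itineraries, which the two permutations share by `shi`; when
   -- these agree, both permutations preserve the order of the arguments.
   order⇒ : ∀ i j -> tn (π · i) < tn (π · j) -> tn (π' · i) < tn (π' · j)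
   order⇒ i j p with O.st-< std p
   ... | inl (O.lt m s l) = O'.lt⇒< std' (O'.lt m (\ a q -> shi a i » s a q » sym (shi a j))
    (subst2 (\ u v -> code u < code v) (sym (shi m i)) (sym (shi m j)) l))
   ... | inr e = O'.st-it std' 1 (it-in π' D' (\ m -> sa-se m i » itin π D (O.it-π⁻ e) m » sym (sa-se m j)))
    (O.st-it⁻ std (O.it-π⁻ e) p)

   order⇐ : ∀ i j -> tn (π' · i) < tn (π' · j) -> tn (π · i) < tn (π · j)
   order⇐ i j p with O'.st-< std' p
   ... | inl (O'.lt m s l) = O.lt⇒< std (O.lt m (\ a q -> sym (shi a i) » s a q » shi a j)
    (subst2 (\ u v -> code u < code v) (shi m i) (shi m j) l))
   ... | inr e = O.st-it std 1 (it-in π D (\ m -> sym (sa-se m i) » itin π' D' (O'.it-π⁻ e) m » sa-se m j))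
    (O'.st-it⁻ std' (O'.it-π⁻ e) p)

   fi : Sta π D k
   fi = sym (sa-or π π' order⇒ order⇐) , D-fi

 module Exi (π : Pe n) (D : Vec Z n) (val : Va bicoloured π D) (prim : Pr π D) where
  open Ord π D

  -- Equal itineraries occur only on different cycles, by primitivity, so the least point of the
  -- cycle breaks all ties; π does not change this tie-break.
  _≺_ : Fin n -> Fin n -> Set
  i ≺ j = Lt i j ⊎ (It π D i j × tn (roo π i) < tn (roo π j))

  ≺? : ∀ i j -> Dec (i ≺ j)
  ≺? i j = lt? i j ⊎-dec (it? π D i j ×-dec tn (roo π i) <?ℕ tn (roo π j))

  ≺-ir : ∀ i -> ¬ i ≺ i
  ≺-ir i (inl l) = lt-ir l
  ≺-ir i (inr (_ , l)) = <-irrefl rfl l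

  ≺-tr : ∀ {i j k} -> i ≺ j -> j ≺ k -> i ≺ k
  ≺-tr (inl l) (inl l') = inl (lt-tr l l')
  ≺-tr (inl l) (inr (e , _)) = inl (lt-itinʳ l e)
  ≺-tr (inr (e , _)) (inl l) = inl (lt-itinˡ e l)
  ≺-tr (inr (e , l)) (inr (e' , l')) = inr (it-tr π D e e' , <-trans l l')

  ≺-to : ∀ i j -> i ≢ j -> i ≺ j ⊎ j ≺ i
  ≺-to i j ne with tri i j
  ... | inl l = inl (inl l)
  ... | inr (inr l) = inr (inl l)
  ... | inr (inl e) with <-cmp (tn (roo π i)) (tn (roo π j))
  ... | tri< l _ _ = inl (inr (e , l))
  ... | tri≈ _ f _ = absurd (prim i j (root≡⇒⇝ π (tn-inj f)) e) ne
  ... | tri> _ _ l = inr (inr (it-sy π D e , l))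

  opaque
   ran : ∃ \ (h : Pe n) -> ∀ i j -> i ≺ j -> tn (h · i) < tn (h · j)
   ran = ranki ≺? ≺-ir ≺-tr ≺-to

  h : Pe n
  h = fst ran

  h-< : ∀ {i j} -> i ≺ j -> tn (h · i) < tn (h · j)
  h-< {i} {j} = snd ran i j

  h-<⁻ : ∀ {i j} -> tn (h · i) < tn (h · j) -> i ≺ j
  h-<⁻ {i} {j} p with i ≟F j
  ... | yes rfl = absurd p (<-irrefl rfl)
  ... | no ne with ≺-to i j ne
  ... | inl q = q
  ... | inr q = absurd p (<-asym (h-< q))

  ≺-co : ∀ {i j} -> i ≺ j -> code (lk D i) < code (lk D j) ⊎ (lk D i == lk D j × (π · i) ≺ (π · j))
  ≺-co (inl (lt zr s l)) = inl l
  ≺-co (inl l@(lt (suc m) s _)) = inr (s 0 (s≤s z≤n) , inl (lt-sh (s 0 (s≤s z≤n)) l))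
  ≺-co {i} {j} (inr (e , l)) = inr (itin π D e 0 , inr (it-π e ,
   subst2 (\ u v -> tn u < tn v) (ro-co π (⇝-in π 1 i)) (ro-co π (⇝-in π 1 j)) l))

  π≢⇒¬itin : ∀ i -> π · i ≢ i -> ¬ It π D i (π · i)
  π≢⇒¬itin i ne e = ne (sym (prim i (π · i) (⇝-in π 1 i) e))

  -- Until the first place where the itineraries of i and π i differ, all letters equal that of i.
  -- At that place the letter is thus still barred, and the rule forbids a descent.
  ba-as : ∀ i -> snd (lk D i) == true -> i ≺ (π · i)
  ba-as i c with π · i ≟F i
  ... | yes f with trans (sym c) (fst (val i) f)
  ... | ()
  ba-as i c | no ne with tri i (π · i)
  ... | inl l = inl l
  ... | inr (inl e) = absurd e (π≢⇒¬itin i ne)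
  ... | inr (inr (lt m s l)) = absurd l (no-de m (\ k p -> s k p))
   where
   cons : ∀ m -> (∀ k -> k < m -> lk D (it π k (π · i)) == lk D (it π k i)) -> lk D (it π m i) == lk D i
   cons zr s = rfl
   cons (suc m) s = cg (lk D) (sym (it-su π m i)) » s m ≤= » cons m (\ k p -> s k (≤t p (n≤1+n m)))
   no-de : ∀ m -> (∀ k -> k < m -> lk D (it π k (π · i)) == lk D (it π k i)) ->
    ¬ code (lk D (it π m (π · i))) < code (lk D (it π m i))
   no-de m s l = step (lk D (it π m i)) rfl (cg snd (cons m s) » c) (subst (\ z -> code (lk D z) < code (lk D (it π m i))) (it-su π m i) l)
    where
    w = it π m i
    step : ∀ z -> lk D w == z -> snd z == true -> ¬ code (lk D (π · w)) < code (lk D w)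
    step (a , true) e _ l with π · w ≟F w
    ... | yes f with trans (sym (cg snd e)) (fst (val w) f)
    ... | ()
    step (a , true) e _ l | no nf = <-irrefl rfl (<-≤-trans (subst (\ z -> code (lk D (π · w)) < code z) e l) (co-≥ (lk D (π · w)) le))
     where
     le : tn a ≤ tn (fst (lk D (π · w)))
     le = subst (\ z -> Lo.E bicoloured z (lk D (π · w))) e (snd (val w) nf)
     co-≥ : ∀ y -> tn a ≤ tn (fst y) -> 2 * tn a ≤ code y
     co-≥ (b , true) p = *-monoʳ-≤ 2 p
     co-≥ (b , false) p = ≤t (*-monoʳ-≤ 2 p) (n≤1+n _)

  un-de : ∀ i -> snd (lk D i) == false -> ¬ i ≺ (π · i)
  un-de i c q with π · i ≟F i
  ... | yes f = ≺-ir i (subst (i ≺_) f q)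
  un-de i c (inr (e , _)) | no ne = π≢⇒¬itin i ne e
  un-de i c (inl (lt m s l)) | no ne = no-as m (\ k p -> sym (s k p)) l
   where
   cons : ∀ m -> (∀ k -> k < m -> lk D (it π k (π · i)) == lk D (it π k i)) -> lk D (it π m i) == lk D i
   cons zr s = rfl
   cons (suc m) s = cg (lk D) (sym (it-su π m i)) » s m ≤= » cons m (\ k p -> s k (≤t p (n≤1+n m)))
   no-as : ∀ m -> (∀ k -> k < m -> lk D (it π k (π · i)) == lk D (it π k i)) ->
    ¬ code (lk D (it π m i)) < code (lk D (it π m (π · i)))
   no-as m s l = step (lk D (it π m i)) rfl (cg snd (cons m s) » c) (subst (\ z -> code (lk D (it π m i)) < code (lk D z)) (it-su π m i) l)
    where
    w = it π m i
    step : ∀ z -> lk D w == z -> snd z == false -> ¬ code (lk D w) < code (lk D (π · w))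
    step (a , false) e _ l with π · w ≟F w
    ... | yes f = <-irrefl (cg (\ z -> code (lk D z)) (sym f)) l
    ... | no nf = <-irrefl rfl (≤-<-trans (co-≤ (lk D (π · w)) le) (subst (\ z -> code z < code (lk D (π · w))) e l))
     where
     le : tn (fst (lk D (π · w))) ≤ tn a
     le = subst (\ z -> Lo.E bicoloured z (lk D (π · w))) e (snd (val w) nf)
     co-≤ : ∀ y -> tn (fst y) ≤ tn a -> code y ≤ suc (2 * tn a)
     co-≤ (b , true) p = ≤t (*-monoʳ-≤ 2 p) (n≤1+n _)
     co-≤ (b , false) p = s≤s (*-monoʳ-≤ 2 p)

  private
   π' = co h π
   D' = D ▹ invₚ h

  st' : (∀ i j -> tn (h · i) < tn (h · j) -> Increasing π' D' (h · i) (h · j)) × (∀ i -> Coloured π' D' (h · i))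
  st' = inc , col
   where
   inc : ∀ i j -> tn (h · i) < tn (h · j) -> Increasing π' D' (h · i) (h · j)
   inc i j p with ≺-co (h-<⁻ p)
   ... | inl l = inl (subst2 (\ u v -> code u < code v) (sym (mo-lo D h i)) (sym (mo-lo D h j)) l)
   ... | inr (e , q) = inr (trans (mo-lo D h i) (e » sym (mo-lo D h j)) ,
    subst2 (\ u v -> tn u < tn v) (sym (con-· h π i)) (sym (con-· h π j)) (h-< q))
   col : ∀ i -> Coloured π' D' (h · i)
   col i = (\ c -> subst (\ z -> tn (h · i) < tn z) (sym (con-· h π i)) (h-< (ba-as i (cg snd (sym (mo-lo D h i)) » c)))) ,
    \ p -> trans (cg snd (mo-lo D h i)) (colo (lk D i) rfl (h-<⁻ (subst (\ z -> tn (h · i) < tn z) (con-· h π i) p)))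
    where
    colo : ∀ z -> lk D i == z -> i ≺ (π · i) -> snd (lk D i) == true
    colo (a , true) e _ = cg snd e
    colo (a , false) e q = absurd q (un-de i (cg snd e))

  standard : Standard π' D'
  standard = (\ i j p -> subst2 (Increasing π' D') (··⁻ h i) (··⁻ h j) (fst st' (h ·⁻ i) (h ·⁻ j)
   (subst2 (\ u v -> tn u < tn v) (sym (··⁻ h i)) (sym (··⁻ h j)) p))) ,
   (\ i -> subst (Coloured π' D') (··⁻ h i) (snd st' (h ·⁻ i)))

module SC (n N : ℕ) where
 open Stand n N public
 open ≡-Reasoning
 open FG (Sym {n}) using (order;Ʃ-left;Ʃ-const)
 open Tw n using (stabiliser)

 mo-st? : ∀ π D h -> Dec (Standard (co h π) (D ▹ invₚ h))
 mo-st? π D h = standard? (co h π) (D ▹ invₚ h)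

 ▹-in-∙ : ∀ {Y : Set} (D : Vec Y n) h g -> D ▹ invₚ (h ∙ₚ g) == (D ▹ invₚ g) ▹ invₚ h
 ▹-in-∙ D h g = cg (D ▹_) (inv-∙ₚ h g) » ▹-∙ D (invₚ g) (invₚ h)

 -- For a valid primitive pair the standardising permutations form one coset of the stabiliser:
 -- `Exi` gives an element, and `Uni` shows that two of them differ by a stabilising one.
 stan : ∀ π D -> Ʃ (\ h -> δ (mo-st? π D h)) == δ (va? bicoloured π D) & (δ (pr? π D) & stabiliser π D)
 stan π D = cou (va? bicoloured π D) (pr? π D)
  where
  cou : (v : Dec (Va bicoloured π D)) (p : Dec (Pr π D)) -> Ʃ (\ h -> δ (mo-st? π D h)) == δ v & (δ p & stabiliser π D)
  cou (no ¬v) p = Ʃ-0 (\ h -> δ-no _ (\ s -> ¬v (mo-va bicoloured π D h (Ord.st-va (co h π) (D ▹ invₚ h) s)))) »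
   sym (cg (_& (δ p & stabiliser π D)) (δ-no (no ¬v) ¬v) » &-zeroˡ _)
  cou (yes v) (no ¬p) = Ʃ-0 (\ h -> δ-no _ (\ s -> ¬p (mo-pr π D h (Ord.st-pr (co h π) (D ▹ invₚ h) s)))) »
   sym (cg (δ (yes v) &_) (cg (_& stabiliser π D) (δ-no (no ¬p) ¬p) » &-zeroˡ _) » &-zeroʳ _)
  cou (yes v) (yes p) = begin
   Ʃ (\ g -> δ (mo-st? π D g))
    ≡⟨ Ʃ-left h (\ g -> δ (mo-st? π D g)) ⟨
   Ʃ (\ g -> δ (mo-st? π D (h ∙ₚ g)))
    ≡⟨ Ʃ-co (\ g -> δ-⇔ _ (st? π D g) (to g) (from g)) ⟩
   stabiliser π D
    ≡⟨ trans (ap2 _&_ (δ-ye (yes v) v) (cg (_& stabiliser π D) (δ-ye (yes p) p) » &-idˡ _)) (&-idˡ _) ⟨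
   δ (yes v) & (δ (yes p) & stabiliser π D) ∎
   where
   open Exi π D v p using (h;standard)
   from : ∀ g -> Sta π D g -> Standard (co (h ∙ₚ g) π) (D ▹ invₚ (h ∙ₚ g))
   from g (a , b) = subst2 Standard (sym (co-∙ h g π » cg (co h) a))
    (sym (▹-in-∙ D h g » cg (_▹ invₚ h) (cg (_▹ invₚ g) (sym b) » ▹-in' D g))) standard
   to : ∀ g -> Standard (co (h ∙ₚ g) π) (D ▹ invₚ (h ∙ₚ g)) -> Sta π D g
   to g s = co-pa , D-pa
    where
    k = h ∙ₚ g ∙ₚ invₚ h
    kh : k ∙ₚ h == h ∙ₚ g
    kh = ∙-cancelʳ′ h (h ∙ₚ g)
    fix : Sta (co h π) (D ▹ invₚ h) k
    fix = Uni.fi (co h π) (D ▹ invₚ h) k standard (subst2 Standard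
     (cg (\ x -> co x π) (sym kh) » co-∙ k h π) (cg (\ x -> D ▹ invₚ x) (sym kh) » ▹-in-∙ D k h) s)
    co-pa : co g π == π
    co-pa = sym (co-in h (co g π)) » cg (co (invₚ h)) (sym (co-∙ h g π) » cg (\ x -> co x π) (sym kh) »
     co-∙ k h π » fst fix) » co-in h π
    D-pa : D ▹ g == D
    D-pa = begin
     D ▹ g ≡⟨ cg (_▹ g) (▹-in D h) ⟨
     ((D ▹ invₚ h) ▹ h) ▹ g ≡⟨ ▹-∙ (D ▹ invₚ h) h g ⟨
     (D ▹ invₚ h) ▹ (h ∙ₚ g) ≡⟨ cg ((D ▹ invₚ h) ▹_) kh ⟨
     (D ▹ invₚ h) ▹ (k ∙ₚ h) ≡⟨ ▹-∙ (D ▹ invₚ h) k h ⟩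
     ((D ▹ invₚ h) ▹ k) ▹ h ≡⟨ cg (_▹ h) (snd fix) ⟩
     (D ▹ invₚ h) ▹ h ≡⟨ ▹-in D h ⟩
     D ∎

 -- Gessel–Reutenauer: every primitive orbit contains exactly one standard element.
 standard-count : (f : Pe n -> Vec Z n -> ℚ) -> (∀ h π D -> f (co h π) (D ▹ invₚ h) == f π D) ->
  Ʃ (\ π -> Ʃ (\ D -> f π D & (δ (va? bicoloured π D) & (δ (pr? π D) & stabiliser π D))))
  == order & Ʃ (\ σ -> Ʃ (\ D -> f σ D & δ (standard? σ D)))
 standard-count f inv = begin
  Ʃ (\ π -> Ʃ (\ D -> f π D & (δ (va? bicoloured π D) & (δ (pr? π D) & stabiliser π D))))
   ≡⟨ Ʃ-co₂ (\ π D -> cg (f π D &_) (sym (stan π D)) » sym (Ʃ-*ˡ _ _)) ⟩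
  Ʃ (\ π -> Ʃ (\ D -> Ʃ (\ h -> f π D & δ (mo-st? π D h))))
   ≡⟨ trans (Ʃ-co (\ π -> Ʃ-sw _)) (Ʃ-sw _) ⟩
  Ʃ (\ h -> Ʃ (\ π -> Ʃ (\ D -> f π D & δ (mo-st? π D h))))
   ≡⟨ Ʃ-co (\ h -> moved h) ⟩
  Ʃ (\ h -> Ʃ (\ π -> Ʃ (\ D -> f π D & δ (standard? π D))))
   ≡⟨ Ʃ-const _ ⟩
  order & Ʃ (\ π -> Ʃ (\ D -> f π D & δ (standard? π D))) ∎
  where
  G : Pe n -> Vec Z n -> ℚ
  G π D = f π D & δ (standard? π D)
  moved : ∀ h -> Ʃ (\ π -> Ʃ (\ D -> f π D & δ (mo-st? π D h))) == Ʃ (\ π -> Ʃ (\ D -> G π D))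
  moved h = begin
   Ʃ (\ π -> Ʃ (\ D -> f π D & δ (mo-st? π D h)))
    ≡⟨ Ʃ-co₂ (\ π D -> cg (_& δ (mo-st? π D h)) (inv h π D)) ⟨
   Ʃ (\ π -> Ʃ (\ D -> G (co h π) (D ▹ invₚ h)))
    ≡⟨ Ʃ-co (\ π -> Ʃ-bi (_▹ invₚ h) (_▹ h) (\ D -> ▹-in D h) (\ D -> ▹-in' D h) (G (co h π))) ⟩
   Ʃ (\ π -> Ʃ (G (co h π)))
    ≡⟨ Ʃ-bi (co h) (co (invₚ h)) (co-in h) (co-in⁻ h) (\ π -> Ʃ (G π)) ⟩
   Ʃ (\ π -> Ʃ (\ D -> G π D)) ∎

-- Formal power series and the generating function identity.

Ser : Set
Ser = ℕ -> ℚ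

infixl 7 _⋆_
_⋆_ : Ser -> Ser -> Ser
(f ⋆ g) zr = f 0 & g 0
(f ⋆ g) (suc n) = f 0 & g (suc n) # ((f ∘ suc) ⋆ g) n

opaque
 unfolding _#_

 al-addˡ : ∀ a b c x y -> (a # b) & c # (x # y) == (a & c # x) # (b & c # y)
 al-addˡ = slv ℚ-ri

 al-addʳ : ∀ a b c x y -> a & (b # c) # (x # y) == (a & b # x) # (a & c # y)
 al-addʳ = slv ℚ-ri

 al-scaleˡ : ∀ k a b x -> k & a & b # k & x == k & (a & b # x)
 al-scaleˡ = slv ℚ-ri

 al-scaleʳ : ∀ k a b x -> a & (k & b) # k & x == k & (a & b # x)
 al-scaleʳ = slv ℚ-ri

 al-ro : ∀ a b c -> a # (b # c) == b # (a # c)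
 al-ro = slv ℚ-ri

 al-as : ∀ a b c x y -> a & b & c # (a & x # y) == a & (b & c # x) # y
 al-as = slv ℚ-ri

⋆-co : ∀ {f f' g g'} -> (∀ k -> f k == f' k) -> (∀ k -> g k == g' k) -> ∀ n -> (f ⋆ g) n == (f' ⋆ g') n
⋆-co p q zr = ap2 _&_ (p 0) (q 0)
⋆-co p q (suc n) = ap2 _#_ (ap2 _&_ (p 0) (q (suc n))) (⋆-co (p ∘ suc) q n)

⋆-addˡ : ∀ f f' g n -> ((\ k -> f k # f' k) ⋆ g) n == (f ⋆ g) n # (f' ⋆ g) n
⋆-addˡ f f' g zr = &-distribʳ (g 0) (f 0) (f' 0)
⋆-addˡ f f' g (suc n) = ap2 _#_ rfl (⋆-addˡ (f ∘ suc) (f' ∘ suc) g n) » al-addˡ (f 0) (f' 0) _ _ _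

⋆-addʳ : ∀ f g g' n -> (f ⋆ (\ k -> g k # g' k)) n == (f ⋆ g) n # (f ⋆ g') n
⋆-addʳ f g g' zr = &-distribˡ (f 0) (g 0) (g' 0)
⋆-addʳ f g g' (suc n) = ap2 _#_ rfl (⋆-addʳ (f ∘ suc) g g' n) » al-addʳ (f 0) _ _ _ _

⋆-scaleˡ : ∀ c f g n -> ((\ k -> c & f k) ⋆ g) n == c & (f ⋆ g) n
⋆-scaleˡ c f g zr = &-as c (f 0) (g 0)
⋆-scaleˡ c f g (suc n) = ap2 _#_ rfl (⋆-scaleˡ c (f ∘ suc) g n) » al-scaleˡ c (f 0) _ _

⋆-scaleʳ : ∀ c f g n -> (f ⋆ (\ k -> c & g k)) n == c & (f ⋆ g) n
⋆-scaleʳ c f g zr = &-sw (f 0) c (g 0)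
⋆-scaleʳ c f g (suc n) = ap2 _#_ rfl (⋆-scaleʳ c (f ∘ suc) g n) » al-scaleʳ c (f 0) _ _

⋆-su' : ∀ f g n -> (f ⋆ g) (suc n) == g 0 & f (suc n) # (f ⋆ (g ∘ suc)) n
⋆-su' f g zr = #-co _ _ » cg (_# f 0 & g 1) (&-co (f 1) (g 0))
⋆-su' f g (suc n) = cg (f 0 & g (suc (suc n)) #_) (⋆-su' (f ∘ suc) g n) » al-ro _ _ _

⋆-com : ∀ f g n -> (f ⋆ g) n == (g ⋆ f) n
⋆-com f g zr = &-co (f 0) (g 0)
⋆-com f g (suc n) = ⋆-su' f g n » cg (g 0 & f (suc n) #_) (⋆-com f (g ∘ suc) n)

⋆-as : ∀ f g h n -> ((f ⋆ g) ⋆ h) n == (f ⋆ (g ⋆ h)) n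
⋆-as f g h zr = &-as (f 0) (g 0) (h 0)
⋆-as f g h (suc n) = cg (f 0 & g 0 & h (suc n) #_)
 (⋆-addˡ (\ k -> f 0 & g (suc k)) ((f ∘ suc) ⋆ g) h n » ap2 _#_ (⋆-scaleˡ (f 0) (g ∘ suc) h n) (⋆-as (f ∘ suc) g h n)) »
 al-as (f 0) (g 0) (h (suc n)) _ _

1ˢ : Ser
1ˢ zr = 1q
1ˢ (suc _) = 0q

⋆-0ˡ : ∀ g n -> ((\ _ -> 0q) ⋆ g) n == 0q
⋆-0ˡ g zr = &-zeroˡ _
⋆-0ˡ g (suc n) = ap2 _#_ (&-zeroˡ _) (⋆-0ˡ g n) » #-idˡ _

⋆-1ˡ : ∀ g n -> (1ˢ ⋆ g) n == g n
⋆-1ˡ g zr = &-idˡ _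
⋆-1ˡ g (suc n) = ap2 _#_ (&-idˡ _) (⋆-0ˡ g n) » #-idʳ _

⋆-ca : ∀ (f g w : Ser) -> w 0 == 1q -> (∀ k -> (w ⋆ f) k == (w ⋆ g) k) -> ∀ k -> f k == g k
⋆-ca f g w w0 eq k = sym (⋆-1ˡ f k) » ⋆-co (\ k -> sym (inve k)) (\ _ -> rfl) k »
 ⋆-as v w f k » ⋆-co (\ _ -> rfl) eq k » sym (⋆-as v w g k) » ⋆-co inve (\ _ -> rfl) k » ⋆-1ˡ g k
 where
 -- The first argument is fuel for the recursion defining the inverse series; by `stabl` the values
 -- do not depend on it once it is large enough.
 v' : ℕ -> Ser
 v' zr _ = 1q
 v' (suc b) zr = 1q
 v' (suc b) (suc n) = ~ (v' b ⋆ (w ∘ suc)) n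
 v : Ser
 v n = v' n n
 ⋆-lo : ∀ f f' g n -> (∀ k -> k ≤ n -> f k == f' k) -> (f ⋆ g) n == (f' ⋆ g) n
 ⋆-lo f f' g zr p = cg (_& g 0) (p 0 z≤n)
 ⋆-lo f f' g (suc n) p = ap2 (\ x y -> x & g (suc n) # y) (p 0 z≤n) (⋆-lo (f ∘ suc) (f' ∘ suc) g n (\ k l -> p (suc k) (s≤s l)))
 stabl : ∀ a b n -> n ≤ a -> n ≤ b -> v' a n == v' b n
 stabl zr zr n _ _ = rfl
 stabl zr (suc b) zr _ _ = rfl
 stabl (suc a) zr zr _ _ = rfl
 stabl (suc a) (suc b) zr _ _ = rfl
 stabl (suc a) (suc b) (suc n) (s≤s p) (s≤s q) = cg ~_ (⋆-lo (v' a) (v' b) (w ∘ suc) n (\ k l -> stabl a b k (≤t l p) (≤t l q)))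
 inve : ∀ n -> (v ⋆ w) n == 1ˢ n
 inve zr = &-idˡ _ » w0
 inve (suc n) = ⋆-su' v w n » ap2 _#_ (cg (_& v (suc n)) w0 » &-idˡ _)
  (⋆-lo v (v' n) (w ∘ suc) n (\ k l -> stabl k n k ≤= l)) » #-co _ _ » ~-invʳ _

-- Multiplication by 1 - x z.
mul : ℚ -> Ser -> Ser
mul x f zr = f 0
mul x f (suc n) = f (suc n) # ~ (x & f n)

opaque
 unfolding _#_

 al-mu : ∀ a b x y c z -> a & b # (y # ~ (x & z)) # ~ (x & (a & c)) == a & b # y # ~ (x & (a & c # z))
 al-mu = slv ℚ-ri

 al-mul0 : ∀ a b x y c -> a & (b # ~ (x & c)) # y == a & b # y # ~ (x & (a & c))
 al-mul0 = slv ℚ-ri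

mu-⋆ʳ : ∀ x f g n -> (f ⋆ mul x g) n == mul x (f ⋆ g) n
mu-⋆ʳ x f g zr = rfl
mu-⋆ʳ x f g (suc zr) = al-mul0 (f 0) (g 1) x (f 1 & g 0) (g 0)
mu-⋆ʳ x f g (suc (suc n)) = cg (f 0 & mul x g (suc (suc n)) #_) (mu-⋆ʳ x (f ∘ suc) g (suc n)) »
 al-mul0 (f 0) (g (suc (suc n))) x _ (g (suc n)) » al-mu (f 0) (g (suc (suc n))) x _ (g (suc n)) _

mu-⋆ˡ : ∀ x f g n -> (mul x f ⋆ g) n == mul x (f ⋆ g) n
mu-⋆ˡ x f g n = ⋆-com (mul x f) g n » mu-⋆ʳ x g f n » mu-co n
 where
 mu-co : ∀ n -> mul x (g ⋆ f) n == mul x (f ⋆ g) n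
 mu-co zr = ⋆-com g f 0
 mu-co (suc n) = ap2 (\ a b -> a # ~ (x & b)) (⋆-com g f (suc n)) (⋆-com g f n)

mu-co : ∀ x {f g : Ser} -> (∀ k -> f k == g k) -> ∀ n -> mul x f n == mul x g n
mu-co x p zr = p 0
mu-co x p (suc n) = ap2 (\ a b -> a # ~ (x & b)) (p (suc n)) (p n)

mu-in : ∀ x {f g : Ser} -> (∀ k -> mul x f k == mul x g k) -> ∀ n -> f n == g n
mu-in x p zr = p 0
mu-in x {f} {g} p (suc n) = lem (f (suc n)) (x & f n) » ap2 _#_ (p (suc n)) (cg (x &_) (mu-in x p n)) » sym (lem (g (suc n)) (x & g n))
 where
 opaque
  unfolding _#_
  lem : ∀ a b -> a == a # ~ b # b
  lem = slv ℚ-ri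

der : Ser -> Ser
der f n = ι (suc n) & f (suc n)

-- The series 1 - z g(z).
on-mi-z : Ser -> Ser
on-mi-z g zr = 1q
on-mi-z g (suc n) = ~ g n

po : ℚ -> ℕ -> ℚ
po x zr = 1q
po x (suc n) = x & po x n

-- Says that y = -w'/w. For w = det(1 - zA) this is the generating series of the traces of the
-- powers of A, starting with A itself.
LD : Ser -> Ser -> Set
LD w y = ∀ n -> (w ⋆ y) n == ~ der w n

lD-un : ∀ w y y' -> w 0 == 1q -> LD w y -> LD w y' -> ∀ n -> y n == y' n
lD-un w y y' w0 p q = ⋆-ca y y' w w0 (\ k -> p k » sym (q k))

lD-mu : ∀ x w y -> LD w y -> LD (mul x w) (\ n -> y n # po x (suc n))
lD-mu x w y p n = ⋆-addʳ (mul x w) y (\ n -> po x (suc n)) n »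
 ap2 _#_ (mu-⋆ˡ x w y n » mu-co x p n) (mu-⋆ˡ x w _ n » sym (mu-⋆ʳ x w _ n) » ge n) » fin n
 where
 opaque
  unfolding _#_
  alg0 : ∀ x p -> x & (x & p) # ~ (x & (x & p)) == 0q
  alg0 = slv ℚ-ri
  alg1 : ∀ w0 w1 x -> ~ ((1q # 0q) & w1) # x & w0 == ~ ((1q # 0q) & (w1 # ~ (x & w0)))
  alg1 = slv ℚ-ri
  alg2 : ∀ k a b x -> ~ ((1q # k) & a) # ~ (x & (~ (k & b))) # x & b == ~ ((1q # k) & (a # ~ (x & b)))
  alg2 = slv ℚ-ri
 he : Ser
 he zr = x
 he (suc _) = 0q
 mu-po : ∀ n -> mul x (\ n -> po x (suc n)) n == he n
 mu-po zr = &-idʳ x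
 mu-po (suc n) = alg0 x (po x n)
 ge : ∀ n -> (w ⋆ mul x (\ n -> po x (suc n))) n == x & w n
 ge n = ⋆-co (\ _ -> rfl) mu-po n » ⋆-com w he n » he-⋆ n
  where
  he-⋆ : ∀ n -> (he ⋆ w) n == x & w n
  he-⋆ zr = rfl
  he-⋆ (suc n) = cg (x & w (suc n) #_) (⋆-0ˡ w n) » #-idʳ _
 fin : ∀ n -> mul x (\ n -> ~ der w n) n # x & w n == ~ der (mul x w) n
 fin zr = alg1 (w 0) (w 1) x
 fin (suc n) = alg2 (ι (suc n)) (w (suc (suc n))) (w (suc n)) x

-- The scalar recursion behind traces of powers of a rank-one perturbation.
module _ (g : Ser) where

 -- For A = K + v uᵀ and g p = uᵀ Kᵖ v this is uᵀ Aᵏ Kᵖ v.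
 ho : ℕ -> ℕ -> ℚ
 ho p zr = g p
 ho p (suc k) = ho (suc p) k # g p & ho 0 k

 -- The sum of the values of `ho` at (q + s, i - s). For q = 0 it is the amount by which the trace
 -- of the power i + 1 of A exceeds that of K.
 di : ℕ -> ℕ -> ℚ
 di q zr = ho q 0
 di q (suc i) = ho q (suc i) # di (suc q) i

 inve : Ser
 inve zr = 1q
 inve (suc k) = ho 0 k

 ho-⋆ : ∀ k p -> ho p k == ((\ m -> g (p + m)) ⋆ inve) k
 ho-⋆ zr p = sym (&-idʳ _ » cg g (+-idr p))
 ho-⋆ (suc k) p = #-co _ _ » ap2 _#_ (cg (\ z -> g z & ho 0 k) (sym (+-idr p)))
  (ho-⋆ k (suc p) » ⋆-co (\ m -> cg g (sym (+-suc p m))) (\ _ -> rfl) k)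

 wei : ℕ -> Ser
 wei q m = ι (suc m) & g (q + m)

 di-⋆ : ∀ i q -> di q i == (wei q ⋆ inve) i
 di-⋆ zr q = ho-⋆ 0 q » cg (_& 1q) (sym (cg (_& g (q + 0)) (#-idʳ 1q) » &-idˡ _))
 di-⋆ (suc i) q = ap2 _#_ (ho-⋆ (suc i) q) (di-⋆ i (suc q)) » #-as _ _ _ »
  ap2 _#_ (cg (_& inve (suc i)) (sym (cg (_& g (q + 0)) (#-idʳ 1q) » &-idˡ _)))
   (sym (⋆-addˡ (\ m -> g (q + suc m)) (wei (suc q)) inve i) »
    ⋆-co (\ m -> cg (\ z -> g (q + suc m) # ι (suc m) & g z) (sym (+-suc q m)) » #-&-su (ι (suc m)) (g (q + suc m))) (\ _ -> rfl) i)

 in-⋆ : ∀ n -> (on-mi-z g ⋆ inve) n == 1ˢ n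
 in-⋆ zr = &-idˡ _
 in-⋆ (suc n) = ap2 _#_ (&-idˡ _ » ho-⋆ n 0) (⋆-co (\ k -> neg (g k)) (\ _ -> rfl) n » ⋆-scaleˡ (~ 1q) g inve n) »
  cg (((\ m -> g m) ⋆ inve) n #_) (sym (neg _)) » ~-invʳ _
  where
  opaque
   unfolding _#_
   neg : ∀ x -> ~ x == ~ 1q & x
   neg = slv ℚ-ri

 -- The logarithmic derivative of the determinant identity det(1 - zA)/det(1 - zK) = 1 - z uᵀ(1 -
 -- zK)⁻¹v, with the determinants eliminated.
 di-lD : LD (on-mi-z g) (di 0)
 di-lD n = ⋆-co (\ _ -> rfl) (\ k -> di-⋆ k 0 » ⋆-com (wei 0) inve k) n »
  sym (⋆-as (on-mi-z g) inve (wei 0) n) » ⋆-co in-⋆ (\ _ -> rfl) n » ⋆-1ˡ (wei 0) n » lem (ι (suc n)) (g n)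
  where
  opaque
   unfolding _#_
   lem : ∀ a b -> a & b == ~ (a & ~ b)
   lem = slv ℚ-ri

ho-lo : ∀ g g' k p -> (∀ m -> m ≤ p + k -> g m == g' m) -> ho g p k == ho g' p k
ho-lo g g' zr p eq = eq p (m≤m+n p 0)
ho-lo g g' (suc k) p eq = ap2 _#_ (ho-lo g g' k (suc p) (\ m l -> eq m (≤t l (≤r (sym (+-suc p k))))))
 (ap2 _&_ (eq p (m≤m+n p _)) (ho-lo g g' k 0 (\ m l -> eq m (≤t l (≤t (n≤1+n k) (m≤n+m (suc k) p))))))

di-lo : ∀ g g' i q -> (∀ m -> m ≤ q + i -> g m == g' m) -> di g q i == di g' q i
di-lo g g' zr q eq = ho-lo g g' 0 q eq
di-lo g g' (suc i) q eq = ap2 _#_ (ho-lo g g' (suc i) q eq)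
 (di-lo g g' i (suc q) (\ m l -> eq m (≤t l (≤r (sym (+-suc q i))))))

module Sy (t : ℚ) where

 el homogeneous hat : List ℚ -> Ser
 el [] = 1ˢ
 el (x ∷ xs) = mul x (el xs)
 homogeneous [] m = 1ˢ m
 homogeneous (x ∷ xs) zr = 1q
 homogeneous (x ∷ xs) (suc m) = homogeneous xs (suc m) # x & homogeneous (x ∷ xs) m
 hat xs m = po t m & homogeneous xs m

 pS : List ℚ -> Ser
 pS [] n = 0q
 pS (x ∷ xs) n = pS xs n # po x (suc n)

 -- Chosen so that (1 - t)(1 - z ju) = Π (1 - xz)/(1 - txz) - t; the recursion clears the
 -- denominator of one variable, see `mu-Q` and `sc-ju`.
 ju : List ℚ -> Ser
 ju [] n = 0q
 ju (x ∷ xs) zr = ju xs 0 # x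
 ju (x ∷ xs) (suc n) = ju xs (suc n) # (t & x & ju (x ∷ xs) n # ~ (x & ju xs n))

 -- The sum t + t² + ... + tᵐ, which is the weight of the marks and of the block itself for a block
 -- of m + 1 letters.
 ge : ℕ -> ℚ
 ge zr = 0q
 ge (suc m) = ge m # po t (suc m)

 blo : List ℚ -> Ser
 blo xs n = homogeneous xs (suc n) & ge n

 homogeneous-0 : ∀ xs -> homogeneous xs 0 == 1q
 homogeneous-0 [] = rfl
 homogeneous-0 (x ∷ xs) = rfl

 private
  opaque
   unfolding _#_
   a1 : ∀ a b -> a # b # ~ b == a
   a1 = slv ℚ-ri
   a2 : ∀ t p a b x -> t & p & (a # x & b) # ~ (t & x & (p & b)) == t & p & a
   a2 = slv ℚ-ri
   a3 : ∀ t j x -> ~ ((1q # ~ t) & (j # x)) # ~ (t & x & 1q) == ~ ((1q # ~ t) & j) # ~ (x & 1q)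
   a3 = slv ℚ-ri
   a4 : ∀ t x a b c -> ~ ((1q # ~ t) & (a # (t & x & b # ~ (x & c)))) # ~ (t & x & ~ ((1q # ~ t) & b))
    == ~ ((1q # ~ t) & a) # ~ (x & ~ ((1q # ~ t) & c))
   a4 = slv ℚ-ri
   a5 : ∀ t -> ~ ((1q # ~ t) & 0q) == 0q
   a5 = slv ℚ-ri
   a7 : ∀ g p t -> (1q # ~ t) & (g # t & p) == (1q # ~ t) & g # t & p # ~ (t & (t & p))
   a7 = slv ℚ-ri
   a8 : ∀ t p -> t # ~ p # p # ~ (t & p) == t # ~ (t & p)
   a8 = slv ℚ-ri
   a9 : ∀ t -> (1q # ~ t) & 0q == t # ~ (t & 1q)
   a9 = slv ℚ-ri
   b1 : ∀ t -> (1q # ~ t) & 1q == 1q & 1q # ~ t & 1q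
   b1 = slv ℚ-ri
   b2 : ∀ t h g -> (1q # ~ t) & ~ (h & g) == ~ (h & ((1q # ~ t) & g))
   b2 = slv ℚ-ri
   b3 : ∀ t h p -> ~ (h & (t # ~ p)) == p & h # ~ t & h
   b3 = slv ℚ-ri
   b4 : ∀ t -> (1q # ~ t) & 1q == 1q # ~ t & 1q
   b4 = slv ℚ-ri
   b5 : ∀ t x -> (1q # ~ t) & ~ x == ~ ((1q # ~ t) & x) # ~ t & 0q
   b5 = slv ℚ-ri
   b6 : ∀ t -> 1q # ~ t == 0q -> t == 1q
   b6 t e = sym (⊝≡0 1q t e)

 mu-ho : ∀ x xs m -> mul x (homogeneous (x ∷ xs)) m == homogeneous xs m
 mu-ho x xs zr = sym (homogeneous-0 xs)
 mu-ho x xs (suc m) = a1 _ _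

 mu-ha : ∀ x xs m -> mul (t & x) (hat (x ∷ xs)) m == hat xs m
 mu-ha x xs zr = cg (1q &_) (sym (homogeneous-0 xs))
 mu-ha x xs (suc m) = a2 t (po t m) (homogeneous xs (suc m)) (homogeneous (x ∷ xs) m) x

 el-ho : ∀ xs n -> (el xs ⋆ homogeneous xs) n == 1ˢ n
 el-ho [] n = ⋆-1ˡ 1ˢ n
 el-ho (x ∷ xs) n = mu-⋆ˡ x (el xs) (homogeneous (x ∷ xs)) n » sym (mu-⋆ʳ x (el xs) (homogeneous (x ∷ xs)) n) »
  ⋆-co (\ _ -> rfl) (mu-ho x xs) n » el-ho xs n

 Q : List ℚ -> Ser
 Q xs zr = 1q
 Q xs (suc n) = ~ ((1q # ~ t) & ju xs n)

 mu-Q : ∀ x xs n -> mul (t & x) (Q (x ∷ xs)) n == mul x (Q xs) n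
 mu-Q x xs zr = rfl
 mu-Q x xs (suc zr) = a3 t (ju xs 0) x
 mu-Q x xs (suc (suc n)) = a4 t x (ju xs (suc n)) (ju (x ∷ xs) n) (ju xs n)

 Q≡ : ∀ xs n -> Q xs n == (el xs ⋆ hat xs) n
 Q≡ [] zr = sym (&-idˡ _ » &-idˡ _)
 Q≡ [] (suc n) = a5 t » sym (⋆-1ˡ (hat []) (suc n) » &-zeroʳ _)
 Q≡ (x ∷ xs) n = mu-in (t & x) (\ k -> mu-Q x xs k » mu-co x (Q≡ xs) k » sym (sym (mu-⋆ʳ (t & x) (el (x ∷ xs)) (hat (x ∷ xs)) k) »
  ⋆-co (\ _ -> rfl) (mu-ha x xs) k » mu-⋆ˡ x (el xs) (hat xs) k)) n

 ge-su : ∀ m -> (1q # ~ t) & ge m == t # ~ po t (suc m)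
 ge-su zr = a9 t
 ge-su (suc m) = a7 (ge m) (po t m) t » cg (\ z -> z # t & po t m # ~ (t & (t & po t m))) (ge-su m) » a8 t (t & po t m)

 sc-bl : ∀ xs n -> (1q # ~ t) & on-mi-z (blo xs) n == hat xs n # ~ t & homogeneous xs n
 sc-bl xs zr = b1 t » ap2 (\ a b -> 1q & a # ~ t & b) (sym (homogeneous-0 xs)) (sym (homogeneous-0 xs))
 sc-bl xs (suc n) = b2 t (homogeneous xs (suc n)) (ge n) » cg (\ z -> ~ (homogeneous xs (suc n) & z)) (ge-su n) »
  b3 t (homogeneous xs (suc n)) (po t (suc n))

 sc-ju : ∀ xs n -> (1q # ~ t) & on-mi-z (ju xs) n == Q xs n # ~ t & 1ˢ n
 sc-ju xs zr = b4 t
 sc-ju xs (suc n) = b5 t (ju xs n)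

 -- Multiplied by 1 - t, the factor 1 - z blo becomes H(tz) - tH(z) by `sc-bl`. Its product with Π
 -- (1 - xz) = 1/H(z) is the series of `sc-ju`. Cancelling 1 - t is what requires t ≠ 1.
 fa : t ≢ 1q -> ∀ xs n -> on-mi-z (ju xs) n == (el xs ⋆ on-mi-z (blo xs)) n
 fa t≢1 xs n = &-ca (\ e -> t≢1 (b6 t e)) (sc-ju xs n » sym (sym (⋆-scaleʳ (1q # ~ t) (el xs) (on-mi-z (blo xs)) n) »
  ⋆-co (\ _ -> rfl) (sc-bl xs) n » ⋆-addʳ (el xs) (hat xs) (\ k -> ~ t & homogeneous xs k) n »
   ap2 _#_ (sym (Q≡ xs n)) (⋆-scaleʳ (~ t) (el xs) (homogeneous xs) n » cg (~ t &_) (el-ho xs n))))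

 lD-el : ∀ xs w y -> LD w y -> LD (el xs ⋆ w) (\ n -> y n # pS xs n)
 lD-el [] w y p n = ⋆-co (⋆-1ˡ w) (\ k -> #-idʳ (y k)) n » p n » cg (\ z -> ~ (ι (suc n) & z)) (sym (⋆-1ˡ w (suc n)))
 lD-el (x ∷ xs) w y p n = ⋆-co (mu-⋆ˡ x (el xs) w) (\ k -> sym (#-as (y k) (pS xs k) (po x (suc k)))) n »
  lD-mu x (el xs ⋆ w) (\ n -> y n # pS xs n) (lD-el xs w y p) n »
   cg (\ z -> ~ (ι (suc n) & z)) (sym (mu-⋆ˡ x (el xs) w (suc n)))

 el-0 : ∀ xs -> el xs 0 == 1q
 el-0 [] = rfl
 el-0 (x ∷ xs) = el-0 xs

 -- The logarithmic derivative of `fa`: the factor Π (1 - xz) contributes the power sums. On the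
 -- side of the tilings they will be accounted for by constant cycles.
 ju-bl : t ≢ 1q -> ∀ xs n -> di (ju xs) 0 n == di (blo xs) 0 n # pS xs n
 ju-bl t≢1 xs n = lD-un (el xs ⋆ on-mi-z (blo xs)) _ _ (&-idʳ _ » el-0 xs)
  (\ k -> ⋆-co (\ m -> sym (fa t≢1 xs m)) (\ _ -> rfl) k » di-lD (ju xs) k »
   cg (\ z -> ~ (ι (suc k) & z)) (fa t≢1 xs (suc k)))
  (lD-el xs _ _ (di-lD (blo xs))) n

-- Traces of powers and products of matrices along cycles.

∏ : ∀ {n} -> (Fin n -> ℚ) -> ℚ
∏ {zr} f = 1q
∏ {suc n} f = f zr & ∏ (f ∘ suc)

∏-co : ∀ {n} {f g : Fin n -> ℚ} -> (∀ i -> f i == g i) -> ∏ f == ∏ g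
∏-co {zr} p = rfl
∏-co {suc n} p = ap2 _&_ (p zr) (∏-co (p ∘ suc))

∏-& : ∀ {n} (f g : Fin n -> ℚ) -> ∏ (\ i -> f i & g i) == ∏ f & ∏ g
∏-& {zr} f g = sym (&-idˡ 1q)
∏-& {suc n} f g = cg (f zr & g zr &_) (∏-& (f ∘ suc) (g ∘ suc)) » &-4 _ _ _ _

Ʃ-∏-at : ∀ {Y : Set} ⦃ _ : Fi Y ⦄ {q} (c : Y -> ℚ) (u : Y -> Fin q -> ℚ) (w : Fin q -> ℚ) (a : Fin q) ->
 (∀ y j -> j ≢ a -> u y j == w j) -> Ʃ (\ y -> c y & u y a) == w a -> Ʃ (\ y -> c y & ∏ (u y)) == ∏ w
Ʃ-∏-at c u w zr sa at = Ʃ-co (\ y -> sym (&-as (c y) (u y zr) _) »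
 cg (c y & u y zr &_) (∏-co (\ j -> sa y (suc j) (\ ())))) » Ʃ-*ʳ (∏ (w ∘ suc)) _ » cg (_& ∏ (w ∘ suc)) at
Ʃ-∏-at c u w (suc a) sa at = Ʃ-co (\ y -> &-sw (c y) (u y zr) _ » cg (_& (c y & ∏ (u y ∘ suc))) (sa y zr (\ ()))) »
 Ʃ-*ˡ (w zr) _ » cg (w zr &_) (Ʃ-∏-at c (\ y -> u y ∘ suc) (w ∘ suc) a (\ y j ne -> sa y (suc j) (\ { rfl -> ne rfl })) at)

module _ {Y : Set} ⦃ _ : Fi Y ⦄ where

 Mat : Set
 Mat = Y -> Y -> ℚ

 infixl 7 _⊙_
 _⊙_ : Mat -> Mat -> Mat
 (M ⊙ N) y z = Ʃ (\ w -> M y w & N w z)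

 tr : Mat -> ℚ
 tr M = Ʃ (\ y -> M y y)

 pw : Mat -> ℕ -> Mat
 pw M zr y z = δ (eq? y z)
 pw M (suc k) = M ⊙ pw M k

 dot : (Y -> ℚ) -> (Y -> ℚ) -> ℚ
 dot u v = Ʃ (\ y -> u y & v y)

 row : (Y -> ℚ) -> Mat -> Y -> ℚ
 row u M z = dot u (\ y -> M y z)

 col : Mat -> (Y -> ℚ) -> Y -> ℚ
 col M v y = dot (M y) v

 do-ro : ∀ u M v -> dot (row u M) v == dot u (col M v)
 do-ro u M v = Ʃ-co (\ z -> sym (Ʃ-*ʳ (v z) _) » Ʃ-co (\ y -> &-as (u y) (M y z) (v z))) »
  Ʃ-sw _ » Ʃ-co (\ y -> Ʃ-*ˡ (u y) _)

 ⊙-as : ∀ L M N y z -> ((L ⊙ M) ⊙ N) y z == (L ⊙ (M ⊙ N)) y z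
 ⊙-as L M N y z = do-ro (L y) M (\ w -> N w z)

 ⊙-congʳ : ∀ (L : Mat) {M M' : Mat} -> (∀ y z -> M y z == M' y z) -> ∀ y z -> (L ⊙ M) y z == (L ⊙ M') y z
 ⊙-congʳ L q y z = Ʃ-co (\ w -> cg (L y w &_) (q w z))

 pw-+ : ∀ M a b y z -> (pw M a ⊙ pw M b) y z == pw M (a + b) y z
 pw-+ M zr b y z = Ʃ-δ' y (\ w -> pw M b w z)
 pw-+ M (suc a) b y z = ⊙-as M (pw M a) (pw M b) y z » ⊙-congʳ M (pw-+ M a b) y z

 pw-co : ∀ M k y z -> (pw M k ⊙ M) y z == pw M (suc k) y z
 pw-co M zr y z = Ʃ-δ' y (\ w -> M w z) » sym (Ʃ-co (\ w -> &-co (M y w) (δ (eq? w z))) » Ʃ-δ z (M y))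
 pw-co M (suc k) y z = ⊙-as M (pw M k) M y z » ⊙-congʳ M (pw-co M k) y z

 pw-con : ∀ {M M' : Mat} -> (∀ y z -> M y z == M' y z) -> ∀ k y z -> pw M k y z == pw M' k y z
 pw-con p zr y z = rfl
 pw-con p (suc k) y z = Ʃ-co (\ w -> ap2 _&_ (p y w) (pw-con p k w z))

 tr-co : ∀ {M M' : Mat} -> (∀ y z -> M y z == M' y z) -> ∀ k -> tr (pw M k) == tr (pw M' k)
 tr-co p k = Ʃ-co (\ y -> pw-con p k y y)

 module Tr (T : Mat) (ra : Y -> ℕ) (upp : ∀ y z -> y ≢ z -> ¬ ra y < ra z -> T y z == 0q) where

  pw-up : ∀ k y z -> y ≢ z -> ¬ ra y < ra z -> pw T k y z == 0q
  pw-up zr y z ne nl = δ-no (eq? y z) ne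
  pw-up (suc k) y z ne nl = Ʃ-0 (\ w -> go w (eq? w y) (ra y <?ℕ ra w))
   where
   go : ∀ w -> Dec (w == y) -> Dec (ra y < ra w) -> T y w & pw T k w z == 0q
   go w (yes rfl) _ = cg (T y y &_) (pw-up k y z ne nl) » &-zeroʳ _
   go w (no f) (no nl') = cg (_& pw T k w z) (upp y w (f ∘ sym) nl') » &-zeroˡ _
   go w (no f) (yes l) = cg (T y w &_) (pw-up k w z (\ { rfl -> nl l }) (\ l' -> nl (<-trans l l'))) » &-zeroʳ _

  pw-di : ∀ k y -> pw T k y y == po (T y y) k
  pw-di zr y = δ-ye (eq? y y) rfl
  pw-di (suc k) y = Ʃ-co (\ w -> go w (eq? w y) (ra y <?ℕ ra w)) » Ʃ-δ y (\ w -> T y w & pw T k w y) » cg (T y y &_) (pw-di k y)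
   where
   go : ∀ w (d : Dec (w == y)) -> Dec (ra y < ra w) -> T y w & pw T k w y == δ d & (T y w & pw T k w y)
   go w (yes e) _ = sym (cg (_& _) (δ-ye (yes e) e) » &-idˡ _)
   go w (no f) (no nl') = cg (_& pw T k w y) (upp y w (f ∘ sym) nl') » &-zeroˡ _ » sym (cg (_& _) (δ-no (no f) f) » &-zeroˡ _)
   go w (no f) (yes l) = cg (T y w &_) (pw-up k w y f (\ l' -> <-irrefl rfl (<-trans l l'))) » &-zeroʳ _ » sym (cg (_& _) (δ-no (no f) f) » &-zeroˡ _)

  tr-pw : ∀ k -> tr (pw T k) == Ʃ (\ y -> po (T y y) k)
  tr-pw k = Ʃ-co (pw-di k)

 module RO (A K : Mat) (v u : Y -> ℚ) (split : ∀ y z -> A y z == K y z # v y & u z) where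

  Kv : ℕ -> Y -> ℚ
  Kv p = col (pw K p) v

  Kv-0 : ∀ y -> Kv 0 y == v y
  Kv-0 y = Ʃ-δ' y v

  Kv-su : ∀ p y -> Kv (suc p) y == col K (Kv p) y
  Kv-su p y = do-ro (K y) (pw K p) v

  g : Ser
  g p = dot u (Kv p)

  uA : ℕ -> Y -> ℚ
  uA k = row u (pw A k)

  co-A : ∀ x y -> col A x y == col K x y # v y & dot u x
  co-A x y = Ʃ-co (\ z -> cg (_& x z) (split y z) » &-distribʳ (x z) (K y z) (v y & u z) » cg (K y z & x z #_) (&-as (v y) (u z) (x z))) »
   Ʃ-# _ _ » cg (col K x y #_) (Ʃ-*ˡ (v y) _)

  do-# : ∀ r x y c -> dot r (\ w -> x w # y w & c) == dot r x # c & dot r y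
  do-# r x y c = Ʃ-co (\ w -> &-distribˡ (r w) (x w) (y w & c) » cg (r w & x w #_) (sym (&-as (r w) (y w) c) » &-co _ c)) »
   Ʃ-# _ _ » cg (dot r x #_) (Ʃ-*ˡ c _)

  do-uA : ∀ k p -> dot (uA k) (Kv p) == ho g p k
  do-uA zr p = Ʃ-co (\ w -> cg (_& Kv p w) (Ʃ-co (\ y -> &-co (u y) (δ (eq? y w))) » Ʃ-δ w u))
  do-uA (suc k) p = begin
   dot (uA (suc k)) (Kv p) ≡⟨ Ʃ-co (\ w -> cg (_& Kv p w) (Ʃ-co (\ y -> cg (u y &_) (sym (pw-co A k y w))) » sym (do-ro u (pw A k) (\ x -> A x w)))) ⟩
   dot (row (uA k) A) (Kv p) ≡⟨ do-ro (uA k) A (Kv p) ⟩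
   dot (uA k) (col A (Kv p)) ≡⟨ Ʃ-co (\ w -> cg (uA k w &_) (co-A (Kv p) w » ap2 _#_ (sym (Kv-su p w)) (cg (_& g p) (sym (Kv-0 w))))) ⟩
   dot (uA k) (\ w -> Kv (suc p) w # Kv 0 w & g p) ≡⟨ do-# (uA k) (Kv (suc p)) (Kv 0) (g p) ⟩
   dot (uA k) (Kv (suc p)) # g p & dot (uA k) (Kv 0) ≡⟨ ap2 (\ a b -> a # g p & b) (do-uA k (suc p)) (do-uA k 0) ⟩
   ho g p (suc k) ∎
   where open ≡-Reasoning

  -- One factor A is replaced by K. The trace of the remainder, of rank one, is the scalar
  -- `ho g p k`.
  exch : ∀ p k -> tr (pw K p ⊙ pw A (suc k)) == ho g p k # tr (pw K (suc p) ⊙ pw A k)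
  exch p k = Ʃ-co poi » Ʃ-# _ _ » cg (_# tr (pw K (suc p) ⊙ pw A k)) (do-uA k p)
   where
   poi : ∀ w -> (pw K p ⊙ pw A (suc k)) w w == uA k w & Kv p w # (pw K (suc p) ⊙ pw A k) w w
   poi w = Ʃ-co (\ y -> cg (pw K p w y &_) (co-A (\ z -> pw A k z w) y)) »
    do-# (pw K p w) (col K (\ z -> pw A k z w)) v (uA k w) » #-co _ _ » cg (uA k w & Kv p w #_)
     (sym (⊙-as (pw K p) K (pw A k) w w) » Ʃ-co (\ x -> cg (_& pw A k x w) (pw-co K p w x)))

  tr-ex : ∀ i p -> tr (pw K p ⊙ pw A (suc i)) == di g p i # tr (pw K (p + suc i))
  tr-ex zr p = exch p 0 » cg (ho g p 0 #_) (Ʃ-co (\ w -> Ʃ-co (\ y -> &-co (pw K (suc p) w y) (δ (eq? y w))) »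
   Ʃ-δ w (pw K (suc p) w) » cg (\ m -> pw K m w w) (+-comm 1 p)))
  tr-ex (suc i) p = exch p (suc i) » cg (ho g p (suc i) #_) (tr-ex i (suc p) »
   cg (\ m -> di g (suc p) i # tr (pw K m)) (sym (+-suc p (suc i)))) » sym (#-as _ _ _)

  tr-pw : ∀ i -> tr (pw A (suc i)) == tr (pw K (suc i)) # di g 0 i
  tr-pw i = Ʃ-co (\ w -> sym (Ʃ-δ' w (\ y -> pw A (suc i) y w))) » tr-ex i 0 » #-co _ _

sk : ∀ {q} -> Fin (suc q) -> Fin (suc q) -> Fin q -> Fin q
sk (suc x) _ _ = x
sk zr (suc a) _ = a
-- Here both 0 and another point are mapped to 0, which an injective map excludes; the value is
-- arbitrary.
sk zr zr j = j

by : ∀ {q} -> (Fin (suc q) -> Fin (suc q)) -> Fin q -> Fin q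
by f j = sk (f (suc j)) (f zr) j

module _ {q : ℕ} (f : Fin (suc q) -> Fin (suc q)) where

 byp-inj : (∀ {i j} -> f i == f j -> i == j) -> ∀ {i j} -> by f i == by f j -> i == j
 byp-inj inj {i} {j} e with f (suc i) in p | f (suc j) in r | f zr in z
 ... | suc x | suc y | _ = su-in (inj (p » cg suc e » sym r))
  where
  su-in : ∀ {n} {i j : Fin n} -> suc i == suc j -> i == j
  su-in rfl = rfl
 ... | zr | zr | suc a = case inj (p » sym r) of \ { rfl -> rfl }
 ... | zr | _ | zr = case inj (p » sym z) of \ ()
 ... | _ | zr | zr = case inj (r » sym z) of \ ()
 ... | suc x | zr | suc a = case inj (p » cg suc e » sym z) of \ ()
 ... | zr | suc y | suc a = case inj (r » cg suc (sym e) » sym z) of \ ()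

 by-in : {Θ : Set} (θ : Fin (suc q) -> Θ) -> (∀ i -> θ (f i) == θ i) -> ∀ j -> θ (suc (by f j)) == θ (suc j)
 by-in θ inv j with f (suc j) in p | f zr in z
 ... | suc x | _ = cg θ (sym p) » inv (suc j)
 ... | zr | suc a = cg θ (sym z) » inv zr » cg θ (sym p) » inv (suc j)
 ... | zr | zr = rfl

-- The exponents are stored minus one. A predecessor of the bypassed point 0 absorbs its full
-- exponent.
leng : ∀ {q} -> (Fin (suc q) -> Fin (suc q)) -> (Fin (suc q) -> ℕ) -> Fin q -> ℕ
leng f k j = k (suc j) + wh (f (suc j) ≟F zr) (suc (k zr))

module Clo {Θ Y : Set} ⦃ _ : Fi Y ⦄ (P : Θ -> Mat {Y}) where

 clo : ∀ q -> (Fin q -> Fin q) -> (Fin q -> Θ) -> (Fin q -> ℕ) -> ℚ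
 clo q f θ k = Ʃ {Vec Y q} (\ D -> ∏ (\ i -> pw (P (θ i)) (suc (k i)) (lk D i) (lk D (f i))))

 module _ {q} (f : Fin (suc q) -> Fin (suc q)) (θ : Fin (suc q) -> Θ) (k : Fin (suc q) -> ℕ) where

  fa : Y -> Vec Y q -> Fin q -> ℚ
  fa y D j = pw (P (θ (suc j))) (suc (k (suc j))) (lk D j) (lk (y ∷ D) (f (suc j)))

  fa' : Vec Y q -> Fin q -> ℚ
  fa' D j = pw (P (θ (suc j))) (suc (leng f k j)) (lk D j) (lk D (by f j))

  factor≡ : ∀ y D j -> f (suc j) ≢ zr -> fa y D j == fa' D j
  factor≡ y D j ne with f (suc j)
  ... | zr = absurd rfl ne
  ... | suc x = cg (\ m -> pw (P (θ (suc j))) (suc m) (lk D j) (lk D x)) (sym (+-idr (k (suc j))))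

  unf : clo (suc q) f θ k == Ʃ (\ D -> Ʃ (\ y -> pw (P (θ zr)) (suc (k zr)) y (lk (y ∷ D) (f zr)) & ∏ (fa y D)))
  unf = Ʃ-∷ _ » Ʃ-sw _

  cl-lo : f zr == zr -> (∀ j -> f (suc j) ≢ zr) ->
   clo (suc q) f θ k == tr (pw (P (θ zr)) (suc (k zr))) & clo q (by f) (θ ∘ suc) (leng f k)
  cl-lo e ne = unf » Ʃ-co (\ D -> Ʃ-co (\ y -> ap2 _&_ (cg (\ z -> pw (P (θ zr)) (suc (k zr)) y (lk (y ∷ D) z)) e)
   (∏-co (\ j -> factor≡ y D j (ne j)))) » Ʃ-*ʳ (∏ (fa' D)) _) » Ʃ-*ˡ (tr (pw (P (θ zr)) (suc (k zr)))) _

  cl-ar : ∀ a j -> f zr == suc a -> f (suc j) == zr -> (∀ i -> f (suc i) == zr -> i == j) -> (∀ i -> θ (f i) == θ i) ->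
   clo (suc q) f θ k == clo q (by f) (θ ∘ suc) (leng f k)
  cl-ar a j e0 ej on inv = unf » Ʃ-co (\ D -> Ʃ-co (\ y -> cg (\ z -> pw (P (θ zr)) (suc (k zr)) y (lk (y ∷ D) z) & ∏ (fa y D)) e0) »
   Ʃ-∏-at (\ y -> pw (P (θ zr)) (suc (k zr)) y (lk D a)) (\ y -> fa y D) (fa' D) j (\ y i ne -> factor≡ y D i (\ z -> ne (on i z))) (at D))
   where
   at : ∀ D -> Ʃ (\ y -> pw (P (θ zr)) (suc (k zr)) y (lk D a) & fa y D j) == fa' D j
   at D rewrite e0 | ej | sym (inv (suc j)) | ej = Ʃ-co (\ y -> &-co (pw (P (θ zr)) (suc (k zr)) y (lk D a)) _) »
    pw-+ (P (θ zr)) (suc (k (suc j))) (suc (k zr)) (lk D j) (lk D a)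

-- A product of matrices along the cycles of a map is a product of traces of powers, so equal traces give equal sums.
module Com {Θ Y₁ Y₂ : Set} ⦃ _ : Fi Y₁ ⦄ ⦃ _ : Fi Y₂ ⦄ (P₁ : Θ -> Mat {Y₁}) (P₂ : Θ -> Mat {Y₂}) (n : ℕ)
 (trac : ∀ θ k -> k < n -> tr (pw (P₁ θ) (suc k)) == tr (pw (P₂ θ) (suc k))) where
 private
  module C₁ = Clo P₁
  module C₂ = Clo P₂

 ι-ca-≤ : ∀ {a b} -> ι a ≤ᵠ ι b -> a ≤ b
 ι-ca-≤ {a} {b} p = ≮⇒≥ (\ l -> ℚP.<-irrefl rfl (ℚP.<-≤-trans (ι-mo-< l) p))

 -- Points are removed one at a time: a loop splits off a trace, any other point is summed away and
 -- merges two powers. The exponents never add up to more than n, so no trace of a higher power is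
 -- asked for.
 compa : ∀ q (f : Fin q -> Fin q) (θ : Fin q -> Θ) (k : Fin q -> ℕ) -> (∀ {i j} -> f i == f j -> i == j) -> (∀ i -> θ (f i) == θ i) ->
  Ʃ (\ i -> ι (suc (k i))) ≤ᵠ ι n -> C₁.clo q f θ k == C₂.clo q f θ k
 compa zr f θ k inj inv b = sin Y₁ » sym (sin Y₂)
  where
  sin : ∀ (Y : Set) ⦃ _ : Fi Y ⦄ -> Ʃ {Vec Y 0} (\ _ -> 1q) == 1q
  sin Y = Ʃ-[] _
 compa (suc q) f θ k inj inv b = go (f zr) rfl (bij ·⁻ zr) rfl
  where
  bij = fst (bi f inj)
  to' : Ʃ (\ i -> ι (suc (k i))) == ι (suc (k zr)) # Ʃ (\ j -> ι (suc (k (suc j))))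
  to' = Ʃ-Fi _
  ih : Ʃ (\ i -> ι (suc (leng f k i))) ≤ᵠ ι n -> C₁.clo q (by f) (θ ∘ suc) (leng f k) == C₂.clo q (by f) (θ ∘ suc) (leng f k)
  ih = compa q (by f) (θ ∘ suc) (leng f k) (byp-inj f inj) (by-in f θ inv)
  lengt : Ʃ (\ i -> ι (suc (leng f k i))) == Ʃ (\ j -> ι (suc (k (suc j)))) # Ʃ (\ j -> δ (f (suc j) ≟F zr) & ι (suc (k zr)))
  lengt = Ʃ-co (\ j -> ι-+ (suc (k (suc j))) _ » cg (ι (suc (k (suc j))) #_) (ι-wh (f (suc j) ≟F zr) _)) » Ʃ-# _ _
  go : ∀ z -> f zr == z -> ∀ p -> p == bij ·⁻ zr -> C₁.clo (suc q) f θ k == C₂.clo (suc q) f θ k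
  go zr e p _ = C₁.cl-lo f θ k e ne » ap2 _&_ (trac (θ zr) (k zr)
   (ι-ca-≤ (ℚP.≤-trans (subst (_≤ᵠ ι (suc (k zr)) # Ʃ (\ j -> ι (suc (k (suc j))))) (#-idʳ _) (#-mo-≤ ℚP.≤-refl (Ʃ-≥0 (\ j -> ι-≥0 (suc (k (suc j))))))) b')))
   (ih (subst (_≤ᵠ ι n) (sym (lengt » cg (Ʃ (\ j -> ι (suc (k (suc j)))) #_) (Ʃ-0 (\ j -> cg (_& ι (suc (k zr))) (δ-no (f (suc j) ≟F zr) (ne j)) » &-zeroˡ _)) » #-idʳ _))
    (ℚP.≤-trans (subst (_≤ᵠ ι (suc (k zr)) # Ʃ (\ j -> ι (suc (k (suc j))))) (#-idˡ _) (#-mo-≤ (ι-≥0 (suc (k zr))) ℚP.≤-refl)) b'))) »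
   sym (C₂.cl-lo f θ k e ne)
   where
   ne : ∀ j -> f (suc j) ≢ zr
   ne j e' = case inj (e' » sym e) of \ ()
   b' = subst (_≤ᵠ ι n) to' b
  go (suc a) e zr ep = case trans (sym e) (sym (snd (bi f inj) zr) » cg (bij ·_) ep » ··⁻ bij zr) of \ ()
  go (suc a) e (suc j) ep = C₁.cl-ar f θ k a j e ej on inv » ih (subst (_≤ᵠ ι n) (to' » #-co _ _ » sym (lengt » cg (Ʃ (\ j -> ι (suc (k (suc j)))) #_)
   (Ʃ-po (\ i -> f (suc i) ≟F zr) j (\ _ -> ι (suc (k zr))) ej on))) b) »
   sym (C₂.cl-ar f θ k a j e ej on inv)
   where
   ej : f (suc j) == zr
   ej = sym (snd (bi f inj) (suc j)) » cg (bij ·_) ep » ··⁻ bij zr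
   on : ∀ i -> f (suc i) == zr -> i == j
   on i p = case inj (p » sym ej) of \ { rfl -> rfl }

-- The alphabets of bicoloured words and of tilings, and their transfer matrices.

import Data.Sum.Properties as SP

instance
 Fi-⊎ : {A B : Set} -> ⦃ Fi A ⦄ -> ⦃ Fi B ⦄ -> Fi (A ⊎ B)
 Fi-⊎ = record
  { els = mapL inl els ++ mapL inr els
  ;eq? = SP.≡-dec eq? eq?
  ;com = \ { (inl a) -> ∈P.∈-++⁺ˡ (∈P.∈-map⁺ inl (com a));(inr b) -> ∈P.∈-++⁺ʳ _ (∈P.∈-map⁺ inr (com b)) }
  ;unique = UP.++⁺ (UP.map⁺ SP.inj₁-injective unique) (UP.map⁺ SP.inj₂-injective unique) dis }
  where
  dis : ∀ {A B : Set} {xs : List A} {ys : List B} {v} -> ¬ (v ∈ mapL inl xs × v ∈ mapL inr ys)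
  dis (p , q) with ∈P.∈-map⁻ inl p | ∈P.∈-map⁻ inr q
  ... | _ , _ , rfl | _ , _ , ()

opaque
 unfolding Ʃ

 Ʃ-⊎ : {A B : Set} ⦃ _ : Fi A ⦄ ⦃ _ : Fi B ⦄ (f : A ⊎ B -> ℚ) -> Ʃ f == Ʃ (f ∘ inl) # Ʃ (f ∘ inr)
 Ʃ-⊎ f = ∑-++ (mapL inl els) (mapL inr els) f » ap2 _#_ (∑-ma inl els f) (∑-ma inr els f)

 Ʃ-Bo : (f : Bool -> ℚ) -> Ʃ f == f true # f false
 Ʃ-Bo f = cg (f true #_) (#-idʳ (f false))

δ-tr : ∀ {P : Set} (d : Dec P) {x : ℚ} -> P -> δ d & x == x
δ-tr d p = δ-* d (\ _ -> rfl) (\ ¬p -> absurd p ¬p)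

δ-fa : ∀ {P : Set} (d : Dec P) {x : ℚ} -> ¬ P -> δ d & x == 0q
δ-fa d ¬p = δ-* d (\ p -> absurd p ¬p) (\ _ -> rfl)

po-& : ∀ x y k -> po (x & y) k == po x k & po y k
po-& x y zr = sym (&-idˡ 1q)
po-& x y (suc k) = cg (x & y &_) (po-& x y k) » &-4 _ _ _ _

po-1 : ∀ k -> po 1q k == 1q
po-1 zr = rfl
po-1 (suc k) = &-idˡ _ » po-1 k

po-0 : ∀ k -> po 0q (suc k) == 0q
po-0 k = &-zeroˡ _

po-+ : ∀ x a b -> po x (a + b) == po x a & po x b
po-+ x zr b = sym (&-idˡ _)
po-+ x (suc a) b = cg (x &_) (po-+ x a b) » sym (&-as _ _ _)

po-* : ∀ x a b -> po x (a * b) == po (po x b) a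
po-* x zr b = rfl
po-* x (suc a) b = po-+ x b (a * b) » cg (po x b &_) (po-* x a b)

module _ (B : ℕ) where

 mo : ∀ {N} -> (Fin N -> ℚ) -> Vec (Fin (suc B)) N -> ℚ
 mo x [] = 1q
 mo x (a ∷ A) = po (x zr) (tn a) & mo (x ∘ suc) A

 mo-po : ∀ {N} (x : Fin N -> ℚ) A k -> po (mo x A) k == mo (\ i -> po (x i) k) A
 mo-po x [] k = po-1 k
 mo-po x (a ∷ A) k = po-& _ _ k » ap2 _&_ (sym (po-* (x zr) k (tn a)) » cg (po (x zr)) (*-comm k (tn a)) » po-* (x zr) (tn a) k)
  (mo-po (x ∘ suc) A k)

 siz : ∀ {N} -> Vec (Fin (suc B)) N -> ℕ
 siz A = « V.map tn A ¦

 ho-mo : ∀ t N (x : Fin N -> ℚ) m -> m ≤ B -> Ʃ (\ A -> δ (siz A ≟ℕ m) & mo x A) == Sy.homogeneous t (L.tabulate x) m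
 ho-mo t zr x m p = Ʃ-[] _ » go m
  where
  go : ∀ m -> δ (0 ≟ℕ m) & 1q == 1ˢ m
  go zr = δ-tr (0 ≟ℕ 0) rfl
  go (suc m) = δ-fa (0 ≟ℕ suc m) (\ ())
 ho-mo t (suc N) x m p = Ʃ-∷ _ » Ʃ-co (\ a -> Ʃ-co (\ A -> &-sw _ (po (x zr) (tn a)) _) » Ʃ-*ˡ _ _) » go B m p p
  where
  open Sy t using (homogeneous;homogeneous-0)
  xs = L.tabulate (x ∘ suc)
  tai : ℕ -> ℕ -> ℚ
  tai a m = Ʃ (\ A -> δ (a + siz A ≟ℕ m) & mo (x ∘ suc) A)
  ta-su : ∀ a m -> tai (suc a) (suc m) == tai a m
  ta-su a m = Ʃ-co (\ A -> cg (_& mo (x ∘ suc) A) (δ-⇔ _ _ suc-injective (cg suc)))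
  go : ∀ c m -> m ≤ c -> m ≤ B -> Ʃ (\ (a : Fin (suc c)) -> po (x zr) (tn a) & tai (tn a) m) == homogeneous (x zr ∷ xs) m
  go c zr q p = Ʃ-Fi _ » ap2 _#_ (&-idˡ _ » ho-mo t N (x ∘ suc) 0 z≤n » homogeneous-0 xs)
   (Ʃ-0 (\ a -> cg (po (x zr) (tn (suc a)) &_) (Ʃ-0 (\ A -> δ-fa (suc (tn a) + siz A ≟ℕ 0) (\ ()))) » &-zeroʳ _)) » #-idʳ _
  go (suc c) (suc m) (s≤s q) p = Ʃ-Fi _ » ap2 _#_ (&-idˡ _ » ho-mo t N (x ∘ suc) (suc m) p)
   (Ʃ-co (\ a -> &-as _ _ _ » cg (\ z -> x zr & (po (x zr) (tn a) & z)) (ta-su (tn a) m)) »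
    Ʃ-*ˡ (x zr) _ » cg (x zr &_) (go c m q (≤t (n≤1+n m) p)))

pS-Ʃ : ∀ t {N} (x : Fin N -> ℚ) k -> Sy.pS t (L.tabulate x) k == Ʃ (\ a -> po (x a) (suc k))
pS-Ʃ t {zr} x k = sym (Ʃ-Fin0 _)
pS-Ʃ t {suc N} x k = #-co _ _ » cg (po (x zr) (suc k) #_) (pS-Ʃ t (x ∘ suc) k) » sym (Ʃ-Fi _)

-- Applied to the number of letters on a cell, it detects the first cell of a block, since only such
-- a cell holds two letters or more.
iB : ℕ -> ℕ
iB zr = 0
iB (suc zr) = 0
iB (suc (suc _)) = 1

module Alp (n N : ℕ) where
 open Stan n N public using (Z;code;code-mono;code-inj;bicoloured)
 open Shap n n public using (Row)

 ∣_∣ : ∀ {K} -> Row K -> ℕ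
 ∣_∣ = siz n

 -- A cell of a tiling: how many cells of its block are still to come, then the multiplicities of
 -- its letters and of its marks. The first cell of a block stores all letters and marks of the
 -- block; the others are empty.
 Ti : Set
 Ti = Fin n × Row N × Row 2

 Y : Set
 Y = Ti ⊎ Z

 re : Ti -> ℕ
 re (r , _) = tn r

 Star Cont Si : Ti -> Set
 Star (r , A , A') = 1 ≤ tn r × ∣ A ∣ == suc (tn r) × suc ∣ A' ∣ == tn r
 Cont (r , A , A') = ∣ A ∣ == 0 × ∣ A' ∣ == 0
 Si (r , A , A') = tn r == 0 × ∣ A ∣ == 1 × ∣ A' ∣ == 0

 sta? : ∀ y -> Dec (Star y)
 sta? (r , A , A') = (1 ≤?ℕ tn r) ×-dec (∣ A ∣ ≟ℕ suc (tn r)) ×-dec (suc ∣ A' ∣ ≟ℕ tn r)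
 con? : ∀ y -> Dec (Cont y)
 con? (r , A , A') = (∣ A ∣ ≟ℕ 0) ×-dec (∣ A' ∣ ≟ℕ 0)
 si? : ∀ y -> Dec (Si y)
 si? (r , A , A') = (tn r ≟ℕ 0) ×-dec (∣ A ∣ ≟ℕ 1) ×-dec (∣ A' ∣ ≟ℕ 0)

 Res Pro : Ti -> Ti -> Set
 Res y z = re y == 0 × Star z
 Pro y z = suc (re z) == re y × Cont z

 res? : ∀ y z -> Dec (Res y z)
 res? y z = (re y ≟ℕ 0) ×-dec sta? z
 pro? : ∀ y z -> Dec (Pro y z)
 pro? y z = (suc (re z) ≟ℕ re y) ×-dec con? z

 -- Besides tiles, bicoloured letters may run around a cycle unchanged. These constant cycles supply
 -- the power sums by which the traces for words and for blocks differ; being periodic, they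
 -- disappear from primitive counts.
 Ne : Y -> Y -> Set
 Ne (inl y) (inl z) = Res y z ⊎ Pro y z
 Ne (inr y) (inr z) = y == z
 Ne _ _ = ⊥

 ne? : ∀ y z -> Dec (Ne y z)
 ne? (inl y) (inl z) = res? y z ⊎-dec pro? y z
 ne? (inr y) (inr z) = eq? y z
 ne? (inl y) (inr z) = no id
 ne? (inr y) (inl z) = no id

 FT : Y -> Set
 FT (inl y) = Si y
 FT (inr _) = ⊥

 fT? : ∀ y -> Dec (FT y)
 fT? (inl y) = si? y
 fT? (inr _) = no id

 ti : Lo Y
 ti = record { E = Ne;E? = ne?;F = FT;F? = fT? }

 mar : Row 2 -> ℕ
 mar (_ ∷ a ∷ []) = tn a

 bar : Bool -> ℕ
 bar true = 1
 bar false = 0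

 -- The exponent of t: the marks of the second kind, and one for each block.
 bars : Y -> ℕ
 bars (inl (_ , A , A')) = mar A' + iB ∣ A ∣
 bars (inr (_ , c)) = bar c

 module We (t : ℚ) (x : Fin N -> ℚ) where
  open Sy t

  xs = L.tabulate x

  wt : Y -> ℚ
  wt (inl (r , A , A')) = po t (bars (inl (r , A , A'))) & mo n x A
  wt (inr (a , c)) = po t (bar c) & x a

  wtZ : Z -> ℚ
  wtZ z = wt (inr z)

  mo-Z fi-Z : Mat {Z}
  mo-Z y z = wtZ y & δ (Lo.E? bicoloured y z)
  fi-Z y z = wtZ y & (δ (Lo.F? bicoloured y) & δ (eq? y z))

  mo-Y fi-Y : Mat {Y}
  mo-Y y z = wt y & δ (ne? y z)
  fi-Y y z = wt y & (δ (fT? y) & δ (eq? y z))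

  di-tr : ∀ {A : Set} ⦃ _ : Fi A ⦄ (w d : A -> ℚ) k ->
   tr (pw (\ y z -> w y & (d y & δ (eq? y z))) k) == Ʃ (\ y -> po (w y & d y) k)
  di-tr w d k = Tr.tr-pw _ (\ _ -> 0) (\ y z ne _ -> cg (\ e -> w y & (d y & e)) (δ-no (eq? y z) ne) » cg (w y &_) (&-zeroʳ _) » &-zeroʳ _) k »
   Ʃ-co (\ y -> cg (\ z -> po (w y & z) k) (cg (d y &_) (δ-ye (eq? y y) rfl) » &-idʳ _))

  -- Both traces are the power sum of degree k + 1. It comes from an unbarred letter on one side and
  -- from a tile with a single letter on the other.
  fi-tr : ∀ k -> k < n -> tr (pw fi-Z (suc k)) == tr (pw fi-Y (suc k))
  fi-tr k k<n = fi-tr-Z » sym fi-tr-Y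
   where
   fi-tr-Z : tr (pw fi-Z (suc k)) == Ʃ (\ a -> po (x a) (suc k))
   fi-tr-Z = di-tr wtZ (\ y -> δ (Lo.F? bicoloured y)) (suc k) » Ʃ-× _ » Ʃ-co (\ a -> Ʃ-Bo _ »
    ap2 _#_ (cg (\ z -> po z (suc k)) (cg (wtZ (a , true) &_) (δ-no _ (\ ())) » &-zeroʳ _) » po-0 k)
     (cg (\ z -> po z (suc k)) (cg (wtZ (a , false) &_) (δ-ye _ rfl) » &-idʳ _ » &-idˡ _)) » #-idˡ _)
   0<n : 0 < n
   0<n = ≤t (s≤s z≤n) k<n
   te : ∀ r A A' -> po (wt (inl (r , A , A')) & δ (si? (r , A , A'))) (suc k)
    == δ (eq? (r , A') (fromℕ< 0<n , zr ∷ zr ∷ [])) & (δ (∣ A ∣ ≟ℕ 1) & mo n (\ a -> po (x a) (suc k)) A)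
   te r A (a ∷ b ∷ []) with si? (r , A , a ∷ b ∷ [])
   ... | no ¬s = cg (\ z -> po z (suc k)) (cg (wt (inl (r , A , a ∷ b ∷ [])) &_) (δ-no (no ¬s) ¬s) » &-zeroʳ _) » po-0 k »
    sym (δ-* (eq? _ _) (\ { rfl -> δ-fa (∣ A ∣ ≟ℕ 1) (\ e -> ¬s (tn-fr 0<n , e , rfl)) }) (\ _ -> rfl))
   ... | yes (p , q , s) with tn-inj {j = zr} (fst (ze s)) | tn-inj {j = zr} (snd (ze s))
    where
    ze : tn a + (tn b + 0) == 0 -> tn a == 0 × tn b == 0
    ze e = n≤0⇒n≡0 (≤t (m≤m+n _ _) (≤r e)) , n≤0⇒n≡0 (≤t (≤t (m≤m+n _ _) (m≤n+m _ (tn a))) (≤r e))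
   ... | rfl | rfl = cg (\ z -> po z (suc k)) (cg (wt (inl (r , A , zr ∷ zr ∷ [])) &_) (δ-ye (yes (p , q , s)) (p , q , s)) »
    &-idʳ _ » cg (\ z -> po t (iB z) & mo n x A) q » &-idˡ _) » mo-po n x A (suc k) »
    sym (δ-tr (eq? _ _) (cg (_, zr ∷ zr ∷ []) (tn-inj (p » sym (tn-fr 0<n)))) » δ-tr (∣ A ∣ ≟ℕ 1) q)
   fi-tr-Y : tr (pw fi-Y (suc k)) == Ʃ (\ a -> po (x a) (suc k))
   fi-tr-Y = di-tr wt (\ y -> δ (fT? y)) (suc k) » Ʃ-⊎ _ » ap2 _#_ tiles
    (Ʃ-0 (\ z -> cg (\ w -> po w (suc k)) (cg (wtZ z &_) (δ-no _ id) » &-zeroʳ _) » po-0 k)) » #-idʳ _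
    where
    sing = Ʃ (\ A -> δ (∣ A ∣ ≟ℕ 1) & mo n (\ a -> po (x a) (suc k)) A)
    one : ∀ xs -> homogeneous xs 1 == ∑ xs id
    one [] = rfl
    one (x ∷ xs) = ap2 _#_ (one xs) (&-idʳ x) » #-co _ _
    ∑-tab : ∀ {N} (y : Fin N -> ℚ) -> ∑ (L.tabulate y) id == Ʃ y
    ∑-tab {zr} y = sym (Ʃ-Fin0 y)
    ∑-tab {suc N} y = cg (y zr #_) (∑-tab (y ∘ suc)) » sym (Ʃ-Fi y)
    tiles : Ʃ (\ y -> po (wt (inl y) & δ (si? y)) (suc k)) == Ʃ (\ a -> po (x a) (suc k))
    tiles = Ʃ-× _ » Ʃ-co (\ r -> Ʃ-× _ » Ʃ-sw _ » Ʃ-co (\ A' -> Ʃ-co (\ A -> te r A A') » Ʃ-*ˡ _ _)) »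
     sym (Ʃ-× _) » Ʃ-δ _ (\ _ -> sing) » ho-mo n t N _ 1 0<n » one (L.tabulate (\ a -> po (x a) (suc k))) » ∑-tab _

  -- Barred letters ascend; the descents of unbarred letters are the complement of strict ascents.
  module Bi where

   K : Mat {Z}
   K (a , true) (b , _) = t & x a & δ (tn a ≤?ℕ tn b)
   K (a , false) (b , _) = ~ (x a & δ (tn a <?ℕ tn b))

   v u : Z -> ℚ
   v (a , true) = 0q
   v (a , false) = x a
   u _ = 1q

   sp-Z : ∀ y z -> mo-Z y z == K y z # v y & u z
   sp-Z (a , true) (b , _) = cg (\ z -> z & x a & δ (tn a ≤?ℕ tn b)) (&-idʳ t) » sym (ap2 _#_ rfl (&-zeroˡ 1q) » #-idʳ _)
   sp-Z (a , false) (b , _) = go (tn b ≤?ℕ tn a) (tn a <?ℕ tn b)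
    where
    opaque
     unfolding _#_
     e1 : ∀ x -> 1q & x & 1q == ~ (x & 0q) # x & 1q
     e1 = slv ℚ-ri
     e2 : ∀ x -> 1q & x & 0q == ~ (x & 1q) # x & 1q
     e2 = slv ℚ-ri
    go : (p : Dec (tn b ≤ tn a)) (q : Dec (tn a < tn b)) -> 1q & x a & δ p == ~ (x a & δ q) # x a & 1q
    go (yes p) (yes q) = absurd p (<⇒≱ q)
    go (no p) (no q) = absurd (≮⇒≥ q) p
    go (yes p) (no q) = cg (1q & x a &_) (δ-ye (yes p) p) » e1 (x a) » cg (\ z -> ~ (x a & z) # x a & 1q) (sym (δ-no (no q) q))
    go (no p) (yes q) = cg (1q & x a &_) (δ-no (no p) p) » e2 (x a) » cg (\ z -> ~ (x a & z) # x a & 1q) (sym (δ-ye (yes q) q))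

   co-< : ∀ a b c d -> tn a < tn b -> code (a , c) < code (b , d)
   co-< a b c d l = ≰⇒> (\ p -> <⇒≱ l (code-mono (b , d) (a , c) p))

   upp : ∀ y z -> y ≢ z -> ¬ code y < code z -> K y z == 0q
   upp (a , true) (b , c) ne nl = cg (t & x a &_) (δ-no _ (\ l -> nl (≤∧≢⇒< (≤t (*-monoʳ-≤ 2 l) (tw c)) (ne ∘ code-inj (a , true) (b , c))))) » &-zeroʳ _
    where
    open import Data.Nat.Properties using (*-monoʳ-≤)
    tw : ∀ c -> 2 * tn b ≤ code (b , c)
    tw true = ≤=
    tw false = n≤1+n _
   upp (a , false) (b , c) ne nl = cg (\ z -> ~ (x a & z)) (δ-no _ (\ l -> nl (co-< a b false c l))) » neg0 (x a)
    where
    opaque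
     unfolding _#_
     neg0 : ∀ x -> ~ (x & 0q) == 0q
     neg0 = slv ℚ-ri

   tr-K : ∀ k -> tr (pw K (suc k)) == Ʃ (\ a -> po (t & x a) (suc k))
   tr-K k = Tr.tr-pw K code upp (suc k) » Ʃ-× _ » Ʃ-co (\ a -> Ʃ-Bo _ »
    ap2 _#_ (cg (\ z -> po z (suc k)) (cg (t & x a &_) (δ-ye _ ≤=) » &-idʳ _))
     (cg (\ z -> po z (suc k)) (cg (\ z -> ~ (x a & z)) (δ-no _ (<-irrefl rfl)) » neg0 (x a)) » po-0 k) » #-idʳ _)
    where
    opaque
     unfolding _#_
     neg0 : ∀ x -> ~ (x & 0q) == 0q
     neg0 = slv ℚ-ri

  -- The two colours of a letter are added up, which is possible because the next step does not see
  -- the colour of its target; the transfer matrix collapses to the alphabet without bars.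
  wa : ∀ {N} -> (Fin N -> ℚ) -> ℕ -> Fin N -> ℚ
  wa x zr a = x a
  wa x (suc p) a = Ʃ (\ b -> (t & x a & δ (tn a ≤?ℕ tn b) # ~ (x a & δ (tn a <?ℕ tn b))) & wa x p b)

  private
   opaque
    unfolding _#_
    w0 : ∀ t x w -> (t & x & 0q # ~ (x & 0q)) & w == 0q
    w0 = slv ℚ-ri
    w1 : ∀ t x w -> (t & x & 1q # ~ (x & 0q)) & w == t & x & w
    w1 = slv ℚ-ri
    w2 : ∀ t x w -> (t & x & 1q # ~ (x & 1q)) & w == (t & x # ~ x) & w
    w2 = slv ℚ-ri
    w3 : ∀ t x w s j -> t & x & w # (t & x # ~ x) & s # j == j # (t & x & (w # s) # ~ (x & s))
    w3 = slv ℚ-ri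

  wa-su : ∀ {N} (x : Fin (suc N) -> ℚ) p a -> wa x p (suc a) == wa (x ∘ suc) p a
  wa-su x zr a = rfl
  wa-su x (suc p) a = Ʃ-Fi _ » ap2 _#_
   (ap2 (\ c d -> (t & x (suc a) & c # ~ (x (suc a) & d)) & wa x p zr) (δ-no _ (\ ())) (δ-no _ (\ ())) » w0 t (x (suc a)) (wa x p zr))
   (Ʃ-co (\ b -> ap2 _&_ (ap2 (\ c d -> t & x (suc a) & c # ~ (x (suc a) & d)) (δ-⇔ _ _ ≤-pred s≤s) (δ-⇔ _ _ ≤-pred s≤s)) (wa-su x p b))) » #-idˡ _

  -- Splitting off the smallest letter reproduces the recursion of `ju`: no step leads back to it
  -- from a larger one.
  wa-ju : ∀ {N} (x : Fin N -> ℚ) p -> Ʃ (wa x p) == ju (L.tabulate x) p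
  wa-ju {zr} x p = Ʃ-Fin0 _
  wa-ju {suc N} x zr = Ʃ-Fi _ » #-co _ _ » cg (_# x zr) (wa-ju (x ∘ suc) 0)
  wa-ju {suc N} x (suc p) = Ʃ-Fi _ » ap2 _#_ at-ze rest » w3 t (x zr) (wa x p zr) (ju ys p) (ju ys (suc p)) »
   cg (\ z -> ju ys (suc p) # (t & x zr & z # ~ (x zr & ju ys p))) (cg (wa x p zr #_) (sym tails) » sym (Ʃ-Fi _) » wa-ju x p)
   where
   ys = L.tabulate (x ∘ suc)
   tails : Ʃ (\ b -> wa x p (suc b)) == ju ys p
   tails = Ʃ-co (wa-su x p) » wa-ju (x ∘ suc) p
   rest : Ʃ (\ b -> wa x (suc p) (suc b)) == ju ys (suc p)
   rest = Ʃ-co (wa-su x (suc p)) » wa-ju (x ∘ suc) (suc p)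
   at-ze : wa x (suc p) zr == t & x zr & wa x p zr # (t & x zr # ~ x zr) & ju ys p
   at-ze = Ʃ-Fi _ » ap2 _#_
    (ap2 (\ c d -> (t & x zr & c # ~ (x zr & d)) & wa x p zr) (δ-ye _ z≤n) (δ-no _ (\ ())) » w1 t (x zr) (wa x p zr))
    (Ʃ-co (\ b -> ap2 (\ c d -> (t & x zr & c # ~ (x zr & d)) & wa x p (suc b)) (δ-ye _ z≤n) (δ-ye _ (s≤s z≤n)) » w2 t (x zr) (wa x p (suc b))) »
     Ʃ-*ˡ _ _ » cg ((t & x zr # ~ x zr) &_) tails)

  module Zr where
   open Bi
   open RO mo-Z K v u sp-Z

   Kv-wa : ∀ p a -> Ʃ (\ c -> Kv p (a , c)) == wa x p a
   Kv-wa zr a = Ʃ-Bo _ » ap2 _#_ (Kv-0 (a , true)) (Kv-0 (a , false)) » #-idˡ _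
   Kv-wa (suc p) a = Ʃ-Bo _ » ap2 _#_ (part true) (part false) » sym (Ʃ-# _ _) »
    Ʃ-co (\ b -> sym (&-distribʳ (Ʃ (\ d -> Kv p (b , d))) _ _) » ap2 _&_ rfl (Kv-wa p b))
    where
    part : ∀ c -> Kv (suc p) (a , c) == Ʃ (\ b -> K (a , c) (b , true) & Ʃ (\ d -> Kv p (b , d)))
    part c = Kv-su p (a , c) » Ʃ-× _ » Ʃ-co (\ b -> Ʃ-co (\ d -> cg (_& Kv p (b , d)) (sa c b d)) » Ʃ-*ˡ (K (a , c) (b , true)) _)
     where
     sa : ∀ c b d -> K (a , c) (b , d) == K (a , c) (b , true)
     sa true b d = rfl
     sa false b d = rfl

   tr-mo-Z : ∀ k -> tr (pw mo-Z (suc k)) == Ʃ (\ a -> po (t & x a) (suc k)) # di (ju xs) 0 k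
   tr-mo-Z k = tr-pw k » ap2 _#_ (tr-K k) (di-lo g (ju xs) k 0 (\ m _ ->
    Ʃ-co (\ y -> &-idˡ _) » Ʃ-× _ » Ʃ-co (Kv-wa m) » wa-ju x m))

  module Yr where

   K : Mat {Y}
   K (inl y) (inl z) = wt (inl y) & δ (pro? y z)
   K (inr y) (inr z) = wt (inr y) & δ (eq? y z)
   K (inl _) (inr _) = 0q
   K (inr _) (inl _) = 0q

   v u : Y -> ℚ
   v (inl y) = wt (inl y) & δ (re y ≟ℕ 0)
   v (inr _) = 0q
   u (inl z) = δ (sta? z)
   u (inr _) = 0q

   private
    opaque
     unfolding _#_
     s1 : ∀ w p r s -> w & (p # r & s) == w & p # w & r & s
     s1 = slv ℚ-ri
     s2 : ∀ w x -> w & 0q == 0q # 0q & x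
     s2 = slv ℚ-ri
     s3 : ∀ w -> w & 0q == 0q # w & 0q
     s3 = slv ℚ-ri
     s4 : ∀ w -> w == w # 0q & 0q
     s4 = slv ℚ-ri

   sp-Y : ∀ y z -> mo-Y y z == K y z # v y & u z
   sp-Y (inl y) (inl z) = cg (wt (inl y) &_) (dis (res? y z) (pro? y z) » cg (δ (pro? y z) #_) (δ-× _ _)) » s1 (wt (inl y)) _ _ _
    where
    dis : ∀ (p : Dec (Res y z)) (q : Dec (Pro y z)) -> δ (p ⊎-dec q) == δ q # δ p
    dis (yes (e , p)) (yes (f , q)) = case trans f e of \ ()
    dis (yes p) (no q) = δ-ye _ (inl p) » sym (ap2 _#_ (δ-no (no q) q) (δ-ye (yes p) p) » #-idˡ _)
    dis (no p) (yes q) = δ-ye _ (inr q) » sym (ap2 _#_ (δ-ye (yes q) q) (δ-no (no p) p) » #-idʳ _)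
    dis (no p) (no q) = (δ-no _ [ p , q ]′) » sym (ap2 _#_ (δ-no (no q) q) (δ-no (no p) p) » #-idʳ _)
   sp-Y (inr y) (inr z) = s4 _
   sp-Y (inl y) (inr z) = cg (wt (inl y) &_) (δ-no _ id) » s3 _ » cg (\ w -> 0q # w) (&-zeroʳ _ » sym (&-zeroʳ _))
   sp-Y (inr y) (inl z) = cg (wt (inr y) &_) (δ-no _ id) » s2 (wt (inr y)) (δ (sta? z))

   open RO mo-Y K v u sp-Y

   ra : Y -> ℕ
   ra (inl y) = n ∸ re y
   ra (inr _) = 0

   upp : ∀ y z -> y ≢ z -> ¬ ra y < ra z -> K y z == 0q
   upp (inl y) (inl z) ne nl = cg (wt (inl y) &_) (δ-no _ (\ (e , _) -> nl (∸-monoʳ-< (≤r e) (<⇒≤ (toℕ<n (fst y)))))) » &-zeroʳ _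
    where open import Data.Nat.Properties using (∸-monoʳ-<)
   upp (inr y) (inr z) ne nl = cg (wt (inr y) &_) (δ-no (eq? y z) (ne ∘ cg inr)) » &-zeroʳ _
   upp (inl _) (inr _) ne nl = rfl
   upp (inr _) (inl _) ne nl = rfl

   tr-K : ∀ k -> tr (pw K (suc k)) == Ʃ (\ a -> po (t & x a) (suc k)) # pS xs k
   tr-K k = Tr.tr-pw K ra upp (suc k) » Ʃ-⊎ _ » ap2 _#_
    (Ʃ-0 (\ y -> cg (\ z -> po z (suc k)) (cg (wt (inl y) &_) (δ-no _ (\ (e , _) -> <-irrefl (sym e) (n<1+n _))) » &-zeroʳ _) » po-0 k))
    (Ʃ-× _ » Ʃ-co (\ a -> Ʃ-Bo _ » ap2 _#_ (loo a true (&-idʳ t)) (loo a false rfl)) » Ʃ-# _ _) » #-idˡ _ »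
    ap2 _#_ rfl (Ʃ-co (\ a -> cg (\ z -> po z (suc k)) (&-idˡ (x a))) » sym (pS-Ʃ t x k))
    where
    loo : ∀ a c {w} -> po t (bar c) == w -> po (K (inr (a , c)) (inr (a , c))) (suc k) == po (w & x a) (suc k)
    loo a c rfl = cg (\ z -> po z (suc k)) (cg (wt (inr (a , c)) &_) (δ-ye (eq? (a , c) (a , c)) rfl) » &-idʳ _)

   bla : ∀ {K} -> Row K
   bla {zr} = []
   bla {suc K} = zr ∷ bla

   si-bl : ∀ {K} -> ∣ bla {K} ∣ == 0
   si-bl {zr} = rfl
   si-bl {suc K} = si-bl {K}

   si-0 : ∀ {K} (A : Row K) -> ∣ A ∣ == 0 -> A == bla
   si-0 [] _ = rfl
   si-0 (zr ∷ A) e = cg (zr ∷_) (si-0 A e)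

   mo-bl : ∀ {K} (x : Fin K -> ℚ) -> mo n x bla == 1q
   mo-bl {zr} x = rfl
   mo-bl {suc K} x = &-idˡ _ » mo-bl (x ∘ suc)

   -- Inside a block the next cell is forced and has weight 1. Going back p cells from the end of a
   -- block therefore leads to the cells with residue p.
   Kv≡ : ∀ p y -> Kv p (inl y) == wt (inl y) & δ (re y ≟ℕ p)
   Kv-in₂ : ∀ p z -> Kv p (inr z) == 0q
   Kv≡ zr y = Kv-0 (inl y)
   Kv≡ (suc p) y = Kv-su p (inl y) » Ʃ-⊎ _ » ap2 _#_ (Ʃ-co (\ z -> ap2 _&_ rfl (Kv≡ p z))) (Ʃ-0 (\ z -> &-zeroˡ _)) »
    #-idʳ _ » go (re y ≟ℕ suc p)
    where
    go : (d : Dec (re y == suc p)) -> Ʃ (\ z -> wt (inl y) & δ (pro? y z) & (wt (inl z) & δ (re z ≟ℕ p))) == wt (inl y) & δ d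
    go (no ¬e) = Ʃ-0 (\ z -> ze' z (re z ≟ℕ p)) » sym (cg (wt (inl y) &_) (δ-no (no ¬e) ¬e) » &-zeroʳ _)
     where
     ze' : ∀ z (d : Dec (re z == p)) -> wt (inl y) & δ (pro? y z) & (wt (inl z) & δ d) == 0q
     ze' z (yes e) = cg (\ a -> wt (inl y) & a & _) (δ-no (pro? y z) (\ (f , _) -> ¬e (sym f » cg suc e))) » cg (_& _) (&-zeroʳ _) » &-zeroˡ _
     ze' z (no ¬f) = cg (\ a -> wt (inl y) & δ (pro? y z) & (wt (inl z) & a)) (δ-no (no ¬f) ¬f) » ap2 _&_ rfl (&-zeroʳ _) » &-zeroʳ _
    go (yes e) = Ʃ-co (\ z -> &-as _ _ _ » cg (wt (inl y) &_) rfl) » Ʃ-*ˡ (wt (inl y)) _ » cg (wt (inl y) &_)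
     (Ʃ-po (pro? y) nex (\ z -> wt (inl z) & δ (re z ≟ℕ p)) (trans (cg suc rem) (sym e) , si-bl {N} , rfl) on »
      ap2 _&_ we-ne (δ-ye (re nex ≟ℕ p) rem) » &-idˡ _ » sym (δ-ye (yes e) e))
     where
     p<n : p < n
     p<n = ≤t (≤r (sym e)) (<⇒≤ (toℕ<n (fst y)))
     nex : Ti
     nex = fromℕ< p<n , bla , zr ∷ zr ∷ []
     rem : re nex == p
     rem = tn-fr p<n
     we-ne : wt (inl nex) == 1q
     we-ne = ap2 _&_ (cg (\ s -> po t (iB s)) (si-bl {N})) (mo-bl x) » &-idˡ _
     on : ∀ z -> Pro y z -> z == nex
     on (r , A , A') (f , a , a') = ap2 _,_ (tn-inj (suc-injective (f » e) » sym rem)) (ap2 _,_ (si-0 A a) (si-0 A' a'))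
   Kv-in₂ zr z = Kv-0 (inr z)
   Kv-in₂ (suc p) z = Kv-su p (inr z) » Ʃ-⊎ _ » ap2 _#_ (Ʃ-0 (\ y -> &-zeroˡ _)) (Ʃ-0 (\ w -> ap2 _&_ rfl (Kv-in₂ p w) » &-zeroʳ _)) » #-idʳ _

   -- A block of p + 1 letters has p - 1 marks, whose generating function is h_{p-1}(1,t); the extra
   -- factor t belongs to the block.
   ge-ma : ∀ p -> p ≤ n -> Ʃ (\ (A' : Row 2) -> δ (suc ∣ A' ∣ ≟ℕ p) & po t (mar A' + 1)) == ge p
   ge-ma zr _ = Ʃ-0 (\ A' -> δ-fa _ (\ ()))
   ge-ma (suc m) p≤n = Ʃ-co te » Ʃ-*ˡ t _ » cg (t &_) (ho-mo n t 2 pair m (≤t (n≤1+n m) p≤n)) » sum≡ m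
    where
    pair : Fin 2 -> ℚ
    pair zr = 1q
    pair (suc _) = t
    te : ∀ A' -> δ (suc ∣ A' ∣ ≟ℕ suc m) & po t (mar A' + 1) == t & (δ (∣ A' ∣ ≟ℕ m) & mo n pair A')
    te (a ∷ b ∷ []) = ap2 _&_ (δ-⇔ _ _ suc-injective (cg suc)) (cg (po t) (+-comm (tn b) 1) »
     cg (t &_) (sym (ap2 _&_ (po-1 (tn a)) (&-idʳ _) » &-idˡ _))) » &-sw _ t _
    ho-t : ∀ m -> homogeneous (t ∷ []) m == po t m
    ho-t zr = rfl
    ho-t (suc m) = #-idˡ _ » cg (t &_) (ho-t m)
    sum≡ : ∀ m -> t & homogeneous (1q ∷ t ∷ []) m == ge (suc m)
    sum≡ zr = sym (#-idˡ _)
    sum≡ (suc m) = &-distribˡ t _ _ » #-co _ _ » ap2 _#_ (cg (t &_) (&-idˡ _) » sum≡ m) (cg (t &_) (ho-t (suc m)))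

   g-bl : ∀ p -> p < n -> g p == blo xs p
   g-bl p p<n = Ʃ-⊎ _ » ap2 _#_ (Ʃ-co (\ y -> ap2 _&_ rfl (Kv≡ p y))) (Ʃ-0 (\ z -> &-zeroˡ _)) » #-idʳ _ »
    Ʃ-× _ » Ʃ-co (\ r -> Ʃ-× _ » Ʃ-co₂ (\ A A' -> te r A A')) »
     Ʃ-co (\ r -> Ʃ-co (\ A -> Ʃ-*ˡ _ _) » Ʃ-*ˡ _ _) » Ʃ-δ (fromℕ< p<n) _ » Ʃ-& _ _ »
      ap2 _&_ (ho-mo n t N x (suc p) p<n) (ge-ma p (<⇒≤ p<n))
    where
    P : Row N -> ℚ
    P A = δ (∣ A ∣ ≟ℕ suc p) & mo n x A
    P' : Row 2 -> ℚ
    P' A' = δ (suc ∣ A' ∣ ≟ℕ p) & po t (mar A' + 1)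
    prod0 : ∀ A A' -> ¬ (∣ A ∣ == suc p × suc ∣ A' ∣ == p) -> P A & P' A' == 0q
    prod0 A A' ¬q with ∣ A ∣ ≟ℕ suc p | suc ∣ A' ∣ ≟ℕ p
    ... | yes a | yes b = absurd (a , b) ¬q
    ... | no a | _ = cg (_& _) (δ-fa (no a) a) » &-zeroˡ _
    ... | yes a | no b = ap2 _&_ rfl (δ-fa (no b) b) » &-zeroʳ _
    te : ∀ r A A' -> δ (sta? (r , A , A')) & (wt (inl (r , A , A')) & δ (tn r ≟ℕ p)) == δ (eq? r (fromℕ< p<n)) & (P A & P' A')
    te r A A' = go (tn r ≟ℕ p) (sta? (r , A , A'))
     where
     w = wt (inl (r , A , A'))
     go : (d : Dec (tn r == p)) (s : Dec (Star (r , A , A'))) -> δ s & (w & δ d) == δ (eq? r (fromℕ< p<n)) & (P A & P' A')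
     go (no ¬e) s = cg (\ z -> δ s & (w & z)) (δ-no (no ¬e) ¬e) » cg (δ s &_) (&-zeroʳ _) » &-zeroʳ _ »
      sym (δ-fa (eq? r (fromℕ< p<n)) (\ { rfl -> ¬e (tn-fr p<n) }))
     go (yes e) (no ¬s) = δ-fa (no ¬s) ¬s » sym (ap2 _&_ rfl (prod0 A A' (\ (a , b) -> ¬s
      (≤t (s≤s z≤n) (≤r (b » sym e)) , trans a (cg suc (sym e)) , trans b (sym e)))) » &-zeroʳ _)
     go (yes e) (yes (l , a , b)) = δ-tr (yes (l , a , b)) (l , a , b) » cg (w &_) (δ-ye (yes e) e) » &-idʳ _ »
      sym (δ-tr (eq? r (fromℕ< p<n)) (tn-inj (e » sym (tn-fr p<n))) » ap2 _&_
       (δ-tr (∣ A ∣ ≟ℕ suc p) (a » cg suc e)) (δ-tr (suc ∣ A' ∣ ≟ℕ p) (b » e)) » &-co _ _ »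
       cg (\ z -> po t (mar A' + z) & mo n x A) (sym (bloc l a)))
      where
      bloc : ∀ {r s} -> 1 ≤ r -> s == suc r -> iB s == 1
      bloc (s≤s _) rfl = rfl

   tr-mo-Y : ∀ k -> k < n -> tr (pw mo-Y (suc k)) == Ʃ (\ a -> po (t & x a) (suc k)) # pS xs k # di (blo xs) 0 k
   tr-mo-Y k k<n = tr-pw k » ap2 _#_ (tr-K k) (di-lo g (blo xs) k 0 (\ m l -> g-bl m (≤-<-trans l k<n)))

  mo-tr : t ≢ 1q -> ∀ k -> k < n -> tr (pw mo-Z (suc k)) == tr (pw mo-Y (suc k))
  mo-tr t≢1 k k<n = Zr.tr-mo-Z k » ap2 _#_ rfl (ju-bl t≢1 xs k » #-co _ _) »
   sym (#-as _ _ _) » sym (Yr.tr-mo-Y k k<n)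

-- Words fixed by a permutation that commutes with π.

import Data.Nat
import Data.List.Properties as LP

∏-δ : ∀ {n} {P : Fin n -> Set} (P? : ∀ i -> Dec (P i)) -> ∏ (\ i -> δ (P? i)) == δ (all? P?)
∏-δ {zr} P? = sym (δ-ye _ (\ ()))
∏-δ {suc n} P? = cg (δ (P? zr) &_) (∏-δ (P? ∘ suc)) » sym (δ-× (P? zr) (all? (P? ∘ suc))) »
 δ-⇔ _ _ (\ { (p , q) zr -> p;(p , q) (suc i) -> q i }) (\ p -> p zr , p ∘ suc)

opaque
 unfolding sF

 ∏-po : ∀ b {n} (e : Fin n -> ℕ) -> ∏ (\ i -> po b (e i)) == po b (sF e)
 ∏-po b {zr} e = rfl
 ∏-po b {suc n} e = cg (po b (e zr) &_) (∏-po b (e ∘ suc)) » sym (po-+ b (e zr) _)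

-- The constraint at a representative of an orbit of g of size suc m; other points are dead.
data Ki : Set where
 dead : Ki
 fi mov : ℕ -> Ki

mu : Ki -> ℕ
mu dead = 0
mu (fi m) = suc m
mu (mov m) = suc m

module Ke {A : Set} ⦃ _ : Fi A ⦄ (ℓ : Lo A) (deg : A -> ℕ) (y₀ : A) (b : ℚ) where
 open Lo ℓ

 Al : Ki -> A -> A -> Set
 Al dead y z = y == y₀ × y == z
 Al (fi _) y z = F y × y == z
 Al (mov _) y z = E y z

 al? : ∀ θ y z -> Dec (Al θ y z)
 al? dead y z = eq? y y₀ ×-dec eq? y z
 al? (fi _) y z = F? y ×-dec eq? y z
 al? (mov _) y z = E? y z

 -- The whole orbit carries the letter of its representative, so the weight is raised to the size of
 -- the orbit. Dead places hold the fixed letter `y₀` with weight 1.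
 ke : Ki -> Mat {A}
 ke θ y z = po b (mu θ * deg y) & δ (al? θ y z)

module Qu {n : ℕ} (π g : Pe n) (fix : co g π == π) where

 comm : ∀ i -> g · (π · i) == π · (g · i)
 comm i = sym (∙-· g π i) » cg (_· i) (fi-co g π fix) » ∙-· π g i

 it-co : ∀ k i -> it g k (π · i) == π · it g k i
 it-co zr i = rfl
 it-co (suc k) i = cg (g ·_) (it-co k i) » comm _

 private
  r : Fin n -> Fin n
  r = roo g

  π-⇝ : ∀ {x y} -> _⇝_ g x y -> _⇝_ g (π · x) (π · y)
  π-⇝ {x} (k , rfl) = ⇝-in' g (tn k) (it-co (tn k) x)

  π-⇝⁻ : ∀ {x y} -> _⇝_ g (π · x) (π · y) -> _⇝_ g x y
  π-⇝⁻ {x} (k , e) = ⇝-in' g (tn k) (·-in π (sym (it-co (tn k) x) » e))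

  ro-π : ∀ i -> r (π · r i) == r (π · i)
  ro-π i = ro-co g (π-⇝ (root⇝ g i))

  fi-⇝ : ∀ {x y} -> _⇝_ g x y -> π · x == x -> π · y == y
  fi-⇝ {x} (k , rfl) e = sym (it-co (tn k) x) » cg (it g (tn k)) e

  ro-fi : ∀ i -> π · i == i -> π · r i == r i
  ro-fi i = fi-⇝ (⇝-sy g (root⇝ g i))

  ro-fi⁻ : ∀ i -> π · r i == r i -> π · i == i
  ro-fi⁻ i = fi-⇝ (root⇝ g i)

 oS : Fin n -> ℕ
 oS x = sF (\ i -> wh (r i ≟F x) 1)

 ι-oS : ∀ x -> ι (oS x) == Ʃ (\ i -> δ (r i ≟F x))
 ι-oS x = ι-sF _ » Ʃ-co (\ i -> ι-wh (r i ≟F x) 1 » cg (δ (r i ≟F x) &_) (#-idʳ 1q) » &-idʳ _)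

 oS-π : ∀ i -> r i == i -> oS (r (π · i)) == oS i
 oS-π i e = ι-in (ι-oS _ » sym (Ʃ-bi (π ·_) (π ·⁻_) (·⁻· π) (··⁻ π) (\ j -> δ (r j ≟F r (π · i)))) »
  Ʃ-co (\ j -> δ-⇔ _ _ (\ p -> ro-co g (π-⇝⁻ (root≡⇒⇝ g p)) » e) (\ p -> ro-co g (π-⇝ (root≡⇒⇝ g (p » sym e))))) » sym (ι-oS i))

 su-pr-si : ∀ i -> r i == i -> suc (pred (oS i)) == oS i
 su-pr-si i e with oS i in z
 ... | suc m = rfl
 ... | zr = absurd (sym (ι-oS i) » cg ι z) (\ f -> ℚP.<⇒≢ (Ʃ->0 (\ j -> δ-≥0 (r j ≟F i)) i (subst (0q <ᵠ_) (sym (δ-ye (r i ≟F i) e)) 1>0)) (sym f))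

 -- The permutation of the orbits of g induced by π, transported to their roots. Leaving the other
 -- places fixed keeps it a permutation of all places, as the comparison of traces needs.
 step : Fin n -> Fin n
 step i = go (iR? g i)
  where
  go : Dec (r i == i) -> Fin n
  go (yes _) = r (π · i)
  go (no _) = i

 kD : ∀ {P Q : Set} -> Dec P -> Dec Q -> ℕ -> Ki
 kD (yes _) (yes _) m = fi (pred m)
 kD (yes _) (no _) m = mov (pred m)
 kD (no _) _ m = dead

 -- It asks whether π fixes the place, not whether it fixes the orbit: if π i ≠ i lies in the orbit
 -- of i, then i is a loop of `step` but still subject to the rule for moved places.
 kind : Fin n -> Ki
 kind i = kD (iR? g i) (π · i ≟F i) (oS i)

 kD-⇔ : ∀ {P Q P' Q' : Set} (p : Dec P) (q : Dec Q) (p' : Dec P') (q′ : Dec Q') {m m'} -> P -> P' -> (Q -> Q') -> (Q' -> Q) -> m == m' -> kD p q m == kD p' q′ m'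
 kD-⇔ (no ¬p) _ _ _ p _ _ _ _ = absurd p ¬p
 kD-⇔ _ _ (no ¬p) _ _ p _ _ _ = absurd p ¬p
 kD-⇔ (yes _) (yes q) (yes _) (yes _) _ _ f h e = cg (fi ∘ pred) e
 kD-⇔ (yes _) (no q) (yes _) (no _) _ _ f h e = cg (mov ∘ pred) e
 kD-⇔ (yes _) (yes q) (yes _) (no ¬q) _ _ f h e = absurd (f q) ¬q
 kD-⇔ (yes _) (no ¬q) (yes _) (yes q) _ _ f h e = absurd (h q) ¬q

 kind-step : ∀ i -> kind (step i) == kind i
 kind-step i with iR? g i in e
 ... | no ¬p = cg (\ d -> kD d (π · i ≟F i) (oS i)) e
 ... | yes p = kD-⇔ (iR? g (r (π · i))) (π · r (π · i) ≟F r (π · i)) (yes p) (π · i ≟F i) (ro-ro g (π · i)) p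
  (\ q -> ·-in π (ro-fi⁻ (π · i) q)) (\ q -> ro-fi (π · i) (cg (π ·_) q)) (oS-π i p)

 step-inj : ∀ {i j} -> step i == step j -> i == j
 step-inj {i} {j} e with iR? g i | iR? g j
 ... | yes p | yes q = sym p » ro-co g (π-⇝⁻ (root≡⇒⇝ g e)) » q
 ... | no ¬p | no ¬q = e
 ... | yes p | no ¬q = absurd (cg r (sym e) » ro-ro g _ » e) ¬q
 ... | no ¬p | yes q = absurd (cg r e » ro-ro g _ » sym e) ¬p

 module _ {A : Set} ⦃ _ : Fi A ⦄ (ℓ : Lo A) (deg : A -> ℕ) (y₀ : A) (b : ℚ) where
  open Lo ℓ
  open Ke ℓ deg y₀ b
  open Clo ke

  private
   pic : ∀ {P : Set} -> Dec P -> A -> A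
   pic (yes _) y = y
   pic (no _) _ = y₀

   res exte : Vec A n -> Vec A n
   res D = tab (\ i -> pic (iR? g i) (lk D i))
   exte D = tab (\ i -> lk D (r i))

   re-ro : ∀ D i -> r i == i -> lk (res D) i == lk D i
   re-ro D i e = lk-tab _ i » go (iR? g i)
    where
    go : (d : Dec (r i == i)) -> pic d (lk D i) == lk D i
    go (yes _) = rfl
    go (no ¬e) = absurd e ¬e

   re-de : ∀ D i -> r i ≢ i -> lk (res D) i == y₀
   re-de D i ne = lk-tab _ i » go (iR? g i)
    where
    go : (d : Dec (r i == i)) -> pic d (lk D i) == y₀
    go (yes e) = absurd e ne
    go (no _) = rfl

   ex-lo : ∀ D i -> lk (exte D) i == lk D (r i)
   ex-lo D i = lk-tab _ i

   Go : Vec A n -> Set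
   Go D = Va ℓ π D × D ▹ g == D
   go? : ∀ D -> Dec (Go D)
   go? D = va? ℓ π D ×-dec eq? (D ▹ g) D

   Fit : Vec A n -> Set
   Fit D = ∀ i -> Al (kind i) (lk D i) (lk D (step i))
   fi? : ∀ D -> Dec (Fit D)
   fi? D = all? (\ i -> al? (kind i) (lk D i) (lk D (step i)))

   in-it : ∀ {D : Vec A n} -> D ▹ g == D -> ∀ k i -> lk D (it g k i) == lk D i
   in-it e zr i = rfl
   in-it {D} e (suc k) i = sym (▹-lo D g _) » cg (\ E -> lk E (it g k i)) e » in-it e k i

   in-ro : ∀ {D : Vec A n} -> D ▹ g == D -> ∀ i -> lk D (r i) == lk D i
   in-ro {D} e i with root⇝ g i
   ... | k , p = sym (in-it e (tn k) (r i)) » cg (lk D) p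

   to : ∀ D -> Go D -> Fit (res D)
   to D (v , inv) i with iR? g i | π · i ≟F i
   ... | no ¬p | _ = re-de D i ¬p , rfl
   ... | yes p | yes q = subst F (sym (re-ro D i p)) (fst (v i) q) , cg (lk (res D)) (sym (cg r q » p))
   ... | yes p | no ¬q = subst2 E (sym (re-ro D i p)) (sym (re-ro D (r (π · i)) (ro-ro g _) » in-ro inv (π · i))) (snd (v i) ¬q)

   liv : ∀ D -> Fit D -> ∀ i -> r i == i -> (π · i == i -> F (lk D i)) × (π · i ≢ i -> E (lk D i) (lk D (r (π · i))))
   liv D ok i e with iR? g i | π · i ≟F i | ok i
   ... | no ¬p | _ | _ = absurd e ¬p
   ... | yes _ | yes q | o = (\ _ -> fst o) , (\ ¬q -> absurd q ¬q)
   ... | yes _ | no ¬q | o = (\ q -> absurd q ¬q) , (\ _ -> o)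

   from : ∀ D -> Fit D -> Go (exte D)
   from D ok = (\ i -> (\ q -> subst F (sym (ex-lo D i)) (fst (liv D ok (r i) (ro-ro g i)) (ro-fi i q))) ,
    (\ ¬q -> subst2 E (sym (ex-lo D i)) (cg (lk D) (ro-π i) » sym (ex-lo D (π · i)))
     (snd (liv D ok (r i) (ro-ro g i)) (¬q ∘ ro-fi⁻ i)))) ,
    lo-ex (\ i -> ▹-lo (exte D) g i » ex-lo D (g · i) » cg (lk D) (ro-co g (⇝-sy g (⇝-in g 1 i))) » sym (ex-lo D i))

   ex-re : ∀ D -> Go D -> exte (res D) == D
   ex-re D (_ , inv) = lo-ex (\ i -> ex-lo (res D) i » re-ro D (r i) (ro-ro g i) » in-ro inv i)

   re-ex : ∀ D -> Fit D -> res (exte D) == D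
   re-ex D ok = lo-ex (\ i -> go i (iR? g i))
    where
    de-va : ∀ i -> r i ≢ i -> lk D i == y₀
    de-va i ne with iR? g i | π · i ≟F i | ok i
    ... | yes e | _ | _ = absurd e ne
    ... | no _ | _ | o = fst o
    go : ∀ i -> Dec (r i == i) -> lk (res (exte D)) i == lk D i
    go i (yes e) = re-ro (exte D) i e » ex-lo D i » cg (lk D) e
    go i (no ne) = re-de (exte D) i ne » sym (de-va i ne)

   to-de : ∀ D -> Go D -> sF (\ i -> mu (kind i) * deg (lk (res D) i)) == sF (\ i -> deg (lk D i))
   to-de D (_ , inv) = ι-in (begin
    ι (sF (\ i -> mu (kind i) * deg (lk (res D) i))) ≡⟨ ι-sF _ ⟩
    Ʃ (\ i -> ι (mu (kind i) * deg (lk (res D) i))) ≡⟨ Ʃ-co (\ i -> go i) ⟩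
    Ʃ (\ x -> Ʃ (\ i -> δ (r i ≟F x) & ι (deg (lk D x)))) ≡⟨ Ʃ-sw _ ⟩
    Ʃ (\ i -> Ʃ (\ x -> δ (r i ≟F x) & ι (deg (lk D x)))) ≡⟨ Ʃ-co (\ i -> Ʃ-δ' (r i) (\ x -> ι (deg (lk D x))) » cg (ι ∘ deg) (in-ro inv i)) ⟩
    Ʃ (\ i -> ι (deg (lk D i))) ≡⟨ ι-sF _ ⟨
    ι (sF (\ i -> deg (lk D i))) ∎)
    where
    open ≡-Reasoning
    go : ∀ x -> ι (mu (kind x) * deg (lk (res D) x)) == Ʃ (\ i -> δ (r i ≟F x) & ι (deg (lk D x)))
    go x with iR? g x in e
    ... | no ne = sym (Ʃ-0 (\ i -> δ-fa (r i ≟F x) (\ p -> ne (cg r (sym p) » ro-ro g i » p))))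
    ... | yes p = cg ι (ap2 (\ a d -> a * deg d) (si-of (π · x ≟F x) » su-pr-si x p) (re-ro D x p)) »
     ι-* (oS x) _ » cg (_& ι (deg (lk D x))) (ι-oS x) » sym (Ʃ-*ʳ _ _)
     where
     si-of : (d : Dec (π · x == x)) -> mu (kD (yes p) d (oS x)) == suc (pred (oS x))
     si-of (yes _) = rfl
     si-of (no _) = rfl

  -- A word fixed by g is determined by its letters at the roots, and its validity along π is the
  -- same as the constraints along `step`. The degrees agree because the orbit sizes appear as
  -- exponents.
  closed-orbits : clo n step kind (\ _ -> 0) == Ʃ (\ D -> δ (va? ℓ π D ×-dec eq? (D ▹ g) D) & po b (sF (\ i -> deg (lk D i))))
  closed-orbits = Ʃ-co (\ D -> ∏-co (\ i -> pw-1 (ke (kind i)) (lk D i) (lk D (step i))) » ∏-& (\ i -> po b (mu (kind i) * deg (lk D i))) (\ i -> δ (al? (kind i) (lk D i) (lk D (step i)))) »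
   ap2 _&_ (∏-po b (\ i -> mu (kind i) * deg (lk D i))) (∏-δ (\ i -> al? (kind i) (lk D i) (lk D (step i)))) » &-co _ _) »
   sym (Ʃ-co (\ D -> δ-co (go? D) (\ ok -> cg (po b) (sym (to-de D ok)))) »
    Ʃ-re go? fi? res exte to from ex-re re-ex (\ D -> po b (sF (\ i -> mu (kind i) * deg (lk D i)))))
   where
   pw-1 : ∀ (M : Mat {A}) y z -> pw M 1 y z == M y z
   pw-1 M y z = Ʃ-co (\ w -> &-co (M y w) _) » Ʃ-δ z (M y)

-- Base b digits determine a multiset of fewer than b exponents.
module Di where

 psu : ℕ -> List ℕ -> ℕ
 psu b [] = 0
 psu b (e ∷ xs) = b ^ e + psu b xs

 ze : List ℕ -> ℕ
 ze [] = 0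
 ze (zr ∷ xs) = suc (ze xs)
 ze (suc _ ∷ xs) = ze xs

 pr : List ℕ -> List ℕ
 pr [] = []
 pr (zr ∷ xs) = pr xs
 pr (suc e ∷ xs) = e ∷ pr xs

 ps-sp : ∀ b xs -> psu b xs == ze xs + psu b (pr xs) * b
 ps-sp b [] = rfl
 ps-sp b (zr ∷ xs) = cg suc (ps-sp b xs)
 ps-sp b (suc e ∷ xs) = cg (b * b ^ e +_) (ps-sp b xs) » lem b (b ^ e) (ze xs) (psu b (pr xs))
  where
  lem : ∀ b p z q -> b * p + (z + q * b) == z + (p + q) * b
  lem = ℕ-ring

 zeros≤ : ∀ xs -> ze xs ≤ length xs
 zeros≤ [] = z≤n
 zeros≤ (zr ∷ xs) = s≤s (zeros≤ xs)
 zeros≤ (suc _ ∷ xs) = ≤t (zeros≤ xs) (n≤1+n _)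

 preds≤ : ∀ xs -> length (pr xs) ≤ length xs
 preds≤ [] = z≤n
 preds≤ (zr ∷ xs) = ≤t (preds≤ xs) (n≤1+n _)
 preds≤ (suc _ ∷ xs) = s≤s (preds≤ xs)

 dig : ℕ -> List ℕ -> ℕ
 dig zr xs = ze xs
 dig (suc m) xs = dig m (pr xs)

 di-un : ∀ m b xs ys -> length xs < suc b -> length ys < suc b -> psu (suc b) xs == psu (suc b) ys -> dig m xs == dig m ys
 di-un m b xs ys p q e = go m
  where
  open import Data.Nat.DivMod using ([m+kn]%n≡m%n;m<n⇒m%n≡m)
  open import Data.Nat.Properties using (*-cancelʳ-≡)
  split : ze xs + psu (suc b) (pr xs) * suc b == ze ys + psu (suc b) (pr ys) * suc b
  split = sym (ps-sp (suc b) xs) » e » ps-sp (suc b) ys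
  sa-ze : ze xs == ze ys
  sa-ze = sym (rem xs p) » cg (_% suc b) split » rem ys q
   where
   rem : ∀ xs -> length xs < suc b -> (ze xs + psu (suc b) (pr xs) * suc b) % suc b == ze xs
   rem xs p = [m+kn]%n≡m%n (ze xs) (psu (suc b) (pr xs)) (suc b) » m<n⇒m%n≡m (≤-<-trans (zeros≤ xs) p)
  go : ∀ m -> dig m xs == dig m ys
  go zr = sa-ze
  go (suc m) = di-un m b (pr xs) (pr ys) (≤-<-trans (preds≤ xs) p) (≤-<-trans (preds≤ ys) q)
   (*-cancelʳ-≡ _ _ (suc b) (+-cancelˡ-≡ (ze ys) _ _ (cg (_+ psu (suc b) (pr xs) * suc b) (sym sa-ze) » split)))

 ι-di : ∀ m xs -> ι (dig m xs) == ∑ xs (\ e -> δ (e ≟ℕ m))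
 ι-di zr [] = rfl
 ι-di zr (zr ∷ xs) = ap2 _#_ (sym (δ-ye (0 ≟ℕ 0) rfl)) (ι-di zr xs)
 ι-di zr (suc e ∷ xs) = ι-di zr xs » sym (ap2 _#_ (δ-no (suc e ≟ℕ 0) (\ ())) rfl » #-idˡ _)
 ι-di (suc m) [] = ι-di m []
 ι-di (suc m) (zr ∷ xs) = ι-di (suc m) xs » sym (ap2 _#_ (δ-no (0 ≟ℕ suc m) (\ ())) rfl » #-idˡ _)
 ι-di (suc m) (suc e ∷ xs) = ι-di m (e ∷ pr xs) » ap2 _#_ (δ-⇔ _ _ (cg suc) suc-injective) (sym (ι-di m (pr xs)) » ι-di (suc m) xs)

 ι-po : ∀ b e -> ι (b ^ e) == po (ι b) e
 ι-po b zr = #-idʳ 1q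
 ι-po b (suc e) = ι-* b (b ^ e) » cg (ι b &_) (ι-po b e)

 ι-ps : ∀ b xs -> ι (psu b xs) == ∑ xs (po (ι b))
 ι-ps b [] = rfl
 ι-ps b (e ∷ xs) = ι-+ (b ^ e) _ » ap2 _#_ (ι-po b e) (ι-ps b xs)

 module _ {A B : Set} ⦃ _ : Fi A ⦄ ⦃ _ : Fi B ⦄ {P : A -> Set} {Q : B -> Set} (P? : ∀ a -> Dec (P a)) (Q? : ∀ b -> Dec (Q b)) (e : A -> ℕ) (f : B -> ℕ) where

  private
   opaque
    unfolding Ʃ
    as-li : {A : Set} ⦃ _ : Fi A ⦄ {P : A -> Set} (P? : ∀ a -> Dec (P a)) (e : A -> ℕ) (F : ℕ -> ℚ) -> Ʃ (\ a -> δ (P? a) & F (e a)) == ∑ (mapL e (filter P? els)) F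
    as-li P? e F = sym (∑-ma e (filter P? els) F » ∑-fil P? els (F ∘ e))

  -- The base is taken beyond the number of terms on both sides, so that the two numerals are
  -- written without carries and their digits can be compared.
  co-eq : (∀ b -> Ʃ (\ a -> δ (P? a) & po (ι (suc (suc b))) (e a)) == Ʃ (\ a -> δ (Q? a) & po (ι (suc (suc b))) (f a))) ->
   ∀ m -> Ʃ (\ a -> δ (P? a) & δ (e a ≟ℕ m)) == Ʃ (\ a -> δ (Q? a) & δ (f a ≟ℕ m))
  co-eq eq m = as-li P? e (\ x -> δ (x ≟ℕ m)) » sym (ι-di m xs) » cg ι (di-un m (suc b) xs ys
   (s≤s (≤t (m≤m+n (length xs) (length ys)) (n≤1+n _))) (s≤s (≤t (m≤n+m (length ys) (length xs)) (n≤1+n _)))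
   (ι-in (ι-ps _ xs » sym (as-li P? e _) » eq b » as-li Q? f _ » sym (ι-ps _ ys)))) »
   ι-di m ys » sym (as-li Q? f (\ x -> δ (x ≟ℕ m)))
   where
   xs = mapL e (filter P? els)
   ys = mapL f (filter Q? els)
   b = length xs + length ys

-- Degree vectors as numerals, and equality of the two counts.

enc : ℕ -> ∀ {M} -> Vec ℕ M -> ℕ
enc K [] = 0
enc K (x ∷ v) = x + K * enc K v

en-+ : ∀ K {M} (u v : Vec ℕ M) -> enc K (u +ᵥ v) == enc K u + enc K v
en-+ K [] [] = rfl
en-+ K (x ∷ u) (y ∷ v) = cg (\ z -> x + y + K * z) (en-+ K u v) » lem x y K (enc K u) (enc K v)
 where
 lem : ∀ x y K u v -> x + y + K * (u + v) == x + K * u + (y + K * v)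
 lem = ℕ-ring

en-0 : ∀ K {M} -> enc K (0ᵥ {M}) == 0
en-0 K {zr} = rfl
en-0 K {suc M} = cg (K *_) (en-0 K {M}) » *-zeroʳ K

Bo : ℕ -> ∀ {M} -> Vec ℕ M -> Set
Bo K v = ∀ i -> lk v i ≤ K

en-in : ∀ K {M} (u v : Vec ℕ M) -> Bo K u -> Bo K v -> enc (suc K) u == enc (suc K) v -> u == v
en-in K [] [] _ _ _ = rfl
en-in K (x ∷ u) (y ∷ v) p q e = ap2 _∷_ hea (en-in K u v (p ∘ suc) (q ∘ suc)
 (*-cancelˡ-≡ _ _ (suc K) (+-cancelˡ-≡ y _ _ (cg (_+ suc K * enc (suc K) u) (sym hea) » e))))
 where
 open import Data.Nat.DivMod using ([m+kn]%n≡m%n;m<n⇒m%n≡m)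
 open import Data.Nat.Properties using (*-cancelˡ-≡)
 rem : ∀ x z -> x ≤ K -> (x + suc K * z) % suc K == x
 rem x z l = cg (\ w -> (x + w) % suc K) (*-comm (suc K) z) » [m+kn]%n≡m%n x z (suc K) » m<n⇒m%n≡m (s≤s l)
 hea : x == y
 hea = sym (rem x _ (p zr)) » cg (_% suc K) e » rem y _ (q zr)

tota : ∀ {A : Set} {M n} -> (A -> Vec ℕ M) -> Vec A n -> Vec ℕ M
tota v [] = 0ᵥ
tota v (y ∷ D) = v y +ᵥ tota v D

opaque
 unfolding sF

 en-to : ∀ K {A : Set} {M n} (v : A -> Vec ℕ M) (D : Vec A n) -> enc K (tota v D) == sF (\ i -> enc K (v (lk D i)))
 en-to K {M = M} v [] = en-0 K {M}
 en-to K v (y ∷ D) = en-+ K (v y) (tota v D) » cg (enc K (v y) +_) (en-to K v D)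

to-bo : ∀ {A : Set} {M n} c (v : A -> Vec ℕ M) (D : Vec A n) -> (∀ y -> Bo c (v y)) -> Bo (n * c) (tota v D)
to-bo c v [] p i = ≤t (≤r (VP.lookup-replicate i 0)) z≤n
to-bo c v (y ∷ D) p i = ≤t (≤r (VP.lookup-zipWith _+_ i (v y) (tota v D))) (+-mono-≤ (p y i) (to-bo c v D p i))

lookup≤«¦ : ∀ {M} (v : Vec ℕ M) -> Bo « v ¦ v
lookup≤«¦ (x ∷ v) zr = m≤m+n x _
lookup≤«¦ (x ∷ v) (suc i) = ≤t (lookup≤«¦ v i) (m≤n+m _ x)

uni : ∀ {N} -> Fin N -> Vec ℕ N
uni zr = 1 ∷ 0ᵥ
uni (suc a) = 0 ∷ uni a

unit≤1 : ∀ {N} (a : Fin N) -> Bo 1 (uni a)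
unit≤1 zr zr = ≤=
unit≤1 zr (suc i) = ≤t (≤r (VP.lookup-replicate i 0)) z≤n
unit≤1 (suc a) zr = z≤n
unit≤1 (suc a) (suc i) = unit≤1 a i

module Cou (n N : ℕ) where
 open Alp n N public
 open Shap n n using (ℕs)

 lett : Y -> Vec ℕ N
 lett (inl (_ , A , _)) = ℕs A
 lett (inr (a , _)) = uni a

 we-Y : Y -> Vec ℕ (suc N)
 we-Y y = bars y ∷ lett y

 weight-Z : Z -> Vec ℕ (suc N)
 weight-Z z = we-Y (inr z)

 mon-con : ∀ {M} {x y : Fin M -> ℚ} (A : Row M) -> (∀ i -> x i == y i) -> mo n x A == mo n y A
 mon-con [] p = rfl
 mon-con (a ∷ A) p = ap2 _&_ (cg (\ z -> po z (tn a)) (p zr)) (mon-con A (p ∘ suc))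

 mo-en : ∀ K t {M} (A : Row M) c -> mo n (\ a -> po t (c * enc K (uni a))) A == po t (c * enc K (ℕs A))
 mo-en K t [] c = cg (po t) (sym (*-zeroʳ c))
 mo-en K t {suc M} (a ∷ A) c = ap2 _&_ (sym (po-* t (tn a) _) » cg (po t) (cg (\ z -> tn a * (c * z)) (cg (\ z -> 1 + K * z) (en-0 K {M}) » cg suc (*-zeroʳ K)) » lem (tn a) c))
  (mon-con A (\ i -> cg (po t) (sym (*-assoc c K _))) » mo-en K t A (c * K)) »
  sym (po-+ t (c * tn a) _) » cg (po t) (le' c (tn a) K (enc K (ℕs A)))
  where
  lem : ∀ a c -> a * (c * 1) == c * a
  lem = ℕ-ring
  le' : ∀ c a K e -> c * a + c * K * e == c * (a + K * e)
  le' = ℕ-ring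

 module _ (K : ℕ) (b : ℚ) (m : ℕ) where
  private
   t = po b m
  open We t (\ a -> po t (K * enc K (uni a)))

  wt-en : ∀ y -> wt y == po b (m * enc K (we-Y y))
  wt-en y = go y » sym (po-* b (enc K (we-Y y)) m) » cg (po b) (*-comm (enc K (we-Y y)) m)
   where
   go : ∀ y -> wt y == po t (enc K (we-Y y))
   go (inl (r , A , A')) = cg (po t (bars (inl (r , A , A'))) &_) (mo-en K t A K) » sym (po-+ t (bars (inl (r , A , A'))) _)
   go (inr (a , c)) = sym (po-+ t (bar c) _)

 de-tr : ∀ {A : Set} ⦃ _ : Fi A ⦄ (y₀ : A) k -> tr (pw (\ y z -> 1q & δ (eq? y y₀ ×-dec eq? y z)) (suc k)) == 1q
 de-tr y₀ k = Tr.tr-pw _ (\ _ -> 0) (\ y z ne _ -> cg (1q &_) (δ-no (eq? y y₀ ×-dec eq? y z) (ne ∘ snd)) » &-zeroʳ 1q) (suc k) »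
  Ʃ-co (\ y -> po-δ (eq? y y₀ ×-dec eq? y y) » δ-⇔ _ (eq? y y₀) fst (_, rfl) » sym (&-idʳ _)) » Ʃ-δ y₀ (\ _ -> 1q)
  where
  po-δ : ∀ {P : Set} (d : Dec P) -> po (1q & δ d) (suc k) == δ d
  po-δ (yes p) = cg (\ z -> po z (suc k)) (&-idˡ _ » δ-ye (yes p) p) » po-1 (suc k) » sym (δ-ye (yes p) p)
  po-δ (no ¬p) = cg (\ z -> po z (suc k)) (&-idˡ _ » δ-no (no ¬p) ¬p) » po-0 k » sym (δ-no (no ¬p) ¬p)

 cou : ∀ {A : Set} ⦃ _ : Fi A ⦄ (ℓ : Lo A) (v : A -> Vec ℕ (suc N)) (π g : Pe n) (τ : Vec ℕ (suc N)) -> ℚ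
 cou ℓ v π g τ = Ʃ (\ D -> δ (va? ℓ π D ×-dec eq? (D ▹ g) D) & δ (VP.≡-dec _≟ℕ_ (tota v D) τ))

 module _ {π g : Pe n} (fix : co g π == π) where
  open Qu π g fix using (step;step-inj;kind;kind-step;closed-orbits)

  -- On an orbit of size m the variables are specialised to t = bᵐ and x_a = t to the power K·Kᵃ,
  -- which makes the weight of a letter b to m times its encoded degree vector. The base is at least
  -- 2, which secures t ≠ 1.
  gen : (a₀ : Fin N) (K b' : ℕ) -> let b = ι (suc (suc b')) in
   Ʃ (\ D -> δ (va? bicoloured π D ×-dec eq? (D ▹ g) D) & po b (sF (\ i -> enc K (weight-Z (lk D i)))))
   == Ʃ (\ D -> δ (va? ti π D ×-dec eq? (D ▹ g) D) & po b (sF (\ i -> enc K (we-Y (lk D i)))))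
  gen a₀ K b' = sym (closed-orbits bicoloured _ (a₀ , false) b) » Com.compa (Ke.ke bicoloured _ (a₀ , false) b) (Ke.ke ti _ (inr (a₀ , false)) b) n trac n step kind (\ _ -> 0) step-inj kind-step
   (ℚP.≤-reflexive (Ʃ-co (\ _ -> #-idʳ 1q) » ones n)) »
   closed-orbits ti _ (inr (a₀ , false)) b
   where
   b = ι (suc (suc b'))
   b^≢1 : ∀ m -> po b (suc m) ≢ 1q
   b^≢1 m e = <≢ (≤t (s≤s (s≤s z≤n)) (m≤m*n (suc (suc b')) (suc (suc b') ^ m) ⦃ m^n≢0 (suc (suc b')) m ⦄))
    (sym (ι-in (Di.ι-po (suc (suc b')) (suc m) » e » sym (#-idʳ 1q))))
    where open import Data.Nat.Properties using (m≤m*n;m^n≢0)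
   trac : ∀ θ k -> k < n -> tr (pw (Ke.ke bicoloured (\ z -> enc K (weight-Z z)) (a₀ , false) b θ) (suc k)) == tr (pw (Ke.ke ti (\ y -> enc K (we-Y y)) (inr (a₀ , false)) b θ) (suc k))
   trac dead k _ = de-tr (a₀ , false) k » sym (de-tr (inr (a₀ , false)) k)
   trac (fi m) k l = tr-co (\ y z -> ap2 _&_ (sym (wt-en K b (suc m) (inr y))) (δ-× _ _)) (suc k) »
    We.fi-tr (po b (suc m)) (\ a -> po (po b (suc m)) (K * enc K (uni a))) k l »
     tr-co (\ y z -> ap2 _&_ (wt-en K b (suc m) y) (sym (δ-× _ _))) (suc k)
   trac (mov m) k l = tr-co (\ y z -> cg (_& _) (sym (wt-en K b (suc m) (inr y)))) (suc k) »
    We.mo-tr (po b (suc m)) (\ a -> po (po b (suc m)) (K * enc K (uni a))) (b^≢1 m) k l »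
     tr-co (\ y z -> cg (_& _) (wt-en K b (suc m) y)) (suc k)

  eq-co : Fin N -> ∀ j (α : Vec ℕ N) -> « α ¦ == n -> cou bicoloured weight-Z π g (j ∷ α) == cou ti we-Y π g (j ∷ α)
  eq-co a₀ j α e = sym (cod bicoloured weight-Z (\ z -> bo (inr z))) » Di.co-eq (\ D -> va? bicoloured π D ×-dec eq? (D ▹ g) D) (\ D -> va? ti π D ×-dec eq? (D ▹ g) D) _ _
   (gen a₀ (suc K)) (enc (suc K) (j ∷ α)) »
   cod ti we-Y bo
   where
   -- A bound for the entries of the target vector, at most j or n, and for those of a sum of n
   -- vectors with entries at most n + 1.
   K = j + n + n * suc n
   bo : ∀ y -> Bo (suc n) (we-Y y)
   bo (inl (r , A , a ∷ b ∷ [])) zr = ≤t (+-mono-≤ (≤-pred (toℕ<n b)) (block≤1 ∣ A ∣)) (≤r (+-comm n 1))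
    where
    block≤1 : ∀ s -> iB s ≤ 1
    block≤1 zr = z≤n
    block≤1 (suc zr) = z≤n
    block≤1 (suc (suc _)) = ≤=
   bo (inl (r , A , A')) (suc i) = ≤t (≤r (VP.lookup-map i tn A)) (<⇒≤ (toℕ<n (lk A i)))
   bo (inr (a , true)) zr = s≤s z≤n
   bo (inr (a , false)) zr = z≤n
   bo (inr (a , c)) (suc i) = ≤t (unit≤1 a i) (s≤s z≤n)
   tar : Bo K (j ∷ α)
   tar zr = ≤t (m≤m+n j n) (m≤m+n _ _)
   tar (suc i) = ≤t (lookup≤«¦ α i) (≤t (≤r e) (≤t (m≤n+m n j) (m≤m+n _ _)))
   cod : ∀ {A : Set} ⦃ _ : Fi A ⦄ (ℓ : Lo A) (v : A -> Vec ℕ (suc N)) -> (∀ y -> Bo (suc n) (v y)) ->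
    Ʃ (\ D -> δ (va? ℓ π D ×-dec eq? (D ▹ g) D) & δ (sF (\ i -> enc (suc K) (v (lk D i))) ≟ℕ enc (suc K) (j ∷ α))) == cou ℓ v π g (j ∷ α)
   cod ℓ v bd = Ʃ-co (\ D -> cg (δ (va? ℓ π D ×-dec eq? (D ▹ g) D) &_) (δ-⇔ _ _
    (\ p -> en-in K (tota v D) (j ∷ α) (\ i -> ≤t (to-bo (suc n) v D bd i) (m≤n+m _ (j + n))) tar (en-to (suc K) v D » p))
    (\ p -> sym (en-to (suc K) v D) » cg (enc (suc K)) p)))

co-ti : ∀ n N {π g} -> co g π == π -> ∀ j (α : Vec ℕ N) -> « α ¦ == n ->
 let open Cou n N in cou bicoloured weight-Z π g (j ∷ α) == cou ti we-Y π g (j ∷ α)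
co-ti n (suc N) fix j α e = Cou.eq-co n (suc N) fix zr j α e
-- An empty alphabet offers no letter to put on dead places, so it is treated separately; only the
-- empty word is left.
co-ti zr zr {π} {g} fix j [] e = Ʃ-[] _ » ap2 _&_ (δ-⇔ _ _ (\ _ -> (\ ()) , rfl) (\ _ -> (\ ()) , rfl)) rfl » sym (Ʃ-[] _)
co-ti (suc n) zr fix j [] ()

-- Positive definiteness of twisted counts.

module Twi {n : ℕ} (ℍ : FG) (Y : Set) ⦃ _ : Fi Y ⦄
 (_▷_ : Pe n -> Y -> Y) (_◁_ : Y -> FG.G ℍ -> Y) (R : Y -> Pe n -> ℕ) {Go : Y -> Set} (go? : ∀ y -> Dec (Go y))
 (▷-∙ : ∀ h g y -> (h ∙ₚ g) ▷ y == h ▷ (g ▷ y)) (▷-id : ∀ y -> idₚ ▷ y == y)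
 (◁-∙ : ∀ y h k -> y ◁ FG._∙_ ℍ h k == (y ◁ h) ◁ k) (◁-ε : ∀ y -> y ◁ FG.ε ℍ == y)
 (R-∙ : ∀ y g h -> R y (h ∙ₚ g) ≈[ n ! ] R y g + R (g ▷ y) h) (go-▷ : ∀ g y -> Go y -> Go (g ▷ y)) where
 open Tw n using (L;ζ;ζ-≈;ε;ε-shift;ε-≈)
 private
  module G = FG (Sym {n})
  module H = FG ℍ

 φ : H.G -> ℚ
 φ h = Ʃ (\ g -> Ʃ (\ y -> δ (go? y) & (δ (eq? (g ▷ y) (y ◁ h)) & ε (R y g))))

 private
  a : Y -> Y -> Fin L -> H.G -> ℚ
  a y y' s k = δ (go? y) & Ʃ (\ g -> δ (eq? (g ▷ y) (y' ◁ k)) & ζ (tn s + R y g))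

  ▷-in : ∀ g y -> invₚ g ▷ (g ▷ y) == y
  ▷-in g y = sym (▷-∙ (invₚ g) g y) » cg (_▷ y) (G.invˡ g) » ▷-id y
  ▷-in' : ∀ g y -> g ▷ (invₚ g ▷ y) == y
  ▷-in' g y = sym (▷-∙ g (invₚ g) y) » cg (_▷ y) (G.invʳ g) » ▷-id y
  ◁-in : ∀ k y -> (y ◁ k) ◁ H.inv k == y
  ◁-in k y = sym (◁-∙ y k (H.inv k)) » cg (y ◁_) (H.invʳ k) » ◁-ε y
  ◁-in' : ∀ k y -> (y ◁ H.inv k) ◁ k == y
  ◁-in' k y = sym (◁-∙ y (H.inv k) k) » cg (y ◁_) (H.invˡ k) » ◁-ε y

  opaque
   unfolding _#_
   sq : ∀ p x y -> (p & x) & (p & y) == p & p & (x & y)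
   sq = slv ℚ-ri

  W : Y -> Y -> H.G -> H.G -> ℚ
  W u y' k h = Ʃ (\ g -> δ (eq? u (y' ◁ k)) & (δ (eq? (g ▷ u) (y' ◁ (k H.∙ h))) & ε (R u g)))

  -- one of the two sums over G is absorbed by the shift of ζ
  cor : ∀ h y y' k -> Ʃ (\ s -> a y y' s k & a y y' s (k H.∙ h)) == δ (go? y) & Ʃ (\ g -> W (g ▷ y) y' k h)
  cor h y y' k = begin
   Ʃ (\ s -> a y y' s k & a y y' s (k H.∙ h))
    ≡⟨ trans (Ʃ-co (\ s -> sq _ _ _ » ap2 _&_ (δ-id (go? y)) (sym (Ʃ-& _ _)))) (Ʃ-*ˡ _ _) ⟩
   δ (go? y) & Ʃ (\ s -> Ʃ (\ g -> Ʃ (\ g₂ -> (A g & ζ (tn s + R y g)) & (B g₂ & ζ (tn s + R y g₂)))))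
    ≡⟨ cg (δ (go? y) &_) (Ʃ-co (\ s -> Ʃ-co (\ g -> sym (G.Ʃ-right g _))) » Ʃ-sw _ » Ʃ-co (\ g -> Ʃ-sw _ » Ʃ-co (\ g₃ -> inn g g₃))) ⟩
   δ (go? y) & Ʃ (\ g -> W (g ▷ y) y' k h) ∎
   where
   open ≡-Reasoning
   A B : Pe n -> ℚ
   A g = δ (eq? (g ▷ y) (y' ◁ k))
   B g = δ (eq? (g ▷ y) (y' ◁ (k H.∙ h)))
   inn : ∀ g g₃ -> Ʃ (\ s -> (A g & ζ (tn s + R y g)) & (B (g₃ ∙ₚ g) & ζ (tn s + R y (g₃ ∙ₚ g)))) == A g & (δ (eq? (g₃ ▷ (g ▷ y)) (y' ◁ (k H.∙ h))) & ε (R (g ▷ y) g₃))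
   inn g g₃ = Ʃ-co (\ s -> &-4 _ _ _ _ » cg (\ z -> A g & B (g₃ ∙ₚ g) & (ζ (tn s + R y g) & z)) (ζ-≈ (tn s) (R-∙ y g g₃))) »
    Ʃ-*ˡ _ _ » &-as _ _ _ » cg (A g &_) (ap2 _&_ (cg (\ u -> δ (eq? u (y' ◁ (k H.∙ h)))) (▷-∙ g₃ g y))
     (S-Ʃ L (\ s -> ζ (s + R y g) & ζ (s + (R y g + R (g ▷ y) g₃))) » ε-shift (R y g) (R (g ▷ y) g₃)))

  ψ : H.G -> Y -> ℚ
  ψ h u = Ʃ (\ g -> δ (eq? (g ▷ u) (u ◁ h)) & ε (R u g))

  W-su : ∀ h u k -> Ʃ (\ y' -> W u y' k h) == ψ h u
  W-su h u k = Ʃ-sw _ » Ʃ-co (\ g -> Ʃ-po (\ y' -> eq? u (y' ◁ k)) (u ◁ H.inv k) _ (sym (◁-in' k u)) (\ { y' rfl -> sym (◁-in k y') }) »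
   cg (\ z -> δ (eq? (g ▷ u) z) & ε (R u g)) (◁-∙ _ k h » cg (_◁ h) (◁-in' k u)))

  φ≡ : ∀ h -> Ʃ (\ y -> δ (go? y) & ψ h y) == φ h
  φ≡ h = Ʃ-co (\ y -> sym (Ʃ-*ˡ _ _)) » Ʃ-sw _

 -- The vectors compare `g ▷ y` with `y' ◁ k`, weighted by ζ at a shift s. Multiplying two of them
 -- and summing over s gives ε at the difference of two rotations, which the cocycle law identifies
 -- with the rotation of a single group element.
 twisted-posdef : H.PosDef φ
 twisted-posdef = record
  { J = Y × Y × Fin L ;a = \ (y , y' , s) -> a y y' s ;c = H.order & G.order ;c>0 = &->0 H.order>0 G.order>0
  ;au = \ h -> sym (begin
   Ʃ (\ ((y , y' , s) : Y × Y × Fin L) -> Ʃ (\ k -> a y y' s k & a y y' s (k H.∙ h)))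
    ≡⟨ Ʃ-× _ » Ʃ-co (\ y -> Ʃ-× _ » Ʃ-co (\ y' -> Ʃ-sw _ » Ʃ-co (\ k -> cor h y y' k))) ⟩
   Ʃ (\ y -> Ʃ (\ y' -> Ʃ (\ k -> δ (go? y) & Ʃ (\ g -> W (g ▷ y) y' k h))))
    ≡⟨ Ʃ-co (\ y -> Ʃ-sw _ » Ʃ-co (\ k -> Ʃ-*ˡ _ _ » cg (δ (go? y) &_) (Ʃ-sw _ » Ʃ-co (\ g -> W-su h (g ▷ y) k)))) » Ʃ-sw _ » H.Ʃ-const _ ⟩
   H.order & Ʃ (\ y -> δ (go? y) & Ʃ (\ g -> ψ h (g ▷ y)))
    ≡⟨ cg (H.order &_) (Ʃ-co (\ y -> sym (Ʃ-*ˡ _ _)) » Ʃ-sw _ » Ʃ-co (\ g -> move h g) » G.Ʃ-const _) ⟩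
   H.order & (G.order & φ h)
    ≡⟨ &-as _ _ _ ⟨
   H.order & G.order & φ h ∎) }
  where
  open ≡-Reasoning
  move : ∀ h g -> Ʃ (\ y -> δ (go? y) & ψ h (g ▷ y)) == φ h
  move h g = Ʃ-co (\ y -> cg (_& ψ h (g ▷ y)) (δ-⇔ (go? y) (go? (g ▷ y)) (go-▷ g y) (\ p -> subst Go (▷-in g y) (go-▷ (invₚ g) (g ▷ y) p)))) »
   Ʃ-bi (g ▷_) (invₚ g ▷_) (▷-in g) (▷-in' g) (\ y -> δ (go? y) & ψ h y) » φ≡ h

module Prod (𝔾 ℍ : FG) where
 private
  module G = FG 𝔾
  module H = FG ℍ

 _⊠_ : FG
 _⊠_ = record
  { G = G.G × H.G ;_∙_ = \ (a , b) (c , d) -> a G.∙ c , b H.∙ d ;ε = G.ε , H.ε ;inv = \ (a , b) -> G.inv a , H.inv b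
  ;assoc = \ _ _ _ -> ap2 _,_ (G.assoc _ _ _) (H.assoc _ _ _) ;idˡ = \ _ -> ap2 _,_ (G.idˡ _) (H.idˡ _) ;idʳ = \ _ -> ap2 _,_ (G.idʳ _) (H.idʳ _)
  ;invˡ = \ _ -> ap2 _,_ (G.invˡ _) (H.invˡ _) ;invʳ = \ _ -> ap2 _,_ (G.invʳ _) (H.invʳ _) }

 Re-⊠ : ∀ {φ ψ} -> G.Rep φ -> H.Rep ψ -> FG.Rep _⊠_ (\ (g , h) -> φ g & ψ h)
 Re-⊠ A B = record
  { I = A.I × B.I
  ;ρ = \ (g , h) (i , j) (k , l) -> A.ρ g i k & B.ρ h j l
  ;ρ-∙ = \ (g , h) (g' , h') (i , j) (k , l) -> ap2 _&_ (A.ρ-∙ g g' i k) (B.ρ-∙ h h' j l) » sym (Ʃ-& _ _) » Ʃ-co₂ (\ _ _ -> &-4 _ _ _ _) » sym (Ʃ-× _)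
  ;ρ-inv = \ (g , h) (i , j) (k , l) -> ap2 _&_ (A.ρ-inv g i k) (B.ρ-inv h j l)
  ;ρ-trace = \ (g , h) -> Ʃ-× _ » Ʃ-& _ _ » ap2 _&_ (A.ρ-trace g) (B.ρ-trace h) }
  where
  module A = G.Rep A
  module B = H.Rep B
  instance
   fA = A.fI
   fB = B.fI

Ʃ-ma-in₁ : {A B : Set} ⦃ _ : Fi A ⦄ ⦃ _ : Fi B ⦄ {m : ℕ} (f : Vec (A ⊎ B) m -> ℚ) ->
 (∀ D i {b} -> lk D i == inr b -> f D == 0q) -> Ʃ f == Ʃ (f ∘ V.map inl)
Ʃ-ma-in₁ {m = zr} f z = Ʃ-[] f » sym (Ʃ-[] _)
Ʃ-ma-in₁ {m = suc m} f z = Ʃ-∷ f » Ʃ-⊎ _ » ap2 _#_ (Ʃ-co (\ a -> Ʃ-ma-in₁ (\ D -> f (inl a ∷ D)) (\ D i e -> z _ (suc i) e)))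
 (Ʃ-0 (\ b -> Ʃ-0 (\ D -> z _ zr rfl))) » #-idʳ _ » sym (Ʃ-∷ _)

-- From primitive words to primitive tilings.

module Cha (n N : ℕ) (C : Pe n -> ℚ) where
 open Cou n N public
 open Tw n using (ε;stabiliser;twisted-sum)

 -- Weighting by stabilisers makes every orbit under simultaneous conjugation and permutation of
 -- places contribute the same amount, the order of the group.
 primitive-sum : ∀ {A : Set} ⦃ _ : Fi A ⦄ (ℓ : Lo A) (v : A -> Vec ℕ (suc N)) (τ : Vec ℕ (suc N)) -> ℚ
 primitive-sum ℓ v τ = Ʃ (\ π -> Ʃ (\ D -> C π & δ (VP.≡-dec _≟ℕ_ (tota v D) τ) & (δ (va? ℓ π D) & (δ (pr? π D) & stabiliser π D))))

 private
  opaque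
   unfolding _#_
   r1 : ∀ e c t v p s -> e & (c & t & (v & (p & s))) == c & (t & v & (p & (e & s)))
   r1 = slv ℚ-ri
   r2 : ∀ t v a b e -> t & v & (a & b & e) == a & e & (v & b & t)
   r2 = slv ℚ-ri

 -- The primitivity condition, multiplied by the stabiliser, is exactly what `twisted-sum` produces.
 -- After the exchange of sums only words fixed by commuting pairs are counted, with no condition of
 -- primitivity.
 tw-co : ∀ {A : Set} ⦃ _ : Fi A ⦄ (ℓ : Lo A) v τ ->
  ε 0 & primitive-sum ℓ v τ == Ʃ (\ π -> C π & Ʃ (\ g -> δ (eq? (co g π) π) & ε (ro π g) & cou ℓ v π g τ))
 tw-co ℓ v τ = sym (Ʃ-*ˡ (ε 0) _) » Ʃ-co (\ π -> sym (Ʃ-*ˡ (ε 0) _) » Ʃ-co (\ D -> r1 _ _ _ _ _ _ » cg (C π &_) (cg (δ (VP.≡-dec _≟ℕ_ (tota v D) τ) & δ (va? ℓ π D) &_) (sym (twisted-sum π D)) » sym (Ʃ-*ˡ _ _) » Ʃ-co (\ g ->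
  cg (\ z -> δ (VP.≡-dec _≟ℕ_ (tota v D) τ) & δ (va? ℓ π D) & (z & ε (ro π g))) (δ-⇔ (st? π D g) (eq? (co g π) π ×-dec eq? (D ▹ g) D) id id » δ-× _ _) »
   r2 _ _ _ _ _ » cg (\ z -> δ (eq? (co g π) π) & ε (ro π g) & (z & δ (VP.≡-dec _≟ℕ_ (tota v D) τ))) (sym (δ-× _ _))))) »
  Ʃ-*ˡ (C π) _ » cg (C π &_) (Ʃ-sw _ » Ʃ-co (\ g -> Ʃ-*ˡ _ _)))

 tiles : Lo Ti
 tiles = record { E = \ y z -> Res y z ⊎ Pro y z ;E? = \ y z -> res? y z ⊎-dec pro? y z ;F = Si ;F? = si? }

 weight-T : Ti -> Vec ℕ (suc N)
 weight-T y = we-Y (inl y)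

 -- A cycle of constant letters is periodic.
 co-im : ∀ (π : Pe n) (D : Vec Y n) i {z} -> lk D i == inr z -> Va ti π D -> ¬ Pr π D
 co-im π D i {z} e v p = moved (sym (p i (π · i) (⇝-in π 1 i) (it-in π D (\ m -> consta m » sym (cg (lk D) (it-su π m i) » consta (suc m))))))
  where
  moved : π · i ≢ i
  moved f = subst FT e (fst (v i) f)
  consta : ∀ m -> lk D (it π m i) == inr z
  consta zr = e
  consta (suc m) = go (lk D (π · it π m i)) rfl (subst (\ y -> Ne y (lk D (π · it π m i))) (consta m)
   (snd (v (it π m i)) (\ f -> moved (ite-inj π m (it-su π m i » f)))))
   where
   go : ∀ y -> lk D (π · it π m i) == y -> Ne (inr z) (lk D (π · it π m i)) -> lk D (π · it π m i) == inr z
   go (inl y) f nx = ⊥-elim (subst (Ne (inr z)) f nx)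
   go (inr y) f nx = f » cg inr (sym (subst (Ne (inr z)) f nx))

 ti-on : ∀ τ -> primitive-sum ti we-Y τ == primitive-sum tiles weight-T τ
 ti-on τ = Ʃ-co (\ π -> Ʃ-ma-in₁ _ (\ D i e -> ap2 _&_ rfl (va π D i e (va? ti π D) (pr? π D)) » &-zeroʳ _) »
  Ʃ-co (\ D -> ap2 _&_ (cg (\ t -> C π & δ (VP.≡-dec _≟ℕ_ t τ)) (to-ma D)) (ap2 _&_ (δ-⇔ _ _ (valid→ π D) (valid← π D))
   (ap2 _&_ (δ-⇔ _ _ (\ p y z q i -> p y z q (it-in π (V.map inl D) (\ m -> at D _ » cg inl (itin π D i m) » sym (at D _))))
    (\ p y z q i -> p y z q (it-in π D (\ m -> inj₁-injective (sym (at D _) » itin π (V.map inl D) i m » at D _)))))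
    (Ʃ-co (\ g -> δ-⇔ _ _ (\ (a , b) -> a , lo-ex (\ i -> inj₁-injective (cg inl (▹-lo D g i) » sym (at D _) » sym (▹-lo (V.map inl D) g i) » cg (\ E -> lk E i) b » at D i)))
     (\ (a , b) -> a , lo-ex (\ i -> ▹-lo (V.map inl D) g i » at D _ » cg inl (sym (▹-lo D g i) » cg (\ E -> lk E i) b) » sym (at D i)))))))))
  where
  open import Data.Sum.Properties using (inj₁-injective)
  at : ∀ (D : Vec Ti n) i -> lk (V.map inl D) i == inl {B = Z} (lk D i)
  at D i = VP.lookup-map i inl D
  to-ma : ∀ {m} (D : Vec Ti m) -> tota we-Y (V.map inl D) == tota weight-T D
  to-ma [] = rfl
  to-ma (y ∷ D) = cg (weight-T y +ᵥ_) (to-ma D)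
  valid→ : ∀ π D -> Va ti π (V.map inl D) -> Va tiles π D
  valid→ π D v i = (\ f -> subst FT (at D i) (fst (v i) f)) , (\ f -> subst2 Ne (at D i) (at D (π · i)) (snd (v i) f))
  valid← : ∀ π D -> Va tiles π D -> Va ti π (V.map inl D)
  valid← π D v i = (\ f -> subst FT (sym (at D i)) (fst (v i) f)) , (\ f -> subst2 Ne (sym (at D i)) (sym (at D (π · i))) (snd (v i) f))
  va : ∀ (π : Pe n) (D : Vec Y n) i {z} -> lk D i == inr z -> (d : Dec (Va ti π D)) (d' : Dec (Pr π D)) -> δ d & (δ d' & stabiliser π D) == 0q
  va π D i e (no ¬v) d' = δ-fa (no ¬v) ¬v
  va π D i e (yes v) (no ¬p) = cg (δ (yes v) &_) (δ-fa (no ¬p) ¬p) » &-zeroʳ _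
  va π D i e (yes v) (yes p) = absurd p (co-im π D i e v)

 -- Words and tilings are exchanged where only fixed words are counted. Undoing the twist restores
 -- primitivity on the side of the tilings and so discards the constant cycles; a second twist
 -- leaves pure tilings.
 primitive-counts : ∀ j (α : Vec ℕ N) -> « α ¦ == n ->
  ε 0 & primitive-sum bicoloured weight-Z (j ∷ α) == Ʃ (\ π -> C π & Ʃ (\ g -> δ (eq? (co g π) π) & ε (ro π g) & cou tiles weight-T π g (j ∷ α)))
 primitive-counts j α e = tw-co bicoloured weight-Z (j ∷ α) » Ʃ-co (\ π -> cg (C π &_) (Ʃ-co (\ g -> &-as _ _ _ » δ-co (eq? (co g π) π) (\ f -> cg (ε (ro π g) &_) (co-ti n N f j α e)) » sym (&-as _ _ _)))) »
  sym (tw-co ti we-Y (j ∷ α)) » cg (ε 0 &_) (ti-on (j ∷ α)) » tw-co tiles weight-T (j ∷ α)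

ma-▹ : ∀ {A B : Set} {n} (f : A -> B) (D : Vec A n) (g : Pe n) -> V.map f (D ▹ g) == V.map f D ▹ g
ma-▹ f D g = lo-ex (\ i -> VP.lookup-map i f (D ▹ g) » cg f (▹-lo D g i) » sym (VP.lookup-map (g · i) f D) » sym (▹-lo (V.map f D) g i))

-- The shape of a tiling.

module Sha (n : ℕ) where
 open Ko n n using (Row;ℕs;rowsum;colsum;≡ᵥ?)

 Re : Set
 Re = Vec (Fin n) n

 rem : Re -> Fin n -> ℕ
 rem r i = tn (lk r i)

 SA : Pe n -> Re -> Fin n -> Set
 SA π r i = (π · i == i -> rem r i == 0) × (π · i ≢ i -> (rem r i == 0 × 1 ≤ rem r (π · i)) ⊎ suc (rem r (π · i)) == rem r i)

 IS : Pe n -> Re -> Set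
 IS π r = ∀ i -> SA π r i

 opaque
  iS? : ∀ π r -> Dec (IS π r)
  iS? π r = all? (\ i -> ((π · i ≟F i) →-dec (rem r i ≟ℕ 0)) ×-dec (¬? (π · i ≟F i) →-dec (((rem r i ≟ℕ 0) ×-dec (1 ≤?ℕ rem r (π · i))) ⊎-dec (suc (rem r (π · i)) ≟ℕ rem r i))))
   where open import Relation.Nullary.Decidable using (_→-dec_)

 -- The numbers of letters and marks on a cell, the decisions being whether π fixes it and whether
 -- its predecessor ends a block. A first cell with residue r opens a block of r + 1 letters, hence
 -- r - 1 marks.
 sD mD : ∀ {P Q : Set} -> Dec P -> Dec Q -> ℕ -> ℕ
 sD (yes _) _ _ = 1
 sD (no _) (yes _) r = suc r
 sD (no _) (no _) _ = 0
 mD (yes _) _ _ = 0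
 mD (no _) (yes _) r = pred r
 mD (no _) (no _) _ = 0

 slo ma : Pe n -> Re -> Fin n -> ℕ
 slo π r i = sD (π · i ≟F i) (rem r (π ·⁻ i) ≟ℕ 0) (rem r i)
 ma π r i = mD (π · i ≟F i) (rem r (π ·⁻ i) ≟ℕ 0) (rem r i)

 sl ma-at : Pe n -> Re -> Vec ℕ n
 sl π r = tab (slo π r)
 ma-at π r = tab (ma π r)

 bl-in : ∀ {m} -> Vec ℕ m -> ℕ
 bl-in v = « V.map iB v ¦

 module _ {π : Pe n} {r : Re} where

  sl-fi : ∀ i -> π · i == i -> slo π r i == 1 × ma π r i == 0
  sl-fi i e with π · i ≟F i
  ... | yes _ = rfl , rfl
  ... | no ne = absurd e ne

  sl-st : ∀ i -> π · i ≢ i -> rem r i == 0 -> slo π r (π · i) == suc (rem r (π · i)) × ma π r (π · i) == pred (rem r (π · i))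
  sl-st i ne z with π · (π · i) ≟F π · i | rem r (π ·⁻ (π · i)) ≟ℕ 0
  ... | yes e | _ = absurd (·-in π e) ne
  ... | no _ | yes _ = rfl , rfl
  ... | no _ | no nz = absurd (cg (rem r) (·⁻· π i) » z) nz

  sl-re : ∀ i -> π · i ≢ i -> rem r i ≢ 0 -> slo π r (π · i) == 0 × ma π r (π · i) == 0
  sl-re i ne z with π · (π · i) ≟F π · i | rem r (π ·⁻ (π · i)) ≟ℕ 0
  ... | yes e | _ = absurd (·-in π e) ne
  ... | no _ | yes f = absurd (cg (rem r) (sym (·⁻· π i)) » f) z
  ... | no _ | no _ = rfl , rfl

 poi : ∀ (π : Pe n) {P : Fin n -> Set} -> (∀ i -> π · i == i -> P i) -> (∀ i -> π · i ≢ i -> P (π · i)) -> ∀ i -> P i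
 poi π {P} f h i with π · i ≟F i
 ... | yes e = f i e
 ... | no ne = subst P (··⁻ π i) (h (π ·⁻ i) (\ e -> ne (cg (π ·_) (sym (··⁻ π i) » e) » ··⁻ π i)))

 -- A block has two more letters than marks and a fixed point one letter and no mark. Summed over
 -- all cells this is the balance n = n' + 2l + k on which the unimodality rests.
 sl-ba : ∀ π r -> IS π r -> ∀ i -> slo π r i == ma π r i + (2 * iB (slo π r i) + wh (π · i ≟F i) 1)
 sl-ba π r sh = poi π fix move
  where
  fix : ∀ i -> π · i == i -> slo π r i == ma π r i + (2 * iB (slo π r i) + wh (π · i ≟F i) 1)
  fix i e with π · i ≟F i
  ... | yes _ = rfl
  ... | no ne = absurd e ne
  move : ∀ i -> π · i ≢ i -> slo π r (π · i) == ma π r (π · i) + (2 * iB (slo π r (π · i)) + wh (π · (π · i) ≟F π · i) 1)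
  move i ne with π · (π · i) ≟F π · i | rem r (π ·⁻ (π · i)) ≟ℕ 0 | snd (sh i) ne
  ... | yes e | _ | _ = absurd (·-in π e) ne
  ... | no _ | no _ | _ = rfl
  ... | no _ | yes z | inr e = absurd (e » cg (rem r) (sym (·⁻· π i)) » z) (\ ())
  ... | no _ | yes z | inl (_ , l) = go (rem r (π · i)) l
   where
   go : ∀ x -> 1 ≤ x -> suc x == pred x + (2 * iB (suc x) + 0)
   go (suc x) _ = +-comm 2 x

 fi-ma : ∀ {L} -> Pe n -> Vec ℕ n -> {P : Vec ℕ L -> Set} -> (∀ c -> Dec (P c)) -> ℚ
 fi-ma {L} g S P? = Ʃ (\ (A : Vec (Row L) n) -> δ (eq? (A ▹ g) A ×-dec (≡ᵥ? (rowsum A) S ×-dec P? (colsum A))))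

 to-su : ∀ {m L} (A : Vec (Row L) m) -> « rowsum A ¦ == « colsum A ¦
 to-su {L = L} [] = sym («0¦ {L})
 to-su (a ∷ A) = cg (« ℕs a ¦ +_) (to-su A) » sym («+¦ (V.map tn a) (colsum A))

 -- Fixed matrices are counted by words of length m in the points, moved alike by g and by a permutation of the places.
 wo-ov : ∀ {m} -> Pe n -> Vec ℕ n -> Pe m -> ℚ
 wo-ov {m} g S h = Ʃ (\ (w : Vec (Fin n) m) -> δ (≡ᵥ? (con w) S) & δ (eq? (V.map (g ·_) w) (w ▹ h)))

 ma-wo : ∀ {m L} (m≤n : m ≤ n) (α : Vec ℕ L) -> « α ¦ == m -> ∀ g S ->
  FG.order (Sym {m}) & fi-ma g S (\ c -> ≡ᵥ? c α) == Ʃ (\ h -> Ch.M m α h & wo-ov g S h)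
 ma-wo {m} {L} m≤n α e g S = sym (Ʃ-co (\ h -> &-co _ _ » sym (Ʃ-& _ _) » Ʃ-co₂ (\ w v -> ar _ _ _ _ (δ-⇔ _ _ sym sym))) »
  Ar.ar' m n m≤n n n L g (\ a b -> δ (≡ᵥ? a S) & δ (≡ᵥ? b α)) » cg (FG.order (Sym {m}) &_) (Ʃ-co (\ A ->
   cg (δ (« rowsum A ¦ ≟ℕ m) &_) (cg (δ (eq? (A ▹ invₚ g) A) &_) (sym (δ-× _ _)) » sym (δ-× _ _)) » sym (δ-× _ _) »
    δ-⇔ _ (eq? (A ▹ g) A ×-dec (≡ᵥ? (rowsum A) S ×-dec ≡ᵥ? (colsum A) α))
     (\ (_ , f , p) -> trans (cg (_▹ g) (sym f)) (▹-in A g) , p)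
     (\ (f , p , q) -> trans (to-su A) (cg «_¦ q » e) , trans (cg (_▹ invₚ g) (sym f)) (▹-in' A g) , p , q))))
  where
  opaque
   unfolding _#_
   arr : ∀ c x d y -> c & x & (d & y) == x & y & (c & d)
   arr = slv ℚ-ri
  ar : ∀ c x d y {x'} -> x == x' -> c & x & (d & y) == x' & y & (c & d)
  ar c x d y rfl = arr c x d y

module Til (n N : ℕ) where
 open Cou n N
 open Cha n N (\ _ -> 1q) using (tiles;weight-T) public
 open Ko n n using (rowsum;colsum;≡ᵥ?)
 open Sha n

 module _ (π : Pe n) (D : Vec Ti n) where
  private
   r = V.map fst D
   X = V.map snd D
   A = V.map fst X
   A' = V.map snd X
   r≡ : ∀ i -> rem r i == re (lk D i)
   r≡ i = cg tn (VP.lookup-map i fst D)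
   lo-ro : ∀ {L m} (B : Vec (Row L) m) i -> lk (rowsum B) i == ∣ lk B i ∣
   lo-ro (b ∷ B) zr = rfl
   lo-ro (b ∷ B) (suc i) = lo-ro B i
   A≡ : ∀ i -> lk (rowsum A) i == ∣ fst (snd (lk D i)) ∣
   A≡ i = lo-ro A i » cg ∣_∣ (VP.lookup-map i fst X » cg fst (VP.lookup-map i snd D))
   A'≡ : ∀ i -> lk (rowsum A') i == ∣ snd (snd (lk D i)) ∣
   A'≡ i = lo-ro A' i » cg ∣_∣ (VP.lookup-map i snd X » cg snd (VP.lookup-map i snd D))

   Siz : Fin n -> Set
   Siz i = ∣ fst (snd (lk D i)) ∣ == slo π r i × ∣ snd (snd (lk D i)) ∣ == ma π r i

  va-sh : Va tiles π D -> IS π r × rowsum A == sl π r × rowsum A' == ma-at π r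
  va-sh v = sh , lo-ex (\ i -> A≡ i » fst (si i) » sym (lk-tab (slo π r) i)) ,
   lo-ex (\ i -> A'≡ i » snd (si i) » sym (lk-tab (ma π r) i))
   where
   sh : IS π r
   sh i = (\ e -> r≡ i » fst (fst (v i) e)) , (\ ne -> case snd (v i) ne of \
    { (inl (z , l , _)) -> inl (trans (r≡ i) z , ≤t l (≤r (sym (r≡ (π · i)))))
    ;(inr (e , _)) -> inr (cg suc (r≡ (π · i)) » e » sym (r≡ i)) })
   move : ∀ i -> π · i ≢ i -> Siz (π · i)
   move i ne with snd (v i) ne
   ... | inl (z , _ , a , a') = let p , q = sl-st {π} {r} i ne (r≡ i » z) in
    trans a (cg suc (sym (r≡ (π · i))) » sym p) , trans (cg pred (a' » sym (r≡ (π · i)))) (sym q)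
   ... | inr (e , a , a') = let p , q = sl-re {π} {r} i ne (\ z -> case trans e (sym (r≡ i) » z) of \ ()) in trans a (sym p) , trans a' (sym q)
   si : ∀ i -> Siz i
   si = poi π (\ i e -> let p , q = sl-fi {π} {r} i e;(_ , a , a') = fst (v i) e in trans a (sym p) , trans a' (sym q)) move

  sh-va : IS π r -> rowsum A == sl π r -> rowsum A' == ma-at π r -> Va tiles π D
  sh-va sh a a' i = (\ e -> let p , q = sl-fi {π} {r} i e in trans (sym (r≡ i)) (fst (sh i) e) , trans (fst (si i)) p , trans (snd (si i)) q) ,
   (\ ne -> go ne (snd (sh i) ne))
   where
   si : ∀ i -> Siz i
   si i = trans (sym (A≡ i)) (cg (\ v -> lk v i) a » lk-tab (slo π r) i) ,
    trans (sym (A'≡ i)) (cg (\ v -> lk v i) a' » lk-tab (ma π r) i)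
   go : π · i ≢ i -> (rem r i == 0 × 1 ≤ rem r (π · i)) ⊎ suc (rem r (π · i)) == rem r i -> Res (lk D i) (lk D (π · i)) ⊎ Pro (lk D i) (lk D (π · i))
   go ne (inl (z , l)) = let p , q = sl-st {π} {r} i ne z in inl (trans (sym (r≡ i)) z , ≤t l (≤r (r≡ (π · i))) ,
    trans (fst (si (π · i))) (p » cg suc (r≡ (π · i))) , trans (cg suc (snd (si (π · i)) » q)) (su-pr' l » r≡ (π · i)))
    where
    su-pr' : ∀ {x} -> 1 ≤ x -> suc (pred x) == x
    su-pr' (s≤s _) = rfl
   go ne (inr e) = let p , q = sl-re {π} {r} i ne (\ z -> case trans e z of \ ()) in
    inr (trans (cg suc (sym (r≡ (π · i)))) (e » r≡ i) , trans (fst (si (π · i))) p , trans (snd (si (π · i))) q)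

 we-pa : ∀ {m} (D : Vec Ti m) -> let X = V.map snd D in
  tota weight-T D == (lk (colsum (V.map snd X)) (suc zr) + bl-in (rowsum (V.map fst X))) ∷ colsum (V.map fst X)
 we-pa [] = rfl
 we-pa ((r , A , a ∷ b ∷ []) ∷ D) = cg (weight-T (r , A , a ∷ b ∷ []) +ᵥ_) (we-pa D) » ap2 _∷_
  (lem (tn b) (iB ∣ A ∣) (lk c (suc zr)) _ » cg (_+ (iB ∣ A ∣ + bl-in (rowsum (V.map fst (V.map snd D))))) (sym (VP.lookup-zipWith _+_ (suc zr) (tn a ∷ tn b ∷ []) c))) rfl
  where
  c = colsum (V.map snd (V.map snd D))
  lem : ∀ b i x y -> b + i + (x + y) == b + x + (i + y)
  lem = ℕ-ring

 -- Once the residues are given, the multisets of letters and of marks are chosen independently,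
 -- subject only to the numbers required on each cell.
 count-shapes : ∀ π g j (α : Vec ℕ N) -> cou tiles weight-T π g (j ∷ α) ==
  Ʃ (\ r -> δ (eq? (r ▹ g) r ×-dec iS? π r) & (fi-ma g (sl π r) (\ c -> ≡ᵥ? c α)
   & fi-ma g (ma-at π r) (\ (c : Vec ℕ 2) -> lk c (suc zr) + bl-in (sl π r) ≟ℕ j)))
 count-shapes π g j α = Ʃ-co po-co » Ʃ-zi (\ r X -> F r (V.map fst X) (V.map snd X)) »
  Ʃ-co (\ r -> Ʃ-zi (F r) » Ʃ-co (\ A -> Ʃ-*ˡ (δ (inv? r)) _) » Ʃ-*ˡ (δ (inv? r)) _ » cg (δ (inv? r) &_) (Ʃ-& _ _))
  where
  inv? : ∀ r -> Dec (r ▹ g == r × IS π r)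
  inv? r = eq? (r ▹ g) r ×-dec iS? π r
  P₁? : ∀ r (A : Vec (Row N) n) -> Dec (A ▹ g == A × (rowsum A == sl π r × colsum A == α))
  P₁? r A = eq? (A ▹ g) A ×-dec (≡ᵥ? (rowsum A) (sl π r) ×-dec ≡ᵥ? (colsum A) α)
  P₂? : ∀ r (A' : Vec (Row 2) n) -> Dec (A' ▹ g == A' × (rowsum A' == ma-at π r × lk (colsum A') (suc zr) + bl-in (sl π r) == j))
  P₂? r A' = eq? (A' ▹ g) A' ×-dec (≡ᵥ? (rowsum A') (ma-at π r) ×-dec (lk (colsum A') (suc zr) + bl-in (sl π r) ≟ℕ j))
  F : Re -> Vec (Row N) n -> Vec (Row 2) n -> ℚ
  F r A A' = δ (inv? r) & (δ (P₁? r A) & δ (P₂? r A'))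
  po-co : ∀ D -> δ (va? tiles π D ×-dec eq? (D ▹ g) D) & δ (VP.≡-dec _≟ℕ_ (tota weight-T D) (j ∷ α))
   == F (V.map fst D) (V.map fst (V.map snd D)) (V.map snd (V.map snd D))
  po-co D = sym (δ-× _ _) » δ-⇔ _ (inv? r ×-dec (P₁? r A ×-dec P₂? r A')) to from » δ-× (inv? r) _ » cg (δ (inv? r) &_) (δ-× (P₁? r A) (P₂? r A'))
   where
   r = V.map fst D
   X = V.map snd D
   A = V.map fst X
   A' = V.map snd X
   ma-fi : ∀ {B E : Set} (f : B -> E) (D : Vec B n) -> D ▹ g == D -> V.map f D ▹ g == V.map f D
   ma-fi f D e = sym (ma-▹ f D g) » cg (V.map f) e
   zi-fi : ∀ {B E : Set} (D : Vec (B × E) n) -> V.map fst D ▹ g == V.map fst D -> V.map snd D ▹ g == V.map snd D -> D ▹ g == D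
   zi-fi D e f = unm (D ▹ g) » ap2 V.zip (ma-▹ fst D g » e) (ma-▹ snd D g » f) » sym (unm D)
    where
    unm : ∀ {B E : Set} (D : Vec (B × E) n) -> D == V.zip (V.map fst D) (V.map snd D)
    unm D = sym (VP.map-id D) » VP.map-<,>-zip fst snd D
   to : (Va tiles π D × D ▹ g == D) × tota weight-T D == j ∷ α -> _
   to ((v , e) , t) = let sh , a , a' = va-sh π D v;w = trans (sym (we-pa D)) t in
    (ma-fi fst D e , sh) , (ma-fi fst X (ma-fi snd D e) , a , VP.∷-injectiveʳ w) ,
    (ma-fi snd X (ma-fi snd D e) , a' , trans (cg (\ s -> lk (colsum A') (suc zr) + bl-in s) (sym a)) (VP.∷-injectiveˡ w))
   from : _ -> (Va tiles π D × D ▹ g == D) × tota weight-T D == j ∷ α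
   from ((e , sh) , (f , a , c) , (f' , a' , c')) = (sh-va π D sh a a' , zi-fi D e (zi-fi X f f')) ,
    trans (we-pa D) (ap2 _∷_ (cg (\ s -> lk (colsum A') (suc zr) + bl-in s) a » c') c)

-- Kostka numbers for contents with two entries.

st-0-ta : ∀ {R} m (μ : Vec ℕ R) -> St (m ∷ μ) 0ᵥ -> « μ ¦ == 0
st-0-ta m [] _ = rfl
st-0-ta m (m' ∷ μ) (_ , p , s) = ap2 _+_ (n≤0⇒n≡0 p) (st-0-ta m' μ s)

module TR (n : ℕ) where
 open Ko n n

 private
  0-st : ∀ {R} b -> St (b ∷ 0ᵥ {R}) 0ᵥ
  0-st {zr} b = z≤n
  0-st {suc R} b = z≤n , z≤n , st-0 {suc R}

  sin : ∀ {R} b (v : Vec ℕ R) -> St (b ∷ v) 0ᵥ -> v == 0ᵥ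
  sin b v s = «¦≡0 v (st-0-ta b v s)

 -- A tableau in two letters is determined by the b copies of the smaller one, which form the
 -- beginning of the first row.
 KR-tw : ∀ {R} (μ : Vec ℕ (suc R)) a b -> b ≤ n -> KR μ (a ∷ b ∷ []) == δ (step? μ (b ∷ 0ᵥ) a)
 KR-tw {R} μ a b b≤n = Ʃ-co (\ ν -> cg (δ (step? μ (ℕs ν) a) &_) (row-cou ν) » sym (δ-× _ _) » δ-⇔ _ (eq? ν ro-b ×-dec step? μ (b ∷ 0ᵥ) a) (\ (s , e) -> ℕs-in (e » sym ℕs-ro) , subst (\ z -> Step μ z a) e s)
  (\ { (rfl , s) -> subst (\ z -> Step μ z a) (sym ℕs-ro) s , ℕs-ro }) » δ-× _ _) » Ʃ-δ ro-b _
  where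
  b0≤n : « b ∷ 0ᵥ {R} ¦ ≤ n
  b0≤n = ≤t (≤r (cg (b +_) («0¦ {R}) » +-idr b)) b≤n
  ro-b : Row (suc R)
  ro-b = cV (b ∷ 0ᵥ)
  ℕs-ro : ℕs ro-b == b ∷ 0ᵥ
  ℕs-ro = ℕs-cV (b ∷ 0ᵥ) b0≤n
  row-cou : ∀ (ν : Row (suc R)) -> KR (ℕs ν) (b ∷ []) == δ (≡ᵥ? (ℕs ν) (b ∷ 0ᵥ))
  row-cou ν = Ʃ-co (\ ρ -> sym (δ-× _ _) » δ-⇔ _ (eq? ρ ro-0 ×-dec ≡ᵥ? (ℕs ν) (b ∷ 0ᵥ)) (to ρ (ℕs ν)) (from ρ (ℕs ν)) » δ-× _ _) » Ʃ-δ ro-0 (\ _ -> δ (≡ᵥ? (ℕs ν) (b ∷ 0ᵥ)))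
   where
   ro-0 : Row (suc R)
   ro-0 = cV 0ᵥ
   ℕs-0' : ℕs ro-0 == 0ᵥ
   ℕs-0' = ℕs-cV 0ᵥ (≤t (≤r («0¦ {suc R})) z≤n)
   to : ∀ (ρ : Row (suc R)) (ν : Vec ℕ (suc R)) -> Step ν (ℕs ρ) b × « ℕs ρ ¦ == 0 -> ρ == ro-0 × ν == b ∷ 0ᵥ
   to ρ (x ∷ ν) ((s , e) , z) = ℕs-in (ρ0 » sym ℕs-0') , ap2 _∷_ (sym (+-idr x) » cg (x +_) (sym (st-0-ta x ν s')) » sym e » cg (_+ b) z) (sin x ν s')
    where
    ρ0 : ℕs ρ == 0ᵥ
    ρ0 = «¦≡0 (ℕs ρ) z
    s' : St (x ∷ ν) 0ᵥ
    s' = subst (St (x ∷ ν)) ρ0 s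
   from : ∀ (ρ : Row (suc R)) (ν : Vec ℕ (suc R)) -> ρ == ro-0 × ν == b ∷ 0ᵥ -> Step ν (ℕs ρ) b × « ℕs ρ ¦ == 0
   from ρ ν (rfl , rfl) = (subst (St (b ∷ 0ᵥ)) (sym ℕs-0') (0-st b) , trans (cg (_+ b) ze-si) (sym (cg (b +_) («0¦ {R}) » +-idr b))) , ze-si
    where
    ze-si : « ℕs ro-0 ¦ == 0
    ze-si = cg «_¦ ℕs-0' » «0¦ {suc R}

 -- The second row has length at most b, so the total size leaves room in the first row for b + 1
 -- copies of the smaller letter.
 tw-ro-mo : ∀ {R} (μ : Vec ℕ (suc R)) a b -> suc b ≤ a -> suc b ≤ n -> KR μ (suc a ∷ b ∷ []) ≤ᵠ KR μ (a ∷ suc b ∷ [])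
 tw-ro-mo μ a b p q = subst2 _≤ᵠ_ (sym (KR-tw μ (suc a) b (≤t (n≤1+n b) q))) (sym (KR-tw μ a (suc b) q)) (δ-mo' (step? μ (b ∷ 0ᵥ) (suc a)) (step? μ (suc b ∷ 0ᵥ) a) (rai μ))
  where
  δ-mo' : ∀ {P Q : Set} (d : Dec P) (d' : Dec Q) -> (P -> Q) -> δ d ≤ᵠ δ d'
  δ-mo' (yes p) d' f = ℚP.≤-reflexive (δ-ye (yes p) p » sym (δ-ye d' (f p)))
  δ-mo' (no ¬p) d' f = subst (_≤ᵠ δ d') (sym (δ-no (no ¬p) ¬p)) (δ-≥0 d')
  rai : ∀ {R} (μ : Vec ℕ (suc R)) -> Step μ (b ∷ 0ᵥ) (suc a) -> Step μ (suc b ∷ 0ᵥ) a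
  rai (m ∷ []) (s , e) = ≤t (≤t p (≤t (n≤1+n a) (m≤n+m (suc a) (b + 0)))) (≤r (e » +-idr m)) , trans (sym (+-suc (b + 0) a)) e
  rai {suc R} (m ∷ m' ∷ μ) ((_ , l , s) , e) = (big , ≤t l (n≤1+n b) , s) , trans (sym (+-suc (b + « 0ᵥ {suc R} ¦) a)) e
   where
   big : suc b ≤ m
   big = ≤t (≤t p (n≤1+n a)) (+-cancelˡ-≤ b (suc a) m (≤t (≤r (cg (_+ suc a) (sym (cg (b +_) («0¦ {suc R}) » +-idr b)) » e »
    cg (\ z -> m + (m' + z)) (st-0-ta m' μ s))) (≤t (≤r (cg (m +_) (+-idr m') » +-comm m m')) (+-monoˡ-≤ m l))))

-- Expansion of the contribution of l blocks in characters.

module Deco (n k : ℕ) {Cl : Pe n -> Set} (cl? : ∀ π -> Dec (Cl π)) (cl-co : ∀ h π -> Cl π -> Cl (co h π))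
 (cl-fi : ∀ π -> Cl π -> sF (\ i -> wh (π · i ≟F i) 1) == k) where
 open Sha n
 open Ch n using (M;chars;ClassFun;young;KR;ℕs;Row;rowsum;colsum;≡ᵥ?)
 open Tw n using (ε)
 private
  module G = FG (Sym {n})

 Te : Set
 Te = Pe n × Pe n × Re

 Ad : ℕ -> Pe n -> Re -> Set
 Ad l π r = Cl π × IS π r × bl-in (sl π r) == l

 ad? : ∀ l π r -> Dec (Ad l π r)
 ad? l π r = cl? π ×-dec (iS? π r ×-dec (bl-in (sl π r) ≟ℕ l))

 sy? : ∀ ((g , π , r) : Te) -> Dec (co g π == π × r ▹ g == r)
 sy? (g , π , r) = eq? (co g π) π ×-dec eq? (r ▹ g) r

 κ : ℕ -> Te -> ℚ
 κ l t@(g , π , r) = δ (ad? l π r) & (δ (sy? t) & ε (ro π g))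

 le-co : ∀ {N} -> Vec ℕ N -> Te -> ℚ
 le-co α (g , π , r) = fi-ma g (sl π r) (\ c -> ≡ᵥ? c α)

 ma-co : ℕ -> Te -> ℚ
 ma-co b (g , π , r) = fi-ma g (ma-at π r) (\ (c : Vec ℕ 2) -> lk c (suc zr) ≟ℕ b)

 part : ∀ {N} -> ℕ -> ℕ -> Vec ℕ N -> ℚ
 part l b α = Ʃ (\ t -> κ l t & (le-co α t & ma-co b t))

 sp-bl : ∀ j bl g (S : Vec ℕ n) -> fi-ma g S (\ (c : Vec ℕ 2) -> lk c (suc zr) + bl ≟ℕ j)
  == Ʃ (\ (b : Fin (suc j)) -> δ (bl ≟ℕ j ∸ tn b) & fi-ma g S (\ (c : Vec ℕ 2) -> lk c (suc zr) ≟ℕ tn b))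
 sp-bl j bl g S = Ʃ-co (\ A -> per (lk (colsum A) (suc zr)) (eq? (A ▹ g) A) (≡ᵥ? (rowsum A) S)) » Ʃ-sw _ » Ʃ-co (\ b -> Ʃ-*ˡ _ _)
  where
  per : ∀ {P Q : Set} x (p : Dec P) (q : Dec Q) -> δ (p ×-dec (q ×-dec (x + bl ≟ℕ j))) == Ʃ (\ (b : Fin (suc j)) -> δ (bl ≟ℕ j ∸ tn b) & δ (p ×-dec (q ×-dec (x ≟ℕ tn b))))
  per x p q with x ≤?ℕ j
  ... | no ¬l = δ-no _ (\ (_ , _ , e) -> ¬l (≤t (m≤m+n x bl) (≤r e))) »
   sym (Ʃ-0 (\ b -> ap2 _&_ rfl (δ-no _ (\ { (_ , _ , rfl) -> ¬l (≤-pred (toℕ<n b)) })) » &-zeroʳ _))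
  ... | yes l = sym (Ʃ-co (\ b -> sym (δ-× _ _) » δ-⇔ _ (eq? b x' ×-dec (p ×-dec (q ×-dec (x + bl ≟ℕ j))))
   (\ { (e , a , c , f) -> tn-inj (sym f » sym x≡) , a , c , trans (ap2 _+_ f e) (m+[n∸m]≡n (≤-pred (toℕ<n b))) })
   (\ { (rfl , a , c , f) -> sym (cg (j ∸_) x≡ » cg (_∸ x) (sym f) » m+n∸m≡n x bl) , a , c , sym x≡ }) » δ-× _ _) » Ʃ-δ x' _)
   where
   x' = fromℕ< (s≤s l)
   x≡ : tn x' == x
   x≡ = tn-fr (s≤s l)

 opaque
  unfolding sF
  «tabulate¦ : ∀ {m} (f : Fin m -> ℕ) -> « tab f ¦ == sF f
  «tabulate¦ f = rfl

 si-ba : ∀ l π r -> Ad l π r -> « sl π r ¦ == « ma-at π r ¦ + (2 * l + k)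
 si-ba l π r (c , sh , bl) = «tabulate¦ _ » sF-co (sl-ba π r sh) » sF-+ _ _ » ap2 _+_ (sym («tabulate¦ _))
  (sF-+ _ _ » ap2 _+_ (sF-+ _ _ » ap2 _+_ blocks≡ (sF-+ _ _ » ap2 _+_ blocks≡ ze)) (cl-fi π c))
  where
  blocks≡ : sF (\ i -> iB (slo π r i)) == l
  blocks≡ = sym («tabulate¦ _) » cg «_¦ (VP.tabulate-∘ iB (slo π r)) » bl
  ze : sF {n} (\ _ -> 0) == 0
  ze = ι-in (ι-sF _ » Ʃ-0 (\ _ -> rfl))

 -- The letter factor vanishes unless the letters number n altogether. In the factor of the marks
 -- one may therefore assume that there are n - 2l - k of them.
 te-co : ∀ {N} l (α : Vec ℕ N) (t@(g , π , r) : Te) {x y : ℚ} -> « α ¦ == n -> (« ma-at π r ¦ + (2 * l + k) == n -> x == y) ->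
  κ l t & (le-co α t & x) == κ l t & (le-co α t & y)
 te-co l α t@(g , π , r) {x} {y} e f = &-as _ _ _ » δ-co (ad? l π r) (\ ad -> cg (δ (sy? t) & ε (ro π g) &_) (go ad (« sl π r ¦ ≟ℕ n))) » sym (&-as _ _ _)
  where
  go : Ad l π r -> Dec (« sl π r ¦ == n) -> le-co α t & x == le-co α t & y
  go ad (yes p) = cg (le-co α t &_) (f (sym (si-ba l π r ad) » p))
  go ad (no ¬p) = cg (_& x) non » &-zeroˡ x » sym (cg (_& y) non » &-zeroˡ y)
   where
   non : le-co α t == 0q
   non = Ʃ-0 (\ A -> δ-no _ (\ (_ , p , q) -> ¬p (cg «_¦ (sym p) » to-su A » cg «_¦ q » e)))

 pa-ze : ∀ {N} l b (α : Vec ℕ N) -> « α ¦ == n -> ¬ (b + (2 * l + k) ≤ n) -> part l b α == 0q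
 pa-ze l b α e nl = Ʃ-0 (\ t -> te-co l α t e (\ p -> Ʃ-0 (\ A -> δ-no _ (\ { (_ , q , rfl) ->
  nl (≤t (+-monoˡ-≤ (2 * l + k) (≤t (lookup≤«¦ (colsum A) (suc zr)) (≤r (sym (to-su A) » cg «_¦ q)))) (≤r p)) }))) »
  cg (κ l t &_) (&-zeroʳ _) » &-zeroʳ _)

 module _ (l n' : ℕ) (balance : n' + (2 * l + k) == n) where
  private
   module Cn' = Ch n'
   n'≤n : n' ≤ n
   n'≤n = ≤t (m≤m+n n' _) (≤r balance)

  open Prod (Sym {n}) (Sym {n'})
  private
   module P = FG _⊠_

  -- A labelled shape: the two words list the cells on which the letters and the marks lie. On their
  -- places the groups on n and n' points act, and the unlabelled matrices are recovered by pairing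
  -- with permutation characters.
  La-sh : Set
  La-sh = Pe n × Re × Vec (Fin n) n × Vec (Fin n) n'

  _▷_ : Pe n -> La-sh -> La-sh
  g ▷ (π , r , w , w') = co g π , r ▹ invₚ g , V.map (g ·_) w , V.map (g ·_) w'

  _◁_ : La-sh -> Pe n × Pe n' -> La-sh
  (π , r , w , w') ◁ (h , h') = π , r , w ▹ h , w' ▹ h'

  Go : La-sh -> Set
  Go (π , r , w , w') = Ad l π r × con w == sl π r × con w' == ma-at π r

  go? : ∀ y -> Dec (Go y)
  go? (π , r , w , w') = ad? l π r ×-dec (≡ᵥ? (con w) (sl π r) ×-dec ≡ᵥ? (con w') (ma-at π r))

  private
   mo-re : ∀ g (r : Re) i -> rem (r ▹ invₚ g) (g · i) == rem r i
   mo-re g r i = cg tn (mo-lo r g i)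

   con-fix : ∀ (g π : Pe n) i -> co g π · (g · i) == g · i -> π · i == i
   con-fix g π i e = ·-in g (sym (con-· g π i) » e)

   mo-sh : ∀ g π r -> IS π r -> IS (co g π) (r ▹ invₚ g)
   mo-sh g π r sh i = subst (SA (co g π) (r ▹ invₚ g)) (··⁻ g i) (at (g ·⁻ i))
    where
    at : ∀ i -> SA (co g π) (r ▹ invₚ g) (g · i)
    at i = (\ e -> mo-re g r i » fst (sh i) (con-fix g π i e)) ,
     (\ ne -> case snd (sh i) (\ e -> ne (con-· g π i » cg (g ·_) e)) of \
      { (inl (z , p)) -> inl (trans (mo-re g r i) z , ≤t p (≤r (sym (nex i))))
      ;(inr e) -> inr (cg suc (nex i) » e » sym (mo-re g r i)) })
     where
     nex : ∀ i -> rem (r ▹ invₚ g) (co g π · (g · i)) == rem r (π · i)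
     nex i = cg (rem (r ▹ invₚ g)) (con-· g π i) » mo-re g r (π · i)

   co-·⁻ : ∀ (g π : Pe n) i -> co g π ·⁻ (g · i) == g · (π ·⁻ i)
   co-·⁻ g π i = ·-in (co g π) (··⁻ (co g π) (g · i) » sym (con-· g π (π ·⁻ i) » cg (g ·_) (··⁻ π i)))

   mo-sl : ∀ g π r i -> slo (co g π) (r ▹ invₚ g) (g · i) == slo π r i × ma (co g π) (r ▹ invₚ g) (g · i) == ma π r i
   mo-sl g π r i with co g π · (g · i) ≟F g · i | π · i ≟F i | rem (r ▹ invₚ g) (co g π ·⁻ (g · i)) ≟ℕ 0 | rem r (π ·⁻ i) ≟ℕ 0
   ... | yes e | yes f | _ | _ = rfl , rfl
   ... | yes e | no nf | _ | _ = absurd (con-fix g π i e) nf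
   ... | no ne | yes f | _ | _ = absurd (con-· g π i » cg (g ·_) f) ne
   ... | no _ | no _ | yes _ | yes _ = cg suc (mo-re g r i) , cg pred (mo-re g r i)
   ... | no _ | no _ | no _ | no _ = rfl , rfl
   ... | no _ | no _ | yes p | no np = absurd (sym (cg (rem (r ▹ invₚ g)) (co-·⁻ g π i) » mo-re g r _) » p) np
   ... | no _ | no _ | no np | yes p = absurd (cg (rem (r ▹ invₚ g)) (co-·⁻ g π i) » mo-re g r _ » p) np

   mo-co : ∀ {m} g (w : Vec (Fin n) m) {f f' : Fin n -> ℕ} -> (∀ i -> f' (g · i) == f i) -> con w == tab f -> con (V.map (g ·_) w) == tab f'
   mo-co g w {f} {f'} p e = tabulate-cong (\ i -> subst (\ i -> cnt (V.map (g ·_) w) i == f' i) (··⁻ g i)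
    (cn-ma (g ·⁻ i) » sym (lk-tab (cnt w) _) » cg (\ v -> lk v (g ·⁻ i)) e » lk-tab f _ » sym (p (g ·⁻ i))))
    where
    cn-ma : ∀ i -> cnt (V.map (g ·_) w) (g · i) == cnt w i
    cn-ma i = ι-in (cn-Ʃ (V.map (g ·_) w) _ » Ʃ-co (\ s -> δ-⇔ _ _ (\ e -> ·-in g (sym (VP.lookup-map s (g ·_) w) » e)) (\ e -> VP.lookup-map s (g ·_) w » cg (g ·_) e)) » sym (cn-Ʃ w i))

   mov-slo : ∀ g π r l -> bl-in (sl π r) == l -> bl-in (sl (co g π) (r ▹ invₚ g)) == l
   mov-slo g π r l e = bl-su (co g π) (r ▹ invₚ g) » ι-in' (sym (Ʃ-bi (g ·_) (g ·⁻_) (·⁻· g) (··⁻ g) (\ i -> ι (iB (slo (co g π) (r ▹ invₚ g) i)))) » Ʃ-co (\ i -> cg (ι ∘ iB) (fst (mo-sl g π r i)))) » sym (bl-su π r) » e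
    where
    bl-su : ∀ π r -> bl-in (sl π r) == sF (\ i -> iB (slo π r i))
    bl-su π r = cg «_¦ (sym (VP.tabulate-∘ iB (slo π r))) » «tabulate¦ _
    ι-in' : ∀ {f f' : Fin n -> ℕ} -> Ʃ (ι ∘ f) == Ʃ (ι ∘ f') -> sF f == sF f'
    ι-in' {f} {f'} q = ι-in (ι-sF f » q » sym (ι-sF f'))

   go-▷ : ∀ g y -> Go y -> Go (g ▷ y)
   go-▷ g (π , r , w , w') ((c , sh , bl) , e , e') = (cl-co g π c , mo-sh g π r sh , mov-slo g π r l bl) ,
    mo-co g w (\ i -> fst (mo-sl g π r i)) e , mo-co g w' (\ i -> snd (mo-sl g π r i)) e'

   ma-∙ : ∀ {m} h g (w : Vec (Fin n) m) -> V.map ((h ∙ₚ g) ·_) w == V.map (h ·_) (V.map (g ·_) w)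
   ma-∙ h g w = VP.map-cong (∙-· h g) w » VP.map-∘ (h ·_) (g ·_) w

   ma-id' : ∀ {m} (w : Vec (Fin n) m) -> V.map (idₚ ·_) w == w
   ma-id' w = VP.map-cong id-· w » VP.map-id w

  open Twi {n} _⊠_ La-sh ⦃ Fi-× ⦄ _▷_ _◁_ (\ (π , _) g -> ro π g) go?
   (\ h g (π , r , w , w') -> ap2 _,_ (co-∙ h g π) (ap2 _,_ (cg (r ▹_) (inv-∙ₚ h g) » ▹-∙ r (invₚ g) (invₚ h)) (ap2 _,_ (ma-∙ h g w) (ma-∙ h g w'))))
   (\ (π , r , w , w') -> ap2 _,_ (co-fi idₚ π (∙-idˡ π » sym (∙-idʳ π))) (ap2 _,_ (Ch.id-mR n r) (ap2 _,_ (ma-id' w) (ma-id' w'))))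
   (\ (π , r , w , w') (h , h') (k , k') -> cg (\ z -> π , r , z) (ap2 _,_ (▹-∙ w h k) (▹-∙ w' h' k')))
   (\ (π , r , w , w') -> cg (\ z -> π , r , z) (ap2 _,_ (▹-id w) (▹-id w')))
   (\ (π , _) g h -> ro-∙ π g h) go-▷ public using (φ;twisted-posdef)

  φ-te : ∀ h h' -> φ (h , h') == Ʃ (\ ((g , π , r) : Te) -> κ l (g , π , r) & (wo-ov g (sl π r) h & wo-ov g (ma-at π r) h'))
  φ-te h h' = Ʃ-co (\ g -> Ʃ-× _ » Ʃ-co (\ π -> Ʃ-× _ » Ʃ-co (\ r -> Ʃ-× _ » per g π r)) » sym (Ʃ-× _)) » sym (Ʃ-× _)
   where
   opaque
    unfolding _#_
    a1 : ∀ ad c c' s m m' e -> (ad & (c & c')) & ((s & (m & m')) & e) == ad & (s & e) & ((c & m) & (c' & m'))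
    a1 = slv ℚ-ri
   per : ∀ g π r -> Ʃ (\ w -> Ʃ (\ w' -> δ (go? (π , r , w , w')) & (δ (eq? (g ▷ (π , r , w , w')) ((π , r , w , w') ◁ (h , h'))) & ε (ro π g))))
    == κ l (g , π , r) & (wo-ov g (sl π r) h & wo-ov g (ma-at π r) h')
   per g π r = Ʃ-co₂ (\ w w' -> ap2 (\ x y -> x & (y & ε (ro π g))) (δ-× _ _ » cg (δ (ad? l π r) &_) (δ-× _ _)) (sa w w') » a1 _ _ _ _ _ _ _) »
    Ʃ-co (\ w -> Ʃ-*ˡ _ _) » Ʃ-*ˡ _ _ » cg (κ l (g , π , r) &_) (Ʃ-& _ _)
    where
    sa : ∀ w w' -> δ (eq? (g ▷ (π , r , w , w')) ((π , r , w , w') ◁ (h , h'))) == δ (sy? (g , π , r)) & (δ (eq? (V.map (g ·_) w) (w ▹ h)) & δ (eq? (V.map (g ·_) w') (w' ▹ h')))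
    sa w w' = δ-⇔ _ (sy? (g , π , r) ×-dec (eq? (V.map (g ·_) w) (w ▹ h) ×-dec eq? (V.map (g ·_) w') (w' ▹ h')))
     (\ e -> (cg fst e , trans (cg (_▹ g) (sym (cg (fst ∘ snd) e))) (▹-in r g)) , cg (fst ∘ snd ∘ snd) e , cg (snd ∘ snd ∘ snd) e)
     (\ ((a , b) , c , d) -> ap2 _,_ a (ap2 _,_ (cg (_▹ invₚ g) (sym b) » ▹-in' r g) (ap2 _,_ c d))) » δ-× _ _ » cg (δ (sy? (g , π , r)) &_) (δ-× _ _)

  private
   or : ℚ
   or = G.order & FG.order (Sym {n'})

   orders>0 : 0q <ᵠ or
   orders>0 = &->0 G.order>0 (FG.order>0 (Sym {n'}))

  pai : ClassFun -> (Pe n' -> ℚ) -> ℚ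
  pai χ ψ = P.⟪_,_⟫ φ (\ (h , h') -> χ h & ψ h')

  -- `ma-wo` is applied to the letters and to the marks. For the marks only the number b of the
  -- second kind is prescribed, but the balance fixes their total, so the content is (n' - b, b).
  pa-pa : ∀ {N} b (α : Vec ℕ N) -> « α ¦ == n -> b ≤ n' -> or & part l b α == pai (M α) (Cn'.M (n' ∸ b ∷ b ∷ []))
  pa-pa b α e b≤ = sym (Ʃ-× _ » Ʃ-co₂ (\ h h' -> cg (_& (M α h & M' h')) (φ-te h h') » sym (Ʃ-*ʳ _ _) » Ʃ-co (\ t -> a2 _ _ _ _ _)) »
   Ʃ-co (\ h -> Ʃ-sw _) » Ʃ-sw _ » Ʃ-co per » Ʃ-*ˡ or _)
   where
   M' = Cn'.M (n' ∸ b ∷ b ∷ [])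
   opaque
    unfolding _#_
    a2 : ∀ k p q x y -> k & (p & q) & (x & y) == k & ((x & p) & (y & q))
    a2 = slv ℚ-ri
    a3 : ∀ k u v x y -> k & ((u & x) & (v & y)) == (u & v) & (k & (x & y))
    a3 = slv ℚ-ri
   per : ∀ (t@(g , π , r) : Te) -> Ʃ (\ h -> Ʃ (\ h' -> κ l t & ((M α h & wo-ov g (sl π r) h) & (M' h' & wo-ov g (ma-at π r) h')))) == or & (κ l t & (le-co α t & ma-co b t))
   per t@(g , π , r) = Ʃ-co (\ h -> Ʃ-*ˡ _ _) » Ʃ-*ˡ _ _ » cg (κ l t &_) (Ʃ-& _ _ » ap2 _&_
    (sym (ma-wo ≤= α e g (sl π r))) (sym (ma-wo n'≤n (n' ∸ b ∷ b ∷ []) (cg (n' ∸ b +_) (+-idr b) » m∸n+n≡m b≤) g (ma-at π r)))) »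
    a3 _ _ _ _ _ » cg (or &_) (te-co l α t e (\ p -> Ʃ-co (\ A -> δ-⇔ _ _
     (\ (f , q , c) -> f , q , cg (\ v -> lk v (suc zr)) c)
     (\ (f , q , c) -> f , q , two (colsum A) c (sym (to-su A) » cg «_¦ q » +-cancelʳ-≡ (2 * l + k) _ _ (p » sym balance))))))
    where
    two : ∀ (c : Vec ℕ 2) -> lk c (suc zr) == b -> « c ¦ == n' -> c == n' ∸ b ∷ b ∷ []
    two (x ∷ y ∷ []) rfl s = cg (_∷ y ∷ []) (sym (m+n∸n≡m x y) » cg (_∸ y) (cg (x +_) (sym (+-idr y)) » s))

  coe : ℕ -> ClassFun -> ℚ
  coe b χ = or ⁻¹ & pai χ (Cn'.M (n' ∸ b ∷ b ∷ []))

  pa-∑ : ∀ {A : Set} (xs : List A) (c : A -> ℚ) (f : A -> ClassFun) (s : A -> Pe n' -> ℚ) {χ ψ} -> (∀ h h' -> χ h & ψ h' == ∑ xs (\ x -> c x & (f x h & s x h'))) ->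
   pai χ ψ == ∑ xs (\ x -> c x & pai (f x) (s x))
  pa-∑ xs c f s eq = Ʃ-co (\ (h , h') -> cg (φ (h , h') &_) (eq h h') » sym (∑-*ˡ xs _ _) » ∑-co xs (\ x -> &-sw _ _ _)) »
   Ʃ-∑ xs » ∑-co xs (\ x -> Ʃ-*ˡ (c x) _)
   where
   Ʃ-∑ : ∀ {A B : Set} ⦃ _ : Fi B ⦄ (xs : List A) {F : B -> A -> ℚ} -> Ʃ (\ b -> ∑ xs (F b)) == ∑ xs (\ a -> Ʃ (\ b -> F b a))
   Ʃ-∑ [] = Ʃ-0 (\ _ -> rfl)
   Ʃ-∑ (x ∷ xs) = Ʃ-# _ _ » ap2 _#_ rfl (Ʃ-∑ xs)

  pa-co : ∀ {N} b (α : Vec ℕ N) -> « α ¦ == n -> b ≤ n' -> part l b α == ∑ chars (\ (μ , χ) -> KR (ℕs μ) α & coe b χ)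
  pa-co b α e b≤ = sym (sym (&-as _ _ _) » cg (_& part l b α) (&-co _ _ » &-⁻¹ (\ z -> ℚP.<⇒≢ orders>0 (sym z))) » &-idˡ _) »
   cg (or ⁻¹ &_) (pa-pa b α e b≤ » pa-∑ chars (\ (μ , _) -> KR (ℕs μ) α) snd (\ _ -> M')
    (\ h h' -> cg (_& M' h') (young α e h) » &-co _ _ » sym (∑-*ˡ chars (M' h') _) » ∑-co chars (\ x -> rot _ _ _))) »
    sym (∑-*ˡ chars _ _) » ∑-co chars (\ x -> &-sw _ _ _)
   where
   M' = Cn'.M (n' ∸ b ∷ b ∷ [])
   rot : ∀ a b c -> a & (b & c) == b & (c & a)
   rot a b c = &-co a _ » &-as b c a

  private
   pa-≥0 : ∀ {χ ψ} -> G.Rep χ -> FG.Rep (Sym {n'}) ψ -> 0q ≤ᵠ pai χ ψ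
   pa-≥0 R R' = P.PosDef-pair twisted-posdef (P.Rep⇒PosDef (Re-⊠ R R'))

   sc-≥0 : ∀ {x} -> 0q ≤ᵠ x -> 0q ≤ᵠ or ⁻¹ & x
   sc-≥0 = &-≥0 (ℚP.<⇒≤ (⁻¹->0 orders>0))

  co-≥0 : ∀ b {χ} -> G.Rep χ -> 0q ≤ᵠ coe b χ
  co-≥0 b R = sc-≥0 (pa-≥0 R (Cn'.M-re _))

  -- Differences of two-rowed permutation characters are characters.
  co-mo : ∀ b {χ} -> G.Rep χ -> 2 * suc b ≤ n' -> 0q ≤ᵠ coe (suc b) χ # ~ coe b χ
  co-mo b {χ} R le = subst (0q ≤ᵠ_) (fa (or ⁻¹) _ _ » ap2 (\ x y -> or ⁻¹ & x # ~ (or ⁻¹ & y)) (sym (exp (suc b) sb≤)) (sym (exp b (≤t (n≤1+n b) sb≤))))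
   (sc-≥0 (subst (0q ≤ᵠ_) (∑-⊝ Cn'.chars) (∑-≥0∈ Cn'.chars Cn'.reps (\ (ν , χ') R' -> subst (0q ≤ᵠ_) (&-distribˡ⊝ _ _ _) (&-≥0 (⊝-≥0 (ko ν)) (pa-≥0 R R'))))))
   where
   open import Data.Nat.Properties using (m+n≤o⇒m≤o∸n)
   sb≤ : suc b ≤ n'
   sb≤ = ≤t (m≤m+n (suc b) _) le
   opaque
    unfolding _#_
    fa : ∀ c x y -> c & (x # ~ y) == c & x # ~ (c & y)
    fa = slv ℚ-ri
    &-distribˡ⊝ : ∀ x y z -> (x # ~ y) & z == x & z # ~ (y & z)
    &-distribˡ⊝ = slv ℚ-ri
    regroup4 : ∀ a b c d -> a # ~ b # (c # ~ d) == a # c # ~ (b # d)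
    regroup4 = slv ℚ-ri
    ze-ne : 0q == 0q # ~ 0q
    ze-ne = rfl
   exp : ∀ b -> b ≤ n' -> pai χ (Cn'.M (n' ∸ b ∷ b ∷ [])) == ∑ Cn'.chars (\ (ν , χ') -> Cn'.KR (Cn'.ℕs ν) (n' ∸ b ∷ b ∷ []) & pai χ χ')
   exp b b≤ = pa-∑ Cn'.chars (\ (ν , _) -> Cn'.KR (Cn'.ℕs ν) (n' ∸ b ∷ b ∷ [])) (\ _ -> χ) snd
    (\ h h' -> cg (χ h &_) (Cn'.young (n' ∸ b ∷ b ∷ []) (cg (n' ∸ b +_) (+-idr b) » m∸n+n≡m b≤) h') » sym (∑-*ˡ Cn'.chars (χ h) _) » ∑-co Cn'.chars (\ x -> &-sw _ _ _))
   ko : ∀ ν -> Cn'.KR (Cn'.ℕs ν) (n' ∸ b ∷ b ∷ []) ≤ᵠ Cn'.KR (Cn'.ℕs ν) (n' ∸ suc b ∷ suc b ∷ [])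
   ko ν@(_ ∷ _) = subst (\ a -> Cn'.KR (Cn'.ℕs ν) (a ∷ b ∷ []) ≤ᵠ Cn'.KR (Cn'.ℕs ν) (n' ∸ suc b ∷ suc b ∷ [])) (sym (∸-su' n' b sb≤))
    (TR.tw-ro-mo n' (Cn'.ℕs ν) (n' ∸ suc b) b (m+n≤o⇒m≤o∸n (suc b) (≤t (≤r (cg (suc b +_) (sym (+-idr (suc b))))) le)) sb≤)
    where
    ∸-su' : ∀ n b -> suc b ≤ n -> n ∸ b == suc (n ∸ suc b)
    ∸-su' (suc n) zr _ = rfl
    ∸-su' (suc n) (suc b) (s≤s p) = ∸-su' n b p
   ∑-⊝ : ∀ {A : Set} (xs : List A) {f h : A -> ℚ} -> ∑ xs (\ x -> f x # ~ h x) == ∑ xs f # ~ ∑ xs h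
   ∑-⊝ [] = ze-ne
   ∑-⊝ (x ∷ xs) = ap2 _#_ rfl (∑-⊝ xs) » regroup4 _ _ _ _
   ∑-≥0∈ : ∀ {A : Set} {P : A -> Set₁} (xs : List A) -> All P xs -> {f : A -> ℚ} -> (∀ x -> P x -> 0q ≤ᵠ f x) -> 0q ≤ᵠ ∑ xs f
   ∑-≥0∈ [] [] h = ℚP.≤-refl
   ∑-≥0∈ (x ∷ xs) (p ∷ ps) h = #-≥0 (h x p) (∑-≥0∈ xs ps h)

module Pa (n N k : ℕ) {Cl : Pe n -> Set} (cl? : ∀ π -> Dec (Cl π)) (cl-co : ∀ h π -> Cl π -> Cl (co h π))
 (cl-fi : ∀ π -> Cl π -> sF (\ i -> wh (π · i ≟F i) 1) == k) where
 open Deco n k cl? cl-co cl-fi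
 open Sha n
 open Til n N using (count-shapes)
 open Cou n N
 open Cha n N (\ π -> δ (cl? π)) using (primitive-sum;primitive-counts)
 open Tw n using (ε)

 private
  opaque
   unfolding _#_
   q1 : ∀ c a e i m x -> c & (a & e & (i & (m & x))) == c & a & i & e & m & x
   q1 = slv ℚ-ri
   q2 : ∀ a s e m y -> a & (s & e) & (m & y) == a & s & e & m & y
   q2 = slv ℚ-ri
   q3 : ∀ d u e m y -> d & u & e & m & y == u & e & m & (d & y)
   q3 = slv ℚ-ri

 -- The degree j in t is made up of b marks of the second kind and l = j - b blocks.
 primitive-parts : ∀ j (α : Vec ℕ N) -> « α ¦ == n -> ε 0 & primitive-sum bicoloured weight-Z (j ∷ α) == Ʃ (\ (b : Fin (suc j)) -> part (j ∸ tn b) (tn b) α)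
 primitive-parts j α e = primitive-counts j α e » Ʃ-co (\ π -> sym (Ʃ-*ˡ _ _) » Ʃ-co (\ g -> cg (\ z -> δ (cl? π) & (δ (eq? (co g π) π) & ε (ro π g) & z)) (count-shapes π g j α) »
  cg (δ (cl? π) &_) (sym (Ʃ-*ˡ _ _)) » sym (Ʃ-*ˡ _ _) » Ʃ-co (\ r -> per g π r))) »
  Ʃ-sw _ » Ʃ-co (\ g -> sym (Ʃ-× (\ (π , r) -> Ʃ (\ (b : Fin (suc j)) -> κ (j ∸ tn b) (g , π , r) & (le-co α (g , π , r) & ma-co (tn b) (g , π , r)))))) »
   sym (Ʃ-× _) » Ʃ-sw _
  where
  per : ∀ g π r -> δ (cl? π) & (δ (eq? (co g π) π) & ε (ro π g) & (δ (eq? (r ▹ g) r ×-dec iS? π r) & (le-co α (g , π , r) & fi-ma g (ma-at π r) (\ (c : Vec ℕ 2) -> lk c (suc zr) + bl-in (sl π r) ≟ℕ j))))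
   == Ʃ (\ (b : Fin (suc j)) -> κ (j ∸ tn b) (g , π , r) & (le-co α (g , π , r) & ma-co (tn b) (g , π , r)))
  per g π r = q1 _ _ _ _ _ _ » cg (δ (cl? π) & δ (eq? (co g π) π) & δ (eq? (r ▹ g) r ×-dec iS? π r) & ε (ro π g) & le-co α (g , π , r) &_) (sp-bl j (bl-in (sl π r)) g (ma-at π r)) »
   sym (Ʃ-*ˡ _ _) » Ʃ-co (\ b -> sym (q2 _ _ _ _ _ » cg (\ z -> z & ε (ro π g) & le-co α (g , π , r) & ma-co (tn b) (g , π , r)) (reg b) » q3 _ _ _ _ _))
   where
   reg : ∀ (b : Fin (suc j)) -> δ (ad? (j ∸ tn b) π r) & δ (sy? (g , π , r)) == δ (bl-in (sl π r) ≟ℕ j ∸ tn b) & (δ (cl? π) & δ (eq? (co g π) π) & δ (eq? (r ▹ g) r ×-dec iS? π r))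
   reg b = sym (δ-× _ _) » δ-⇔ _ ((bl-in (sl π r) ≟ℕ j ∸ tn b) ×-dec ((cl? π ×-dec eq? (co g π) π) ×-dec (eq? (r ▹ g) r ×-dec iS? π r)))
    (\ ((c , s , e) , (f , i)) -> e , (c , f) , i , s) (\ (e , (c , f) , i , s) -> (c , s , e) , f , i) » δ-× _ _ » cg (δ (bl-in (sl π r) ≟ℕ j ∸ tn b) &_) (δ-× _ _ » cg (_& δ (eq? (r ▹ g) r ×-dec iS? π r)) (δ-× _ _))

to-lo : ∀ {A : Set} {M n} (v : A -> Vec ℕ M) (D : Vec A n) i -> ι (lk (tota v D) i) == Ʃ (\ s -> ι (lk (v (lk D s)) i))
to-lo v [] i = cg ι (VP.lookup-replicate i 0) » sym (Ʃ-Fin0 _)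
to-lo v (y ∷ D) i = cg ι (VP.lookup-zipWith _+_ i (v y) (tota v D)) » ι-+ (lk (v y) i) _ » cg (ι (lk (v y) i) #_) (to-lo v D i) » sym (Ʃ-Fi _)

to-▹ : ∀ {A : Set} {M n} (v : A -> Vec ℕ M) (D : Vec A n) (g : Pe n) -> tota v (D ▹ g) == tota v D
to-▹ v D g = lo-ex (\ i -> ι-in (to-lo v (D ▹ g) i » Ʃ-co (\ s -> cg (\ y -> ι (lk (v y) i)) (▹-lo D g s)) »
 Ʃ-bi (g ·_) (g ·⁻_) (·⁻· g) (··⁻ g) (\ s -> ι (lk (v (lk D s)) i)) » sym (to-lo v D i)))

module Ex (n k : ℕ) {Cl : Pe n -> Set} (cl? : ∀ π -> Dec (Cl π)) (cl-co : ∀ h π -> Cl π -> Cl (co h π))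
 (cl-fi : ∀ π -> Cl π -> sF (\ i -> wh (π · i ≟F i) 1) == k) where
 open Deco n k cl? cl-co cl-fi
 open Ch n using (chars;ClassFun;KR;ℕs;Rep;order;order>0)
 open Tw n using (ε;ε0>0)

 -- Extended by 0 to the cases where l blocks do not fit or b exceeds the number of marks; `pa-ze`
 -- shows that there is nothing to count then.
 coef : ℕ -> ℕ -> ClassFun -> ℚ
 coef l b χ with 2 * l + k ≤?ℕ n
 ... | no _ = 0q
 ... | yes p with b ≤?ℕ n ∸ (2 * l + k)
 ... | no _ = 0q
 ... | yes _ = coe l (n ∸ (2 * l + k)) (m∸n+n≡m p) b χ

 coe-≥0 : ∀ l b {χ} -> Rep χ -> 0q ≤ᵠ coef l b χ
 coe-≥0 l b R with 2 * l + k ≤?ℕ n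
 ... | no _ = ℚP.≤-refl
 ... | yes p with b ≤?ℕ n ∸ (2 * l + k)
 ... | no _ = ℚP.≤-refl
 ... | yes _ = co-≥0 l (n ∸ (2 * l + k)) (m∸n+n≡m p) b R

 coe-mon : ∀ l b {χ} -> Rep χ -> 2 * suc b + (2 * l + k) ≤ n -> 0q ≤ᵠ coef l (suc b) χ # ~ coef l b χ
 coe-mon l b R q with 2 * l + k ≤?ℕ n
 ... | no np = absurd (≤t (m≤n+m (2 * l + k) (2 * suc b)) q) np
 ... | yes p with suc b ≤?ℕ n ∸ (2 * l + k) | b ≤?ℕ n ∸ (2 * l + k) | m+n≤o⇒m≤o∸n (2 * suc b) q
 ... | yes _ | yes _ | le = co-mo l (n ∸ (2 * l + k)) (m∸n+n≡m p) b R le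
 ... | no ns | _ | le = absurd (≤t (m≤m+n (suc b) _) le) ns
 ... | yes s | no nb | _ = absurd (≤t (n≤1+n b) s) nb

 par-coe : ∀ {N} l b (α : Vec ℕ N) -> « α ¦ == n -> part l b α == ∑ chars (\ (μ , χ) -> KR (ℕs μ) α & coef l b χ)
 par-coe l b α e with 2 * l + k ≤?ℕ n
 ... | no np = pa-ze l b α e (\ q -> np (≤t (m≤n+m _ b) q)) » sym (∑-zero∈ chars (\ _ -> &-zeroʳ _))
 ... | yes p with b ≤?ℕ n ∸ (2 * l + k)
 ... | no nb = pa-ze l b α e (\ q -> nb (m+n≤o⇒m≤o∸n b q)) » sym (∑-zero∈ chars (\ _ -> &-zeroʳ _))
 ... | yes q = pa-co l (n ∸ (2 * l + k)) (m∸n+n≡m p) b α e q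

 private
  sc : ℚ
  sc = (ε 0 & order) ⁻¹

  sca-pos : 0q <ᵠ ε 0 & order
  sca-pos = &->0 ε0>0 order>0

  sc-≥0 : ∀ {x} -> 0q ≤ᵠ x -> 0q ≤ᵠ sc & x
  sc-≥0 = &-≥0 (ℚP.<⇒≤ (⁻¹->0 sca-pos))

  al-co : ℕ -> ClassFun -> ℚ
  al-co j χ = Ʃ (\ (b : Fin (suc j)) -> coef (j ∸ tn b) (tn b) χ)

 sc-co : ℕ -> ClassFun -> ℚ
 sc-co j χ = sc & al-co j χ

 sc-co-≥0 : ∀ j {χ} -> Rep χ -> 0q ≤ᵠ sc-co j χ
 sc-co-≥0 j R = sc-≥0 (Ʃ-≥0 (\ (b : Fin (suc j)) -> coe-≥0 (j ∸ tn b) (tn b) R))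

 -- For each number l of blocks, passing from j to j + 1 raises b by one; the only term without a
 -- partner is b = 0, which is nonnegative. With l = j - b, the condition 2(j + 1) ≤ n - k is
 -- precisely 2(b + 1) ≤ n - 2l - k, so the same hypothesis serves every l.
 sc-co-mo : ∀ j {χ} -> Rep χ -> 2 * suc j ≤ n ∸ k -> 0q ≤ᵠ sc-co (suc j) χ # ~ sc-co j χ
 sc-co-mo j {χ} R le = subst (0q ≤ᵠ_) (fa sc _ _) (sc-≥0 (subst (0q ≤ᵠ_) (shif _ _ _ » cg (_# ~ al-co j χ) (sym (Ʃ-Fi _)))
  (#-≥0 (coe-≥0 (suc j) 0 R) (subst (0q ≤ᵠ_) (Ʃ-⊝ _ _) (Ʃ-≥0 (\ (b : Fin (suc j)) -> coe-mon (j ∸ tn b) (tn b) R (bo (tn b) (≤-pred (toℕ<n b)))))))))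
  where
  opaque
   unfolding _#_
   fa : ∀ c x y -> c & (x # ~ y) == c & x # ~ (c & y)
   fa = slv ℚ-ri
   shif : ∀ x y z -> x # (y # ~ z) == x # y # ~ z
   shif = slv ℚ-ri
  k≤n : k ≤ n
  k≤n with k ≤?ℕ n
  ... | yes p = p
  ... | no np = case ≤t le (≤r (m≤n⇒m∸n≡0 (<⇒≤ (≰⇒> np)))) of \ ()
  bo : ∀ b -> b ≤ j -> 2 * suc b + (2 * (j ∸ b) + k) ≤ n
  bo b p = ≤t (≤r (lem b (j ∸ b) k » cg (\ z -> 2 * suc z + k) (m+[n∸m]≡n p))) (≤t (+-monoˡ-≤ k le) (≤r (m∸n+n≡m k≤n)))
   where
   lem : ∀ b c k -> 2 * suc b + (2 * c + k) == 2 * suc (b + c) + k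
   lem = ℕ-ring

 module _ {N : ℕ} where
  open Pa n N k cl? cl-co cl-fi using (primitive-parts)
  open Cou n N using (weight-Z)
  open SC n N using (Z;standard?;standard-count;bicoloured)
  open Cha n N (\ π -> δ (cl? π)) using (primitive-sum)

  sta : ℕ -> Vec ℕ N -> ℚ
  sta j α = Ʃ (\ σ -> Ʃ (\ D -> δ (cl? σ) & δ (VP.≡-dec _≟ℕ_ (tota weight-Z D) (j ∷ α)) & δ (standard? σ D)))

  sc-ex : ∀ j (α : Vec ℕ N) -> « α ¦ == n -> sta j α == ∑ chars (\ (μ , χ) -> KR (ℕs μ) α & sc-co j χ)
  sc-ex j α e = begin
   sta j α ≡⟨ trans (cg (_& sta j α) (&-co _ _ » &-⁻¹ (\ z -> ℚP.<⇒≢ sca-pos (sym z)))) (&-idˡ _) ⟨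
   sc & (ε 0 & order) & sta j α ≡⟨ trans (&-as _ _ _) (cg (sc &_) (&-as _ _ _ » cg (ε 0 &_) (sym (standard-count _ inva)))) ⟩
   sc & (ε 0 & primitive-sum bicoloured weight-Z (j ∷ α)) ≡⟨ cg (sc &_) (primitive-parts j α e » Ʃ-co (\ b -> par-coe (j ∸ tn b) (tn b) α e) » Ʃ-∑ chars) ⟩
   sc & ∑ chars (\ (μ , χ) -> Ʃ (\ b -> KR (ℕs μ) α & coef (j ∸ tn b) (tn b) χ)) ≡⟨ trans (sym (∑-*ˡ chars _ _)) (∑-co chars (\ (μ , χ) -> cg (sc &_) (Ʃ-*ˡ _ _) » &-sw _ _ _)) ⟩
   ∑ chars (\ (μ , χ) -> KR (ℕs μ) α & sc-co j χ) ∎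
   where
   open ≡-Reasoning
   Ʃ-∑ : ∀ {A : Set} (xs : List A) {F : Fin (suc j) -> A -> ℚ} -> Ʃ (\ b -> ∑ xs (F b)) == ∑ xs (\ a -> Ʃ (\ b -> F b a))
   Ʃ-∑ [] = Ʃ-0 (\ _ -> rfl)
   Ʃ-∑ (x ∷ xs) = Ʃ-# _ _ » ap2 _#_ rfl (Ʃ-∑ xs)
   inva : ∀ h π D -> δ (cl? (co h π)) & δ (VP.≡-dec _≟ℕ_ (tota weight-Z (D ▹ invₚ h)) (j ∷ α)) == δ (cl? π) & δ (VP.≡-dec _≟ℕ_ (tota weight-Z D) (j ∷ α))
   inva h π D = ap2 _&_ (δ-⇔ _ _ (\ c -> subst Cl (co-in h π) (cl-co (invₚ h) (co h π) c)) (cl-co h π)) (cg (\ t -> δ (VP.≡-dec _≟ℕ_ t (j ∷ α))) (to-▹ weight-Z D (invₚ h)))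

-- Translation of the concrete definitions into finite sums.

import Defs
open Defs using (countᵇ;eqList;compatible;firstWith;Qcoeff;multiplicity)
open import Data.Bool using (T;T?)
open import Data.Bool.Properties using (T-∧)
open import Data.Bool.ListAction using (any)
open import Data.Nat using (_<ᵇ_;_≤ᵇ_;_≡ᵇ_)
open import Data.Nat.Properties using (<ᵇ⇒<;<⇒<ᵇ;≤ᵇ⇒≤;≤⇒≤ᵇ;≡ᵇ⇒≡;≡⇒≡ᵇ)
open import Data.List using (zip;zipWith;drop;downFrom;applyUpTo;filterᵇ) renaming (replicate to rep)
open import Function.Bundles using (Equivalence)

T-ex : ∀ {a b} -> (T a -> T b) -> (T b -> T a) -> a == b
T-ex {true} {true} f g = rfl
T-ex {true} {false} f g = ⊥-elim (f tt)
T-ex {false} {true} f g = ⊥-elim (g tt)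
T-ex {false} {false} f g = rfl

∧-T : ∀ a b -> T (a ∧ b) -> T a × T b
∧-T a b = Equivalence.to (T-∧ {a} {b})

T-∧' : ∀ a b -> T a -> T b -> T (a ∧ b)
T-∧' a b p q = Equivalence.from (T-∧ {a} {b}) (p , q)

ι-countᵇ : ∀ {A : Set} (p : A -> Bool) xs -> ι (countᵇ p xs) == ∑ xs (\ x -> δ (T? (p x)))
ι-countᵇ p xs = le-∑ (filterᵇ p xs) » ∑-fil (T? ∘ p) xs (\ _ -> 1q) » ∑-co xs (\ x -> &-idʳ _)
 where
 le-∑ : ∀ {A : Set} (ys : List A) -> ι (length ys) == ∑ ys (\ _ -> 1q)
 le-∑ [] = rfl
 le-∑ (y ∷ ys) = cg (1q #_) (le-∑ ys)

ι-su : ∀ {A : Set} (f : A -> ℕ) xs -> ι (LA.sum (mapL f xs)) == ∑ xs (ι ∘ f)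
ι-su f [] = rfl
ι-su f (x ∷ xs) = ι-+ (f x) _ » cg (ι (f x) #_) (ι-su f xs)

eL-so : ∀ xs ys -> T (eqList xs ys) -> xs == ys
eL-so [] [] _ = rfl
eL-so (x ∷ xs) (y ∷ ys) t = let p , q = ∧-T (x ≡ᵇ y) _ t in ap2 _∷_ (≡ᵇ⇒≡ x y p) (eL-so xs ys q)

eL-re : ∀ xs -> T (eqList xs xs)
eL-re [] = tt
eL-re (x ∷ xs) = T-∧' (x ≡ᵇ x) _ (≡⇒≡ᵇ x x rfl) (eL-re xs)

lst : ∀ {N m} -> Vec (Fin N) m -> List ℕ
lst w = V.toList (V.map tn w)

le-ls : ∀ {N m} (w : Vec (Fin N) m) -> length (lst w) == m
le-ls [] = rfl
le-ls (a ∷ w) = cg suc (le-ls w)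

at-ls : ∀ {N m} (w : Vec (Fin N) m) i -> Defs.at (lst w) (tn i) == tn (lk w i)
at-ls (a ∷ w) zr = rfl
at-ls (a ∷ w) (suc i) = at-ls w i

tL-in : ∀ {A : Set} {m} (u v : Vec A m) -> V.toList u == V.toList v -> u == v
tL-in [] [] _ = rfl
tL-in (x ∷ u) (y ∷ v) e = ap2 _∷_ (LP.∷-injectiveˡ e) (tL-in u v (LP.∷-injectiveʳ e))

∑-tL : ∀ {A : Set} {m} (h : Fin m -> A) (F : A -> ℚ) -> ∑ (V.toList (tab h)) F == Ʃ (F ∘ h)
∑-tL {m = zr} h F = sym (Ʃ-Fin0 _)
∑-tL {m = suc m} h F = cg (F (h zr) #_) (∑-tL (h ∘ suc) F) » sym (Ʃ-Fi _)

ma-tL : ∀ {A B : Set} {m} (g : A -> B) (h : Fin m -> A) -> mapL g (V.toList (tab h)) == V.toList (tab (g ∘ h))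
ma-tL {m = zr} g h = rfl
ma-tL {m = suc m} g h = cg (g (h zr) ∷_) (ma-tL g (h ∘ suc))

aUT-tL : ∀ {A : Set} (f : ℕ -> A) m -> applyUpTo f m == V.toList (tab {n = m} (f ∘ tn))
aUT-tL f zr = rfl
aUT-tL f (suc m) = cg (f 0 ∷_) (aUT-tL (f ∘ suc) m)

in-ls : ∀ {N m} (f : ℕ -> ℕ) (w : Vec (Fin N) m) -> zip (applyUpTo f (length (lst w))) (lst w) == V.toList (tab (\ i -> f (tn i) , tn (lk w i)))
in-ls f [] = rfl
in-ls f (a ∷ w) = cg ((f 0 , tn a) ∷_) (in-ls (f ∘ suc) w)

∑-uT : ∀ m (F : ℕ -> ℚ) -> ∑ (upTo m) F == Ʃ (\ (i : Fin m) -> F (tn i))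
∑-uT m F = cg (\ xs -> ∑ xs F) (aUT-tL id m) » ∑-tL tn F

∑-wo : ∀ N m (F : List ℕ -> ℚ) -> ∑ (Defs.words N m) F == Ʃ (\ (w : Vec (Fin N) m) -> F (lst w))
∑-wo N zr F = #-idʳ _ » sym (Ʃ-[] _)
∑-wo N (suc m) F = ∑-cM _ (upTo N) F » ∑-co (upTo N) (\ a -> ∑-ma (a ∷_) (Defs.words N m) F » ∑-wo N m (\ w -> F (a ∷ w))) » ∑-uT N _ » sym (Ʃ-∷ _)

countᵇ-uT : ∀ (p : ℕ -> Bool) m -> ι (countᵇ p (upTo m)) == Ʃ (\ (i : Fin m) -> δ (T? (p (tn i))))
countᵇ-uT p m = ι-countᵇ p (upTo m) » ∑-uT m _

co-ls : ∀ {N m} (w : Vec (Fin N) m) -> Defs.content N (lst w) == V.toList (con w)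
co-ls {N} w = cg (mapL _) (aUT-tL id N) » ma-tL _ tn » cg V.toList (tabulate-cong (\ a -> ι-in (ι-countᵇ _ (lst w) »
 lett w a » sym (cn-Ʃ w a))))
 where
 lett : ∀ {N m} (w : Vec (Fin N) m) a -> ∑ (lst w) (\ b -> δ (T? (tn a ≡ᵇ b))) == Ʃ (\ i -> δ (eq? (lk w i) a))
 lett [] a = sym (Ʃ-Fin0 _)
 lett (b ∷ w) a = ap2 _#_ (δ-⇔ _ _ (\ t -> tn-inj (sym (≡ᵇ⇒≡ (tn a) (tn b) t))) (\ { rfl -> ≡⇒≡ᵇ (tn a) (tn a) rfl })) (lett w a) » sym (Ʃ-Fi _)

ha-co : ∀ {N m} (w : Vec (Fin N) m) (α : Vec ℕ N) -> T (eqList (Defs.content N (lst w)) (V.toList α)) -> con w == α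
ha-co {N} w α t = tL-in (con w) α (sym (co-ls w) » eL-so (Defs.content N (lst w)) _ t)

ha-co⁻ : ∀ {N m} (w : Vec (Fin N) m) (α : Vec ℕ N) -> con w == α -> T (eqList (Defs.content N (lst w)) (V.toList α))
ha-co⁻ {N} w α e = subst (\ xs -> T (eqList (Defs.content N (lst w)) xs)) (co-ls w » cg V.toList e) (eL-re (Defs.content N (lst w)))

-- Fundamental quasisymmetric functions: the word and the keys increase lexicographically.
Lexᵏ : ℕ × ℕ -> ℕ × ℕ -> Set
Lexᵏ (a , k) (b , l) = a < b ⊎ (a == b × k ≤ l)

Lexᵏ-tr : ∀ {x y z} -> Lexᵏ x y -> Lexᵏ y z -> Lexᵏ x z
Lexᵏ-tr (inl p) (inl q) = inl (<-trans p q)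
Lexᵏ-tr (inl p) (inr (rfl , _)) = inl p
Lexᵏ-tr (inr (rfl , _)) (inl q) = inl q
Lexᵏ-tr (inr (rfl , p)) (inr (rfl , q)) = inr (rfl , ≤t p q)

de : List ℕ -> List Bool
de ks = zipWith (\ a b -> b <ᵇ a) ks (drop 1 ks)

private
 st-so : ∀ a b k l -> T (if l <ᵇ k then a <ᵇ b else a ≤ᵇ b) -> Lexᵏ (a , k) (b , l)
 st-so a b k l t with l <ᵇ k in e
 ... | true = inl (<ᵇ⇒< a b t)
 ... | false with <-cmp a b
 ... | tri< p _ _ = inl p
 ... | tri≈ _ p _ = inr (p , ≮⇒≥ (\ q -> subst T e (<⇒<ᵇ q)))
 ... | tri> _ _ p = absurd (≤ᵇ⇒≤ a b t) (<⇒≱ p)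

 st-co : ∀ a b k l -> Lexᵏ (a , k) (b , l) -> T (if l <ᵇ k then a <ᵇ b else a ≤ᵇ b)
 st-co a b k l x with l <ᵇ k in e
 st-co a b k l (inl p) | true = <⇒<ᵇ p
 st-co a b k l (inl p) | false = ≤⇒≤ᵇ (<⇒≤ p)
 st-co a b k l (inr (rfl , q)) | false = ≤⇒≤ᵇ (≤= {a})
 st-co a b k l (inr (rfl , q)) | true = absurd q (<⇒≱ (<ᵇ⇒< l k (subst T (sym e) tt)))

-- Compatibility compares neighbours only; transitivity of the lexicographic order extends it to all
-- pairs of places, as `Standard` requires.
co-so : ∀ {N m} (w : Vec (Fin N) m) (ks : Vec ℕ m) -> T (compatible (de (V.toList ks)) (lst w)) ->
 ∀ i j -> tn i < tn j -> Lexᵏ (tn (lk w i) , lk ks i) (tn (lk w j) , lk ks j)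
co-so (a ∷ b ∷ w) (k ∷ l ∷ ks) t zr (suc zr) _ = st-so (tn a) (tn b) k l (fst (∧-T (if l <ᵇ k then _ else _) _ t))
co-so (a ∷ b ∷ w) (k ∷ l ∷ ks) t zr (suc (suc j)) _ = let p , q = ∧-T (if l <ᵇ k then _ else _) _ t in
 Lexᵏ-tr (st-so (tn a) (tn b) k l p) (co-so (b ∷ w) (l ∷ ks) q zr (suc j) (s≤s z≤n))
co-so (a ∷ b ∷ w) (k ∷ l ∷ ks) t (suc i) (suc j) (s≤s p) = co-so (b ∷ w) (l ∷ ks) (snd (∧-T (if l <ᵇ k then _ else _) _ t)) i j p
co-so (a ∷ []) ks t zr zr ()

co-co : ∀ {N m} (w : Vec (Fin N) m) (ks : Vec ℕ m) -> (∀ i j -> tn i < tn j -> Lexᵏ (tn (lk w i) , lk ks i) (tn (lk w j) , lk ks j)) ->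
 T (compatible (de (V.toList ks)) (lst w))
co-co [] [] h = tt
co-co (a ∷ []) (k ∷ []) h = tt
co-co (a ∷ b ∷ w) (k ∷ l ∷ ks) h = T-∧' (if l <ᵇ k then _ else _) _ (st-co (tn a) (tn b) k l (h zr (suc zr) (s≤s z≤n)))
 (co-co (b ∷ w) (l ∷ ks) (\ i j p -> h (suc i) (suc j) (s≤s p)))

di-so : ∀ {N m} (s : Vec (Fin N) m) -> T (Defs.distinct (lst s)) -> ∀ {i j} -> lk s i == lk s j -> i == j
di-so (a ∷ s) t {i} {j} = go i j
 where
 par = ∧-T (not (any (\ y -> tn a ≡ᵇ y) (lst s))) _ t
 fr : ∀ {m} (s : Vec (Fin _) m) -> T (not (any (\ y -> tn a ≡ᵇ y) (lst s))) -> ∀ i -> lk s i ≢ a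
 fr (b ∷ s) t i e with tn a ≡ᵇ tn b in f
 fr (b ∷ s) t zr rfl | false = subst T f (≡⇒≡ᵇ (tn a) (tn a) rfl)
 fr (b ∷ s) t (suc i) e | false = fr s t i e
 go : ∀ i j -> lk (a ∷ s) i == lk (a ∷ s) j -> i == j
 go zr zr e = rfl
 go zr (suc j) e = absurd (sym e) (fr s (fst par) j)
 go (suc i) zr e = absurd e (fr s (fst par) i)
 go (suc i) (suc j) e = cg suc (di-so s (snd par) e)

di-co : ∀ {N m} (s : Vec (Fin N) m) -> (∀ {i j} -> lk s i == lk s j -> i == j) -> T (Defs.distinct (lst s))
di-co [] inj = tt
di-co (a ∷ s) inj = T-∧' (not (any (\ y -> tn a ≡ᵇ y) (lst s))) _ (fr s (\ i e -> case inj {zr} {suc i} (sym e) of \ ()))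
 (di-co s (\ {i} {j} e -> su-in (inj {suc i} {suc j} e)))
 where
 su-in : ∀ {n} {i j : Fin n} -> suc i == suc j -> i == j
 su-in rfl = rfl
 fr : ∀ {m} (s : Vec (Fin _) m) -> (∀ i -> lk s i ≢ a) -> T (not (any (\ y -> tn a ≡ᵇ y) (lst s)))
 fr [] h = tt
 fr (b ∷ s) h with tn a ≡ᵇ tn b in f
 ... | true = h zr (sym (tn-inj (≡ᵇ⇒≡ (tn a) (tn b) (subst T (sym f) tt))))
 ... | false = fr s (h ∘ suc)

module OL (n : ℕ) where

 oL : Pe n -> List ℕ
 oL σ = lst (tab (σ ·_))

 ∑-pe : (F : List ℕ -> ℚ) -> ∑ (Defs.perms n) F == Ʃ (F ∘ oL)
 ∑-pe F = ∑-fil (T? ∘ Defs.distinct) (Defs.words n n) F » ∑-wo n n _ » sym (Ʃ-co (\ σ -> sym (δ-tr (yes tt) tt)) »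
  Ʃ-re (\ _ -> yes tt) (\ s -> T? (Defs.distinct (lst s))) (\ σ -> tab (σ ·_)) pe
   (\ σ _ -> di-co (tab (σ ·_)) (\ {i} {j} e -> ·-in σ (sym (lk-tab (σ ·_) i) » e » lk-tab (σ ·_) j)))
   (\ _ _ -> tt) (\ σ _ -> pe-ex (\ i -> pe-· (tab (σ ·_)) (di-co (tab (σ ·_)) (\ {i} {j} e -> ·-in σ (sym (lk-tab (σ ·_) i) » e » lk-tab (σ ·_) j))) i » lk-tab (σ ·_) i))
   (\ s t -> lo-ex (\ i -> lk-tab _ i » pe-· s t i)) (F ∘ lst))
  where
  pD : ∀ s -> Dec (T (Defs.distinct (lst s))) -> Pe n
  pD s (yes t) = fst (bi (lk s) (di-so s t))
  pD s (no _) = idₚ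
  pe : Vec (Fin n) n -> Pe n
  pe s = pD s (T? (Defs.distinct (lst s)))
  pe-· : ∀ s -> T (Defs.distinct (lst s)) -> ∀ i -> pe s · i == lk s i
  pe-· s t i with T? (Defs.distinct (lst s))
  ... | yes t' = snd (bi (lk s) (di-so s t')) i
  ... | no nt = absurd t nt

 le-oL : ∀ σ -> length (oL σ) == n
 le-oL σ = le-ls (tab (σ ·_))

 it-oL : ∀ σ k i -> Defs.iter (oL σ) k (tn i) == tn (it σ k i)
 it-oL σ zr i = rfl
 it-oL σ (suc k) i = cg (Defs.at (oL σ)) (it-oL σ k i) » at-ls (tab (σ ·_)) (it σ k i) » cg tn (lk-tab (σ ·_) _)

 fW-co : ∀ {p q : ℕ -> Bool} d xs -> (∀ k -> p k == q k) -> firstWith p d xs == firstWith q d xs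
 fW-co d [] e = rfl
 fW-co d (x ∷ xs) e rewrite e x | fW-co d xs e = rfl

 re? : Pe n -> Fin n -> ℕ -> Bool
 re? σ i k = tn (it σ k i) ≡ᵇ tn i

 cL-oL : ∀ σ i -> Defs.cycleLength (oL σ) (tn i) == firstWith (re? σ i) n (mapL suc (upTo n))
 cL-oL σ i = fW-co (length (oL σ)) (mapL suc (upTo (length (oL σ)))) (\ k -> cg (_≡ᵇ tn i) (it-oL σ k i)) » cg (\ m -> firstWith (re? σ i) m (mapL suc (upTo m))) (le-oL σ)

 co-cy : ∀ σ ℓ -> ι (countᵇ (\ i -> Defs.cycleLength (oL σ) i ≡ᵇ suc ℓ) (upTo (length (oL σ)))) == Ʃ (\ i -> δ (T? (firstWith (re? σ i) n (mapL suc (upTo n)) ≡ᵇ suc ℓ)))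
 co-cy σ ℓ = cg (\ m -> ι (countᵇ (\ i -> Defs.cycleLength (oL σ) i ≡ᵇ suc ℓ) (upTo m))) (le-oL σ) » countᵇ-uT _ n »
  Ʃ-co (\ i -> cg (\ c -> δ (T? (c ≡ᵇ suc ℓ))) (cL-oL σ i))

 cT-co : ∀ h σ -> Defs.cycleType (oL (co h σ)) == Defs.cycleType (oL σ)
 cT-co h σ = LP.concatMap-cong (\ ℓ -> cg (\ c -> rep (c / suc ℓ) (suc ℓ)) (ι-in {raw (co h σ) ℓ} {raw σ ℓ} (co-cy (co h σ) ℓ » sym (Ʃ-bi (h ·_) (h ·⁻_) (·⁻· h) (··⁻ h) (\ i -> δ (T? (firstWith (re? (co h σ) i) n (mapL suc (upTo n)) ≡ᵇ suc ℓ)))) » Ʃ-co (\ i -> cg (\ c -> δ (T? (c ≡ᵇ suc ℓ)))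
  (fW-co n (mapL suc (upTo n)) (sa i))) » sym (co-cy σ ℓ)))) (downFrom (length (oL (co h σ)))) »
  cg (\ m -> concatMap (\ ℓ -> rep (Defs.numCycles (oL σ) ℓ) (suc ℓ)) (downFrom m)) (le-oL (co h σ) » sym (le-oL σ))
  where
  raw : Pe n -> ℕ -> ℕ
  raw σ ℓ = countᵇ (\ i -> Defs.cycleLength (oL σ) i ≡ᵇ suc ℓ) (upTo (length (oL σ)))
  sa : ∀ i k -> re? (co h σ) (h · i) k == re? σ i k
  sa i k = T-ex (\ t -> ≡⇒≡ᵇ _ _ (cg tn (·-in h (sym (co-it h σ k i) » tn-inj (≡ᵇ⇒≡ _ _ t)))))
   (\ t -> ≡⇒≡ᵇ _ _ (cg tn (co-it h σ k i » cg (h ·_) (tn-inj (≡ᵇ⇒≡ _ _ t)))))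

 -- Parts equal to 1 arise only from `ℓ` = 0, where the number of points is divided by 1; and a
 -- point has cycle length 1 exactly when it is fixed.
 mu-1 : ∀ σ -> multiplicity 1 (Defs.cycleType (oL σ)) == sF (\ i -> wh (σ · i ≟F i) 1)
 mu-1 σ = on-in (Defs.numCycles (oL σ)) (length (oL σ)) (\ e -> n/1≡n c₁ » ι-in (co-cy σ 0 » Ʃ-no (sym (le-oL σ) » e) _)) »
  n/1≡n c₁ » ι-in (co-cy σ 0 » Ʃ-co (\ i -> δ-⇔ _ _ (fix i) (fi⁻ i)) » sym (ι-sF _ » Ʃ-co (\ i -> ι-wh (σ · i ≟F i) 1 » cg (δ (σ · i ≟F i) &_) (#-idʳ 1q) » &-idʳ _)))
  where
  open import Data.Nat.DivMod using (n/1≡n)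
  c₁ : ℕ
  c₁ = countᵇ (\ i -> Defs.cycleLength (oL σ) i ≡ᵇ 1) (upTo (length (oL σ)))
  Ʃ-no : ∀ {m} -> m == 0 -> (f : Fin m -> ℚ) -> Ʃ f == 0q
  Ʃ-no rfl f = Ʃ-Fin0 f
  on-in : ∀ (g : ℕ -> ℕ) m -> (m == 0 -> g 0 == 0) -> multiplicity 1 (concatMap (\ ℓ -> rep (g ℓ) (suc ℓ)) (downFrom m)) == g 0
  on-in g zr z = sym (z rfl)
  on-in g (suc m) z = co-++ (rep (g m) (suc m)) _ » go m
   where
   co-++ : ∀ xs ys -> multiplicity 1 (xs ++ ys) == multiplicity 1 xs + multiplicity 1 ys
   co-++ [] ys = rfl
   co-++ (x ∷ xs) ys with x ≡ᵇ 1
   ... | true = cg suc (co-++ xs ys)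
   ... | false = co-++ xs ys
   al-1 : ∀ c -> multiplicity 1 (rep c 1) == c
   al-1 zr = rfl
   al-1 (suc c) = cg suc (al-1 c)
   no-1 : ∀ c x -> multiplicity 1 (rep c (suc (suc x))) == 0
   no-1 zr x = rfl
   no-1 (suc c) x = no-1 c x
   go : ∀ m -> multiplicity 1 (rep (g m) (suc m)) + multiplicity 1 (concatMap (\ ℓ -> rep (g ℓ) (suc ℓ)) (downFrom m)) == g 0
   go zr = +-idr _ » al-1 (g 0)
   go (suc m) = ap2 _+_ (no-1 (g (suc m)) m) (on-in g (suc m) (\ ()))
  -- Once the candidate 1 has failed, the search meets only lengths of at least 2, and so is its
  -- default value.
  lat : ∀ (p : ℕ -> Bool) d (f : ℕ -> ℕ) m -> (∀ k -> 2 ≤ f k) -> 2 ≤ d -> 2 ≤ firstWith p d (applyUpTo f m)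
  lat p d f zr h q = q
  lat p d f (suc m) h q with p (f 0)
  ... | true = h 0
  ... | false = lat p d (f ∘ suc) m (h ∘ suc) q
  cyc : Fin n -> ℕ -> ℕ
  cyc i m = firstWith (re? σ i) m (mapL suc (upTo m))
  fi⁻ : ∀ i -> σ · i == i -> T (cyc i n ≡ᵇ 1)
  fi⁻ i e = go n rfl
   where
   go : ∀ m -> m == n -> T (cyc i m ≡ᵇ 1)
   go zr q = case subst Fin (sym q) i of \ ()
   go (suc m) q with tn (σ · i) ≡ᵇ tn i in r
   ... | true = tt
   ... | false = ⊥-elim (subst T r (≡⇒≡ᵇ _ _ (cg tn e)))
  fix : ∀ i -> T (cyc i n ≡ᵇ 1) -> σ · i == i
  fix i t = go n rfl t
   where
   sin : ∀ {n} -> 1 == n -> (i j : Fin n) -> i == j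
   sin rfl zr zr = rfl
   go : ∀ m -> m == n -> T (cyc i m ≡ᵇ 1) -> σ · i == i
   go zr q t = case subst Fin (sym q) i of \ ()
   go (suc zr) q t = sin q (σ · i) i
   go (suc (suc m)) q t with tn (σ · i) ≡ᵇ tn i in r
   ... | true = tn-inj (≡ᵇ⇒≡ _ _ (subst T (sym r) tt))
   ... | false = absurd (≡ᵇ⇒≡ (firstWith (re? σ i) (suc (suc m)) (mapL suc (applyUpTo (\ k -> suc k) (suc m)))) 1 t) (\ e -> <≢ (subst (\ xs -> 2 ≤ firstWith (re? σ i) (suc (suc m)) xs) (sym (LP.map-applyUpTo (\ k -> suc k) (\ k -> suc k) (suc m)))
    (lat (re? σ i) (suc (suc m)) (\ k -> suc (suc k)) (suc m) (\ k -> s≤s (s≤s {0} {k} z≤n)) (s≤s (s≤s z≤n)))) (sym e))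

lo-un : ∀ {N} (b a : Fin N) -> ι (lk (uni b) a) == δ (eq? b a)
lo-un zr zr = #-idʳ 1q » sym (δ-ye _ rfl)
lo-un zr (suc a) = cg ι (VP.lookup-replicate a 0) » sym (δ-no _ (\ ()))
lo-un (suc b) zr = sym (δ-no _ (\ ()))
lo-un (suc b) (suc a) = lo-un b a » δ-⇔ _ _ (cg suc) (\ { rfl -> rfl })

module Eu (n : ℕ) (lam : List ℕ) where
 open OL n

 Cl : Pe n -> Set
 Cl σ = T (eqList (Defs.cycleType (oL σ)) lam)

 cl? : ∀ σ -> Dec (Cl σ)
 cl? σ = T? (eqList (Defs.cycleType (oL σ)) lam)

 cl-co : ∀ h σ -> Cl σ -> Cl (co h σ)
 cl-co h σ = subst (\ τ -> T (eqList τ lam)) (sym (cT-co h σ))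

 cl-fi : ∀ σ -> Cl σ -> sF (\ i -> wh (σ · i ≟F i) 1) == multiplicity 1 lam
 cl-fi σ c = sym (mu-1 σ) » cg (multiplicity 1) (eL-so (Defs.cycleType (oL σ)) lam c)

 open Ex n (multiplicity 1 lam) cl? cl-co cl-fi public

 module _ {N : ℕ} where
  open SC n N using (Z;standard?;Standard;Increasing;Coloured;code;code-mono)
  open Cou n N using (weight-Z;bar)

  module _ where
   ex : Pe n -> Fin n -> Bool
   ex σ i = tn i <ᵇ tn (lk (tab (σ ·_)) i)

   ex-< : ∀ σ i -> T (ex σ i) -> tn i < tn (σ · i)
   ex-< σ i t = subst (\ z -> tn i < tn z) (lk-tab (σ ·_) i) (<ᵇ⇒< _ _ t)

   <-ex : ∀ σ i -> tn i < tn (σ · i) -> T (ex σ i)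
   <-ex σ i p = <⇒<ᵇ (subst (\ z -> tn i < tn z) (sym (lk-tab (σ ·_) i)) p)

   key : Pe n -> Fin n -> ℕ
   key σ i = if ex σ i then tn (lk (tab (σ ·_)) i) else length (oL σ) + tn (lk (tab (σ ·_)) i)

   indexed≡ : ∀ (σ : Pe n) -> Defs.indexed (oL σ) == V.toList (tab (\ i -> tn i , tn (lk (tab (σ ·_)) i)))
   indexed≡ σ = in-ls id (tab (σ ·_))

   exc≡ : ∀ σ -> Defs.exc (oL σ) == sF (\ i -> bar (ex σ i))
   exc≡ σ = ι-in (ι-countᵇ _ (Defs.indexed (oL σ)) » cg (\ xs -> ∑ xs _) (indexed≡ σ) » ∑-tL _ _ » Ʃ-co (\ i -> bar≡ (ex σ i)) » sym (ι-sF _))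
    where
    bar≡ : ∀ c -> δ (T? c) == ι (bar c)
    bar≡ true = δ-ye _ tt » sym (#-idʳ 1q)
    bar≡ false = δ-no _ id

   dex≡ : ∀ σ -> Defs.dex (oL σ) == de (V.toList (tab (key σ)))
   dex≡ σ = cg de (cg (mapL _) (indexed≡ σ) » ma-tL _ _)

   colo : Pe n -> Vec (Fin N) n -> Vec Z n
   colo σ w = tab (\ i -> lk w i , ex σ i)

   lo-co : ∀ (σ : Pe n) w i -> lk (colo σ w) i == (lk w i , ex σ i)
   lo-co σ w i = lk-tab _ i

   to-Z : ∀ (D : Vec Z n) -> tota weight-Z D == sF (\ i -> bar (snd (lk D i))) ∷ con (V.map fst D)
   to-Z D = lo-ex \
    { zr -> ι-in (to-lo weight-Z D zr » sym (ι-sF _))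
    ;(suc a) -> ι-in (to-lo weight-Z D (suc a) » Ʃ-co (\ s -> lo-un (fst (lk D s)) a » cg (\ z -> δ (eq? z a)) (sym (VP.lookup-map s fst D))) »
     sym (cg ι (lk-tab (cnt (V.map fst D)) a) » cn-Ʃ (V.map fst D) a)) }

   length≡n = le-oL

   ke-≤ : ∀ (σ : Pe n) i j -> key σ i ≤ key σ j -> i ≢ j -> (T (ex σ i) × ¬ T (ex σ j)) ⊎ (ex σ i == ex σ j × tn (σ · i) < tn (σ · j))
   ke-≤ σ i j p ne with ex σ i | ex σ j
   ... | true | false = inl (tt , id)
   ... | true | true = inr (rfl , stri p)
    where
    stri : tn (lk (tab (σ ·_)) i) ≤ tn (lk (tab (σ ·_)) j) -> tn (σ · i) < tn (σ · j)
    stri p = ≤∧≢⇒< (subst2 (\ x y -> tn x ≤ tn y) (lk-tab (σ ·_) i) (lk-tab (σ ·_) j) p) (\ e -> ne (·-in σ (tn-inj e)))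
   ... | false | false = inr (rfl , stri (+-cancelˡ-≤ (length (oL σ)) _ _ p))
    where
    stri : tn (lk (tab (σ ·_)) i) ≤ tn (lk (tab (σ ·_)) j) -> tn (σ · i) < tn (σ · j)
    stri p = ≤∧≢⇒< (subst2 (\ x y -> tn x ≤ tn y) (lk-tab (σ ·_) i) (lk-tab (σ ·_) j) p) (\ e -> ne (·-in σ (tn-inj e)))
   ... | false | true = absurd (≤t (m≤m+n (length (oL σ)) _) p) (<⇒≱ (≤t (toℕ<n _) (≤r (sym (length≡n σ)))))

   ≤-ke : ∀ σ i j -> (T (ex σ i) × ¬ T (ex σ j)) ⊎ (ex σ i == ex σ j × tn (σ · i) < tn (σ · j)) -> key σ i ≤ key σ j
   ≤-ke σ i j x with ex σ i | ex σ j
   ≤-ke σ i j (inl (_ , nf)) | true | true = absurd tt nf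
   ≤-ke σ i j (inl _) | true | false = ≤t (<⇒≤ (toℕ<n _)) (≤t (≤r (sym (length≡n σ))) (m≤m+n _ _))
   ≤-ke σ i j (inl (t , _)) | false | _ = ⊥-elim t
   ≤-ke σ i j (inr (_ , p)) | true | true = subst2 (\ x y -> tn x ≤ tn y) (sym (lk-tab (σ ·_) i)) (sym (lk-tab (σ ·_) j)) (<⇒≤ p)
   ≤-ke σ i j (inr (_ , p)) | false | false = +-monoʳ-≤ (length (oL σ)) (subst2 (\ x y -> tn x ≤ tn y) (sym (lk-tab (σ ·_) i)) (sym (lk-tab (σ ·_) j)) (<⇒≤ p))

   -- The key puts bars before values, so ordering by letter and key is ordering by letter, bar and
   -- value; `code` merges the first two of these.
   lex-cod : ∀ σ (w : Vec (Fin N) n) i j -> i ≢ j -> Lexᵏ (tn (lk w i) , key σ i) (tn (lk w j) , key σ j) -> Increasing σ (colo σ w) i j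
   lex-cod σ w i j ne x = subst2 (\ y z -> code y < code z ⊎ (y == z × tn (σ · i) < tn (σ · j))) (sym (lo-co σ w i)) (sym (lo-co σ w j)) (go x)
    where
    go : Lexᵏ (tn (lk w i) , key σ i) (tn (lk w j) , key σ j) -> code (lk w i , ex σ i) < code (lk w j , ex σ j) ⊎ ((lk w i , ex σ i) == (lk w j , ex σ j) × tn (σ · i) < tn (σ · j))
    go (inl p) = inl (≰⇒> (\ q -> <⇒≱ p (code-mono (lk w j , ex σ j) (lk w i , ex σ i) q)))
    go (inr (e , p)) with ke-≤ σ i j p ne
    ... | inr (f , q) = inr (ap2 _,_ (tn-inj e) f , q)
    ... | inl (t , nt) with ex σ i | ex σ j
    ... | true | false = inl (s≤s (≤r (cg (2 *_) e)))
    ... | true | true = absurd tt nt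
    ... | false | _ = ⊥-elim t

   co-le : ∀ σ (w : Vec (Fin N) n) i j -> Increasing σ (colo σ w) i j -> Lexᵏ (tn (lk w i) , key σ i) (tn (lk w j) , key σ j)
   co-le σ w i j x = go (subst2 (\ y z -> code y < code z ⊎ (y == z × tn (σ · i) < tn (σ · j))) (lo-co σ w i) (lo-co σ w j) x)
    where
    barr : ∀ {a b : Fin N} {c d} -> code (a , c) < code (b , d) -> ¬ (tn a < tn b) -> T c × ¬ T d
    barr {c = true} {false} p _ = tt , id
    barr {a} {b} {true} {true} p nl = absurd (≰⇒> (\ q -> <⇒≱ p (*-monoʳ-≤ 2 q))) nl
     where open import Data.Nat.Properties using (*-monoʳ-≤)
    barr {a} {b} {false} {d} p nl = absurd (≤t (lowe d) (s≤s (*-monoʳ-≤ 2 (≮⇒≥ nl)))) (<⇒≱ p)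
     where
     open import Data.Nat.Properties using (*-monoʳ-≤)
     lowe : ∀ d -> code (b , d) ≤ suc (2 * tn b)
     lowe true = n≤1+n _
     lowe false = ≤=
    go : code (lk w i , ex σ i) < code (lk w j , ex σ j) ⊎ ((lk w i , ex σ i) == (lk w j , ex σ j) × tn (σ · i) < tn (σ · j)) -> Lexᵏ (tn (lk w i) , key σ i) (tn (lk w j) , key σ j)
    go (inr (e , p)) = inr (cg (tn ∘ fst) e , ≤-ke σ i j (inr (cg snd e , p)))
    go (inl p) with tn (lk w i) <?ℕ tn (lk w j)
    ... | yes q = inl q
    ... | no nq = inr (≤-antisym (code-mono (lk w i , ex σ i) (lk w j , ex σ j) (<⇒≤ p)) (≮⇒≥ nq) , ≤-ke σ i j (inl (barr p nq)))

  -- For a given σ the bars are forced to lie on the excedances. Adding or forgetting them matches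
  -- compatible words with standard bicoloured words, and the number of bars is the excedance
  -- number.
  Qc-st : ∀ j (α : List ℕ) (αᵥ : Vec ℕ N) -> α == V.toList αᵥ -> ι (Qcoeff n lam j α) == sta j αᵥ
  Qc-st j α αᵥ rfl = ι-su _ (filterᵇ _ (Defs.perms n)) » ∑-fil (T? ∘ \ σ -> (Defs.exc σ ≡ᵇ j) ∧ eqList (Defs.cycleType σ) lam) (Defs.perms n) _ »
   ∑-pe _ » Ʃ-co (\ σ -> ap2 _&_ rfl (ι-countᵇ _ (Defs.words (length α) n) » cg (\ m -> ∑ (Defs.words m n) (goo σ m)) (le-tL αᵥ) » ∑-wo N n (goo σ N)) »
    sym (Ʃ-*ˡ _ _) » Ʃ-co (\ w -> sym (δ-× _ _) » sym (&-idʳ _)) » Ʃ-re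
     (\ w -> T? ((Defs.exc (oL σ) ≡ᵇ j) ∧ eqList (Defs.cycleType (oL σ)) lam) ×-dec T? (compatible (Defs.dex (oL σ)) (lst w) ∧ eqList (Defs.content N (lst w)) (V.toList αᵥ)))
     (\ D -> (cl? σ ×-dec VP.≡-dec _≟ℕ_ (tota weight-Z D) (j ∷ αᵥ)) ×-dec standard? σ D) (colo σ) (V.map fst) (to σ) (from σ) (\ w _ -> unc σ w) (reco σ) (\ _ -> 1q) »
     Ʃ-co (\ D -> &-idʳ _ » δ-× _ _ » cg (_& δ (standard? σ D)) (δ-× _ _)))
   where
   le-tL : ∀ {m} (v : Vec ℕ m) -> length (V.toList v) == m
   le-tL [] = rfl
   le-tL (x ∷ v) = cg suc (le-tL v)
   goo : Pe n -> ℕ -> List ℕ -> ℚ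
   goo σ m w = δ (T? (compatible (Defs.dex (oL σ)) w ∧ eqList (Defs.content m w) (V.toList αᵥ)))
   Bef Af : Pe n -> Vec (Fin N) n -> Set
   Bef σ w = T ((Defs.exc (oL σ) ≡ᵇ j) ∧ eqList (Defs.cycleType (oL σ)) lam) × T (compatible (Defs.dex (oL σ)) (lst w) ∧ eqList (Defs.content N (lst w)) (V.toList αᵥ))
   Af σ w = (Cl σ × tota weight-Z (colo σ w) == j ∷ αᵥ) × Standard σ (colo σ w)
   unc : ∀ σ w -> V.map fst (colo σ w) == w
   unc σ w = lo-ex (\ i -> VP.lookup-map i fst (colo σ w) » cg fst (lo-co σ w i))
   ba-to : ∀ σ w -> sF (\ i -> bar (snd (lk (colo σ w) i))) == Defs.exc (oL σ)
   ba-to σ w = sF-co (\ i -> cg (bar ∘ snd) (lo-co σ w i)) » sym (exc≡ σ)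
   to : ∀ σ w -> Bef σ w -> Af σ w
   to σ w (p , q) = let e , c = ∧-T (Defs.exc (oL σ) ≡ᵇ j) _ p;s , t = ∧-T (compatible (Defs.dex (oL σ)) (lst w)) _ q in
    (c , trans (to-Z (colo σ w)) (ap2 _∷_ (ba-to σ w » ≡ᵇ⇒≡ _ j e) (cg con (unc σ w) » ha-co w αᵥ t))) ,
    ((\ i j l -> lex-cod σ w i j (\ { rfl -> <-irrefl rfl l }) (subst2 (\ k k' -> Lexᵏ (_ , k) (_ , k')) (lk-tab (key σ) i) (lk-tab (key σ) j)
     (co-so w (tab (key σ)) (subst (\ ds -> T (compatible ds (lst w))) (dex≡ σ) s) i j l))) ,
     (\ i -> (\ f -> ex-< σ i (subst T (sym (sym (cg snd (lo-co σ w i)) » f)) tt)) , (\ l -> cg snd (lo-co σ w i) » T-tr (<-ex σ i l))))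
    where
    T-tr : ∀ {b} -> T b -> b == true
    T-tr {true} _ = rfl
   fr' : ∀ σ w -> Af σ w -> Bef σ w
   fr' σ w ((c , t) , (inc , _)) = T-∧' (Defs.exc (oL σ) ≡ᵇ j) _ (≡⇒≡ᵇ _ j (sym (ba-to σ w) » VP.∷-injectiveˡ t')) c ,
    T-∧' (compatible (Defs.dex (oL σ)) (lst w)) _ (subst (\ ds -> T (compatible ds (lst w))) (sym (dex≡ σ)) (co-co w (tab (key σ))
     (\ i j l -> subst2 (\ k k' -> Lexᵏ (_ , k) (_ , k')) (sym (lk-tab (key σ) i)) (sym (lk-tab (key σ) j)) (co-le σ w i j (inc i j l)))))
     (ha-co⁻ w αᵥ (cg con (sym (unc σ w)) » VP.∷-injectiveʳ t'))
    where
    t' : sF (\ i -> bar (snd (lk (colo σ w) i))) ∷ con (V.map fst (colo σ w)) == j ∷ αᵥ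
    t' = sym (to-Z (colo σ w)) » t
   reco : ∀ σ D -> (Cl σ × tota weight-Z D == j ∷ αᵥ) × Standard σ D -> colo σ (V.map fst D) == D
   reco σ D (_ , (_ , col)) = lo-ex (\ i -> lo-co σ (V.map fst D) i » ap2 _,_ (VP.lookup-map i fst D) (T-ex
    (\ t -> subst T (sym (snd (col i) (ex-< σ i t))) tt) (\ t -> <-ex σ i (fst (col i) (is-tr t)))))
    where
    is-tr : ∀ {b} -> T b -> b == true
    is-tr {true} _ = rfl
   from : ∀ σ D -> (Cl σ × tota weight-Z D == j ∷ αᵥ) × Standard σ D -> Bef σ (V.map fst D)
   from σ D p = fr' σ (V.map fst D) (subst (\ D -> (Cl σ × tota weight-Z D == j ∷ αᵥ) × Standard σ D) (sym (reco σ D p)) p)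

-- Semistandard tableaux and Kostka numbers.

open Defs using (weaklyIncreasing;columnsStrict;isSSYT;fillings;schurCoeff)
open import Data.Bool.ListAction using (and)
open import Data.Bool.Properties using (∧-zeroʳ)
open import Data.List using (concat)

δ-∧ : ∀ a b -> δ (T? (a ∧ b)) == δ (T? a) & δ (T? b)
δ-∧ a b = δ-⇔ (T? (a ∧ b)) (T? a ×-dec T? b) (∧-T a b) (\ (p , q) -> T-∧' a b p q) » δ-× (T? a) (T? b)

Ʃ-la : ∀ N (F : ℕ -> ℚ) -> Ʃ (\ (a : Fin (suc N)) -> F (tn a)) == Ʃ (\ (a : Fin N) -> F (tn a)) # F N
Ʃ-la zr F = Ʃ-Fi _ » cg (F 0 #_) (Ʃ-Fin0 _) » #-co _ _ » cg (_# F 0) (sym (Ʃ-Fin0 _))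
Ʃ-la (suc N) F = Ʃ-Fi _ » cg (F 0 #_) (Ʃ-la N (F ∘ suc)) » sym (#-as _ _ _) » cg (_# F (suc N)) (sym (Ʃ-Fi _))

module _ (N : ℕ) where

 be : ℕ -> List ℕ -> Bool
 be a [] = true
 be a (x ∷ _) = a ≤ᵇ x

 wi-∷ : ∀ a w -> weaklyIncreasing (a ∷ w) == be a w ∧ weaklyIncreasing w
 wi-∷ a [] = rfl
 wi-∷ a (x ∷ w) = rfl

 wi-Σ : ∀ {M} -> ℕ -> (List ℕ -> ℚ) -> ℚ
 wi-Σ {M} r F = Ʃ (\ (w : Vec (Fin M) r) -> δ (T? (weaklyIncreasing (lst w))) & F (lst w))

 wi-Σ-∷ : ∀ {M} r F -> wi-Σ {M} (suc r) F == Ʃ (\ (a : Fin M) -> wi-Σ {M} r (\ w -> δ (T? (be (tn a) w)) & F (tn a ∷ w)))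
 wi-Σ-∷ {M} r F = Ʃ-∷ _ » Ʃ-co₂ (\ a w -> cg (\ b -> δ (T? b) & F (tn a ∷ lst w)) (wi-∷ (tn a) (lst w)) »
  cg (_& F (tn a ∷ lst w)) (δ-∧ _ _ » &-co _ _) » &-as _ _ _)

 -- The occurrences of the largest letter N form the end of a row.
 row-ste : ∀ B r (F : List ℕ -> ℚ) -> r ≤ B -> wi-Σ {suc N} r F == Ʃ (\ (f : Fin (suc B)) -> δ (tn f ≤?ℕ r) & wi-Σ {N} (tn f) (\ w -> F (w ++ rep (r ∸ tn f) N)))
 row-ste B zr F _ = Ʃ-[] _ » sym (Ʃ-Fi _ » ap2 _#_ (δ-tr (0 ≤?ℕ 0) z≤n » Ʃ-[] _) (Ʃ-0 (\ f -> δ-fa _ (\ ()))) » #-idʳ _)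
 row-ste (suc B) (suc r) F (s≤s p) = begin
  wi-Σ {suc N} (suc r) F
   ≡⟨ trans (wi-Σ-∷ r F) (Ʃ-co (\ a -> row-ste B r (\ w -> δ (T? (be (tn a) w)) & F (tn a ∷ w)) p)) ⟩
  Ʃ (\ (a : Fin (suc N)) -> Ʃ (\ f -> δ (tn f ≤?ℕ r) & wi-Σ {N} (tn f) (H (tn a) (tn f))))
   ≡⟨ Ʃ-la N (\ a -> Ʃ (\ (f : Fin (suc B)) -> δ (tn f ≤?ℕ r) & wi-Σ {N} (tn f) (H a (tn f)))) ⟩
  Ʃ (\ (a : Fin N) -> Ʃ (\ (f : Fin (suc B)) -> δ (tn f ≤?ℕ r) & wi-Σ {N} (tn f) (H (tn a) (tn f)))) # Ʃ (\ (f : Fin (suc B)) -> δ (tn f ≤?ℕ r) & wi-Σ {N} (tn f) (H N (tn f)))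
   ≡⟨ trans (#-co _ _) (ap2 _#_ lar (Ʃ-sw _ » Ʃ-co sma)) ⟩
  F (rep (suc r) N) # Ʃ (\ (f : Fin (suc B)) -> δ (suc (tn f) ≤?ℕ suc r) & wi-Σ {N} (suc (tn f)) (\ w -> F (w ++ rep (r ∸ tn f) N)))
   ≡⟨ trans (Ʃ-Fi _) (ap2 _#_ (δ-tr (0 ≤?ℕ suc r) z≤n » Ʃ-[] _ » δ-tr (T? true) tt) rfl) ⟨
  Ʃ (\ (f : Fin (suc (suc B))) -> δ (tn f ≤?ℕ suc r) & wi-Σ {N} (tn f) (\ w -> F (w ++ rep (suc r ∸ tn f) N))) ∎
  where
  open ≡-Reasoning
  H : ℕ -> ℕ -> List ℕ -> ℚ
  H a f w = δ (T? (be a (w ++ rep (r ∸ f) N))) & F (a ∷ w ++ rep (r ∸ f) N)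
  re-be : ∀ a k -> a ≤ N -> T (be a (rep k N))
  re-be a zr _ = tt
  re-be a (suc k) l = ≤⇒≤ᵇ l
  lar : Ʃ (\ (f : Fin (suc B)) -> δ (tn f ≤?ℕ r) & wi-Σ {N} (tn f) (H N (tn f))) == F (rep (suc r) N)
  lar = Ʃ-Fi _ » ap2 _#_ (δ-tr (0 ≤?ℕ r) z≤n » Ʃ-[] _ » δ-tr (T? true) tt » δ-tr (T? _) (re-be N r ≤=))
   (Ʃ-0 (\ f -> cg (δ (suc (tn f) ≤?ℕ r) &_) (Ʃ-0 (\ { w@(x ∷ _) -> cg (δ (T? (weaklyIncreasing (lst w))) &_) (δ-fa (T? (N ≤ᵇ tn x)) (\ t -> <⇒≱ (toℕ<n x) (≤ᵇ⇒≤ N (tn x) t))) » &-zeroʳ _ })) » &-zeroʳ _)) » #-idʳ _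
  sma : ∀ f -> Ʃ (\ (a : Fin N) -> δ (tn f ≤?ℕ r) & wi-Σ {N} (tn f) (H (tn a) (tn f))) == δ (suc (tn f) ≤?ℕ suc r) & wi-Σ {N} (suc (tn f)) (\ w -> F (w ++ rep (r ∸ tn f) N))
  sma f = Ʃ-*ˡ _ _ » ap2 _&_ (δ-⇔ _ _ s≤s ≤-pred) (Ʃ-co (\ a -> Ʃ-co (\ w -> cg (\ z -> δ (T? (weaklyIncreasing (lst w))) & (z & F (tn a ∷ lst w ++ rep (r ∸ tn f) N))) (sa a w))) »
   sym (wi-Σ-∷ (tn f) (\ w -> F (w ++ rep (r ∸ tn f) N))))
   where
   sa : ∀ {f} a (w : Vec (Fin N) f) -> δ (T? (be (tn a) (lst w ++ rep (r ∸ f) N))) == δ (T? (be (tn a) (lst w)))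
   sa {f} a [] = δ-⇔ _ (T? true) (\ _ -> tt) (\ _ -> re-be (tn a) (r ∸ f) (<⇒≤ (toℕ<n a)))
   sa a (x ∷ w) = rfl

al-wi : List (List ℕ) -> Bool
al-wi Θ = and (mapL weaklyIncreasing Θ)

ext : ℕ -> ∀ {R} -> Vec ℕ R -> Vec ℕ R -> List (List ℕ) -> List (List ℕ)
ext N (m ∷ μ) (f ∷ ν) (w ∷ Θ) = (w ++ rep (m ∸ f) N) ∷ ext N μ ν Θ
ext N _ _ Θ = Θ

∑-fi : ∀ N r rs (F : List (List ℕ) -> ℚ) -> ∑ (fillings N (r ∷ rs)) F == Ʃ (\ (w : Vec (Fin N) r) -> ∑ (fillings N rs) (\ Θ -> F (lst w ∷ Θ)))
∑-fi N r rs F = ∑-cM _ (Defs.words N r) F » ∑-co (Defs.words N r) (\ w -> ∑-ma (w ∷_) (fillings N rs) F) » ∑-wo N r _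

module Ta (B : ℕ) where
 open Ko B 0 using (Row;ℕs;KR;step?;Step)

 SSY : ∀ N {R} -> Vec ℕ R -> (List (List ℕ) -> ℚ) -> ℚ
 SSY N μ G = ∑ (fillings N (V.toList μ)) (\ Θ -> δ (T? (al-wi Θ)) & G Θ)

 SS-∷ : ∀ N {R} r (μ : Vec ℕ R) G -> SSY N (r ∷ μ) G == wi-Σ N {N} r (\ w -> SSY N μ (\ Θ -> G (w ∷ Θ)))
 SS-∷ N r μ G = ∑-fi N r (V.toList μ) _ » Ʃ-co (\ w -> ∑-co (fillings N (V.toList μ)) (\ Θ ->
  cg (_& G (lst w ∷ Θ)) (δ-∧ (weaklyIncreasing (lst w)) (al-wi Θ)) » &-as _ _ _) » ∑-*ˡ (fillings N (V.toList μ)) _ _)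

 fi-st : ∀ N {R} (μ : Vec ℕ R) G -> (∀ i -> lk μ i ≤ B) -> SSY (suc N) μ G == Ʃ (\ (ν : Row R) -> δ (le? (ℕs ν) μ) & SSY N (ℕs ν) (\ Θ -> G (ext N μ (ℕs ν) Θ)))
 fi-st N [] G b = sym (Ʃ-[] _ » δ-tr (le? [] []) tt)
 fi-st N (m ∷ μ) G b = begin
  SSY (suc N) (m ∷ μ) G
   ≡⟨ trans (SS-∷ (suc N) m μ G) (row-ste N B m (\ w -> SSY (suc N) μ (\ Θ -> G (w ∷ Θ))) (b zr)) ⟩
  Ʃ (\ (f : Fin (suc B)) -> δ (tn f ≤?ℕ m) & wi-Σ N {N} (tn f) (\ w -> SSY (suc N) μ (\ Θ -> G ((w ++ rep (m ∸ tn f) N) ∷ Θ))))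
   ≡⟨ Ʃ-co (\ f -> cg (δ (tn f ≤?ℕ m) &_) (Ʃ-co (\ w -> cg (δ (T? (weaklyIncreasing (lst w))) &_) (fi-st N μ _ (b ∘ suc)) » sym (Ʃ-*ˡ _ _) » Ʃ-co (\ ν -> &-sw _ _ _)) »
    Ʃ-sw _ » Ʃ-co (\ ν -> Ʃ-*ˡ (δ (le? (ℕs ν) μ)) _)) » sym (Ʃ-*ˡ _ _) » Ʃ-co (\ ν -> sym (&-as _ _ _) » ap2 _&_ (sym (δ-× _ _)) (sym (SS-∷ N (tn f) (ℕs ν) (\ Θ -> G (ext N (m ∷ μ) (tn f ∷ ℕs ν) Θ))))) ) ⟩
  Ʃ (\ f -> Ʃ (\ ν -> δ (le? (tn f ∷ ℕs ν) (m ∷ μ)) & SSY N (tn f ∷ ℕs ν) (\ Θ -> G (ext N (m ∷ μ) (tn f ∷ ℕs ν) Θ))))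
   ≡⟨ Ʃ-∷ _ ⟨
  Ʃ (\ ν -> δ (le? (ℕs ν) (m ∷ μ)) & SSY N (ℕs ν) (\ Θ -> G (ext N (m ∷ μ) (ℕs ν) Θ))) ∎
  where open ≡-Reasoning

 data Filling (N : ℕ) : ∀ {R} -> Vec ℕ R -> List (List ℕ) -> Set where
  [] : Filling N [] []
  _∷_ : ∀ {r R} {ν : Vec ℕ R} {Θ} (w : Vec (Fin N) r) -> Filling N ν Θ -> Filling N (r ∷ ν) (lst w ∷ Θ)

 ∑-fi-co : ∀ N {R} (ν : Vec ℕ R) {F G : List (List ℕ) -> ℚ} -> (∀ Θ -> Filling N ν Θ -> F Θ == G Θ) -> ∑ (fillings N (V.toList ν)) F == ∑ (fillings N (V.toList ν)) G
 ∑-fi-co N [] h = cg (_# 0q) (h [] [])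
 ∑-fi-co N (r ∷ ν) h = ∑-fi N r (V.toList ν) _ » Ʃ-co (\ w -> ∑-fi-co N ν (\ Θ t -> h (lst w ∷ Θ) (w ∷ t))) » sym (∑-fi N r (V.toList ν) _)

 ro-st : List ℕ -> List ℕ -> Bool
 ro-st r s = and (zipWith _<ᵇ_ r s)

 -- Nothing can stand below a copy of the largest letter N. Hence the lower row, including its own
 -- copies of N, must end before the copies of N in the upper row begin; this is the strip
 -- condition.
 ro-ex : ∀ N {f f'} (w : Vec (Fin N) f) (w' : Vec (Fin N) f') c c' -> f' + c' ≤ f + c ->
  ro-st (lst w ++ rep c N) (lst w' ++ rep c' N) == (f' + c' ≤ᵇ f) ∧ ro-st (lst w) (lst w')
 ro-ex N [] [] zr zr p = rfl
 ro-ex N [] [] (suc c) zr p = rfl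
 ro-ex N [] [] (suc c) (suc c') p = ap2 _∧_ (irr N) rfl
  where
  irr : ∀ N -> (N <ᵇ N) == false
  irr zr = rfl
  irr (suc N) = irr N
 ro-ex N [] (y ∷ w') (suc c) c' p = ap2 _∧_ (T-ex (\ t -> <⇒≱ (toℕ<n y) (<⇒≤ (<ᵇ⇒< N (tn y) t))) (\ ())) rfl
 ro-ex N (x ∷ w) [] c zr p = rfl
 ro-ex N {suc f} (x ∷ w) [] c (suc c') (s≤s p) = ap2 _∧_ (T-ex (\ _ -> tt) (\ _ -> <⇒<ᵇ (toℕ<n x))) (ro-ex N w [] c c' p) » ap2 _∧_ (T-ex (\ t -> <⇒<ᵇ (s≤s (≤ᵇ⇒≤ c' f t))) (\ t -> ≤⇒≤ᵇ (≤-pred (<ᵇ⇒< c' (suc f) t)))) (nil (lst w))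
  where
  nil : ∀ r -> ro-st r [] == true
  nil [] = rfl
  nil (_ ∷ _) = rfl
 ro-ex N {suc f} {suc f'} (x ∷ w) (y ∷ w') c c' (s≤s p) with tn x <ᵇ tn y
 ... | true = ro-ex N w w' c c' p » cg (_∧ ro-st (lst w) (lst w')) (T-ex (\ t -> <⇒<ᵇ (s≤s (≤ᵇ⇒≤ (f' + c') f t))) (\ t -> ≤⇒≤ᵇ (≤-pred (<ᵇ⇒< (f' + c') (suc f) t))))
 ... | false = sym (∧-zeroʳ _)

 co-ex : ∀ N {R} (μ ν : Vec ℕ R) Θ -> Filling N ν Θ -> Le ν μ -> De μ ->
  (T (columnsStrict (ext N μ ν Θ)) -> St μ ν × T (columnsStrict Θ)) × (St μ ν -> T (columnsStrict Θ) -> T (columnsStrict (ext N μ ν Θ)))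
 co-ex N [] [] _ [] _ _ = (\ _ -> tt , tt) , (\ _ _ -> tt)
 co-ex N (m ∷ []) (f ∷ []) _ (w ∷ []) (l , _) _ = (\ _ -> l , tt) , (\ _ _ -> tt)
 co-ex N (m ∷ μ'@(m' ∷ μ)) (f ∷ ν'@(f' ∷ ν)) _ (w ∷ t'@(w' ∷ t)) (l , ls'@(l' , ls)) (d , ds) = let rec = co-ex N μ' ν' _ t' ls' ds in
  (\ c -> let p , q = ∧-T _ (columnsStrict (ext N (m' ∷ μ) (f' ∷ ν) (lst w' ∷ _))) c;s , u = fst rec q;a , b = ∧-T (f' + (m' ∸ f') ≤ᵇ f) _ (subst T eq p) in
   (l , subst (_≤ f) (m+[n∸m]≡n l') (≤ᵇ⇒≤ _ f a) , s) , T-∧' (ro-st (lst w) (lst w')) _ b u) ,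
  (\ (_ , s , ss) c -> let p , q = ∧-T (ro-st (lst w) (lst w')) _ c in
   T-∧' (ro-st (lst w ++ rep (m ∸ f) N) (lst w' ++ rep (m' ∸ f') N)) _ (subst T (sym eq) (T-∧' (f' + (m' ∸ f') ≤ᵇ f) _ (≤⇒≤ᵇ (subst (_≤ f) (sym (m+[n∸m]≡n l')) s)) p)) (snd rec ss q))
  where
  eq : ro-st (lst w ++ rep (m ∸ f) N) (lst w' ++ rep (m' ∸ f') N) == (f' + (m' ∸ f') ≤ᵇ f) ∧ ro-st (lst w) (lst w')
  eq = ro-ex N w w' (m ∸ f) (m' ∸ f') (subst2 _≤_ (sym (m+[n∸m]≡n l')) (sym (m+[n∸m]≡n l)) d)

 oc : ℕ -> List ℕ -> ℕ
 oc a w = countᵇ (\ b -> a ≡ᵇ b) w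

 oc-++ : ∀ a u v -> oc a (u ++ v) == oc a u + oc a v
 oc-++ a [] v = rfl
 oc-++ a (x ∷ u) v with a ≡ᵇ x
 ... | true = cg suc (oc-++ a u v)
 ... | false = oc-++ a u v

 oc-se : ∀ N c -> oc N (rep c N) == c
 oc-se N zr = rfl
 oc-se N (suc c) with N ≡ᵇ N in e
 ... | true = cg suc (oc-se N c)
 ... | false = ⊥-elim (subst T e (≡⇒≡ᵇ N N rfl))

 oc-ot : ∀ {a b} -> a ≢ b -> ∀ c -> oc a (rep c b) == 0
 oc-ot ne zr = rfl
 oc-ot {a} {b} ne (suc c) with a ≡ᵇ b in e
 ... | true = absurd (≡ᵇ⇒≡ a b (subst T (sym e) tt)) ne
 ... | false = oc-ot ne c

 oc-N : ∀ {N r} (w : Vec (Fin N) r) -> oc N (lst w) == 0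
 oc-N [] = rfl
 oc-N {N} (x ∷ w) with N ≡ᵇ tn x in e
 ... | true = absurd (≡ᵇ⇒≡ N (tn x) (subst T (sym e) tt)) (\ f -> <≢ (toℕ<n x) (sym f))
 ... | false = oc-N w

 ex-la : ∀ N {R} (μ ν : Vec ℕ R) {Θ} -> Filling N ν Θ -> Le ν μ -> « ν ¦ + oc N (concat (ext N μ ν Θ)) == « μ ¦
 ex-la N [] [] [] _ = rfl
 ex-la N (m ∷ μ) (f ∷ ν) {_ ∷ Θ} (w ∷ t) (l , ls) = cg (f + « ν ¦ +_) (oc-++ N (lst w ++ rep (m ∸ f) N) _ » cg (_+ oc N (concat (ext N μ ν Θ)))
  (oc-++ N (lst w) _ » ap2 _+_ (oc-N w) (oc-se N (m ∸ f)))) » (lem f « ν ¦ (m ∸ f) _) » ap2 _+_ (m+[n∸m]≡n l) (ex-la N μ ν t ls)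
  where
  lem : ∀ a b c d -> a + b + (0 + c + d) == a + c + (b + d)
  lem = ℕ-ring

 ex-sm : ∀ N {R} (μ ν : Vec ℕ R) {Θ} a -> a < N -> Filling N ν Θ -> oc a (concat (ext N μ ν Θ)) == oc a (concat Θ)
 ex-sm N [] [] a l [] = rfl
 ex-sm N (m ∷ μ) (f ∷ ν) {_ ∷ Θ} a l (w ∷ t) = oc-++ a (lst w ++ rep (m ∸ f) N) _ » ap2 _+_
  (oc-++ a (lst w) _ » cg (oc a (lst w) +_) (oc-ot (<≢ l) (m ∸ f)) » +-idr _) (ex-sm N μ ν a l t) » sym (oc-++ a (lst w) _)

 downs : (ℕ -> ℕ) -> ∀ N -> Vec ℕ N
 downs f zr = []
 downs f (suc N) = f N ∷ downs f N

 -- The content condition letter by letter from the largest down, matching the recursion of `KR`.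
 Con : (N : ℕ) -> List (List ℕ) -> (ℕ -> ℕ) -> Set
 Con zr Θ f = ⊤
 Con (suc N) Θ f = oc N (concat Θ) == f N × Con N Θ f

 co? : ∀ (N : ℕ) Θ f -> Dec (Con N Θ f)
 co? zr Θ f = yes tt
 co? (suc N) Θ f = (oc N (concat Θ) ≟ℕ f N) ×-dec co? N Θ f

 con-ext : ∀ N {Θ T'} f -> (∀ a -> a < N -> oc a (concat Θ) == oc a (concat T')) -> Con N Θ f -> Con N T' f
 con-ext zr f e _ = tt
 con-ext (suc N) f e (p , q) = trans (sym (e N ≤=)) p , con-ext N f (\ a l -> e a (≤t l (n≤1+n N))) q

 st-le : ∀ {R} (μ ν : Vec ℕ R) -> St μ ν -> Le ν μ
 st-le [] [] _ = tt
 st-le (m ∷ []) (n ∷ []) p = p , tt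
 st-le (m ∷ m' ∷ μ) (n ∷ ν) (p , _ , s) = p , st-le (m' ∷ μ) ν s

 st-de-in : ∀ {R} (μ ν : Vec ℕ R) -> St μ ν -> De ν
 st-de-in [] [] _ = tt
 st-de-in (m ∷ []) (n ∷ []) _ = tt
 st-de-in (m ∷ m' ∷ μ) (n ∷ n' ∷ ν) (_ , q , s) = ≤t (st-he {μ = μ} {ν} s) q , st-de-in (m' ∷ μ) (n' ∷ ν) s

 ta : ∀ N {R} -> Vec ℕ R -> (ℕ -> ℕ) -> ℚ
 ta N μ f = SSY N μ (\ Θ -> δ (T? (columnsStrict Θ)) & δ (co? N Θ f))

 -- The cells of the largest letter form a horizontal strip, and removing it is one step of the
 -- recursion for `KR`.
 tableaux-KR : ∀ N {R} (μ : Vec ℕ R) f -> De μ -> (∀ i -> lk μ i ≤ B) -> ta N μ f == KR μ (downs f N)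
 tableaux-KR zr μ f d b = emp μ _ » cg (δ (« μ ¦ ≟ℕ 0) &_) (δ-tr (T? _) (wi (V.toList μ)) » δ-tr (T? _) (cs (V.toList μ)) » δ-ye _ tt) » &-idʳ _
  where
  em : ∀ {A : Set} -> List A -> List (List ℕ)
  em = mapL (\ _ -> [])
  wi : ∀ {A : Set} (xs : List A) -> T (al-wi (em xs))
  wi [] = tt
  wi (x ∷ xs) = wi xs
  cs : ∀ {A : Set} (xs : List A) -> T (columnsStrict (em xs))
  cs [] = tt
  cs (x ∷ []) = tt
  cs (x ∷ y ∷ xs) = cs (y ∷ xs)
  emp : ∀ {R} (μ : Vec ℕ R) (F : List (List ℕ) -> ℚ) -> ∑ (fillings 0 (V.toList μ)) F == δ (« μ ¦ ≟ℕ 0) & F (em (V.toList μ))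
  emp [] F = #-idʳ _ » sym (δ-tr (0 ≟ℕ 0) rfl)
  emp (zr ∷ μ) F = ∑-fi 0 0 (V.toList μ) F » Ʃ-[] _ » emp μ (\ Θ -> F ([] ∷ Θ))
  emp (suc m ∷ μ) F = sym (δ-fa (suc m + « μ ¦ ≟ℕ 0) (\ ()))
 tableaux-KR (suc N) μ f d b = fi-st N μ _ b » Ʃ-co (\ ν -> per ν (step? μ (ℕs ν) (f N)))
  where
  per : ∀ ν (s : Dec (Step μ (ℕs ν) (f N))) -> δ (le? (ℕs ν) μ) & SSY N (ℕs ν) (\ Θ -> δ (T? (columnsStrict (ext N μ (ℕs ν) Θ))) & δ (co? (suc N) (ext N μ (ℕs ν) Θ) f)) == δ s & KR (ℕs ν) (downs f N)
  per ν (yes (st , e)) = δ-tr (le? (ℕs ν) μ) le » ∑-fi-co N (ℕs ν) (\ Θ t -> cg (δ (T? (al-wi Θ)) &_) (sym (δ-× _ _) » δ-⇔ _ (T? (columnsStrict Θ) ×-dec co? N Θ f)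
   (\ (c , _ , q) -> snd (fst (co-ex N μ (ℕs ν) Θ t le d) c) , con-ext N f (\ a l -> ex-sm N μ (ℕs ν) a l t) q)
   (\ (c , q) -> snd (co-ex N μ (ℕs ν) Θ t le d) st c , +-cancelˡ-≡ « ℕs ν ¦ _ _ (ex-la N μ (ℕs ν) t le » sym e) , con-ext N f (\ a l -> sym (ex-sm N μ (ℕs ν) a l t)) q) » δ-× _ _)) »
   tableaux-KR N (ℕs ν) f (st-de-in μ (ℕs ν) st) (\ i -> ≤t (≤r (VP.lookup-map i tn ν)) (≤-pred (toℕ<n (lk ν i)))) » sym (δ-tr (yes (st , e)) (st , e))
   where le = st-le μ (ℕs ν) st
  per ν (no ns) = go (le? (ℕs ν) μ) » sym (δ-fa (no ns) ns)
   where
   go : (l : Dec (Le (ℕs ν) μ)) -> δ l & SSY N (ℕs ν) (\ Θ -> δ (T? (columnsStrict (ext N μ (ℕs ν) Θ))) & δ (co? (suc N) (ext N μ (ℕs ν) Θ) f)) == 0q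
   go (no nl) = δ-fa (no nl) nl
   go (yes le) = cg (δ (yes le) &_) (∑-fi-co N (ℕs ν) (\ Θ t -> cg (δ (T? (al-wi Θ)) &_) (sym (δ-× _ _) » δ-no _ (\ (c , q , _) ->
    ns (fst (fst (co-ex N μ (ℕs ν) Θ t le d) c) , trans (cg (« ℕs ν ¦ +_) (sym q)) (ex-la N μ (ℕs ν) t le)))) » &-zeroʳ _) » ∑-0 (fillings N (V.toList (ℕs ν)))) » &-zeroʳ _

 schurCoeff-tableaux : ∀ {R} (μ : Vec ℕ R) α -> ι (schurCoeff (V.toList μ) α) == ta (length α) μ (Defs.at α)
 schurCoeff-tableaux μ α = ι-countᵇ _ (fillings (length α) (V.toList μ)) » ∑-co (fillings (length α) (V.toList μ)) (\ Θ -> δ-∧ (isSSYT Θ) _ » cg (_& δ (T? (Defs.hasContent α (concat Θ)))) (δ-∧ (al-wi Θ) (columnsStrict Θ)) »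
  &-as _ _ _ » cg (\ z -> δ (T? (al-wi Θ)) & (δ (T? (columnsStrict Θ)) & z)) (δ-⇔ _ _ (to Θ) (from Θ)))
  where
  lis : ∀ (α : List ℕ) (g : ℕ -> ℕ) -> (mapL g (upTo (length α)) == α -> ∀ a -> a < length α -> g a == Defs.at α a) × ((∀ a -> a < length α -> g a == Defs.at α a) -> mapL g (upTo (length α)) == α)
  lis α g = subst (\ xs -> (xs == α -> ∀ a -> a < length α -> g a == Defs.at α a) × ((∀ a -> a < length α -> g a == Defs.at α a) -> xs == α)) (sym (LP.map-applyUpTo id g (length α))) (go α g)
   where
   go : ∀ (α : List ℕ) (g : ℕ -> ℕ) -> (applyUpTo g (length α) == α -> ∀ a -> a < length α -> g a == Defs.at α a) × ((∀ a -> a < length α -> g a == Defs.at α a) -> applyUpTo g (length α) == α)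
   go [] g = (\ _ _ ()) , (\ _ -> rfl)
   go (x ∷ α) g = (\ { e zr _ -> LP.∷-injectiveˡ e;e (suc a) (s≤s l) -> fst (go α (g ∘ suc)) (LP.∷-injectiveʳ e) a l }) ,
    (\ h -> ap2 _∷_ (h 0 (s≤s z≤n)) (snd (go α (g ∘ suc)) (\ a l -> h (suc a) (s≤s l))))
  all : ∀ (N : ℕ) Θ f -> (∀ a -> a < N -> oc a (concat Θ) == f a) -> Con N Θ f
  all zr Θ f h = tt
  all (suc N) Θ f h = h N ≤= , all N Θ f (\ a l -> h a (≤t l (n≤1+n N)))
  an' : ∀ (N : ℕ) Θ f -> Con N Θ f -> ∀ a -> a < N -> oc a (concat Θ) == f a
  an' (suc N) Θ f (p , q) a (s≤s l) with a ≟ℕ N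
  ... | yes rfl = p
  ... | no ne = an' N Θ f q a (≤∧≢⇒< l ne)
  to : ∀ T' -> T (Defs.hasContent α (concat T')) -> Con (length α) T' (Defs.at α)
  to T' t = all (length α) T' (Defs.at α) (fst (lis α (\ a -> oc a (concat T'))) (eL-so _ α t))
  from : ∀ T' -> Con (length α) T' (Defs.at α) -> T (Defs.hasContent α (concat T'))
  from T' c = subst (\ xs -> T (eqList xs α)) (sym (snd (lis α (\ a -> oc a (concat T'))) (an' (length α) T' (Defs.at α) c))) (eL-re α)

-- Integrality and Schur positivity.

open Defs using (IsPartition;IsPartitionOf;SchurPositive;SchurPositiveDiff;schurCoeff;fillings;isSSYT;columnsStrict)
open import Data.List.Properties using (concat-++;++-identityʳ)
open import Data.List.Relation.Unary.Linked using (Linked;[];[-];_∷_)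
open import Data.List.Relation.Unary.All.Properties using () renaming (++⁺ to All-++)
open import Data.Nat.ListAction using (sum)
open import Data.Fin using (opposite)
open import Data.Fin.Properties using (opposite-prop;opposite-involutive)

posi : ∀ {R} -> Vec ℕ R -> List ℕ
posi [] = []
posi (zr ∷ μ) = posi μ
posi (suc m ∷ μ) = suc m ∷ posi μ

po-ze : ∀ {R} (μ : Vec ℕ R) -> De (0 ∷ μ) -> posi μ == [] × μ == 0ᵥ
po-ze [] _ = rfl , rfl
po-ze (zr ∷ μ) (_ , d) = let p , q = po-ze μ d in p , cg (0 ∷_) q

po-pa : ∀ {R} (μ : Vec ℕ R) -> De μ -> IsPartition (posi μ)
po-pa μ d = pos μ , li μ d
 where
 pos : ∀ {R} (μ : Vec ℕ R) -> All (1 ≤_) (posi μ)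
 pos [] = []
 pos (zr ∷ μ) = pos μ
 pos (suc m ∷ μ) = s≤s z≤n ∷ pos μ
 ta-de : ∀ {R} x (μ : Vec ℕ R) -> De (x ∷ μ) -> De μ
 ta-de x [] _ = tt
 ta-de x (_ ∷ _) (_ , d) = d
 li : ∀ {R} (μ : Vec ℕ R) -> De μ -> Linked _≥_ (posi μ)
 li [] _ = []
 li (zr ∷ μ) d = li μ (ta-de 0 μ d)
 li (suc m ∷ []) _ = [-]
 li (suc m ∷ zr ∷ μ) (_ , d) = subst (\ xs -> Linked _≥_ (suc m ∷ xs)) (sym (fst (po-ze μ d))) [-]
 li (suc m ∷ suc m' ∷ μ) (p , d) = p ∷ li (suc m' ∷ μ) d

fi-po : ∀ N {R} (μ : Vec ℕ R) -> De μ -> ∃ \ k -> ∀ F -> ∑ (fillings N (V.toList μ)) F == ∑ (fillings N (posi μ)) (\ Θ -> F (Θ ++ rep k []))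
fi-po N [] d = 0 , \ F -> rfl
fi-po N {suc R} (zr ∷ μ) d with po-ze μ d
... | e , rfl = suc R , \ F -> trans (ze (suc R) F) (sym (#-idʳ _) » cg (\ xs -> ∑ (fillings N xs) (\ Θ -> F (Θ ++ rep (suc R) []))) (sym e))
 where
 ze : ∀ R F -> ∑ (fillings N (V.toList (0ᵥ {R}))) F == F (rep R [])
 ze zr F = #-idʳ _
 ze (suc R) F = ∑-fi N 0 (V.toList (0ᵥ {R})) F » Ʃ-[] _ » ze R (\ Θ -> F ([] ∷ Θ))
fi-po N (suc m ∷ []) d = 0 , \ F -> ∑-co (fillings N (suc m ∷ [])) (\ Θ -> cg F (sym (++-identityʳ Θ)))
fi-po N (suc m ∷ μ@(_ ∷ _)) (_ , d) = let k , h = fi-po N μ d in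
 k , \ F -> trans (∑-fi N (suc m) (V.toList μ) F) (Ʃ-co (\ w -> h (\ Θ -> F (lst w ∷ Θ))) » sym (∑-fi N (suc m) (posi μ) (\ Θ -> F (Θ ++ rep k []))))

sC-po : ∀ {R} (μ : Vec ℕ R) α -> De μ -> ι (schurCoeff (posi μ) α) == ι (schurCoeff (V.toList μ) α)
sC-po μ α d = let k , h = fi-po (length α) μ d in trans (ι-countᵇ _ (fillings (length α) (posi μ))) (∑-co (fillings (length α) (posi μ)) (\ Θ -> ap2 (\ a w -> δ (T? (a ∧ Defs.hasContent α w)))
 (sym (ap2 _∧_ (wi Θ k) (cs Θ k))) (sym (sym (concat-++ Θ (rep k [])) » cg (concat Θ ++_) (nil k) » ++-identityʳ _))) » sym (ι-countᵇ _ (fillings (length α) (V.toList μ)) » h _))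
 where
 open import Data.Bool.ListAction using (and)
 open import Data.Bool.Properties using (∧-assoc)
 nil : ∀ k -> concat {A = ℕ} (rep k []) == []
 nil zr = rfl
 nil (suc k) = nil k
 wi : ∀ Θ k -> al-wi (Θ ++ rep k []) == al-wi Θ
 wi [] zr = rfl
 wi [] (suc k) = wi [] k
 wi (r ∷ Θ) k = cg (Defs.weaklyIncreasing r ∧_) (wi Θ k)
 cs : ∀ Θ k -> columnsStrict (Θ ++ rep k []) == columnsStrict Θ
 cs [] zr = rfl
 cs [] (suc zr) = rfl
 cs [] (suc (suc k)) = cs [] (suc k)
 cs (r ∷ []) zr = rfl
 cs (r ∷ []) (suc k) = cg (_∧ columnsStrict ([] ∷ rep k [])) (non r) » cs [] (suc k)
  where
  non : ∀ r -> and (zipWith _<ᵇ_ r []) == true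
  non [] = rfl
  non (_ ∷ _) = rfl
 cs (r ∷ s ∷ Θ) k = cg (and (zipWith _<ᵇ_ r s) ∧_) (cs (s ∷ Θ) k)

IN : ℚ -> Set
IN x = ∃ \ k -> x == ι k

na-# : ∀ {x y} -> IN x -> IN y -> IN (x # y)
na-# (a , rfl) (b , rfl) = a + b , sym (ι-+ a b)

na-& : ∀ {x y} -> IN x -> IN y -> IN (x & y)
na-& (a , rfl) (b , rfl) = a * b , sym (ι-* a b)

na-∑ : ∀ {A : Set} (xs : List A) {f : A -> ℚ} -> All (IN ∘ f) xs -> IN (∑ xs f)
na-∑ [] [] = 0 , rfl
na-∑ (x ∷ xs) (p ∷ ps) = na-# p (na-∑ xs ps)

opaque
 unfolding Ʃ δ

 na-Ʃ : ∀ {A : Set} ⦃ _ : Fi A ⦄ {f : A -> ℚ} -> (∀ a -> IN (f a)) -> IN (Ʃ f)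
 na-Ʃ h = na-∑ els (All.universal h els)

 na-δ : ∀ {P : Set} (d : Dec P) -> IN (δ d)
 na-δ (yes _) = 1 , sym (#-idʳ 1q)
 na-δ (no _) = 0 , rfl

na-di : ∀ a m {d} -> ι a == ι m # d -> 0q ≤ᵠ d -> IN d
na-di a m {d} e p = a ∸ m , sym (can (ι m) (ι (a ∸ m)) » cg (_# ~ ι m) (sym (ι-+ m (a ∸ m)) » cg ι (m+[n∸m]≡n m≤a) » e) » sym (can (ι m) d))
 where
 m≤a : m ≤ a
 m≤a = ≮⇒≥ (\ l -> ℚP.<-irrefl rfl (ℚP.<-≤-trans (ι-mo-< l) (subst2 _≤ᵠ_ (#-idʳ (ι m)) (sym e) (#-mo-≤ (ℚP.≤-refl {ι m}) p))))
 opaque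
  unfolding _#_
  can : ∀ m x -> x == m # x # ~ m
  can = slv ℚ-ri

module Int (n : ℕ) where
 open Ch n
 open import Data.List.Relation.Unary.All.Properties using (++⁻ʳ)

 na-KR : ∀ {R N} (μ : Vec ℕ R) (α : Vec ℕ N) -> IN (KR μ α)
 na-KR μ [] = na-δ (« μ ¦ ≟ℕ 0)
 na-KR μ (a ∷ α) = na-Ʃ (\ ν -> na-& (na-δ (step? μ (ℕs ν) a)) (na-KR (ℕs ν) α))

 ch-IP : All (IP ∘ fst) chars
 ch-IP = un (subst (All IP) (sym labe) pa-IP)
  where
  un : ∀ {xs : List La} -> All IP (mapL fst xs) -> All (IP ∘ fst) xs
  un {[]} [] = []
  un {x ∷ xs} (p ∷ ps) = p ∷ un ps

 -- Kostka numbers are unitriangular, so integrality descends from the values to the coefficients.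
 inte : (d : ClassFun -> ℚ) (F G : ∀ {N} -> Vec ℕ N -> ℕ) -> (∀ {χ} -> Rep χ -> 0q ≤ᵠ d χ) ->
  (∀ {N} (α : Vec ℕ N) -> « α ¦ == n -> ι (F α) == ι (G α) # ∑ chars (\ (μ , χ) -> KR (ℕs μ) α & d χ)) -> All (IN ∘ d ∘ snd) chars
 inte d F G d≥0 eq = go [] chars rfl
  where
  go : ∀ pre xs -> pre ++ xs == chars -> All (IN ∘ d ∘ snd) xs
  go pre [] _ = []
  go pre ((ν , χ) ∷ xs) e = na-di (F ν̂) (G ν̂ + fst lat) (eq ν̂ ν̂-si » cg (ι (G ν̂) #_) split » reg _ _ _ » cg (_# d χ) (cg (ι (G ν̂) #_) (snd lat) » sym (ι-+ (G ν̂) (fst lat)))) (d≥0 (All.head (++⁻ʳ pre (subst (All _) (sym e) reps)))) ∷ rest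
   where
   rest = go (pre ++ (ν , χ) ∷ []) xs (++-assoc pre _ xs » e)
   ν̂ = reverseᵥ (ℕs ν)
   ν-pa : IP ν
   ν-pa = All.head (++⁻ʳ pre (subst (All (IP ∘ fst)) (sym e) ch-IP))
   ν̂-si : « ν̂ ¦ == n
   ν̂-si = «reverse¦ (ℕs ν) » snd ν-pa
   lat : IN (∑ xs (\ (μ , ψ) -> KR (ℕs μ) ν̂ & d ψ))
   lat = na-∑ xs (All.map (\ {x} p -> na-& (na-KR (ℕs (fst x)) ν̂) p) rest)
   opaque
    unfolding _#_
    reg : ∀ g x y -> g # (x # y) == g # y # x
    reg = slv ℚ-ri
   ea : ∀ pre -> AllPairs Lex (mapL fst (pre ++ (ν , χ) ∷ xs)) -> All (IP ∘ fst) (pre ++ (ν , χ) ∷ xs) -> ∑ pre (\ (μ , ψ) -> KR (ℕs μ) ν̂ & d ψ) == 0q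
   ea [] _ _ = rfl
   ea (x ∷ pre) (p ∷ ap) (q ∷ qs) = ap2 _#_ (cg (_& d (snd x)) (KR-le (fst x) ν (fst q) (lex pre p)) » &-zeroˡ _) (ea pre ap qs) » #-idˡ _
    where
    lex : ∀ pre -> All (Lex (fst x)) (mapL fst (pre ++ (ν , χ) ∷ xs)) -> Lex (fst x) ν
    lex [] (l ∷ _) = l
    lex (_ ∷ pre) (_ ∷ ls) = lex pre ls
   split : ∑ chars (\ (μ , ψ) -> KR (ℕs μ) ν̂ & d ψ) == d χ # ∑ xs (\ (μ , ψ) -> KR (ℕs μ) ν̂ & d ψ)
   split = cg (\ ys -> ∑ ys (\ (μ , ψ) -> KR (ℕs μ) ν̂ & d ψ)) (sym e) » ∑-++ pre _ _ » ap2 _#_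
    (ea pre (subst (AllPairs Lex) (sym (cg (mapL fst) e » labe)) pa-le) (subst (All (IP ∘ fst)) (sym e) ch-IP))
    (ap2 _#_ (cg (_& d χ) (KR-di ν (fst ν-pa)) » &-idˡ _) rfl) » #-idˡ _

 open Ta n using (tableaux-KR;schurCoeff-tableaux;downs)

 lo-do : ∀ f N (i : Fin N) -> lk (downs f N) i == f (tn (opposite i))
 lo-do f (suc N) zr = cg f (sym (opposite-prop (zr {N})))
 lo-do f (suc N) (suc i) = lo-do f N i » cg f (opposite-prop i » sym (opposite-prop (suc i)))

 lo-at : ∀ {N} (α : Vec ℕ N) i -> lk α i == Defs.at (V.toList α) (tn i)
 lo-at (x ∷ α) zr = rfl
 lo-at (x ∷ α) (suc i) = lo-at α i

 rev : ∀ {N} (α : Vec ℕ N) i -> lk (downs (Defs.at (V.toList α)) N) i == lk α (opposite i)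
 rev {N} α i = lo-do _ N i » sym (lo-at α (opposite i))

 «downs¦ : ∀ {N} (α : Vec ℕ N) -> « downs (Defs.at (V.toList α)) N ¦ == « α ¦
 «downs¦ {N} α = ι-in («¦-Ʃ (downs (Defs.at (V.toList α)) N) » Ʃ-co (\ i -> cg ι (rev α i)) » Ʃ-bi opposite opposite opposite-involutive opposite-involutive (\ i -> ι (lk α i)) » sym («¦-Ʃ α))

 -- Reversing the alphabet does not change permutation characters.
 M-do : ∀ {N} (α : Vec ℕ N) g -> M (downs (Defs.at (V.toList α)) N) g == M α g
 M-do {N} α g = Ʃ-co (\ w -> ap2 _&_ (δ-⇔ _ _ (to w) (from w)) (δ-⇔ _ _ (\ e -> sym (ma-▹ opposite w g) » cg (V.map opposite) e)
  (\ e -> sym (ba (w ▹ g)) » cg (V.map opposite) (ma-▹ opposite w g » e) » ba w))) »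
  Ʃ-bi (V.map opposite) (V.map opposite) ba ba (\ w -> δ (≡ᵥ? (con w) α) & δ (eq? (w ▹ g) w))
  where
  ba : ∀ {m} (w : Vec (Fin N) m) -> V.map opposite (V.map opposite w) == w
  ba w = sym (VP.map-∘ opposite opposite w) » VP.map-cong opposite-involutive w » VP.map-id w
  fl : ∀ {m} (w : Vec (Fin N) m) a -> lk (con (V.map opposite w)) (opposite a) == lk (con w) a
  fl w a = lk-tab (cnt (V.map opposite w)) (opposite a) » ι-in (cn-Ʃ (V.map opposite w) _ » Ʃ-co (\ s -> cg (\ z -> δ (eq? z (opposite a))) (VP.lookup-map s opposite w) »
   δ-⇔ _ _ (\ e -> sym (opposite-involutive _) » cg opposite e » opposite-involutive a) (cg opposite)) » sym (cn-Ʃ w a)) » sym (lk-tab (cnt w) a)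
  to : ∀ w -> con w == downs (Defs.at (V.toList α)) N -> con (V.map opposite w) == α
  to w e = lo-ex (\ i -> cg (lk (con (V.map opposite w))) (sym (opposite-involutive i)) » fl w (opposite i) »
   cg (\ v -> lk v (opposite i)) e » rev α (opposite i) » cg (lk α) (opposite-involutive i))
  from : ∀ w -> con (V.map opposite w) == α -> con w == downs (Defs.at (V.toList α)) N
  from w e = lo-ex (\ i -> sym (fl w i) » cg (\ v -> lk v (opposite i)) e » sym (rev α i))

 -- `KR` reads the content from its largest letter, a monomial from its first variable. The required
 -- symmetry of Kostka numbers under reversal of the content is read off from the pairings with
 -- permutation characters, which do not see the order of the alphabet.
 KR-do : ∀ {N} (α : Vec ℕ N) -> « α ¦ == n -> All (\ (μ , _) -> KR (ℕs μ) (downs (Defs.at (V.toList α)) N) == KR (ℕs μ) α) chars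
 KR-do {N} α e = zA chars (pairs (downs (Defs.at (V.toList α)) N) («downs¦ α » e)) (pairs α e)
  where
  zA : ∀ (xs : List La) -> All (\ (μ , χ) -> ⟪ χ , M (downs (Defs.at (V.toList α)) N) ⟫ == order & KR (ℕs μ) (downs (Defs.at (V.toList α)) N)) xs -> All (\ (μ , χ) -> ⟪ χ , M α ⟫ == order & KR (ℕs μ) α) xs ->
   All (\ (μ , _) -> KR (ℕs μ) (downs (Defs.at (V.toList α)) N) == KR (ℕs μ) α) xs
  zA [] [] [] = []
  zA ((μ , χ) ∷ xs) (p ∷ ps) (q ∷ qs) = &-ca order≢0 (sym p » Ʃ-co (\ g -> cg (χ g &_) (M-do α g)) » q) ∷ zA xs ps qs

 le-tL : ∀ {N} (α : Vec ℕ N) -> length (V.toList α) == N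
 le-tL [] = rfl
 le-tL (x ∷ α) = cg suc (le-tL α)

 sC-KR : ∀ {N} (μ : Sh) (α : Vec ℕ N) -> IP μ -> ι (schurCoeff (posi (ℕs μ)) (V.toList α)) == KR (ℕs μ) (downs (Defs.at (V.toList α)) N)
 sC-KR {N} μ α (d , _) = sC-po (ℕs μ) (V.toList α) d » schurCoeff-tableaux (ℕs μ) (V.toList α) » tableaux-KR (length (V.toList α)) (ℕs μ) (Defs.at (V.toList α)) d (\ i -> ≤t (≤r (VP.lookup-map i tn μ)) (≤-pred (toℕ<n (lk μ i)))) »
  cg (\ m -> KR (ℕs μ) (downs (Defs.at (V.toList α)) m)) (le-tL α)

 -- The coefficients `d` are nonnegative on representations and integral by `inte`, so they can be
 -- spelled out as repetitions in a list of partitions. In degrees other than n both functions agree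
 -- and every Schur coefficient vanishes.
 sc-po : (d : ClassFun -> ℚ) (F G : List ℕ -> ℕ) -> (∀ {χ} -> Rep χ -> 0q ≤ᵠ d χ) ->
  (∀ {N} (α : Vec ℕ N) -> « α ¦ == n -> ι (F (V.toList α)) == ι (G (V.toList α)) # ∑ chars (\ (μ , χ) -> KR (ℕs μ) α & d χ)) ->
  (∀ {N} (α : Vec ℕ N) -> « α ¦ ≢ n -> F (V.toList α) == G (V.toList α)) -> SchurPositiveDiff F G
 sc-po d F G d≥0 eq ne = sha chars int , parti chars int ch-IP , \ α -> subst (\ β -> F β == G β + sum (mapL (\ μ -> schurCoeff μ β) (sha chars int))) (VP.toList∘fromList α) (valu (V.fromList α))
  where
  int : All (IN ∘ d ∘ snd) chars
  int = inte d (F ∘ V.toList) (G ∘ V.toList) d≥0 eq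
  sha : ∀ (xs : List La) -> All (IN ∘ d ∘ snd) xs -> List (List ℕ)
  sha [] [] = []
  sha ((μ , _) ∷ xs) ((c , _) ∷ cs) = rep c (posi (ℕs μ)) ++ sha xs cs
  parti : ∀ xs cs -> All (IP ∘ fst) xs -> All IsPartition (sha xs cs)
  parti [] [] [] = []
  parti ((μ , _) ∷ xs) ((c , _) ∷ cs) (p ∷ ps) = All-++ (cop c) (parti xs cs ps)
   where
   cop : ∀ c -> All IsPartition (rep c (posi (ℕs μ)))
   cop zr = []
   cop (suc c) = po-pa (ℕs μ) (fst p) ∷ cop c
  module _ {N : ℕ} (α : Vec ℕ N) where
   β = V.toList α
   α' = downs (Defs.at β) N
   ∑-sh : ∀ xs cs -> All (IP ∘ fst) xs -> ∑ (sha xs cs) (\ μ -> ι (schurCoeff μ β)) == ∑ xs (\ (μ , χ) -> KR (ℕs μ) α' & d χ)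
   ∑-sh [] [] [] = rfl
   ∑-sh ((μ , χ) ∷ xs) ((c , e) ∷ cs) (p ∷ ps) = ∑-++ (rep c (posi (ℕs μ))) (sha xs cs) _ » ap2 _#_ (cop c » &-co _ _ » ap2 _&_ (sC-KR μ α p) (sym e)) (∑-sh xs cs ps)
    where
    cop : ∀ c -> ∑ (rep c (posi (ℕs μ))) (\ μ -> ι (schurCoeff μ β)) == ι c & ι (schurCoeff (posi (ℕs μ)) β)
    cop zr = sym (&-zeroˡ _)
    cop (suc c) = ap2 _#_ rfl (cop c) » #-&-su _ _
   ∑-do : « α ¦ == n -> ∑ chars (\ (μ , χ) -> KR (ℕs μ) α' & d χ) == ∑ chars (\ (μ , χ) -> KR (ℕs μ) α & d χ)
   ∑-do e = ∑-cong∈ chars (\ {x} m -> cg (_& d (snd x)) (All.lookup (KR-do α e) m))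
   valu : F β == G β + sum (mapL (\ μ -> schurCoeff μ β) (sha chars int))
   valu = go (« α ¦ ≟ℕ n)
    where
    sum≡ : ι (sum (mapL (\ μ -> schurCoeff μ β) (sha chars int))) == ∑ chars (\ (μ , χ) -> KR (ℕs μ) α' & d χ)
    sum≡ = ι-su (\ μ -> schurCoeff μ β) (sha chars int) » ∑-sh chars int ch-IP
    go : Dec (« α ¦ == n) -> F β == G β + sum (mapL (\ μ -> schurCoeff μ β) (sha chars int))
    go (yes e) = ι-in (eq α e » cg (ι (G β) #_) (sym (sum≡ » ∑-do e)) » sym (ι-+ (G β) _))
    go (no ¬e) = ι-in (cg ι (ne α ¬e) » sym (#-idʳ _) » cg (ι (G β) #_) (sym (sum≡ » ∑-zero∈ chars (\ {x} m -> cg (_& d (snd x))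
     (KR-si (ℕs (fst x)) α' (\ f -> ¬e (sym (f » «downs¦ α) » snd (All.lookup ch-IP m)))) » &-zeroˡ _))) » sym (ι-+ (G β) _))

module _ (n : ℕ) (lam : List ℕ) where
 open Eu n lam
 open Int n
 open Ch n using (ClassFun;chars;KR;ℕs)

 Qc-si : ∀ {N} j (α : Vec ℕ N) -> « α ¦ ≢ n -> Qcoeff n lam j (V.toList α) == 0
 Qc-si j α ne = ι-in (Qc-st j (V.toList α) α rfl » Ʃ-0 (\ σ -> Ʃ-0 (\ D -> ap2 _&_ (cg (δ (cl? σ) &_) (δ-no _ (\ e -> ne
  (cg «_¦ (sym (VP.∷-injectiveʳ (sym (to-Z D) » e))) » «content¦ (V.map fst D)))) » &-zeroʳ _) rfl » &-zeroˡ _)))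

 Qc-ex : ∀ {N} j (α : Vec ℕ N) -> « α ¦ == n -> ι (Qcoeff n lam j (V.toList α)) == ∑ chars (\ (μ , χ) -> KR (ℕs μ) α & sc-co j χ)
 Qc-ex j α e = Qc-st j (V.toList α) α rfl » sc-ex j α e

 Qc-po : ∀ j -> SchurPositive (Qcoeff n lam j)
 Qc-po j = sc-po (sc-co j) (Qcoeff n lam j) (\ _ -> 0) (sc-co-≥0 j) (\ α e -> Qc-ex j α e » sym (#-idˡ _)) (Qc-si j)

 Qc-un : ∀ j -> 2 * suc j ≤ n ∸ multiplicity 1 lam -> SchurPositiveDiff (Qcoeff n lam (suc j)) (Qcoeff n lam j)
 Qc-un j le = sc-po (\ χ -> sc-co (suc j) χ # ~ sc-co j χ) (Qcoeff n lam (suc j)) (Qcoeff n lam j) (\ R -> sc-co-mo j R le)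
  (\ α e -> Qc-ex (suc j) α e » ∑-co chars (\ x -> ins _ _ _) » ∑-# chars _ _ » cg (_# ∑ chars (\ (μ , χ) -> KR (ℕs μ) α & (sc-co (suc j) χ # ~ sc-co j χ))) (sym (Qc-ex j α e)))
  (\ α ne -> Qc-si (suc j) α ne » sym (Qc-si j α ne))
  where
  opaque
   unfolding _#_
   ins : ∀ k x y -> k & x == k & y # k & (x # ~ y)
   ins = slv ℚ-ri

theorem1p1 : (n : ℕ) (lam : List ℕ) → IsPartitionOf n lam →
 ((j : ℕ) → SchurPositive (Qcoeff n lam j)) ×
 ((j : ℕ) → 1 ≤ j → 2 * j ≤ n ∸ multiplicity 1 lam →
 SchurPositiveDiff (Qcoeff n lam j) (Qcoeff n lam (j ∸ 1)))
theorem1p1 n lam _ = Qc-po n lam , \ { (suc j) _ le -> Qc-un n lam j le }
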